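{- Let $n>k\geq 1$ be integers and let $\lambda,\mu,\nu$ be partitions with at most $k$ parts and largest part at most $n-k-1$ (i.e. fitting inside a rectangle of $k$ rows of length $n-k-1$), such that $|\nu|\leq|\lambda|+|\mu|$. Then the number of $\mathrm{H}$-puzzle tilings with boundary $\Delta_{\lambda\mu}^{\nu}$ (of side length $n$) equals the coefficient $d_{\lambda\mu}^{\nu}$.
   Context: Partitions are weakly decreasing finite sequences of nonnegative integers; $|\lambda|=\sum_i\lambda_i$. The (Young) diagram of $\lambda$ has $\lambda_i$ left-justified boxes in row $i$ (rows numbered top to bottom). Binary string: for a partition $\lambda$ with at most $k$ parts and $\lambda_1\le n-k$, its binary string is the word of length $n$ in $\{0,1\}$ with exactly $k$ ones in which, for $j=1,\dots,k$, the $j$-th one (from the left) is preceded by exactly $n-k-\lambda_j$ zeros. (Equivalently: inside the rectangle of $k$ rows of length $n-k$, label horizontal edges of the lower-right boundary of the diagram of $\lambda$ by $0$ and vertical edges by $1$ and read from top-right to bottom-left.) Puzzles: work in the triangular lattice of unit equilateral triangles having horizontal edges. Edges of pieces are labelled $0$ or $1$. The standard puzzle pieces are: the unit triangle with all edges labelled $0$ (both orientations, upward and downward); the unit triangle with all edges labelled $1$ (both orientations); and the rhombus formed by two adjacent unit triangles (all three rotations), where, traversing the rhombus boundary clockwise, each edge immediately following an acute vertex is labelled $0$ and each edge immediately following an obtuse vertex is labelled $1$. The piece $\mathrm{H}$ is the regular hexagon of unit side (union of the six unit triangles around a lattice point) with horizontal top and bottom edges, whose edge labels, going counterclockwise starting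 from the bottom edge, are $1,0,1,0,1,0$ (bottom $1$, lower-right $0$, upper-right $1$, top $0$, upper-left $1$, lower-left $0$). An $\mathrm{H}$-puzzle tiling of a region is a tiling of the region by lattice-translated copies of the standard pieces (only in the listed orientations) and translated (not rotated) copies of $\mathrm{H}$, such that labels on shared edges agree. Boundary $\Delta_{\lambda\mu}^{\nu}$: the upward-pointing equilateral triangle of side $n$ in the lattice with horizontal base, whose boundary edges are labelled so that the left side, the right side and the bottom side, each read from left to right, are the binary strings of $\lambda$, $\mu$, $\nu$ respectively. A tiling with this boundary covers exactly this triangle and has these boundary labels. Stable Grothendieck polynomials: a set-valued tableau of shape $\lambda$ fills each box with a nonempty finite set of positive integers; it is semistandard if for horizontally adjacent boxes $A$ (left), $B$ (right) we have $\max A\le\min B$, and for vertically adjacent boxes $A$ (above), $B$ (below) we have $\max A<\min B$. Let $G_\lambda=\sum_T(-1)^{|T|-|\lambda|}x^T$, summed over semistandard set-valued tableaux $T$ of shape $\lambda$, where $|T|$ is the total number of entries and $x^T=\prod_{\text{boxes}}\prod_{a\in\text{box}}x_a$. The linear span of the $G_\lambda$ is a bialgebra (Buch) whose coproduct $\Delta$ is induced by $f(x_1,x_2,\dots)\mapsto f(x_1,x_2,\dots,y_1,y_2,\dots)$; the integers $d_{\lambda\mu}^{\nu}$ are defined by $\Delta(G_\nu)=\sum_{\lambda,\mu}(-1)^{|\nu|-|\lambda|-|\mu|}d_{\lambda\mu}^{\nu}\,G_\lambda\otimes G_\mu$. -}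

module Defs where

open import Data.Bool using (Bool; true; false; _∧_; _∨_; not; if_then_else_; T)
open import Data.Nat using (ℕ; zero; suc; _+_; _∸_; _≤_; _<_; _⊔_; _⊓_; _≤ᵇ_; _<ᵇ_; _≡ᵇ_)
open import Data.List using (List; []; _∷_; [_]; _++_; map; concat; concatMap; length; upTo; filterᵇ; foldr; zip)
open import Data.Product using (_×_; _,_)
open import Data.Integer using (ℤ; +_; -_) renaming (_+_ to _+ℤ_; _*_ to _*ℤ_)
open import Relation.Binary.PropositionalEquality using (_≡_)
open import Data.Sum using (_⊎_)

sublists : {A : Set} → List A → List (List A)
sublists []       = [ [] ]
sublists (x ∷ xs) = map (x ∷_) (sublists xs) ++ sublists xs

sumℤ : List ℤ → ℤ
sumℤ = foldr _+ℤ_ (+ 0)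

prodℤ : List ℤ → ℤ
prodℤ = foldr _*ℤ_ (+ 1)

negOnePow : ℕ → ℤ
negOnePow zero          = + 1
negOnePow (suc zero)    = - (+ 1)
negOnePow (suc (suc e)) = negOnePow e

oneTo : ℕ → List ℕ
oneTo m = map suc (upTo m)

all : {A : Set} → (A → Bool) → List A → Bool
all p []       = true
all p (x ∷ xs) = p x ∧ all p xs

beq : Bool → Bool → Bool
beq true  b = b
beq false b = not b

-- Partitions: finite weakly decreasing lists of POSITIVE integers
-- (the canonical representative; trailing zeros are dropped).

decreasingPos : List ℕ → Bool
decreasingPos []            = true
decreasingPos (a ∷ [])      = 1 ≤ᵇ a
decreasingPos (a ∷ b ∷ l)   = (b ≤ᵇ a) ∧ decreasingPos (b ∷ l)

IsPartition : List ℕ → Set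
IsPartition l = T (decreasingPos l)

size : List ℕ → ℕ
size = foldr _+_ 0

-- λ_j (0-indexed: part l j = λ_{j+1}), zero beyond the length
part : List ℕ → ℕ → ℕ
part []      _       = 0
part (a ∷ l) zero    = a
part (a ∷ l) (suc j) = part l j

-- all partitions of s with all parts ≤ b (fuel f ≥ s)
partsOf : ℕ → ℕ → ℕ → List (List ℕ)
partsOf _       zero    _ = [ [] ]
partsOf zero    (suc s) _ = []
partsOf (suc f) (suc s) b =
  concatMap (λ p → map (p ∷_) (partsOf f (suc s ∸ p) p)) (oneTo (suc s ⊓ b))

partitionsUpTo : ℕ → List (List ℕ)
partitionsUpTo N = concatMap (λ s → partsOf s s s) (upTo (suc N))

zerosBeforeOne : ℕ → List Bool → ℕ
zerosBeforeOne j       []           = 0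
zerosBeforeOne j       (false ∷ w)  = suc (zerosBeforeOne j w)
zerosBeforeOne zero    (true ∷ w)   = 0
zerosBeforeOne (suc j) (true ∷ w)   = zerosBeforeOne j w

countOnes : List Bool → ℕ
countOnes []          = 0
countOnes (true ∷ w)  = suc (countOnes w)
countOnes (false ∷ w) = countOnes w

IsBinaryString : ℕ → ℕ → List ℕ → List Bool → Set
IsBinaryString n k l w =
  (length w ≡ n) × (countOnes w ≡ k) ×
  (∀ j → j < k → zerosBeforeOne j w ≡ n ∸ k ∸ part l j)

-- Stable Grothendieck polynomials, evaluated at finitely many variables.
-- A filling of shape λ: list of rows, each row a list of boxes, each box a
-- nonempty set of entries from {1..m} (as a strictly increasing list).

nonemptySets : ℕ → List (List ℕ)
nonemptySets m = filterᵇ (λ { [] → false ; (_ ∷ _) → true }) (sublists (oneTo m))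

rowFillings : ℕ → ℕ → List (List (List ℕ))
rowFillings m zero    = [ [] ]
rowFillings m (suc l) = concatMap (λ s → map (s ∷_) (rowFillings m l)) (nonemptySets m)

fillings : ℕ → List ℕ → List (List (List (List ℕ)))
fillings m []      = [ [] ]
fillings m (l ∷ λs) = concatMap (λ r → map (r ∷_) (fillings m λs)) (rowFillings m l)

leSets : List ℕ → List ℕ → Bool
leSets A B = all (λ a → all (λ b → a ≤ᵇ b) B) A

ltSets : List ℕ → List ℕ → Bool
ltSets A B = all (λ a → all (λ b → a <ᵇ b) B) A

rowOK : List (List ℕ) → Bool
rowOK (A ∷ B ∷ r) = leSets A B ∧ rowOK (B ∷ r)
rowOK _           = true

-- upper row, lower row (columns left-justified)
colOK : List (List ℕ) → List (List ℕ) → Bool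
colOK (A ∷ as) (B ∷ bs) = ltSets A B ∧ colOK as bs
colOK _        _        = true

semistandard : List (List (List ℕ)) → Bool
semistandard []            = true
semistandard (r ∷ [])      = rowOK r
semistandard (r ∷ r' ∷ rs) = rowOK r ∧ colOK r r' ∧ semistandard (r' ∷ rs)

entries : List (List (List ℕ)) → List ℕ
entries T = concat (concat T)

-- value of the variable x_a (a ≥ 1) for variables xs = (x_1,...,x_m)
var : List ℤ → ℕ → ℤ
var []       _             = + 0
var (x ∷ xs) zero          = + 0
var (x ∷ xs) (suc zero)    = x
var (x ∷ xs) (suc (suc a)) = var xs (suc a)

-- G_λ(x_1,...,x_m), i.e. G_λ with x_{m+1} = x_{m+2} = ... = 0
G : List ℕ → List ℤ → ℤ
G l xs = sumℤ (map (λ T → negOnePow (length (entries T) ∸ size l)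
                          *ℤ prodℤ (map (var xs) (entries T)))
                   (filterᵇ semistandard (fillings (length xs) l)))

SupportedUpTo : (List ℕ → List ℕ → ℤ) → ℕ → Set
SupportedUpTo c N = ∀ l m → IsPartition l → IsPartition m →
  (N < size l) ⊎ (N < size m) → c l m ≡ + 0

-- Δ(G_ν) = Σ_{λ,μ} (-1)^{|ν|-|λ|-|μ|} c(λ,μ) G_λ ⊗ G_μ, as an identity of
-- power series in x_1,x_2,...,y_1,y_2,..., checked on all finite specialisations
CoproductExpansion : List ℕ → (List ℕ → List ℕ → ℤ) → ℕ → Set
CoproductExpansion ν c N = ∀ (xs ys : List ℤ) →
  G ν (xs ++ ys) ≡
  sumℤ (concatMap (λ l → map (λ m → negOnePow (size ν + size l + size m)
                                     *ℤ c l m *ℤ G l xs *ℤ G m ys)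
                             (partitionsUpTo N))
                  (partitionsUpTo N))

-- Puzzles in the upward triangle of side n.
-- Lattice points (r , i), 0 ≤ i ≤ r ≤ n, r = row from the top.
-- up r i   : upward unit triangle with vertices (r,i),(r+1,i),(r+1,i+1),  0 ≤ i ≤ r < n
-- down r i : downward unit triangle with vertices (r,i),(r,i+1),(r+1,i+1), 0 ≤ i < r < n
-- hE r i : horizontal edge (r,i)-(r,i+1)
-- lE r i : edge (r,i)-(r+1,i)   ("/" direction; left side of up r i)
-- rE r i : edge (r,i)-(r+1,i+1) ("\" direction; right side of up r i)

data Tri : Set where
  up down : ℕ → ℕ → Tri

data Edge : Set where
  hE lE rE : ℕ → ℕ → Edge

eqTri : Tri → Tri → Bool
eqTri (up r i)   (up s j)   = (r ≡ᵇ s) ∧ (i ≡ᵇ j)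
eqTri (down r i) (down s j) = (r ≡ᵇ s) ∧ (i ≡ᵇ j)
eqTri _ _ = false

eqEdge : Edge → Edge → Bool
eqEdge (hE r i) (hE s j) = (r ≡ᵇ s) ∧ (i ≡ᵇ j)
eqEdge (lE r i) (lE s j) = (r ≡ᵇ s) ∧ (i ≡ᵇ j)
eqEdge (rE r i) (rE s j) = (r ≡ᵇ s) ∧ (i ≡ᵇ j)
eqEdge _ _ = false

-- a placed piece: the unit triangles it covers and the labels of its
-- boundary edges (false = 0, true = 1)
record Piece : Set where
  constructor piece
  field
    cells  : List Tri
    labels : List (Edge × Bool)
open Piece public

allTris : ℕ → List Tri
allTris n = concatMap (λ r → map (up r) (upTo (suc r)) ++ map (down r) (upTo r)) (upTo n)

bits : List Bool
bits = false ∷ true ∷ []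

upSingles : ℕ → List Piece
upSingles n = concatMap (λ r → concatMap (λ i → map (λ b →
  piece [ up r i ] ((lE r i , b) ∷ (rE r i , b) ∷ (hE (suc r) i , b) ∷ []))
  bits) (upTo (suc r))) (upTo n)

downSingles : ℕ → List Piece
downSingles n = concatMap (λ r → concatMap (λ i → map (λ b →
  piece [ down r i ] ((hE r i , b) ∷ (rE r i , b) ∷ (lE r (suc i) , b) ∷ []))
  bits) (upTo r)) (upTo n)

-- rhombus up r i ∪ down (r+1) i (acute angles at top and bottom)
vertRhombi : ℕ → List Piece
vertRhombi n = concatMap (λ r → map (λ i →
  piece (up r i ∷ down (suc r) i ∷ [])
        ((lE r i , true) ∷ (rE r i , false) ∷ (lE (suc r) (suc i) , true) ∷ (rE (suc r) i , false) ∷ []))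
  (upTo (suc r))) (upTo (n ∸ 1))

-- rhombus up r i ∪ down r i (sharing the "\" edge rE r i)
leftRhombi : ℕ → List Piece
leftRhombi n = concatMap (λ r → map (λ i →
  piece (up r i ∷ down r i ∷ [])
        ((hE r i , true) ∷ (lE r (suc i) , false) ∷ (hE (suc r) i , true) ∷ (lE r i , false) ∷ []))
  (upTo r)) (upTo n)

-- rhombus down r i ∪ up r (i+1) (sharing the "/" edge lE r (i+1))
rightRhombi : ℕ → List Piece
rightRhombi n = concatMap (λ r → map (λ i →
  piece (down r i ∷ up r (suc i) ∷ [])
        ((hE r i , false) ∷ (rE r (suc i) , true) ∷ (hE (suc r) (suc i) , false) ∷ (rE r i , true) ∷ []))
  (upTo r)) (upTo n)

-- hexagon H around the interior lattice point (r' + 1 , i' + 1), i' < r', r' + 1 < n;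
-- labels ccw from the bottom edge: 1,0,1,0,1,0
hexagons : ℕ → List Piece
hexagons n = concatMap (λ r' → map (λ i' →
  let r = suc r' ; i = suc i' in
  piece (up r i ∷ down r i ∷ up r' i ∷ down r' i' ∷ up r' i' ∷ down r i' ∷ [])
        ((hE (suc r) i , true)      -- bottom
         ∷ (lE r (suc i) , false)   -- lower right
         ∷ (rE r' i , true)         -- upper right
         ∷ (hE r' i' , false)       -- top
         ∷ (lE r' i' , true)        -- upper left
         ∷ (rE r i' , false)        -- lower left
         ∷ []))
  (upTo r')) (upTo (n ∸ 1))

allPieces : ℕ → List Piece
allPieces n = upSingles n ++ downSingles n ++ vertRhombi n ++ leftRhombi n
              ++ rightRhombi n ++ hexagons n

-- boundary labels: left side (bottom-left corner to top), right side
-- (top to bottom-right corner), bottom (left to right)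
boundaryLabels : ℕ → List Bool → List Bool → List Bool → List (Edge × Bool)
boundaryLabels n wl wm wn =
  zip (map (λ j → lE (n ∸ 1 ∸ j) 0) (upTo n)) wl
  ++ zip (map (λ j → rE j j) (upTo n)) wm
  ++ zip (map (λ j → hE n j) (upTo n)) wn

count : {A : Set} → (A → Bool) → List A → ℕ
count p l = length (filterᵇ p l)

consistent : List (Edge × Bool) → List (Edge × Bool) → Bool
consistent L M = all (λ { (e , b) → all (λ { (e' , b') → not (eqEdge e e') ∨ beq b b' }) M }) L

isTiling : ℕ → List Bool → List Bool → List Bool → List Piece → Bool
isTiling n wl wm wn S =
  all (λ t → count (λ p → count (eqTri t) (cells p) ≡ᵇ 1) S ≡ᵇ 1) (allTris n)
  ∧ consistent (concatMap labels S) (concatMap labels S)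
  ∧ consistent (boundaryLabels n wl wm wn) (concatMap labels S)

puzzleCount : ℕ → List Bool → List Bool → List Bool → ℕ
puzzleCount n wl wm wn = count (isTiling n wl wm wn) (sublists (allPieces n))

{-# OPTIONS --safe #-}
module Submission where

-- Substituting -x for x removes all signs: let g_λ be the generating function of set-valued tableaux.
-- Splitting off the largest variable y gives a branching rule, g_ν(x,y) = Σ_τ S_y(ν,τ) g_τ(x), where
-- S_y is a transducer on binary words.  Puzzles are built row by row by another transducer (an H piece
-- is cut into six triangles with extra interior labels).  The transducer of S_y extends to rows with
-- interior labels so that it commutes with the row transfer; moving it through the puzzle from the
-- bottom side to the right side gives
--   Σ_τ P(λ,μ,τ) S_y(ν,τ) = Σ_σ P(λ,σ,ν) S_y(σ,μ)
-- for the numbers P of puzzles.  With P(λ,∅,ν) = [λ = ν], induction on the number of variables yields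
-- g_ν(x,y) = Σ P(λ,μ,ν) g_λ(x) g_μ(y), and the g_λ are linearly independent.

-- The two composites, strip below a row and strip above it, do not match state by state: in a given
-- pair of states one of them is in general only a linear combination, with coefficients polynomial
-- in y, of values in other pairs. `nf` lists these relations. A relation holds for all rows once it
-- is preserved by reading one letter and holds at the right end, so the commutation becomes a
-- finite computation. At the left border the composites are compared only on outputs that do not
-- begin with 1. This is where the bound n - k - 1 on the parts of ν enters: its word begins with 0,
-- whereas a 1 at the left end of a row persists down to the bottom side. All variables are
-- integers, because the expansion is given through its specialisations. Coefficients of polynomials
-- therefore cannot be compared directly; in the linear independence, divisibility by every positive
-- integer replaces the vanishing of a lowest coefficient. The given expansion runs over partitions
-- of bounded size and the puzzles over words of a fixed box, so both are moved to a larger box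
-- before independence is applied.

-- Finite sums of integers, and words of bits.

module Sums where

  open import Data.Bool using (Bool; true; false)
  open import Data.Nat using (ℕ; zero; suc)
  open import Data.List using (List; []; _∷_; _++_; map; concatMap; filterᵇ; length)
  open import Data.List.Membership.Propositional using (_∈_)
  open import Data.List.Relation.Unary.Any using (here; there)
  open import Data.Integer using (ℤ; +_; _+_; _*_)
  import Data.Integer.Properties as ℤₚ
  open import Algebra.Properties.CommutativeSemigroup ℤₚ.+-commutativeSemigroup using (interchange; x∙yz≈y∙xz) public
  open import Algebra.Properties.CommutativeSemigroup ℤₚ.*-commutativeSemigroup using () renaming (x∙yz≈y∙xz to *-left-comm) public
  open import Relation.Binary.PropositionalEquality

  private variable
    A B : Set

  ∑ : List A → (A → ℤ) → ℤ
  ∑ []       f = + 0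
  ∑ (x ∷ xs) f = f x + ∑ xs f

  ∑-cong-∈ : (xs : List A) {f g : A → ℤ} → (∀ x → x ∈ xs → f x ≡ g x) → ∑ xs f ≡ ∑ xs g
  ∑-cong-∈ []       h = refl
  ∑-cong-∈ (x ∷ xs) h = cong₂ _+_ (h x (here refl)) (∑-cong-∈ xs (λ y y∈ → h y (there y∈)))

  ∑-cong : (xs : List A) {f g : A → ℤ} → (∀ x → f x ≡ g x) → ∑ xs f ≡ ∑ xs g
  ∑-cong xs h = ∑-cong-∈ xs (λ x _ → h x)

  ∑-zero : (xs : List A) → ∑ xs (λ _ → + 0) ≡ + 0
  ∑-zero []       = refl
  ∑-zero (x ∷ xs) = trans (ℤₚ.+-identityˡ _) (∑-zero xs)

  ∑-zero-∈ : (xs : List A) {f : A → ℤ} → (∀ x → x ∈ xs → f x ≡ + 0) → ∑ xs f ≡ + 0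
  ∑-zero-∈ xs h = trans (∑-cong-∈ xs h) (∑-zero xs)

  ∑-++ : (xs ys : List A) (f : A → ℤ) → ∑ (xs ++ ys) f ≡ ∑ xs f + ∑ ys f
  ∑-++ []       ys f = sym (ℤₚ.+-identityˡ _)
  ∑-++ (x ∷ xs) ys f = trans (cong (_+_ (f x)) (∑-++ xs ys f)) (sym (ℤₚ.+-assoc (f x) _ _))

  ∑-map : (g : A → B) (xs : List A) (f : B → ℤ) → ∑ (map g xs) f ≡ ∑ xs (λ x → f (g x))
  ∑-map g []       f = refl
  ∑-map g (x ∷ xs) f = cong (_+_ (f (g x))) (∑-map g xs f)

  ∑-concatMap : (g : A → List B) (xs : List A) (f : B → ℤ) → ∑ (concatMap g xs) f ≡ ∑ xs (λ x → ∑ (g x) f)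
  ∑-concatMap g []       f = refl
  ∑-concatMap g (x ∷ xs) f = trans (∑-++ (g x) _ f) (cong (_+_ (∑ (g x) f)) (∑-concatMap g xs f))

  ∑-+ : (xs : List A) (f g : A → ℤ) → ∑ xs (λ x → f x + g x) ≡ ∑ xs f + ∑ xs g
  ∑-+ []       f g = refl
  ∑-+ (x ∷ xs) f g = trans (cong (_+_ (f x + g x)) (∑-+ xs f g)) (interchange (f x) (g x) _ _)

  ∑-*ˡ : (c : ℤ) (xs : List A) (f : A → ℤ) → ∑ xs (λ x → c * f x) ≡ c * ∑ xs f
  ∑-*ˡ c []       f = sym (ℤₚ.*-zeroʳ c)
  ∑-*ˡ c (x ∷ xs) f = trans (cong (_+_ (c * f x)) (∑-*ˡ c xs f)) (sym (ℤₚ.*-distribˡ-+ c (f x) _))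

  ∑-*ʳ : (c : ℤ) (xs : List A) (f : A → ℤ) → ∑ xs (λ x → f x * c) ≡ ∑ xs f * c
  ∑-*ʳ c xs f = trans (∑-cong xs (λ x → ℤₚ.*-comm (f x) c)) (trans (∑-*ˡ c xs f) (ℤₚ.*-comm c _))

  ∑-swap : (xs : List A) (ys : List B) (f : A → B → ℤ) →
           ∑ xs (λ x → ∑ ys (f x)) ≡ ∑ ys (λ y → ∑ xs (λ x → f x y))
  ∑-swap []       ys f = sym (∑-zero ys)
  ∑-swap (x ∷ xs) ys f = trans (cong (_+_ (∑ ys (f x))) (∑-swap xs ys f)) (sym (∑-+ ys (f x) _))

  ∑-[] : (x : A) (f : A → ℤ) → ∑ (x ∷ []) f ≡ f x
  ∑-[] x f = ℤₚ.+-identityʳ _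

  [_]ᵇ : Bool → ℤ
  [ true ]ᵇ  = + 1
  [ false ]ᵇ = + 0

  ∑-filter : (p : A → Bool) (xs : List A) (f : A → ℤ) → ∑ (filterᵇ p xs) f ≡ ∑ xs (λ x → [ p x ]ᵇ * f x)
  ∑-filter p []       f = refl
  ∑-filter p (x ∷ xs) f with p x
  ... | true  = cong₂ _+_ (sym (ℤₚ.*-identityˡ (f x))) (∑-filter p xs f)
  ... | false = trans (∑-filter p xs f) (sym (ℤₚ.+-identityˡ _))

  ∑-length : (xs : List A) → ∑ xs (λ _ → + 1) ≡ + length xs
  ∑-length []       = refl
  ∑-length (x ∷ xs) = cong (_+_ (+ 1)) (∑-length xs)

  words : ℕ → List (List Bool)
  words zero    = [] ∷ []
  words (suc n) = map (false ∷_) (words n) ++ map (true ∷_) (words n)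

  ∑-words-suc : (n : ℕ) (f : List Bool → ℤ) →
    ∑ (words (suc n)) f ≡ ∑ (words n) (λ w → f (false ∷ w)) + ∑ (words n) (λ w → f (true ∷ w))
  ∑-words-suc n f = trans (∑-++ (map (false ∷_) (words n)) _ f)
    (cong₂ _+_ (∑-map (false ∷_) (words n) f) (∑-map (true ∷_) (words n) f))

-- Row transfer of puzzles, the skewing operator, and formal combinations of states.

module Rows where

  open import Data.Bool using (Bool; true; false; if_then_else_; _∧_)
  open import Data.Bool.Properties using (∧-conicalˡ; ∧-conicalʳ; T-≡)
  open import Data.Nat using (ℕ; zero; suc; _≡ᵇ_)
  import Data.Nat.Properties as ℕₚ
  open import Data.List using (List; []; _∷_; map; concatMap; filterᵇ)
  open import Data.Maybe using (Maybe; just; nothing)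
  open import Data.Product using (_×_; _,_)
  open import Data.Integer using (ℤ; +_; _+_; _*_; -[1+_])
  import Data.Integer.Properties as ℤₚ
  open import Function using (_∘_; Equivalence)
  open import Relation.Binary.PropositionalEquality
  open import Defs using (all)
  open Sums

  data Lab : Set where
    bit      : Bool → Lab
    i₁ i₂ i₃ : Lab

  -- What covers an upward triangle: a single triangle, a vertical, left or right rhombus, or one of
  -- the three upward triangles of H.  The labels i₁, i₂, i₃ mark edges interior to a piece.
  data Kind : Set where
    sing                 : Bool → Kind
    vR lR rR hx₁ hx₂ hx₃ : Kind

  left right bot : Kind → Lab
  left (sing b) = bit b
  left vR  = bit true
  left lR  = bit false
  left rR  = i₁
  left hx₁ = bit true
  left hx₂ = i₂
  left hx₃ = i₃
  right (sing b) = bit b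
  right vR  = bit false
  right lR  = i₁
  right rR  = bit true
  right hx₁ = i₂
  right hx₂ = bit true
  right hx₃ = i₃
  bot (sing b) = bit b
  bot vR  = i₁
  bot lR  = bit true
  bot rR  = bit false
  bot hx₁ = i₂
  bot hx₂ = i₃
  bot hx₃ = bit true

  kindsFrom : Lab → List Kind
  kindsFrom (bit false) = sing false ∷ lR ∷ []
  kindsFrom (bit true)  = sing true ∷ vR ∷ hx₁ ∷ []
  kindsFrom i₁ = rR ∷ []
  kindsFrom i₂ = hx₂ ∷ []
  kindsFrom i₃ = hx₃ ∷ []

  -- The label of the "/" edge of a downward triangle, given those of its "\" and top edges.
  dn : Lab → Lab → Maybe Lab
  dn (bit false) (bit false) = just (bit false)
  dn (bit true)  (bit true)  = just (bit true)
  dn (bit false) i₁          = just (bit true)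
  dn i₁          (bit true)  = just (bit false)
  dn (bit true)  (bit false) = just i₁
  dn i₂          (bit false) = just i₂
  dn (bit false) i₂          = just i₃
  dn i₃          i₃          = just (bit false)
  dn _           _           = nothing

  isBit : Bool → Lab → Bool
  isBit true  (bit true)  = true
  isBit false (bit false) = true
  isBit _     _           = false

  extend : {A : Set} → Maybe Lab → (Lab → List A) → List A
  extend nothing  f = []
  extend (just ρ) f = f ρ

  -- The fillings of one row of the triangle, built from left to right. The argument `ρ` is the
  -- label on the left edge of the next upward triangle; `w` labels the horizontal edges above the
  -- downward triangles, so there is one more upward triangle than letters, and the last one ends on
  -- the right side of the puzzle.
  rows : Lab → List Lab → Bool → List (List Kind)
  rows ρ []      b = map (_∷ []) (filterᵇ (λ κ → isBit b (right κ)) (kindsFrom ρ))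
  rows ρ (u ∷ w) b = concatMap (λ κ → extend (dn (right κ) u) (λ ρ′ → map (κ ∷_) (rows ρ′ w b))) (kindsFrom ρ)

  ends : Lab → Bool → List Lab
  ends ρ b = map bot (filterᵇ (λ κ → isBit b (right κ)) (kindsFrom ρ))

  up : Lab → Lab → List (Lab × Lab)
  up ρ u = concatMap (λ κ → extend (dn (right κ) u) (λ ρ′ → (bot κ , ρ′) ∷ [])) (kindsFrom ρ)

  opaque
    -- In continuation form the transfer acts on functions of the word below, so that composing it
    -- with the strip is substitution. It is opaque so that later goals keep this name instead of
    -- unfolding into sums over `rows`.
    row : Lab → List Lab → Bool → (List Lab → ℤ) → ℤ
    row ρ w b f = ∑ (rows ρ w b) (λ ks → f (map bot ks))

    row-def : ∀ ρ w b f → row ρ w b f ≡ ∑ (rows ρ w b) (λ ks → f (map bot ks))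
    row-def ρ w b f = refl

    row-[] : ∀ ρ b f → row ρ [] b f ≡ ∑ (ends ρ b) (λ a → f (a ∷ []))
    row-[] ρ b f = let κs = filterᵇ (λ κ → isBit b (right κ)) (kindsFrom ρ) in
      trans (∑-map (_∷ []) κs _) (sym (∑-map bot κs _))

    row-∷ : ∀ ρ u w b f → row ρ (u ∷ w) b f ≡ ∑ (up ρ u) (λ (a , ρ′) → row ρ′ w b (f ∘ (a ∷_)))
    row-∷ ρ u w b f = trans (∑-concatMap _ (kindsFrom ρ) _)
      (trans (∑-cong (kindsFrom ρ) step) (sym (∑-concatMap _ (kindsFrom ρ) _)))
      where
      step : ∀ κ → ∑ (extend (dn (right κ) u) (λ ρ′ → map (κ ∷_) (rows ρ′ w b))) (λ ks → f (map bot ks))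
                 ≡ ∑ (extend (dn (right κ) u) (λ ρ′ → (bot κ , ρ′) ∷ [])) (λ (a , ρ′) → row ρ′ w b (f ∘ (a ∷_)))
      step κ with dn (right κ) u
      ... | nothing = refl
      ... | just ρ′ = trans (∑-map (κ ∷_) (rows ρ′ w b) _) (sym (ℤₚ.+-identityʳ _))

    row-cong : ∀ ρ w b {f g} → (∀ v → f v ≡ g v) → row ρ w b f ≡ row ρ w b g
    row-cong ρ w b h = ∑-cong (rows ρ w b) (λ ks → h (map bot ks))

    row-∑ : {A : Set} (ρ : Lab) (w : List Lab) (b : Bool) (zs : List A) (h : A → List Lab → ℤ) →
            row ρ w b (λ v → ∑ zs (λ z → h z v)) ≡ ∑ zs (λ z → row ρ w b (h z))
    row-∑ ρ w b zs h = ∑-swap (rows ρ w b) zs _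

    row-* : ∀ ρ w b c f → row ρ w b (λ v → c * f v) ≡ c * row ρ w b f
    row-* ρ w b c f = ∑-*ˡ c (rows ρ w b) _

    row-zero : ∀ ρ w b {f} → (∀ v → f v ≡ + 0) → row ρ w b f ≡ + 0
    row-zero ρ w b h = ∑-zero-∈ (rows ρ w b) (λ ks _ → h (map bot ks))

  -- The one-variable skewing operator on binary words, read from left to right; weights are
  -- polynomials in the variable y.  On words of bits, a carried one is being moved to the right
  -- across zeros (horizontal strip), and a marked one has y added to the last box of its row.
  data Mode : Set where
    idle mark carry : Mode

  -- Coefficients by increasing degree. Trailing zeros are allowed, so two polynomials are compared
  -- by testing their difference with `isZero`.
  Poly : Set
  Poly = List ℤ

  one yy 1+y -one -yy : Poly
  one  = + 1 ∷ []
  yy   = + 0 ∷ + 1 ∷ []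
  1+y  = + 1 ∷ + 1 ∷ []
  -one = -[1+ 0 ] ∷ []
  -yy  = + 0 ∷ -[1+ 0 ] ∷ []

  -- The input is the word of the smaller shape, the output that of the larger one. A one is emitted
  -- early, and each position up to its place in the input costs y, one box of its row. After a mark
  -- the next letter must be 0 in both words: the last box of that row in the smaller shape exists
  -- and has no box of the larger shape below it.
  side : Mode → Bool → List (Bool × Mode × Poly)
  side idle  false = (false , idle , one) ∷ (true , carry , one) ∷ []
  side idle  true  = (true , idle , one) ∷ (true , mark , one) ∷ []
  side mark  false = (false , idle , yy) ∷ []
  side mark  true  = []
  side carry false = (false , carry , yy) ∷ []
  side carry true  = (false , idle , yy) ∷ (false , mark , yy) ∷ []

  -- The extension of that operator to rows of labels inside a puzzle.  It was found by solving the
  -- commutation relation with the row transfer (strip-row below) for short rows.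
  data St : Set where
    S N E C P Q Z X W F Y U : St

  -- On bits, the states N, E, C behave as idle, mark, carry in `side`. S is N without the
  -- transitions that emit 1; it is the state at the left border.
  tr : St → Lab → List (Lab × St × Poly)
  tr S (bit false) = (bit false , N , one) ∷ []
  tr S i₁ = (i₁ , N , one) ∷ (i₂ , X , one) ∷ []
  tr S i₂ = (i₂ , W , one) ∷ []
  tr N (bit false) = (bit false , N , one) ∷ (bit true , C , one) ∷ []
  tr N (bit true) = (bit true , N , one) ∷ (bit true , E , one) ∷ []
  tr N i₁ = (i₁ , N , one) ∷ (bit true , P , one) ∷ (i₂ , X , one) ∷ []
  tr N i₂ = (i₂ , W , one) ∷ (bit true , U , one) ∷ []
  tr E (bit false) = (bit false , N , yy) ∷ []
  tr E i₁ = (i₁ , N , yy) ∷ (i₂ , X , yy) ∷ []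
  tr E i₂ = (i₂ , W , yy) ∷ []
  tr C (bit false) = (bit false , C , yy) ∷ []
  tr C (bit true) = (bit false , N , yy) ∷ (bit false , E , yy) ∷ []
  tr C i₁ = (bit false , P , yy) ∷ []
  tr C i₂ = (bit false , U , yy) ∷ []
  tr P (bit false) = (bit false , Q , 1+y) ∷ (i₁ , Z , yy) ∷ []
  tr P (bit true) = (i₁ , N , yy) ∷ (i₁ , E , yy) ∷ []
  tr P i₁ = (i₁ , P , yy) ∷ []
  tr P i₂ = (i₁ , U , yy) ∷ []
  tr Q (bit false) = (bit false , Q , one) ∷ (i₁ , Z , yy) ∷ []
  tr Q (bit true) = (i₁ , N , yy) ∷ (i₁ , E , yy) ∷ []
  tr Q i₁ = (i₁ , P , yy) ∷ []
  tr Q i₂ = (i₁ , U , yy) ∷ []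
  tr Z (bit false) = (bit false , Z , yy) ∷ []
  tr Z (bit true) = (bit false , N , yy) ∷ (bit false , E , yy) ∷ []
  tr Z i₁ = (bit false , P , yy) ∷ []
  tr Z i₂ = (bit false , U , yy) ∷ []
  tr X (bit false) = (i₃ , Q , one) ∷ []
  tr W i₃ = (i₃ , N , one) ∷ (i₃ , F , one) ∷ []
  tr F (bit false) = (bit false , F , one) ∷ (i₂ , Y , yy) ∷ []
  tr F i₁ = (i₁ , N , yy) ∷ (i₂ , X , yy) ∷ []
  tr F i₂ = (i₂ , W , yy) ∷ []
  tr Y (bit false) = (i₃ , Z , one) ∷ []
  tr Y (bit true) = (i₃ , N , one) ∷ (i₃ , E , one) ∷ []
  tr Y i₁ = (i₃ , P , one) ∷ []
  tr Y i₂ = (i₃ , U , one) ∷ []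
  tr U i₃ = (bit false , F , 1+y) ∷ (i₂ , Y , yy) ∷ []
  tr _ _ = []

  -- The mode in which the strip turns the corner from the row into the right side of the puzzle.
  -- The list is empty for states that cannot end a row; a carried one leaves through P or Q, not
  -- through C.
  exit : St → List Mode
  exit S = idle ∷ []
  exit N = idle ∷ []
  exit E = mark ∷ []
  exit F = mark ∷ []
  exit P = carry ∷ []
  exit Q = carry ∷ []
  exit _ = []

  data Side : Set where
    L R : Side

  -- key L ρ s: the strip (in state s) below a row transfer (in state ρ); key R ρ s: above it.
  data Key : Set where
    key : Side → Lab → St → Key

  -- The linear relations, found by elimination, between the states of the two composites.
  nf : Key → List (Key × Poly)
  nf (key L (bit false) C) = (key R (bit false) Z , one) ∷ []
  nf (key L (bit false) E) = (key R (bit false) N , yy) ∷ (key R i₃ Y , -yy) ∷ []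
  nf (key L (bit false) N) = (key R (bit false) N , one) ∷ []
  nf (key L (bit false) P) = (key L i₁ E , -one) ∷ (key L i₁ N , -one) ∷ (key L i₂ U , -one) ∷ (key R (bit true) Z , one) ∷ (key R i₁ N , 1+y) ∷ []
  nf (key L (bit false) Q) = (key L i₁ F , -one) ∷ (key L i₁ N , -one) ∷ (key R (bit true) Z , one) ∷ (key R i₁ N , one) ∷ []
  nf (key L (bit false) X) = (key L i₂ W , -one) ∷ (key R i₂ N , one) ∷ []
  nf (key L (bit false) Z) = (key R (bit false) Z , one) ∷ []
  nf (key L (bit true) C) = (key R i₁ E , yy) ∷ (key R i₁ N , yy) ∷ []
  nf (key L (bit true) E) = (key R (bit true) E , one) ∷ (key R i₃ X , -one) ∷ []
  nf (key L (bit true) F) = (key R (bit true) E , one) ∷ (key R i₃ X , -one) ∷ []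
  nf (key L (bit true) N) = (key R (bit true) N , one) ∷ (key R i₃ X , one) ∷ []
  nf (key L (bit true) P) = (key R (bit true) P , one) ∷ []
  nf (key L (bit true) Q) = (key R (bit true) P , one) ∷ []
  nf (key L (bit true) X) = []
  nf (key L (bit true) Y) = (key R i₂ E , one) ∷ (key R i₂ N , one) ∷ []
  nf (key L (bit true) Z) = (key R i₁ E , yy) ∷ (key R i₁ N , yy) ∷ []
  nf (key L i₁ C) = (key R i₁ Z , yy) ∷ []
  nf (key L i₁ Y) = (key R i₂ Z , one) ∷ []
  nf (key L i₁ Z) = (key R i₁ Z , yy) ∷ []
  nf (key L i₃ C) = (key R (bit false) U , one) ∷ []
  nf (key L i₃ N) = (key R i₃ W , one) ∷ []
  nf (key L i₃ P) = (key R (bit true) U , one) ∷ []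
  nf (key L i₃ Q) = (key R (bit true) U , one) ∷ []
  nf (key L i₃ X) = []
  nf (key L i₃ Z) = (key R (bit false) U , one) ∷ []
  nf (key R (bit false) C) = (key R (bit false) Z , one) ∷ []
  nf (key R (bit false) E) = (key R (bit false) N , yy) ∷ (key R i₃ Y , -yy) ∷ []
  nf (key R (bit false) F) = (key R (bit false) N , yy) ∷ (key R i₃ Y , -yy) ∷ []
  nf (key R (bit false) P) = (key R i₁ E , yy) ∷ (key R i₁ N , yy) ∷ []
  nf (key R (bit false) Q) = (key R i₁ N , yy) ∷ []
  nf (key R (bit true) C) = (key R (bit true) Z , one) ∷ []
  nf (key R i₁ C) = (key R i₁ Z , one) ∷ []
  nf (key R i₁ F) = []
  nf (key R i₁ P) = []
  nf (key R i₁ Q) = []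
  nf (key R i₁ U) = []
  nf (key R i₂ C) = (key R i₂ Z , one) ∷ []
  nf (key R i₂ F) = []
  nf (key R i₂ P) = []
  nf (key R i₂ Q) = []
  nf (key R i₂ U) = []
  nf q = (q , one) ∷ []

  -- A retraction into ℕ makes Boolean equality and its soundness cost one clause per label instead
  -- of one per pair of labels.
  codeLab : Lab → ℕ
  codeLab (bit false) = 0
  codeLab (bit true)  = 1
  codeLab i₁ = 2
  codeLab i₂ = 3
  codeLab i₃ = 4

  uncodeLab : ℕ → Lab
  uncodeLab 0 = bit false
  uncodeLab 1 = bit true
  uncodeLab 2 = i₁
  uncodeLab 3 = i₂
  uncodeLab _ = i₃

  codeSt : St → ℕ
  codeSt S = 0
  codeSt N = 1
  codeSt E = 2
  codeSt C = 3
  codeSt P = 4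
  codeSt Q = 5
  codeSt Z = 6
  codeSt X = 7
  codeSt W = 8
  codeSt F = 9
  codeSt Y = 10
  codeSt U = 11

  uncodeSt : ℕ → St
  uncodeSt 0 = S
  uncodeSt 1 = N
  uncodeSt 2 = E
  uncodeSt 3 = C
  uncodeSt 4 = P
  uncodeSt 5 = Q
  uncodeSt 6 = Z
  uncodeSt 7 = X
  uncodeSt 8 = W
  uncodeSt 9 = F
  uncodeSt 10 = Y
  uncodeSt _ = U

  uncode-codeLab : ∀ l → uncodeLab (codeLab l) ≡ l
  uncode-codeLab (bit false) = refl
  uncode-codeLab (bit true)  = refl
  uncode-codeLab i₁ = refl
  uncode-codeLab i₂ = refl
  uncode-codeLab i₃ = refl

  uncode-codeSt : ∀ s → uncodeSt (codeSt s) ≡ s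
  uncode-codeSt S = refl
  uncode-codeSt N = refl
  uncode-codeSt E = refl
  uncode-codeSt C = refl
  uncode-codeSt P = refl
  uncode-codeSt Q = refl
  uncode-codeSt Z = refl
  uncode-codeSt X = refl
  uncode-codeSt W = refl
  uncode-codeSt F = refl
  uncode-codeSt Y = refl
  uncode-codeSt U = refl

  ≡ᵇ-sound : ∀ m n → (m ≡ᵇ n) ≡ true → m ≡ n
  ≡ᵇ-sound m n h = ℕₚ.≡ᵇ⇒≡ m n (Equivalence.from T-≡ h)

  ≡ᵇ-refl : ∀ n → (n ≡ᵇ n) ≡ true
  ≡ᵇ-refl zero    = refl
  ≡ᵇ-refl (suc n) = ≡ᵇ-refl n

  eqLab : Lab → Lab → Bool
  eqLab l m = codeLab l ≡ᵇ codeLab m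

  eqLab-sound : ∀ l m → eqLab l m ≡ true → l ≡ m
  eqLab-sound l m h = trans (sym (uncode-codeLab l)) (trans (cong uncodeLab (≡ᵇ-sound _ _ h)) (uncode-codeLab m))

  eqSt-sound : ∀ s t → (codeSt s ≡ᵇ codeSt t) ≡ true → s ≡ t
  eqSt-sound s t h = trans (sym (uncode-codeSt s)) (trans (cong uncodeSt (≡ᵇ-sound _ _ h)) (uncode-codeSt t))

  eqSide : Side → Side → Bool
  eqSide L L = true
  eqSide R R = true
  eqSide _ _ = false

  eqSide-sound : ∀ s t → eqSide s t ≡ true → s ≡ t
  eqSide-sound L L _ = refl
  eqSide-sound R R _ = refl

  eqMode : Mode → Mode → Bool
  eqMode idle  idle  = true
  eqMode mark  mark  = true
  eqMode carry carry = true
  eqMode _ _ = false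

  eqMode-sound : ∀ s t → eqMode s t ≡ true → s ≡ t
  eqMode-sound idle  idle  _ = refl
  eqMode-sound mark  mark  _ = refl
  eqMode-sound carry carry _ = refl

  ∧-split : ∀ {a b} → (a ∧ b) ≡ true → (a ≡ true) × (b ≡ true)
  ∧-split {a} {b} h = ∧-conicalˡ a b h , ∧-conicalʳ a b h

  eqLabKey : Lab × Key → Lab × Key → Bool
  eqLabKey (c , key sd ρ s) (c′ , key sd′ ρ′ s′) =
    eqLab c c′ ∧ eqSide sd sd′ ∧ eqLab ρ ρ′ ∧ (codeSt s ≡ᵇ codeSt s′)

  eqLabKey-sound : ∀ k k′ → eqLabKey k k′ ≡ true → k ≡ k′
  eqLabKey-sound (c , key sd ρ s) (c′ , key sd′ ρ′ s′) h =
    let h₁ , h′ = ∧-split {eqLab c c′} h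
        h₂ , h″ = ∧-split {eqSide sd sd′} h′
        h₃ , h₄ = ∧-split {eqLab ρ ρ′} h″
    in cong₂ _,_ (eqLab-sound c c′ h₁)
         (trans (cong₂ (λ sd ρ → key sd ρ s) (eqSide-sound sd sd′ h₂) (eqLab-sound ρ ρ′ h₃))
                (cong (key sd′ ρ′) (eqSt-sound s s′ h₄)))

  eqLabMode : Lab × Mode → Lab × Mode → Bool
  eqLabMode (c , t) (c′ , t′) = eqLab c c′ ∧ eqMode t t′

  eqLabMode-sound : ∀ k k′ → eqLabMode k k′ ≡ true → k ≡ k′
  eqLabMode-sound (c , t) (c′ , t′) h =
    let h₁ , h₂ = ∧-split {eqLab c c′} h in cong₂ _,_ (eqLab-sound c c′ h₁) (eqMode-sound t t′ h₂)

  infixl 6 _⊕_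
  infixl 7 _⊗_

  _⊕_ : Poly → Poly → Poly
  []      ⊕ q       = q
  (a ∷ p) ⊕ []      = a ∷ p
  (a ∷ p) ⊕ (b ∷ q) = (a + b) ∷ (p ⊕ q)

  scale : ℤ → Poly → Poly
  scale c = map (c *_)

  _⊗_ : Poly → Poly → Poly
  []      ⊗ q = []
  (a ∷ p) ⊗ q = scale a q ⊕ (+ 0 ∷ (p ⊗ q))

  isZero : Poly → Bool
  isZero []            = true
  isZero (+ zero ∷ p)  = isZero p
  isZero (_ ∷ p)       = false

  module Combination {K : Set} (eq : K → K → Bool) (eq-sound : ∀ k k′ → eq k k′ ≡ true → k ≡ k′) where

    insert : K → Poly → List (K × Poly) → List (K × Poly)
    insert k p []              = (k , p) ∷ []
    insert k p ((k′ , q) ∷ v) = if eq k k′ then (k′ , p ⊕ q) ∷ v else (k′ , q) ∷ insert k p v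

    collect : List (K × Poly) → List (K × Poly)
    collect []            = []
    collect ((k , p) ∷ v) = insert k p (collect v)

    -- A computable sufficient condition for the combination to evaluate to 0 whatever values the
    -- keys receive: like terms are merged and every coefficient is tested as a polynomial.
    vanishes : List (K × Poly) → Bool
    vanishes v = all (λ (_ , p) → isZero p) (collect v)

  module Eval (y : ℤ) where

    ⟪_⟫ : Poly → ℤ
    ⟪ [] ⟫    = + 0
    ⟪ a ∷ p ⟫ = a + y * ⟪ p ⟫

    ⟪one⟫ : ⟪ one ⟫ ≡ + 1
    ⟪one⟫ rewrite ℤₚ.*-zeroʳ y = refl

    ⟪yy⟫ : ⟪ yy ⟫ ≡ y
    ⟪yy⟫ rewrite ⟪one⟫ | ℤₚ.*-identityʳ y = ℤₚ.+-identityˡ y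

    open ≡-Reasoning

    ⟪⟫-⊕ : ∀ p q → ⟪ p ⊕ q ⟫ ≡ ⟪ p ⟫ + ⟪ q ⟫
    ⟪⟫-⊕ []      q       = sym (ℤₚ.+-identityˡ _)
    ⟪⟫-⊕ (a ∷ p) []      = sym (ℤₚ.+-identityʳ _)
    ⟪⟫-⊕ (a ∷ p) (b ∷ q) = begin
      (a + b) + y * ⟪ p ⊕ q ⟫                   ≡⟨ cong (λ t → (a + b) + y * t) (⟪⟫-⊕ p q) ⟩
      (a + b) + y * (⟪ p ⟫ + ⟪ q ⟫)             ≡⟨ cong (_+_ (a + b)) (ℤₚ.*-distribˡ-+ y ⟪ p ⟫ ⟪ q ⟫) ⟩
      (a + b) + (y * ⟪ p ⟫ + y * ⟪ q ⟫)         ≡⟨ interchange a b _ _ ⟩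
      (a + y * ⟪ p ⟫) + (b + y * ⟪ q ⟫)         ∎

    ⟪⟫-scale : ∀ c p → ⟪ scale c p ⟫ ≡ c * ⟪ p ⟫
    ⟪⟫-scale c []      = sym (ℤₚ.*-zeroʳ c)
    ⟪⟫-scale c (a ∷ p) = begin
      c * a + y * ⟪ scale c p ⟫  ≡⟨ cong (λ t → c * a + y * t) (⟪⟫-scale c p) ⟩
      c * a + y * (c * ⟪ p ⟫)    ≡⟨ cong (_+_ (c * a)) (*-left-comm y c ⟪ p ⟫) ⟩
      c * a + c * (y * ⟪ p ⟫)    ≡⟨ sym (ℤₚ.*-distribˡ-+ c a _) ⟩
      c * (a + y * ⟪ p ⟫)        ∎

    ⟪⟫-⊗ : ∀ p q → ⟪ p ⊗ q ⟫ ≡ ⟪ p ⟫ * ⟪ q ⟫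
    ⟪⟫-⊗ []      q = refl
    ⟪⟫-⊗ (a ∷ p) q = begin
      ⟪ scale a q ⊕ (+ 0 ∷ (p ⊗ q)) ⟫           ≡⟨ ⟪⟫-⊕ (scale a q) _ ⟩
      ⟪ scale a q ⟫ + (+ 0 + y * ⟪ p ⊗ q ⟫)     ≡⟨ cong₂ _+_ (⟪⟫-scale a q) (trans (ℤₚ.+-identityˡ _) (cong (y *_) (⟪⟫-⊗ p q))) ⟩
      a * ⟪ q ⟫ + y * (⟪ p ⟫ * ⟪ q ⟫)           ≡⟨ cong (_+_ (a * ⟪ q ⟫)) (sym (ℤₚ.*-assoc y ⟪ p ⟫ ⟪ q ⟫)) ⟩
      a * ⟪ q ⟫ + y * ⟪ p ⟫ * ⟪ q ⟫             ≡⟨ sym (ℤₚ.*-distribʳ-+ ⟪ q ⟫ a _) ⟩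
      (a + y * ⟪ p ⟫) * ⟪ q ⟫                   ∎

    isZero-sound : ∀ p → isZero p ≡ true → ⟪ p ⟫ ≡ + 0
    isZero-sound []           h = refl
    isZero-sound (+ zero ∷ p) h rewrite isZero-sound p h = trans (ℤₚ.+-identityˡ _) (ℤₚ.*-zeroʳ y)

    ev : {K : Set} → List (K × Poly) → (K → ℤ) → ℤ
    ev v V = ∑ v (λ (k , p) → ⟪ p ⟫ * V k)

    module _ {K : Set} (eq : K → K → Bool) (eq-sound : ∀ k k′ → eq k k′ ≡ true → k ≡ k′) where
      open Combination eq eq-sound

      ev-insert : ∀ k p v V → ev (insert k p v) V ≡ ⟪ p ⟫ * V k + ev v V
      ev-insert k p []             V = refl
      ev-insert k p ((k′ , q) ∷ v) V with eq k k′ in e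
      ... | true rewrite eq-sound k k′ e | ⟪⟫-⊕ p q =
        trans (cong (_+ ev v V) (ℤₚ.*-distribʳ-+ (V k′) ⟪ p ⟫ ⟪ q ⟫)) (ℤₚ.+-assoc (⟪ p ⟫ * V k′) _ _)
      ... | false = trans (cong (_+_ (⟪ q ⟫ * V k′)) (ev-insert k p v V))
                          (x∙yz≈y∙xz (⟪ q ⟫ * V k′) (⟪ p ⟫ * V k) (ev v V))

      ev-collect : ∀ v V → ev (collect v) V ≡ ev v V
      ev-collect []            V = refl
      ev-collect ((k , p) ∷ v) V =
        trans (ev-insert k p (collect v) V) (cong (_+_ (⟪ p ⟫ * V k)) (ev-collect v V))

      ev-allZero : (v : List (K × Poly)) (V : K → ℤ) → all (λ (_ , p) → isZero p) v ≡ true → ev v V ≡ + 0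
      ev-allZero []            V h = refl
      ev-allZero ((k , p) ∷ v) V h with h₁ , h₂ ← ∧-split h
        rewrite isZero-sound p h₁ = trans (ℤₚ.+-identityˡ _) (ev-allZero v V h₂)

      ev-vanishes : (v : List (K × Poly)) (V : K → ℤ) → vanishes v ≡ true → ev v V ≡ + 0
      ev-vanishes v V h = trans (sym (ev-collect v V)) (ev-allZero (collect v) V h)

-- Commutation of the strip with the row transfer.

module Commutation where

  open import Data.Bool using (Bool; true; false; _∧_; not)
  open import Data.List using (List; []; _∷_; _++_; map; concatMap; filterᵇ)
  open import Data.Product using (_×_; _,_; proj₁; proj₂)
  open import Data.Integer using (ℤ; +_; -_; _+_; _*_)
  import Data.Integer.Properties as ℤₚ
  open import Function using (_∘_)
  open import Relation.Binary.PropositionalEquality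
  open Sums
  open Rows

  step : Key → Lab → List ((Lab × Key) × Poly)
  step (key L ρ s) u = concatMap (λ (a , ρ′) → map (λ (c , s′ , p) → ((c , key L ρ′ s′) , p)) (tr s a)) (up ρ u)
  step (key R ρ s) u = concatMap (λ (a , s′ , p) → map (λ (c , ρ′) → ((c , key R ρ′ s′) , p)) (up ρ a)) (tr s u)

  -- At the right end of the composite R the strip has left the row and passes through the right
  -- label by `side` before the row below it is closed; in L the row is closed first and the strip
  -- leaves afterwards.
  final : Key → Bool → List ((Lab × Mode) × Poly)
  final (key L ρ s) b =
    concatMap (λ a → concatMap (λ (c , s′ , p) → map (λ t → ((c , t) , p)) (exit s′)) (tr s a)) (ends ρ b)
  final (key R ρ s) b =
    concatMap (λ t → concatMap (λ (b′ , t′ , p) → map (λ c → ((c , t′) , p)) (ends ρ b′)) (side t b)) (exit s)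

  negate : {K : Set} → List (K × Poly) → List (K × Poly)
  negate = map (λ (k , p) → (k , -one ⊗ p))

  normal : List ((Lab × Key) × Poly) → List ((Lab × Key) × Poly)
  normal = concatMap (λ ((c , q) , p) → map (λ (q′ , p′) → ((c , q′) , p ⊗ p′)) (nf q))

  combine : {K : Set} → List (Key × Poly) → (Key → List (K × Poly)) → List (K × Poly)
  combine v f = concatMap (λ (q , p) → map (λ (k , p′) → (k , p ⊗ p′)) (f q)) v

  -- The relation of `q` is preserved by the letter `u`: after one step both of its sides agree as
  -- formal combinations, provided that the new keys are themselves rewritten by the relations.
  stepOK : Key → Lab → Bool
  stepOK q u = Combination.vanishes eqLabKey eqLabKey-sound
    (normal (step q u) ++ negate (normal (combine (nf q) (λ q′ → step q′ u))))

  finalOK : Key → Bool → Bool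
  finalOK q b = Combination.vanishes eqLabMode eqLabMode-sound
    (final q b ++ negate (combine (nf q) (λ q′ → final q′ b)))

  isOne : Lab → Bool
  isOne (bit true) = true
  isOne _          = false

  -- At the left border, terms whose first output is 1 may be discarded because the continuations in
  -- use vanish on such words.
  dropOne : {K : Set} → List ((Lab × K) × Poly) → List ((Lab × K) × Poly)
  dropOne = filterᵇ (λ ((c , _) , _) → not (isOne c))

  startOK : Bool → Lab → Bool
  startOK l u = Combination.vanishes eqLabKey eqLabKey-sound
    (normal (dropOne (step (key L (bit l) S) u)) ++ negate (normal (dropOne (step (key R (bit l) S) u))))

  startEndOK : Bool → Bool → Bool
  startEndOK l b = Combination.vanishes eqLabMode eqLabMode-sound
    (dropOne (final (key L (bit l) S) b) ++ negate (dropOne (final (key R (bit l) S) b)))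

  ∀Bool : (Bool → Bool) → Bool
  ∀Bool p = p false ∧ p true

  ∀Bool-sound : ∀ p → ∀Bool p ≡ true → ∀ b → p b ≡ true
  ∀Bool-sound p h false = proj₁ (∧-split h)
  ∀Bool-sound p h true  = proj₂ (∧-split {p false} h)

  ∀Lab : (Lab → Bool) → Bool
  ∀Lab p = ∀Bool (p ∘ bit) ∧ p i₁ ∧ p i₂ ∧ p i₃

  ∀Lab-sound : ∀ p → ∀Lab p ≡ true → ∀ l → p l ≡ true
  ∀Lab-sound p h (bit b) = ∀Bool-sound (p ∘ bit) (proj₁ (∧-split h)) b
  ∀Lab-sound p h i₁ = proj₁ (∧-split (proj₂ (∧-split {∀Bool (p ∘ bit)} h)))
  ∀Lab-sound p h i₂ = proj₁ (∧-split (proj₂ (∧-split {p i₁} (proj₂ (∧-split {∀Bool (p ∘ bit)} h)))))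
  ∀Lab-sound p h i₃ = proj₂ (∧-split {p i₂} (proj₂ (∧-split {p i₁} (proj₂ (∧-split {∀Bool (p ∘ bit)} h)))))

  ∀St : (St → Bool) → Bool
  ∀St p = p S ∧ p N ∧ p E ∧ p C ∧ p P ∧ p Q ∧ p Z ∧ p X ∧ p W ∧ p F ∧ p Y ∧ p U

  ∀St-sound : ∀ p → ∀St p ≡ true → ∀ s → p s ≡ true
  ∀St-sound p h = λ
    { S → hd h
    ; N → hd (tl {p S} h)
    ; E → hd (tl {p N} (tl {p S} h))
    ; C → hd (h₃ h)
    ; P → hd (tl {p C} (h₃ h))
    ; Q → hd (tl {p P} (tl {p C} (h₃ h)))
    ; Z → hd (h₆ h)
    ; X → hd (tl {p Z} (h₆ h))
    ; W → hd (tl {p X} (tl {p Z} (h₆ h)))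
    ; F → hd (h₉ h)
    ; Y → hd (tl {p F} (h₉ h))
    ; U → tl {p Y} (tl {p F} (h₉ h))
    }
    where
    hd : ∀ {a b} → (a ∧ b) ≡ true → a ≡ true
    hd = proj₁ ∘ ∧-split
    tl : ∀ {a b} → (a ∧ b) ≡ true → b ≡ true
    tl {a} = proj₂ ∘ ∧-split {a}
    h₃ : _ → _
    h₃ h = tl {p E} (tl {p N} (tl {p S} h))
    h₆ : _ → _
    h₆ h = tl {p Q} (tl {p P} (tl {p C} (h₃ h)))
    h₉ : _ → _
    h₉ h = tl {p W} (tl {p X} (tl {p Z} (h₆ h)))

  ∀Key : (Key → Bool) → Bool
  ∀Key p = ∀Lab (λ ρ → ∀St (λ s → p (key L ρ s) ∧ p (key R ρ s)))

  ∀Key-sound : ∀ p → ∀Key p ≡ true → ∀ q → p q ≡ true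
  ∀Key-sound p h (key sd ρ s)
    with h₁ , h₂ ← ∧-split {p (key L ρ s)} (∀St-sound (λ s → p (key L ρ s) ∧ p (key R ρ s))
                      (∀Lab-sound (λ ρ → ∀St (λ s → p (key L ρ s) ∧ p (key R ρ s))) h ρ) s)
    with sd
  ... | L = h₁
  ... | R = h₂

  -- Decided by evaluation over the 120 keys and 5 letters; this is the finite core of the
  -- commutation.
  step-check : ∀Key (λ q → ∀Lab (stepOK q)) ≡ true
  step-check = refl

  final-check : ∀Key (λ q → ∀Bool (finalOK q)) ≡ true
  final-check = refl

  start-check : ∀Bool (λ l → ∀Lab (startOK l)) ≡ true
  start-check = refl

  startEnd-check : ∀Bool (λ l → ∀Bool (startEndOK l)) ≡ true
  startEnd-check = refl

  module Transfer (y : ℤ) where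
    open Eval y
    open ≡-Reasoning

    str : St → List Lab → (Mode → List Lab → ℤ) → ℤ
    str s []      k = ∑ (exit s) (λ t → k t [])
    str s (u ∷ w) k = ∑ (tr s u) (λ (c , s′ , p) → ⟪ p ⟫ * str s′ w (λ t v → k t (c ∷ v)))

    str-cong : ∀ s w {k k′} → (∀ t v → k t v ≡ k′ t v) → str s w k ≡ str s w k′
    str-cong s []      h = ∑-cong (exit s) (λ t → h t [])
    str-cong s (u ∷ w) h = ∑-cong (tr s u) (λ (c , s′ , p) → cong (⟪ p ⟫ *_) (str-cong s′ w (λ t v → h t (c ∷ v))))

    str-∑ : {A : Set} (s : St) (w : List Lab) (zs : List A) (k : A → Mode → List Lab → ℤ) →
            str s w (λ t v → ∑ zs (λ z → k z t v)) ≡ ∑ zs (λ z → str s w (k z))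
    str-∑ s []      zs k = ∑-swap (exit s) zs _
    str-∑ s (u ∷ w) zs k = trans
      (∑-cong (tr s u) (λ (c , s′ , p) → trans (cong (⟪ p ⟫ *_) (str-∑ s′ w zs (λ z t v → k z t (c ∷ v))))
                                                (sym (∑-*ˡ ⟪ p ⟫ zs _))))
      (∑-swap (tr s u) zs _)

    sideSum : Mode → Bool → (Mode → Bool → ℤ) → ℤ
    sideSum t b f = ∑ (side t b) (λ (b′ , t′ , p) → ⟪ p ⟫ * f t′ b′)

    val : Key → List Lab → Bool → (Mode → List Lab → ℤ) → ℤ
    val (key L ρ s) w b k = row ρ w b (λ v → str s v k)
    val (key R ρ s) w b k = str s w (λ t v → sideSum t b (λ t′ b′ → row ρ v b′ (k t′)))

    val-step : ∀ q u w b k → val q (u ∷ w) b k ≡ ev (step q u) (λ (c , q′) → val q′ w b (λ t v → k t (c ∷ v)))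
    val-step (key L ρ s) u w b k = begin
      row ρ (u ∷ w) b (λ v → str s v k)
        ≡⟨ row-∷ ρ u w b (λ v → str s v k) ⟩
      ∑ (up ρ u) (λ (a , ρ′) → row ρ′ w b (λ v → str s (a ∷ v) k))
        ≡⟨ ∑-cong (up ρ u) (λ (a , ρ′) → trans (row-∑ ρ′ w b (tr s a) (λ (c , s′ , p) v → ⟪ p ⟫ * str s′ v (λ t v → k t (c ∷ v))))
             (trans (∑-cong (tr s a) (λ (c , s′ , p) → row-* ρ′ w b ⟪ p ⟫ (λ v → str s′ v (λ t v → k t (c ∷ v))))) (sym (∑-map _ (tr s a) _)))) ⟩
      ∑ (up ρ u) (λ (a , ρ′) → ev (map (λ (c , s′ , p) → ((c , key L ρ′ s′) , p)) (tr s a)) _)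
        ≡⟨ sym (∑-concatMap _ (up ρ u) _) ⟩
      ev (step (key L ρ s) u) _ ∎
    val-step (key R ρ s) u w b k = begin
      ∑ (tr s u) (λ (a , s′ , p) → ⟪ p ⟫ * str s′ w (λ t v → sideSum t b (λ t′ b′ → row ρ (a ∷ v) b′ (k t′))))
        ≡⟨ ∑-cong (tr s u) (λ (a , s′ , p) → trans (cong (⟪ p ⟫ *_)
             (trans (str-cong s′ w (λ t v → move t v a)) (str-∑ s′ w (up ρ a) _)))
             (trans (sym (∑-*ˡ ⟪ p ⟫ (up ρ a) _)) (sym (∑-map _ (up ρ a) _)))) ⟩
      ∑ (tr s u) (λ (a , s′ , p) → ev (map (λ (c , ρ′) → ((c , key R ρ′ s′) , p)) (up ρ a)) _)
        ≡⟨ sym (∑-concatMap _ (tr s u) _) ⟩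
      ev (step (key R ρ s) u) _ ∎
      where
      move : ∀ t v a → sideSum t b (λ t′ b′ → row ρ (a ∷ v) b′ (k t′))
           ≡ ∑ (up ρ a) (λ (c , ρ′) → sideSum t b (λ t′ b′ → row ρ′ v b′ (λ v′ → k t′ (c ∷ v′))))
      move t v a = trans (∑-cong (side t b) (λ (b′ , t′ , p) → trans (cong (⟪ p ⟫ *_) (row-∷ ρ a v b′ (k t′)))
                                                                   (sym (∑-*ˡ ⟪ p ⟫ (up ρ a) _))))
                         (∑-swap (side t b) (up ρ a) _)

    val-final : ∀ q b k → val q [] b k ≡ ev (final q b) (λ (c , t) → k t (c ∷ []))
    val-final (key L ρ s) b k = begin
      row ρ [] b (λ v → str s v k)
        ≡⟨ row-[] ρ b (λ v → str s v k) ⟩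
      ∑ (ends ρ b) (λ a → str s (a ∷ []) k)
        ≡⟨ ∑-cong (ends ρ b) (λ a → trans (∑-cong (tr s a) (λ (c , s′ , p) →
             trans (sym (∑-*ˡ ⟪ p ⟫ (exit s′) _)) (sym (∑-map _ (exit s′) _)))) (sym (∑-concatMap _ (tr s a) _))) ⟩
      ∑ (ends ρ b) (λ a → ev (concatMap (λ (c , s′ , p) → map (λ t → ((c , t) , p)) (exit s′)) (tr s a)) _)
        ≡⟨ sym (∑-concatMap _ (ends ρ b) _) ⟩
      ev (final (key L ρ s) b) _ ∎
    val-final (key R ρ s) b k = trans
      (∑-cong (exit s) (λ t → trans (∑-cong (side t b) (λ (b′ , t′ , p) →
        trans (cong (⟪ p ⟫ *_) (row-[] ρ b′ (k t′)))
          (trans (sym (∑-*ˡ ⟪ p ⟫ (ends ρ b′) _)) (sym (∑-map _ (ends ρ b′) _)))))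
        (sym (∑-concatMap _ (side t b) _))))
      (sym (∑-concatMap _ (exit s) _))

    ev-negate : {K : Set} (v : List (K × Poly)) (V : K → ℤ) → ev (negate v) V ≡ - ev v V
    ev-negate v V = begin
      ev (negate v) V                            ≡⟨ ∑-map _ v _ ⟩
      ∑ v (λ (k , p) → ⟪ -one ⊗ p ⟫ * V k)       ≡⟨ ∑-cong v (λ (k , p) → cong (_* V k) (⟪⟫-⊗ -one p)) ⟩
      ∑ v (λ (k , p) → ⟪ -one ⟫ * ⟪ p ⟫ * V k)   ≡⟨ ∑-cong v (λ (k , p) → trans (ℤₚ.*-assoc ⟪ -one ⟫ ⟪ p ⟫ (V k)) (cong (_* (⟪ p ⟫ * V k)) -one≡)) ⟩
      ∑ v (λ (k , p) → - (+ 1) * (⟪ p ⟫ * V k))  ≡⟨ ∑-*ˡ (- (+ 1)) v _ ⟩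
      - (+ 1) * ev v V                           ≡⟨ ℤₚ.-1*i≡-i _ ⟩
      - ev v V                                   ∎
      where
      -one≡ : ⟪ -one ⟫ ≡ - (+ 1)
      -one≡ rewrite ℤₚ.*-zeroʳ y = refl

    ev-mapped : {K K′ : Set} (g : K → K′) (p : Poly) (v : List (K × Poly)) (V : K′ → ℤ) →
                ev (map (λ (k , p′) → (g k , p ⊗ p′)) v) V ≡ ⟪ p ⟫ * ev v (V ∘ g)
    ev-mapped g p v V = trans (∑-map _ v _) (trans
      (∑-cong v (λ (k , p′) → trans (cong (_* V (g k)) (⟪⟫-⊗ p p′)) (ℤₚ.*-assoc ⟪ p ⟫ ⟪ p′ ⟫ _))) (∑-*ˡ ⟪ p ⟫ v _))

    ev-combine : {K : Set} (v : List (Key × Poly)) (f : Key → List (K × Poly)) (V : K → ℤ) →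
                 ev (combine v f) V ≡ ev v (λ q → ev (f q) V)
    ev-combine v f V = trans (∑-concatMap _ v _) (∑-cong v (λ (q , p) → ev-mapped (λ k → k) p (f q) V))

    ev-normal : ∀ v V → (∀ c q → V (c , q) ≡ ev (nf q) (λ q′ → V (c , q′))) → ev (normal v) V ≡ ev v V
    ev-normal v V h = trans (∑-concatMap _ v _)
      (∑-cong v (λ ((c , q) , p) → trans (ev-mapped (c ,_) p (nf q) V) (cong (⟪ p ⟫ *_) (sym (h c q)))))

    cancel : {K : Set} (eq : K → K → Bool) (eq-sound : ∀ k k′ → eq k k′ ≡ true → k ≡ k′)
             (u v : List (K × Poly)) (V : K → ℤ) →
             Combination.vanishes eq eq-sound (u ++ negate v) ≡ true → ev u V ≡ ev v V
    cancel eq eq-sound u v V h = ℤₚ.i-j≡0⇒i≡j _ _ (trans (cong (_+_ (ev u V)) (sym (ev-negate v V)))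
      (trans (sym (∑-++ u (negate v) _)) (ev-vanishes eq eq-sound (u ++ negate v) V h)))

    -- All relations are proved simultaneously by induction on the row. After one letter the
    -- hypothesis, taken for every key and for the shifted continuation, rewrites the keys on both
    -- sides, and the computed check makes the two sides cancel.
    val-nf : ∀ w b k q → val q w b k ≡ ev (nf q) (λ q′ → val q′ w b k)
    val-nf [] b k q = begin
      val q [] b k                                   ≡⟨ val-final q b k ⟩
      ev (final q b) V                               ≡⟨ cancel eqLabMode eqLabMode-sound (final q b) (combine (nf q) (λ q′ → final q′ b)) V
        (∀Bool-sound (finalOK q) (∀Key-sound (λ q → ∀Bool (finalOK q)) final-check q) b) ⟩
      ev (combine (nf q) (λ q′ → final q′ b)) V      ≡⟨ ev-combine (nf q) _ V ⟩
      ev (nf q) (λ q′ → ev (final q′ b) V)           ≡⟨ ∑-cong (nf q) (λ (q′ , p) → cong (⟪ p ⟫ *_) (sym (val-final q′ b k))) ⟩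
      ev (nf q) (λ q′ → val q′ [] b k)               ∎
      where V = λ (c , t) → k t (c ∷ [])
    val-nf (u ∷ w) b k q = begin
      val q (u ∷ w) b k                              ≡⟨ val-step q u w b k ⟩
      ev (step q u) V                                ≡⟨ sym (ev-normal (step q u) V h) ⟩
      ev (normal (step q u)) V                       ≡⟨ cancel eqLabKey eqLabKey-sound (normal (step q u)) (normal (combine (nf q) (λ q′ → step q′ u))) V
        (∀Lab-sound (stepOK q) (∀Key-sound (λ q → ∀Lab (stepOK q)) step-check q) u) ⟩
      ev (normal (combine (nf q) (λ q′ → step q′ u))) V ≡⟨ ev-normal (combine (nf q) (λ q′ → step q′ u)) V h ⟩
      ev (combine (nf q) (λ q′ → step q′ u)) V       ≡⟨ ev-combine (nf q) _ V ⟩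
      ev (nf q) (λ q′ → ev (step q′ u) V)            ≡⟨ ∑-cong (nf q) (λ (q′ , p) → cong (⟪ p ⟫ *_) (sym (val-step q′ u w b k))) ⟩
      ev (nf q) (λ q′ → val q′ (u ∷ w) b k)          ∎
      where
      V = λ (c , q′) → val q′ w b (λ t v → k t (c ∷ v))
      h : ∀ c q → V (c , q) ≡ ev (nf q) (λ q′ → V (c , q′))
      h c q = val-nf w b (λ t v → k t (c ∷ v)) q

    ev-dropOne : {K : Set} (v : List ((Lab × K) × Poly)) (V : Lab × K → ℤ) → (∀ k → V (bit true , k) ≡ + 0) →
                 ev (dropOne v) V ≡ ev v V
    ev-dropOne v V h = trans (∑-filter _ v _) (∑-cong v kill)
      where
      kill : ∀ x → [ not (isOne (proj₁ (proj₁ x))) ]ᵇ * (⟪ proj₂ x ⟫ * V (proj₁ x)) ≡ ⟪ proj₂ x ⟫ * V (proj₁ x)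
      kill ((bit true , k) , p)  rewrite h k = sym (ℤₚ.*-zeroʳ ⟪ p ⟫)
      kill ((bit false , k) , p) = ℤₚ.*-identityˡ _
      kill ((i₁ , k) , p) = ℤₚ.*-identityˡ _
      kill ((i₂ , k) , p) = ℤₚ.*-identityˡ _
      kill ((i₃ , k) , p) = ℤₚ.*-identityˡ _

    str-zero : ∀ s w {k} → (∀ t v → k t v ≡ + 0) → str s w k ≡ + 0
    str-zero s []      h = ∑-zero-∈ (exit s) (λ t _ → h t [])
    str-zero s (u ∷ w) h = ∑-zero-∈ (tr s u) (λ (c , s′ , p) _ →
      trans (cong (⟪ p ⟫ *_) (str-zero s′ w (λ t v → h t (c ∷ v)))) (ℤₚ.*-zeroʳ ⟪ p ⟫))

    -- In L the state S never emits 1 as the first letter, whereas in R the row below the strip may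
    -- do so; the hypothesis on `k` removes these terms. Once the first letter has been read, the
    -- relations of `nf` settle the comparison.
    strip-row : ∀ l w b k → (∀ t v → k t (bit true ∷ v) ≡ + 0) →
                val (key L (bit l) S) w b k ≡ val (key R (bit l) S) w b k
    strip-row l [] b k h = begin
      val qL [] b k                 ≡⟨ val-final qL b k ⟩
      ev (final qL b) V             ≡⟨ sym (ev-dropOne (final qL b) V hV) ⟩
      ev (dropOne (final qL b)) V   ≡⟨ cancel eqLabMode eqLabMode-sound (dropOne (final qL b)) (dropOne (final qR b)) V
        (∀Bool-sound (startEndOK l) (∀Bool-sound (λ l → ∀Bool (startEndOK l)) startEnd-check l) b) ⟩
      ev (dropOne (final qR b)) V   ≡⟨ ev-dropOne (final qR b) V hV ⟩
      ev (final qR b) V             ≡⟨ sym (val-final qR b k) ⟩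
      val qR [] b k                 ∎
      where
      qL = key L (bit l) S
      qR = key R (bit l) S
      V = λ (c , t) → k t (c ∷ [])
      hV : ∀ t → V (bit true , t) ≡ + 0
      hV t = h t []
    strip-row l (u ∷ w) b k h = begin
      val qL (u ∷ w) b k                   ≡⟨ val-step qL u w b k ⟩
      ev (step qL u) V                     ≡⟨ sym (ev-dropOne (step qL u) V hV) ⟩
      ev (dropOne (step qL u)) V           ≡⟨ sym (ev-normal (dropOne (step qL u)) V hn) ⟩
      ev (normal (dropOne (step qL u))) V  ≡⟨ cancel eqLabKey eqLabKey-sound (normal (dropOne (step qL u))) (normal (dropOne (step qR u))) V
        (∀Lab-sound (startOK l) (∀Bool-sound (λ l → ∀Lab (startOK l)) start-check l) u) ⟩
      ev (normal (dropOne (step qR u))) V  ≡⟨ ev-normal (dropOne (step qR u)) V hn ⟩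
      ev (dropOne (step qR u)) V           ≡⟨ ev-dropOne (step qR u) V hV ⟩
      ev (step qR u) V                     ≡⟨ sym (val-step qR u w b k) ⟩
      val qR (u ∷ w) b k                   ∎
      where
      qL = key L (bit l) S
      qR = key R (bit l) S
      V = λ (c , q′) → val q′ w b (λ t v → k t (c ∷ v))
      hn : ∀ c q → V (c , q) ≡ ev (nf q) (λ q′ → V (c , q′))
      hn c q = val-nf w b (λ t v → k t (c ∷ v)) q
      hV : ∀ q → V (bit true , q) ≡ + 0
      hV (key L ρ s) = row-zero ρ w b (λ v → str-zero s v h)
      hV (key R ρ s) = str-zero s w (λ t v → ∑-zero-∈ (side t b) (λ (b′ , t′ , p) _ →
        trans (cong (⟪ p ⟫ *_) (row-zero ρ v b′ (h t′))) (ℤₚ.*-zeroʳ ⟪ p ⟫)))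

-- Puzzle numbers, and the passage of the strip from the bottom side to the right side.

module Puzzle where

  open import Data.Bool using (Bool; true; false; if_then_else_)
  open import Data.Nat using (zero; suc)
  open import Data.List using (List; []; _∷_; map; concatMap; length; reverse)
  open import Data.Product using (_×_; _,_)
  open import Data.Integer using (ℤ; +_; _+_; _*_)
  import Data.Integer.Properties as ℤₚ
  open import Data.Unit using (⊤)
  open import Function using (_∘_)
  open import Relation.Binary.PropositionalEquality
  open import Data.Integer.Tactic.RingSolver using (solve-∀)
  open Sums
  open Rows
  open Commutation

  -- Bottom words of the H-puzzles with given left and right labels (both read downwards), below a
  -- given top word.
  bots : List Bool → List Bool → List Lab → List (List Lab)
  bots (l ∷ ls) (m ∷ ms) w = concatMap (λ ks → bots ls ms (map bot ks)) (rows (bit l) w m)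
  bots []       []       w = w ∷ []
  bots _        _        w = []

  PZ : List Bool → List Bool → (List Lab → ℤ) → List Lab → ℤ
  PZ ls ms f w = ∑ (bots ls ms w) f

  PZ-∷ : ∀ l ls m ms f w → PZ (l ∷ ls) (m ∷ ms) f w ≡ row (bit l) w m (PZ ls ms f)
  PZ-∷ l ls m ms f w = trans (∑-concatMap _ (rows (bit l) w m) f) (sym (row-def (bit l) w m (PZ ls ms f)))

  -- Interior labels count as mismatches: on the bottom side they would belong to a piece that
  -- sticks out of the triangle.
  δ : List Bool → List Lab → ℤ
  δ []      []      = + 1
  δ (b ∷ ν) (c ∷ z) = if isBit b c then δ ν z else + 0
  δ _       _       = + 0

  -- The left side is read upwards in the boundary convention while rows are built downwards, hence
  -- the reversal. The initial word is empty because the top row is a single upward triangle.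
  puzzles : List Bool → List Bool → List Bool → ℤ
  puzzles la mu nu = PZ (reverse la) mu (δ nu) []

  -- Below a leftmost horizontal edge labelled 1, the only possible first upward triangle is that of
  -- a left rhombus (left label 0) or a single triangle (left label 1), and its bottom edge is again
  -- labelled 1.
  PZ-one : ∀ ls ms f w → (∀ v → f (bit true ∷ v) ≡ + 0) → PZ ls ms f (bit true ∷ w) ≡ + 0
  PZ-one []       []       f w h = trans (∑-[] _ f) (h w)
  PZ-one []       (_ ∷ _)  f w h = refl
  PZ-one (_ ∷ _)  []       f w h = refl
  PZ-one (l ∷ ls) (m ∷ ms) f w h =
    trans (PZ-∷ l ls m ms f (bit true ∷ w)) (trans (row-∷ (bit l) (bit true) w m (PZ ls ms f)) (kill l))
    where
    zero-row : ∀ ρ → row ρ w m (λ v → PZ ls ms f (bit true ∷ v)) ≡ + 0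
    zero-row ρ = row-zero ρ w m (λ v → PZ-one ls ms f v h)
    kill : ∀ l → ∑ (up (bit l) (bit true)) (λ (a , ρ′) → row ρ′ w m (PZ ls ms f ∘ (a ∷_))) ≡ + 0
    kill false = trans (ℤₚ.+-identityʳ _) (zero-row (bit false))
    kill true  = trans (ℤₚ.+-identityʳ _) (zero-row (bit true))

  module Skew (y : ℤ) where
    open Eval y
    open Transfer y
    open ≡-Reasoning

    -- run t τ g sums g over the words ν obtained from τ by adding a horizontal strip; pull is adjoint.
    run : Mode → List Bool → (List Bool → ℤ) → ℤ
    run idle  []          g = g []
    run mark  []          g = + 0
    run carry []          g = + 0
    run idle  (false ∷ τ) g = run idle τ (g ∘ (false ∷_)) + run carry τ (g ∘ (true ∷_))
    run idle  (true  ∷ τ) g = run idle τ (g ∘ (true ∷_)) + run mark τ (g ∘ (true ∷_))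
    run mark  (false ∷ τ) g = y * run idle τ (g ∘ (false ∷_))
    run mark  (true  ∷ τ) g = + 0
    run carry (false ∷ τ) g = y * run carry τ (g ∘ (false ∷_))
    run carry (true  ∷ τ) g = y * (run idle τ (g ∘ (false ∷_)) + run mark τ (g ∘ (false ∷_)))

    pull : Mode → List Bool → (List Bool → ℤ) → ℤ
    pull idle  []          g = g []
    pull mark  []          g = + 0
    pull carry []          g = + 0
    pull idle  (false ∷ w) g = pull idle w (g ∘ (false ∷_))
    pull idle  (true  ∷ w) g =
      (pull idle w (g ∘ (true ∷_)) + pull mark w (g ∘ (true ∷_))) + pull carry w (g ∘ (false ∷_))
    pull mark  (false ∷ w) g = y * pull idle w (g ∘ (false ∷_))
    pull mark  (true  ∷ w) g = + 0
    pull carry (false ∷ w) g =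
      y * (pull carry w (g ∘ (false ∷_)) + (pull idle w (g ∘ (true ∷_)) + pull mark w (g ∘ (true ∷_))))
    pull carry (true  ∷ w) g = + 0

    run-side : ∀ t b τ g → run t (b ∷ τ) g ≡ sideSum t b (λ t′ b′ → run t′ τ (g ∘ (b′ ∷_)))
    run-side idle  false τ g rewrite ⟪one⟫ | ℤₚ.*-identityˡ (run idle τ (g ∘ (false ∷_)))
      | ℤₚ.*-identityˡ (run carry τ (g ∘ (true ∷_))) | ℤₚ.+-identityʳ (run carry τ (g ∘ (true ∷_))) = refl
    run-side idle  true  τ g rewrite ⟪one⟫ | ℤₚ.*-identityˡ (run idle τ (g ∘ (true ∷_)))
      | ℤₚ.*-identityˡ (run mark τ (g ∘ (true ∷_))) | ℤₚ.+-identityʳ (run mark τ (g ∘ (true ∷_))) = refl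
    run-side mark  false τ g rewrite ⟪yy⟫ = sym (ℤₚ.+-identityʳ _)
    run-side mark  true  τ g = refl
    run-side carry false τ g rewrite ⟪yy⟫ = sym (ℤₚ.+-identityʳ _)
    run-side carry true  τ g rewrite ⟪yy⟫ = trans (ℤₚ.*-distribˡ-+ y (run idle τ (g ∘ (false ∷_))) (run mark τ (g ∘ (false ∷_))))
      (cong (_+_ (y * run idle τ (g ∘ (false ∷_)))) (sym (ℤₚ.+-identityʳ (y * run mark τ (g ∘ (false ∷_))))))

    run-∑ : {A : Set} (t : Mode) (τ : List Bool) (zs : List A) (g : A → List Bool → ℤ) →
            run t τ (λ σ → ∑ zs (λ z → g z σ)) ≡ ∑ zs (λ z → run t τ (g z))
    run-∑ idle  [] zs g = refl
    run-∑ mark  [] zs g = sym (∑-zero zs)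
    run-∑ carry [] zs g = sym (∑-zero zs)
    run-∑ t (b ∷ τ) zs g = begin
      run t (b ∷ τ) (λ σ → ∑ zs (λ z → g z σ))
        ≡⟨ run-side t b τ _ ⟩
      ∑ (side t b) (λ (b′ , t′ , p) → ⟪ p ⟫ * run t′ τ (λ σ → ∑ zs (λ z → g z (b′ ∷ σ))))
        ≡⟨ ∑-cong (side t b) (λ (b′ , t′ , p) → trans (cong (⟪ p ⟫ *_) (run-∑ t′ τ zs (λ z → g z ∘ (b′ ∷_)))) (sym (∑-*ˡ ⟪ p ⟫ zs _))) ⟩
      ∑ (side t b) (λ (b′ , t′ , p) → ∑ zs (λ z → ⟪ p ⟫ * run t′ τ (g z ∘ (b′ ∷_))))
        ≡⟨ ∑-swap (side t b) zs _ ⟩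
      ∑ zs (λ z → sideSum t b (λ t′ b′ → run t′ τ (g z ∘ (b′ ∷_))))
        ≡⟨ ∑-cong zs (λ z → sym (run-side t b τ (g z))) ⟩
      ∑ zs (λ z → run t (b ∷ τ) (g z)) ∎

    run-[] : ∀ t {g h} → g [] ≡ h [] → run t [] g ≡ run t [] h
    run-[] idle  e = e
    run-[] mark  e = refl
    run-[] carry e = refl

    run-cong : ∀ t τ {g h} → (∀ σ → g σ ≡ h σ) → run t τ g ≡ run t τ h
    run-cong t []      e = run-[] t (e [])
    run-cong t (b ∷ τ) {g} {h} e = trans (run-side t b τ g) (trans
      (∑-cong (side t b) (λ (b′ , t′ , p) → cong (⟪ p ⟫ *_) (run-cong t′ τ (λ σ → e (b′ ∷ σ))))) (sym (run-side t b τ h)))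

    run-zero : ∀ t τ {g} → (∀ σ → g σ ≡ + 0) → run t τ g ≡ + 0
    -- The zero function is a sum over the empty list, so linearity gives the value.
    run-zero t τ e = trans (run-cong t τ e) (run-∑ {⊤} t τ [] (λ _ _ → + 0))

    pull-zero : ∀ t w {g} → (∀ σ → g σ ≡ + 0) → pull t w g ≡ + 0
    pull-zero idle  [] e = e []
    pull-zero mark  [] e = refl
    pull-zero carry [] e = refl
    pull-zero idle  (false ∷ w) e = pull-zero idle w (e ∘ (false ∷_))
    pull-zero idle  (true  ∷ w) e rewrite pull-zero idle w (e ∘ (true ∷_)) | pull-zero mark w (e ∘ (true ∷_))
      | pull-zero carry w (e ∘ (false ∷_)) = refl
    pull-zero mark  (false ∷ w) e rewrite pull-zero idle w (e ∘ (false ∷_)) = ℤₚ.*-zeroʳ y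
    pull-zero mark  (true  ∷ w) e = refl
    pull-zero carry (false ∷ w) e rewrite pull-zero idle w (e ∘ (true ∷_)) | pull-zero mark w (e ∘ (true ∷_))
      | pull-zero carry w (e ∘ (false ∷_)) = ℤₚ.*-zeroʳ y
    pull-zero carry (true  ∷ w) e = refl

    pull-∑ : {A : Set} (t : Mode) (w : List Bool) (zs : List A) (c : A → ℤ) (g : A → List Bool → ℤ) →
             pull t w (λ σ → ∑ zs (λ z → c z * g z σ)) ≡ ∑ zs (λ z → c z * pull t w (g z))
    pull-∑ idle  [] zs c g = refl
    pull-∑ mark  [] zs c g = sym (∑-zero-∈ zs (λ z _ → ℤₚ.*-zeroʳ (c z)))
    pull-∑ carry [] zs c g = sym (∑-zero-∈ zs (λ z _ → ℤₚ.*-zeroʳ (c z)))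
    pull-∑ idle  (false ∷ w) zs c g = pull-∑ idle w zs c (λ z → g z ∘ (false ∷_))
    pull-∑ idle  (true  ∷ w) zs c g
      rewrite pull-∑ idle w zs c (λ z → g z ∘ (true ∷_)) | pull-∑ mark w zs c (λ z → g z ∘ (true ∷_))
      | pull-∑ carry w zs c (λ z → g z ∘ (false ∷_)) =
      trans (cong (_+ ∑ zs cC) (sym (∑-+ zs cN cE))) (trans (sym (∑-+ zs (λ z → cN z + cE z) cC))
        (∑-cong zs (λ z → distrib₃ (c z) (pull idle w (g z ∘ (true ∷_))) (pull mark w (g z ∘ (true ∷_))) (pull carry w (g z ∘ (false ∷_))))))
      where
      cN = λ z → c z * pull idle w (g z ∘ (true ∷_))
      cE = λ z → c z * pull mark w (g z ∘ (true ∷_))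
      cC = λ z → c z * pull carry w (g z ∘ (false ∷_))
      distrib₃ : ∀ c x y z → c * x + c * y + c * z ≡ c * (x + y + z)
      distrib₃ = solve-∀
    pull-∑ mark  (false ∷ w) zs c g rewrite pull-∑ idle w zs c (λ z → g z ∘ (false ∷_)) =
      trans (sym (∑-*ˡ y zs _)) (∑-cong zs (λ z → *-left-comm y (c z) _))
    pull-∑ mark  (true  ∷ w) zs c g = sym (∑-zero-∈ zs (λ z _ → ℤₚ.*-zeroʳ (c z)))
    pull-∑ carry (false ∷ w) zs c g
      rewrite pull-∑ idle w zs c (λ z → g z ∘ (true ∷_)) | pull-∑ mark w zs c (λ z → g z ∘ (true ∷_))
      | pull-∑ carry w zs c (λ z → g z ∘ (false ∷_)) =
      trans (cong (λ t → y * (∑ zs cC + t)) (sym (∑-+ zs cN cE))) (trans (cong (y *_) (sym (∑-+ zs cC (λ z → cN z + cE z))))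
        (trans (sym (∑-*ˡ y zs (λ z → cC z + (cN z + cE z)))) (∑-cong zs (λ z →
          distrib₃ y (c z) (pull carry w (g z ∘ (false ∷_))) (pull idle w (g z ∘ (true ∷_))) (pull mark w (g z ∘ (true ∷_)))))))
      where
      cN = λ z → c z * pull idle w (g z ∘ (true ∷_))
      cE = λ z → c z * pull mark w (g z ∘ (true ∷_))
      cC = λ z → c z * pull carry w (g z ∘ (false ∷_))
      distrib₃ : ∀ y c x y′ z → y * (c * x + (c * y′ + c * z)) ≡ c * (y * (x + (y′ + z)))
      distrib₃ = solve-∀
    pull-∑ carry (true  ∷ w) zs c g = sym (∑-zero-∈ zs (λ z _ → ℤₚ.*-zeroʳ (c z)))

    -- Both sides are the same double sum over pairs of words, weighted by the transducer and
    -- grouped by the larger or by the smaller shape. The induction splits off the first letters of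
    -- both words; the residual modes then agree.
    adjoint : ∀ n t (e g : List Bool → ℤ) →
              ∑ (words n) (λ w → e w * pull t w g) ≡ ∑ (words n) (λ τ → run t τ e * g τ)
    adjoint zero idle  e g = refl
    adjoint zero mark  e g = cong (_+ + 0) (ℤₚ.*-zeroʳ (e []))
    adjoint zero carry e g = cong (_+ + 0) (ℤₚ.*-zeroʳ (e []))
    adjoint (suc n) idle e g = begin
      ∑ (words (suc n)) (λ w → e w * pull idle w g)
        ≡⟨ ∑-words-suc n _ ⟩
      ∑ (words n) (λ w → e₀ w * pull idle w g₀) +
      ∑ (words n) (λ w → e₁ w * ((pull idle w g₁ + pull mark w g₁) + pull carry w g₀))
        ≡⟨ cong (_+_ A) (trans (∑-cong (words n) (λ w → distrib (e₁ w) (pull idle w g₁) (pull mark w g₁) (pull carry w g₀)))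
             (trans (∑-+ (words n) (λ w → e₁ w * pull idle w g₁ + e₁ w * pull mark w g₁) (λ w → e₁ w * pull carry w g₀))
               (cong (_+ B″) (∑-+ (words n) (λ w → e₁ w * pull idle w g₁) (λ w → e₁ w * pull mark w g₁))))) ⟩
      A + ((B + B′) + B″)
        ≡⟨ cong₂ _+_ (adjoint n idle e₀ g₀) (cong₂ _+_ (cong₂ _+_ (adjoint n idle e₁ g₁) (adjoint n mark e₁ g₁)) (adjoint n carry e₁ g₀)) ⟩
      A′ + ((∑ (words n) (λ τ → run idle τ e₁ * g₁ τ) + ∑ (words n) (λ τ → run mark τ e₁ * g₁ τ)) + ∑ (words n) (λ τ → run carry τ e₁ * g₀ τ))
        ≡⟨ shuffle A′ (∑ (words n) (λ τ → run idle τ e₁ * g₁ τ)) _ _ ⟩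
      (A′ + ∑ (words n) (λ τ → run carry τ e₁ * g₀ τ)) + (∑ (words n) (λ τ → run idle τ e₁ * g₁ τ) + ∑ (words n) (λ τ → run mark τ e₁ * g₁ τ))
        ≡⟨ cong₂ _+_ (fuse (λ τ → run idle τ e₀) (λ τ → run carry τ e₁) g₀) (fuse (λ τ → run idle τ e₁) (λ τ → run mark τ e₁) g₁) ⟩
      ∑ (words n) (λ τ → (run idle τ e₀ + run carry τ e₁) * g₀ τ) + ∑ (words n) (λ τ → (run idle τ e₁ + run mark τ e₁) * g₁ τ)
        ≡⟨ sym (∑-words-suc n _) ⟩
      ∑ (words (suc n)) (λ τ → run idle τ e * g τ) ∎
      where
      e₀ = e ∘ (false ∷_)
      e₁ = e ∘ (true ∷_)
      g₀ = g ∘ (false ∷_)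
      g₁ = g ∘ (true ∷_)
      A  = ∑ (words n) (λ w → e₀ w * pull idle w g₀)
      A′ = ∑ (words n) (λ τ → run idle τ e₀ * g₀ τ)
      B  = ∑ (words n) (λ w → e₁ w * pull idle w g₁)
      B′ = ∑ (words n) (λ w → e₁ w * pull mark w g₁)
      B″ = ∑ (words n) (λ w → e₁ w * pull carry w g₀)
      distrib : ∀ e x y z → e * ((x + y) + z) ≡ (e * x + e * y) + e * z
      distrib = solve-∀
      shuffle : ∀ a b c d → a + ((b + c) + d) ≡ (a + d) + (b + c)
      shuffle = solve-∀
      fuse : ∀ (p q h : List Bool → ℤ) → ∑ (words n) (λ τ → p τ * h τ) + ∑ (words n) (λ τ → q τ * h τ)
           ≡ ∑ (words n) (λ τ → (p τ + q τ) * h τ)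
      fuse p q h = trans (sym (∑-+ (words n) _ _)) (∑-cong (words n) (λ τ → sym (ℤₚ.*-distribʳ-+ (h τ) (p τ) (q τ))))
    adjoint (suc n) mark e g = begin
      ∑ (words (suc n)) (λ w → e w * pull mark w g)
        ≡⟨ ∑-words-suc n _ ⟩
      ∑ (words n) (λ w → e₀ w * (y * pull idle w g₀)) + ∑ (words n) (λ w → e (true ∷ w) * + 0)
        ≡⟨ cong₂ _+_ (trans (∑-cong (words n) (λ w → *-left-comm (e₀ w) y _)) (trans (∑-*ˡ y (words n) _) (cong (y *_) (adjoint n idle e₀ g₀))))
             (∑-zero-∈ (words n) (λ w _ → ℤₚ.*-zeroʳ (e (true ∷ w)))) ⟩
      y * ∑ (words n) (λ τ → run idle τ e₀ * g₀ τ) + + 0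
        ≡⟨ cong₂ _+_ (trans (sym (∑-*ˡ y (words n) _)) (∑-cong (words n) (λ τ → sym (ℤₚ.*-assoc y (run idle τ e₀) _)))) (sym (∑-zero (words n))) ⟩
      ∑ (words n) (λ τ → y * run idle τ e₀ * g₀ τ) + ∑ (words n) (λ τ → + 0 * g (true ∷ τ))
        ≡⟨ sym (∑-words-suc n _) ⟩
      ∑ (words (suc n)) (λ τ → run mark τ e * g τ) ∎
      where
      e₀ = e ∘ (false ∷_)
      g₀ = g ∘ (false ∷_)
    adjoint (suc n) carry e g = begin
      ∑ (words (suc n)) (λ w → e w * pull carry w g)
        ≡⟨ ∑-words-suc n _ ⟩
      ∑ (words n) (λ w → e₀ w * (y * (pull carry w g₀ + (pull idle w g₁ + pull mark w g₁)))) + ∑ (words n) (λ w → e (true ∷ w) * + 0)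
        ≡⟨ cong₂ _+_ (trans (∑-cong (words n) (λ w → distrib (e₀ w) y (pull carry w g₀) _ _))
             (trans (∑-*ˡ y (words n) _) (cong (y *_) (trans (∑-+ (words n) _ _) (cong₂ _+_ (adjoint n carry e₀ g₀)
               (trans (∑-+ (words n) _ _) (cong₂ _+_ (adjoint n idle e₀ g₁) (adjoint n mark e₀ g₁))))))))
             (∑-zero-∈ (words n) (λ w _ → ℤₚ.*-zeroʳ (e (true ∷ w)))) ⟩
      y * (A + (B + D)) + + 0
        ≡⟨ shuffle y A B D ⟩
      y * A + y * (B + D)
        ≡⟨ cong₂ _+_ (trans (sym (∑-*ˡ y (words n) _)) (∑-cong (words n) (λ τ → sym (ℤₚ.*-assoc y (run carry τ e₀) _))))
             (trans (cong (y *_) (trans (sym (∑-+ (words n) _ _)) (∑-cong (words n) (λ τ → sym (ℤₚ.*-distribʳ-+ (g₁ τ) (run idle τ e₀) _)))))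
               (trans (sym (∑-*ˡ y (words n) _)) (∑-cong (words n) (λ τ → sym (ℤₚ.*-assoc y (run idle τ e₀ + run mark τ e₀) _))))) ⟩
      ∑ (words n) (λ τ → y * run carry τ e₀ * g₀ τ) + ∑ (words n) (λ τ → y * (run idle τ e₀ + run mark τ e₀) * g₁ τ)
        ≡⟨ sym (∑-words-suc n _) ⟩
      ∑ (words (suc n)) (λ τ → run carry τ e * g τ) ∎
      where
      e₀ = e ∘ (false ∷_)
      g₀ = g ∘ (false ∷_)
      g₁ = g ∘ (true ∷_)
      A = ∑ (words n) (λ τ → run carry τ e₀ * g₀ τ)
      B = ∑ (words n) (λ τ → run idle τ e₀ * g₁ τ)
      D = ∑ (words n) (λ τ → run mark τ e₀ * g₁ τ)
      distrib : ∀ e y a b c → e * (y * (a + (b + c))) ≡ y * (e * a + (e * b + e * c))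
      distrib = solve-∀
      shuffle : ∀ y a b c → y * (a + (b + c)) + + 0 ≡ y * a + y * (b + c)
      shuffle = solve-∀

    -- At the bottom right corner nothing is left to read: `run` on an empty side keeps idle and
    -- discards a pending mark or carried one.
    final-mode : (List Lab → ℤ) → Mode → List Lab → ℤ
    final-mode f t z = run t [] (λ _ → f z)

    -- The commutation iterated over the rows. Each row lets the strip pass from the word below to
    -- the word above, and crossing the right label of that row is one step of `run`; in the end the
    -- strip reads the top word and then runs down the whole right side.
    strip-PZ : ∀ ls ms f w → length ls ≡ length ms → (∀ v → f (bit true ∷ v) ≡ + 0) →
      str S w (λ t v → run t ms (λ σ → PZ ls σ f v)) ≡ PZ ls ms (λ τ → str S τ (final-mode f)) w
    strip-PZ [] [] f w _ h =
      trans (str-cong S w (λ t v → run-[] t (ℤₚ.+-identityʳ (f v)))) (sym (ℤₚ.+-identityʳ _))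
    strip-PZ (l ∷ ls) (b ∷ ms) f w e h = begin
      str S w (λ t v → run t (b ∷ ms) (λ σ → PZ (l ∷ ls) σ f v))
        ≡⟨ str-cong S w (λ t v → trans (run-side t b ms _) (∑-cong (side t b) (λ (b′ , t′ , p) → cong (⟪ p ⟫ *_)
             (run-row t′ b′ v)))) ⟩
      val (key R (bit l) S) w b k
        ≡⟨ sym (strip-row l w b k (λ t v → run-zero t ms (λ σ → PZ-one ls σ f v h))) ⟩
      row (bit l) w b (λ v → str S v k)
        ≡⟨ row-cong (bit l) w b (λ v → strip-PZ ls ms f v (suc-injective e) h) ⟩
      row (bit l) w b (PZ ls ms (λ τ → str S τ (final-mode f)))
        ≡⟨ sym (PZ-∷ l ls b ms _ w) ⟩
      PZ (l ∷ ls) (b ∷ ms) (λ τ → str S τ (final-mode f)) w ∎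
      where
      open import Data.Nat.Properties using (suc-injective)
      k : Mode → List Lab → ℤ
      k t v = run t ms (λ σ → PZ ls σ f v)
      run-row : ∀ t b′ v → run t ms (λ σ → PZ (l ∷ ls) (b′ ∷ σ) f v) ≡ row (bit l) v b′ (k t)
      run-row t b′ v = trans (run-cong t ms (λ σ → trans (PZ-∷ l ls b′ σ f v) (row-def (bit l) v b′ (PZ ls σ f))))
        (trans (run-∑ t ms (rows (bit l) v b′) (λ ks σ → PZ ls σ f (map bot ks))) (sym (row-def (bit l) v b′ (k t))))

    afterδ : List Bool → Lab → (List Bool → ℤ) → ℤ
    afterδ []      c h = + 0
    afterδ (b ∷ ν) c h = if isBit b c then h ν else + 0

    final-δ : List Bool → Mode → List Lab → ℤ
    final-δ ν = final-mode (δ ν)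

    str-δ : ∀ s x ν c → str s x (λ t z → final-δ ν t (c ∷ z)) ≡ afterδ ν c (λ ν′ → str s x (final-δ ν′))
    str-δ s x []      c = str-zero s x (λ t z → run-zero t [] (λ _ → refl))
    str-δ s x (b ∷ ν) c with isBit b c
    ... | true  = refl
    ... | false = str-zero s x (λ t z → run-zero t [] (λ _ → refl))

    str-∷δ : ∀ s u x ν → str s (u ∷ x) (final-δ ν)
           ≡ ∑ (tr s u) (λ (c , s′ , p) → ⟪ p ⟫ * afterδ ν c (λ ν′ → str s′ x (final-δ ν′)))
    str-∷δ s u x ν = ∑-cong (tr s u) (λ (c , s′ , p) → cong (⟪ p ⟫ *_) (str-δ s′ x ν c))

    str-nil : ∀ s u x → str s (u ∷ x) (final-δ []) ≡ + 0
    str-nil s u x = trans (str-∷δ s u x []) (∑-zero-∈ (tr s u) (λ (c , s′ , p) _ → ℤₚ.*-zeroʳ ⟪ p ⟫))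

    data Dead : St → Set where
      dP : Dead P
      dQ : Dead Q
      dF : Dead F
      dU : Dead U

    drop-term : ∀ {a b : ℤ} c → a ≡ + 0 → b ≡ + 0 → c * a + b ≡ + 0
    drop-term c refl refl = trans (ℤₚ.+-identityʳ _) (ℤₚ.*-zeroʳ c)

    -- From these states on, no word of bits is produced in mode idle.
    dead : ∀ {s} → Dead s → ∀ x ν → str s x (final-δ ν) ≡ + 0
    dead dP [] ν = refl
    dead dQ [] ν = refl
    dead dF [] ν = refl
    dead dU [] ν = refl
    dead {s} d (u ∷ x) [] = str-nil s u x
    dead dP (bit false ∷ x) (false ∷ ν) = trans (str-∷δ P (bit false) x (false ∷ ν)) (drop-term ⟪ 1+y ⟫ (dead dQ x ν) (drop-term ⟪ yy ⟫ refl refl))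
    dead dP (bit false ∷ x) (true ∷ ν)  = trans (str-∷δ P (bit false) x (true ∷ ν)) (drop-term ⟪ 1+y ⟫ refl (drop-term ⟪ yy ⟫ refl refl))
    dead dP (bit true ∷ x) (false ∷ ν) = trans (str-∷δ P (bit true) x (false ∷ ν)) (drop-term ⟪ yy ⟫ refl (drop-term ⟪ yy ⟫ refl refl))
    dead dP (bit true ∷ x) (true ∷ ν)  = trans (str-∷δ P (bit true) x (true ∷ ν)) (drop-term ⟪ yy ⟫ refl (drop-term ⟪ yy ⟫ refl refl))
    dead dP (i₁ ∷ x) (false ∷ ν) = trans (str-∷δ P i₁ x (false ∷ ν)) (drop-term ⟪ yy ⟫ refl refl)
    dead dP (i₁ ∷ x) (true ∷ ν)  = trans (str-∷δ P i₁ x (true ∷ ν)) (drop-term ⟪ yy ⟫ refl refl)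
    dead dP (i₂ ∷ x) (false ∷ ν) = trans (str-∷δ P i₂ x (false ∷ ν)) (drop-term ⟪ yy ⟫ refl refl)
    dead dP (i₂ ∷ x) (true ∷ ν)  = trans (str-∷δ P i₂ x (true ∷ ν)) (drop-term ⟪ yy ⟫ refl refl)
    dead dP (i₃ ∷ x) ν = refl
    dead dQ (bit false ∷ x) (false ∷ ν) = trans (str-∷δ Q (bit false) x (false ∷ ν)) (drop-term ⟪ one ⟫ (dead dQ x ν) (drop-term ⟪ yy ⟫ refl refl))
    dead dQ (bit false ∷ x) (true ∷ ν)  = trans (str-∷δ Q (bit false) x (true ∷ ν)) (drop-term ⟪ one ⟫ refl (drop-term ⟪ yy ⟫ refl refl))
    dead dQ (bit true ∷ x) (false ∷ ν) = trans (str-∷δ Q (bit true) x (false ∷ ν)) (drop-term ⟪ yy ⟫ refl (drop-term ⟪ yy ⟫ refl refl))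
    dead dQ (bit true ∷ x) (true ∷ ν)  = trans (str-∷δ Q (bit true) x (true ∷ ν)) (drop-term ⟪ yy ⟫ refl (drop-term ⟪ yy ⟫ refl refl))
    dead dQ (i₁ ∷ x) (false ∷ ν) = trans (str-∷δ Q i₁ x (false ∷ ν)) (drop-term ⟪ yy ⟫ refl refl)
    dead dQ (i₁ ∷ x) (true ∷ ν)  = trans (str-∷δ Q i₁ x (true ∷ ν)) (drop-term ⟪ yy ⟫ refl refl)
    dead dQ (i₂ ∷ x) (false ∷ ν) = trans (str-∷δ Q i₂ x (false ∷ ν)) (drop-term ⟪ yy ⟫ refl refl)
    dead dQ (i₂ ∷ x) (true ∷ ν)  = trans (str-∷δ Q i₂ x (true ∷ ν)) (drop-term ⟪ yy ⟫ refl refl)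
    dead dQ (i₃ ∷ x) ν = refl
    dead dF (bit false ∷ x) (false ∷ ν) = trans (str-∷δ F (bit false) x (false ∷ ν)) (drop-term ⟪ one ⟫ (dead dF x ν) (drop-term ⟪ yy ⟫ refl refl))
    dead dF (bit false ∷ x) (true ∷ ν)  = trans (str-∷δ F (bit false) x (true ∷ ν)) (drop-term ⟪ one ⟫ refl (drop-term ⟪ yy ⟫ refl refl))
    dead dF (bit true ∷ x) ν = refl
    dead dF (i₁ ∷ x) (false ∷ ν) = trans (str-∷δ F i₁ x (false ∷ ν)) (drop-term ⟪ yy ⟫ refl (drop-term ⟪ yy ⟫ refl refl))
    dead dF (i₁ ∷ x) (true ∷ ν)  = trans (str-∷δ F i₁ x (true ∷ ν)) (drop-term ⟪ yy ⟫ refl (drop-term ⟪ yy ⟫ refl refl))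
    dead dF (i₂ ∷ x) (false ∷ ν) = trans (str-∷δ F i₂ x (false ∷ ν)) (drop-term ⟪ yy ⟫ refl refl)
    dead dF (i₂ ∷ x) (true ∷ ν)  = trans (str-∷δ F i₂ x (true ∷ ν)) (drop-term ⟪ yy ⟫ refl refl)
    dead dF (i₃ ∷ x) ν = refl
    dead dU (bit _ ∷ x) ν = refl
    dead dU (i₁ ∷ x) ν = refl
    dead dU (i₂ ∷ x) ν = refl
    dead dU (i₃ ∷ x) (false ∷ ν) = trans (str-∷δ U i₃ x (false ∷ ν)) (drop-term ⟪ 1+y ⟫ (dead dF x ν) (drop-term ⟪ yy ⟫ refl refl))
    dead dU (i₃ ∷ x) (true ∷ ν)  = trans (str-∷δ U i₃ x (true ∷ ν)) (drop-term ⟪ 1+y ⟫ refl (drop-term ⟪ yy ⟫ refl refl))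

    state : Mode → St
    state idle  = N
    state mark  = E
    state carry = C

    -- With the output forced to be the bits of ν, the states N, E, C follow the modes of `pull`.
    -- Every additional transition out of them either emits an interior label, which `final-δ`
    -- rejects, or enters P or U, where `dead` applies.
    pull-δ : ∀ t ν x → pull t ν (λ τ → δ τ x) ≡ str (state t) x (final-δ ν)
    pull-δ idle  [] [] = refl
    pull-δ mark  [] [] = refl
    pull-δ carry [] [] = refl
    pull-δ t (b ∷ ν) [] = trans (pull-[] t b) (sym (str-[] t))
      where
      pull-[] : ∀ t b → pull t (b ∷ ν) (λ τ → δ τ []) ≡ + 0
      pull-[] t b = pull-nonempty t b (λ b′ τ → refl)
        where
        pull-nonempty : ∀ t b {g} → (∀ b′ τ → g (b′ ∷ τ) ≡ + 0) → pull t (b ∷ ν) g ≡ + 0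
        pull-nonempty idle  false e = pull-zero idle ν (e false)
        pull-nonempty idle  true  e rewrite pull-zero idle ν (e true) | pull-zero mark ν (e true) | pull-zero carry ν (e false) = refl
        pull-nonempty mark  false e rewrite pull-zero idle ν (e false) = ℤₚ.*-zeroʳ y
        pull-nonempty mark  true  e = refl
        pull-nonempty carry false e rewrite pull-zero idle ν (e true) | pull-zero mark ν (e true) | pull-zero carry ν (e false) = ℤₚ.*-zeroʳ y
        pull-nonempty carry true  e = refl
      str-[] : ∀ t → str (state t) [] (final-δ (b ∷ ν)) ≡ + 0
      str-[] idle  = refl
      str-[] mark  = refl
      str-[] carry = refl
    pull-δ t [] (u ∷ x) = trans (pull-nil t) (sym (str-nil (state t) u x))
      where
      pull-nil : ∀ t → pull t [] (λ τ → δ τ (u ∷ x)) ≡ + 0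
      pull-nil idle  = refl
      pull-nil mark  = refl
      pull-nil carry = refl
    pull-δ t (b ∷ ν) (u ∷ x) = trans (cases t b u) (sym (str-∷δ (state t) u x (b ∷ ν)))
      where
      cases : ∀ t b u → pull t (b ∷ ν) (λ τ → δ τ (u ∷ x))
            ≡ ∑ (tr (state t) u) (λ (c , s′ , p) → ⟪ p ⟫ * afterδ (b ∷ ν) c (λ ν′ → str s′ x (final-δ ν′)))
      cases idle false (bit false) rewrite ⟪one⟫ | pull-δ idle ν x =
        solve₀ (str N x (final-δ ν))
        where
        solve₀ : ∀ a → a ≡ + 1 * a + + 0
        solve₀ = solve-∀
      cases idle false (bit true) = trans (pull-zero idle ν (λ _ → refl)) (sym (drop-term ⟪ one ⟫ refl (drop-term ⟪ one ⟫ refl refl)))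
      cases idle false i₁ = trans (pull-zero idle ν (λ _ → refl)) (sym (drop-term ⟪ one ⟫ refl (drop-term ⟪ one ⟫ refl (drop-term ⟪ one ⟫ refl refl))))
      cases idle false i₂ = trans (pull-zero idle ν (λ _ → refl)) (sym (drop-term ⟪ one ⟫ refl (drop-term ⟪ one ⟫ refl refl)))
      cases idle false i₃ = pull-zero idle ν (λ _ → refl)
      cases idle true (bit false) rewrite ⟪one⟫ | pull-δ carry ν x
        | pull-zero idle ν {λ τ → δ (true ∷ τ) (bit false ∷ x)} (λ _ → refl) | pull-zero mark ν {λ τ → δ (true ∷ τ) (bit false ∷ x)} (λ _ → refl) =
        solve₁ (str C x (final-δ ν))
        where
        solve₁ : ∀ a → + 0 + a ≡ + 0 + (+ 1 * a + + 0)
        solve₁ = solve-∀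
      cases idle true (bit true) rewrite ⟪one⟫ | pull-δ idle ν x | pull-δ mark ν x
        | pull-zero carry ν {λ τ → δ (false ∷ τ) (bit true ∷ x)} (λ _ → refl) = solve₂ (str N x (final-δ ν)) (str E x (final-δ ν))
        where
        solve₂ : ∀ a b → a + b + + 0 ≡ + 1 * a + (+ 1 * b + + 0)
        solve₂ = solve-∀
      cases idle true i₁ rewrite dead dP x ν | pull-zero carry ν {λ τ → δ (false ∷ τ) (i₁ ∷ x)} (λ _ → refl)
        | pull-zero idle ν {λ τ → δ (true ∷ τ) (i₁ ∷ x)} (λ _ → refl) | pull-zero mark ν {λ τ → δ (true ∷ τ) (i₁ ∷ x)} (λ _ → refl)
        = sym (drop-term ⟪ one ⟫ refl (drop-term ⟪ one ⟫ refl (drop-term ⟪ one ⟫ refl refl)))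
      cases idle true i₂ rewrite dead dU x ν | pull-zero carry ν {λ τ → δ (false ∷ τ) (i₂ ∷ x)} (λ _ → refl)
        | pull-zero idle ν {λ τ → δ (true ∷ τ) (i₂ ∷ x)} (λ _ → refl) | pull-zero mark ν {λ τ → δ (true ∷ τ) (i₂ ∷ x)} (λ _ → refl)
        = sym (drop-term ⟪ one ⟫ refl (drop-term ⟪ one ⟫ refl refl))
      cases idle true i₃ rewrite pull-zero carry ν {λ τ → δ (false ∷ τ) (i₃ ∷ x)} (λ _ → refl)
        | pull-zero idle ν {λ τ → δ (true ∷ τ) (i₃ ∷ x)} (λ _ → refl) | pull-zero mark ν {λ τ → δ (true ∷ τ) (i₃ ∷ x)} (λ _ → refl) = refl
      cases mark false (bit false) rewrite ⟪yy⟫ | pull-δ idle ν x = sym (ℤₚ.+-identityʳ _)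
      cases mark false (bit true) rewrite pull-zero idle ν {λ τ → δ (false ∷ τ) (bit true ∷ x)} (λ _ → refl) = ℤₚ.*-zeroʳ y
      cases mark false i₁ rewrite pull-zero idle ν {λ τ → δ (false ∷ τ) (i₁ ∷ x)} (λ _ → refl) =
        trans (ℤₚ.*-zeroʳ y) (sym (drop-term ⟪ yy ⟫ refl (drop-term ⟪ yy ⟫ refl refl)))
      cases mark false i₂ rewrite pull-zero idle ν {λ τ → δ (false ∷ τ) (i₂ ∷ x)} (λ _ → refl) =
        trans (ℤₚ.*-zeroʳ y) (sym (drop-term ⟪ yy ⟫ refl refl))
      cases mark false i₃ rewrite pull-zero idle ν {λ τ → δ (false ∷ τ) (i₃ ∷ x)} (λ _ → refl) = ℤₚ.*-zeroʳ y
      cases mark true (bit false) = sym (drop-term ⟪ yy ⟫ refl refl)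
      cases mark true (bit true) = refl
      cases mark true i₁ = sym (drop-term ⟪ yy ⟫ refl (drop-term ⟪ yy ⟫ refl refl))
      cases mark true i₂ = sym (drop-term ⟪ yy ⟫ refl refl)
      cases mark true i₃ = refl
      cases carry false (bit false) rewrite ⟪yy⟫ | pull-δ carry ν x
        | pull-zero idle ν {λ τ → δ (true ∷ τ) (bit false ∷ x)} (λ _ → refl) | pull-zero mark ν {λ τ → δ (true ∷ τ) (bit false ∷ x)} (λ _ → refl) =
        solve₃ y (str C x (final-δ ν))
        where
        solve₃ : ∀ y a → y * (a + + 0) ≡ y * a + + 0
        solve₃ = solve-∀
      cases carry false (bit true) rewrite ⟪yy⟫ | pull-δ idle ν x | pull-δ mark ν x
        | pull-zero carry ν {λ τ → δ (false ∷ τ) (bit true ∷ x)} (λ _ → refl) = solve₄ y (str N x (final-δ ν)) (str E x (final-δ ν))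
        where
        solve₄ : ∀ y a b → y * (+ 0 + (a + b)) ≡ y * a + (y * b + + 0)
        solve₄ = solve-∀
      cases carry false i₁ rewrite dead dP x ν | pull-zero carry ν {λ τ → δ (false ∷ τ) (i₁ ∷ x)} (λ _ → refl)
        | pull-zero idle ν {λ τ → δ (true ∷ τ) (i₁ ∷ x)} (λ _ → refl) | pull-zero mark ν {λ τ → δ (true ∷ τ) (i₁ ∷ x)} (λ _ → refl)
        = trans (ℤₚ.*-zeroʳ y) (sym (drop-term ⟪ yy ⟫ refl refl))
      cases carry false i₂ rewrite dead dU x ν | pull-zero carry ν {λ τ → δ (false ∷ τ) (i₂ ∷ x)} (λ _ → refl)
        | pull-zero idle ν {λ τ → δ (true ∷ τ) (i₂ ∷ x)} (λ _ → refl) | pull-zero mark ν {λ τ → δ (true ∷ τ) (i₂ ∷ x)} (λ _ → refl)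
        = trans (ℤₚ.*-zeroʳ y) (sym (drop-term ⟪ yy ⟫ refl refl))
      cases carry false i₃ rewrite pull-zero carry ν {λ τ → δ (false ∷ τ) (i₃ ∷ x)} (λ _ → refl)
        | pull-zero idle ν {λ τ → δ (true ∷ τ) (i₃ ∷ x)} (λ _ → refl) | pull-zero mark ν {λ τ → δ (true ∷ τ) (i₃ ∷ x)} (λ _ → refl) = ℤₚ.*-zeroʳ y
      cases carry true (bit false) = sym (drop-term ⟪ yy ⟫ refl refl)
      cases carry true (bit true) = sym (drop-term ⟪ yy ⟫ refl (drop-term ⟪ yy ⟫ refl refl))
      cases carry true i₁ = sym (drop-term ⟪ yy ⟫ refl refl)
      cases carry true i₂ = sym (drop-term ⟪ yy ⟫ refl refl)
      cases carry true i₃ = refl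

    -- N differs from S only by transitions that emit 1, and these are rejected when the prescribed
    -- output begins with 0.
    start-δ : ∀ ν x → str N x (final-δ (false ∷ ν)) ≡ str S x (final-δ (false ∷ ν))
    start-δ ν []      = refl
    start-δ ν (u ∷ x) = trans (str-∷δ N u x (false ∷ ν)) (trans (cases u) (sym (str-∷δ S u x (false ∷ ν))))
      where
      V : Lab × St × Poly → ℤ
      V (c , s , p) = ⟪ p ⟫ * afterδ (false ∷ ν) c (λ ν′ → str s x (final-δ ν′))
      kill : ∀ s p → V (bit true , s , p) ≡ + 0
      kill s p = ℤₚ.*-zeroʳ ⟪ p ⟫
      cases : ∀ u → ∑ (tr N u) V ≡ ∑ (tr S u) V
      cases (bit false) = cong (_+_ (V (bit false , N , one))) (cong (_+ + 0) (kill C one))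
      cases (bit true)  = cong₂ _+_ (kill N one) (cong (_+ + 0) (kill E one))
      cases i₁ = cong (_+_ (V (i₁ , N , one))) (trans (cong (_+ (V (i₂ , X , one) + + 0)) (kill P one)) (ℤₚ.+-identityˡ _))
      cases i₂ = cong (_+_ (V (i₂ , W , one))) (cong (_+ + 0) (kill U one))
      cases i₃ = refl

    pull-cong : ∀ t w {g h} → (∀ σ → g σ ≡ h σ) → pull t w g ≡ pull t w h
    pull-cong idle  [] e = e []
    pull-cong mark  [] e = refl
    pull-cong carry [] e = refl
    pull-cong idle  (false ∷ w) e = pull-cong idle w (e ∘ (false ∷_))
    pull-cong idle  (true  ∷ w) e = cong₂ _+_ (cong₂ _+_ (pull-cong idle w (e ∘ (true ∷_))) (pull-cong mark w (e ∘ (true ∷_))))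
      (pull-cong carry w (e ∘ (false ∷_)))
    pull-cong mark  (false ∷ w) e = cong (y *_) (pull-cong idle w (e ∘ (false ∷_)))
    pull-cong mark  (true  ∷ w) e = refl
    pull-cong carry (false ∷ w) e = cong (y *_) (cong₂ _+_ (pull-cong carry w (e ∘ (false ∷_)))
      (cong₂ _+_ (pull-cong idle w (e ∘ (true ∷_))) (pull-cong mark w (e ∘ (true ∷_)))))
    pull-cong carry (true  ∷ w) e = refl

    -- Removing a strip from the bottom word amounts to adding one to the right word. The leading 0
    -- of the bottom word serves twice: it allows the strip to start in S, and it makes `δ` vanish
    -- on words beginning with 1, as the commutation requires.
    pull-puzzles : ∀ la mu nu → length la ≡ length mu →
      pull idle (false ∷ nu) (puzzles la mu) ≡ run idle mu (λ σ → puzzles la σ (false ∷ nu))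
    pull-puzzles la mu nu eq = begin
      pull idle ν (λ τ → ∑ bs (δ τ))
        ≡⟨ pull-cong idle ν (λ τ → ∑-cong bs (λ x → sym (ℤₚ.*-identityˡ (δ τ x)))) ⟩
      pull idle ν (λ τ → ∑ bs (λ x → + 1 * δ τ x))
        ≡⟨ pull-∑ idle ν bs (λ _ → + 1) (λ x τ → δ τ x) ⟩
      ∑ bs (λ x → + 1 * pull idle ν (λ τ → δ τ x))
        ≡⟨ ∑-cong bs (λ x → trans (ℤₚ.*-identityˡ _) (trans (pull-δ idle ν x) (start-δ nu x))) ⟩
      PZ (reverse la) mu (λ x → str S x (final-δ ν)) []
        ≡⟨ sym (strip-PZ (reverse la) mu (δ ν) [] (trans (length-reverse la) eq) (λ v → refl)) ⟩
      str S [] (λ t v → run t mu (λ σ → PZ (reverse la) σ (δ ν) v))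
        ≡⟨ ℤₚ.+-identityʳ _ ⟩
      run idle mu (λ σ → puzzles la σ ν) ∎
      where
      ν = false ∷ nu
      bs = bots (reverse la) mu []
      open import Data.List.Properties using (length-reverse)

-- Puzzles whose right side is the word of the empty partition.

module UnitLaw where

  open import Data.Bool using (Bool; true; false)
  open import Data.Nat using (ℕ; zero; suc; _≤_; z≤n; s≤s) renaming (_+_ to _+ℕ_)
  import Data.Nat.Properties as ℕₚ
  open import Data.List using (List; []; _∷_; _++_; map; length; reverse; replicate; _ʳ++_)
  open import Data.List.Properties using (reverse-involutive; length-reverse)
  open import Data.Product using (_,_)
  open import Data.Integer using (ℤ; +_; _+_)
  import Data.Integer.Properties as ℤₚ
  open import Function using (_∘_)
  open import Relation.Binary.PropositionalEquality
  open import Relation.Nullary using (contradiction)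
  open import Defs using (countOnes)
  open Sums
  open Rows
  open Puzzle

  bitWord : List Bool → List Lab
  bitWord = map bit

  -- The first t ones of a word are in transit (i₁), the remaining ones have reached the right side.
  mix : ℕ → List Bool → List Lab
  mix t       (false ∷ u) = bit false ∷ mix t u
  mix zero    (true ∷ u)  = bit true ∷ mix zero u
  mix (suc t) (true ∷ u)  = i₁ ∷ mix t u
  mix t       []          = []

  mix-zero : ∀ u → mix zero u ≡ bitWord u
  mix-zero []          = refl
  mix-zero (false ∷ u) = cong (bit false ∷_) (mix-zero u)
  mix-zero (true ∷ u)  = cong (bit true ∷_) (mix-zero u)

  -- The pair i₂ i₃ is the horizontal middle line of a hexagon whose upper half has been placed and
  -- whose lower half is still to come.
  data Tail : List Lab → Set where
    []   : Tail []
    b∷   : ∀ b {w} → Tail w → Tail (bit b ∷ w)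
    hex∷ : ∀ {w} → Tail w → Tail (i₂ ∷ i₃ ∷ w)

  -- Words through which an H piece passes: they lie on no puzzle all of whose further right labels are 1.
  data BadTail : List Lab → Set where
    hex∷ : ∀ {w} → Tail w → BadTail (i₂ ∷ i₃ ∷ w)
    b∷   : ∀ b {w} → BadTail w → BadTail (bit b ∷ w)

  data Bad : List Lab → Set where
    tail : ∀ {w} → BadTail w → Bad w
    0∷   : ∀ {w} → Bad w → Bad (bit false ∷ w)
    i₁∷  : ∀ {w} → Bad w → Bad (i₁ ∷ w)

  bad⇒tail : ∀ {w} → BadTail w → Tail w
  bad⇒tail (hex∷ t) = hex∷ t
  bad⇒tail (b∷ b t) = b∷ b (bad⇒tail t)

  private
    0+ : ∀ {a b} → a ≡ + 0 → b ≡ + 0 → a + b ≡ + 0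
    0+ refl refl = refl

    single : ∀ {a b} → a ≡ b → a + + 0 ≡ b
    single refl = ℤₚ.+-identityʳ _

  -- A carried label 0 is again 0 after every bit and after every pair i₂ i₃, and no upward triangle
  -- with left label 0 has right label 1.
  tail-from-0 : ∀ {w} → Tail w → ∀ h → row (bit false) w true h ≡ + 0
  tail-from-0 [] h = row-[] (bit false) true h
  tail-from-0 {_ ∷ w} (b∷ false t) h = trans (row-∷ (bit false) (bit false) w true h) (single (tail-from-0 t _))
  tail-from-0 {_ ∷ w} (b∷ true t)  h = trans (row-∷ (bit false) (bit true) w true h) (single (tail-from-0 t _))
  tail-from-0 {_ ∷ _ ∷ w} (hex∷ t) h = trans (row-∷ (bit false) i₂ (i₃ ∷ w) true h)
    (single (trans (row-∷ i₃ i₃ w true _) (single (tail-from-0 t _))))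

  record Zero (w : List Lab) : Set where
    field
      from : ∀ b h → row (bit b) w true h ≡ + 0
      from₁ : ∀ h → row i₁ w true h ≡ + 0
      from₂ : ∀ h → row i₂ w true h ≡ + 0
  open Zero

  -- The pair i₂ i₃ either blocks the row or turns the carried label into 0, from which the right
  -- label 1 is out of reach.
  badTail-zero : ∀ {w} → BadTail w → Zero w
  badTail-zero (hex∷ {w} t) .from false h = tail-from-0 (hex∷ t) h
  badTail-zero (hex∷ {w} t) .from true h = trans (row-∷ (bit true) i₂ (i₃ ∷ w) true h)
    (single (trans (row-∷ i₃ i₃ w true _) (single (tail-from-0 t _))))
  badTail-zero (hex∷ {w} t) .from₁ h = row-∷ i₁ i₂ (i₃ ∷ w) true h
  badTail-zero (hex∷ {w} t) .from₂ h = row-∷ i₂ i₂ (i₃ ∷ w) true h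
  badTail-zero (b∷ b t) .from false h = tail-from-0 (b∷ b (bad⇒tail t)) h
  badTail-zero (b∷ false {w} t) .from true h = trans (row-∷ (bit true) (bit false) w true h)
    (0+ (badTail-zero t .from₁ _) (0+ (tail-from-0 (bad⇒tail t) _) (single (badTail-zero t .from₂ _))))
  badTail-zero (b∷ true {w} t) .from true h = trans (row-∷ (bit true) (bit true) w true h) (single (badTail-zero t .from true _))
  badTail-zero (b∷ false {w} t) .from₁ h = trans (row-∷ i₁ (bit false) w true h) (single (badTail-zero t .from₁ _))
  badTail-zero (b∷ true {w} t)  .from₁ h = trans (row-∷ i₁ (bit true) w true h) (single (badTail-zero t .from true _))
  badTail-zero (b∷ false {w} t) .from₂ h = trans (row-∷ i₂ (bit false) w true h) (single (badTail-zero t .from₁ _))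
  badTail-zero (b∷ true {w} t)  .from₂ h = trans (row-∷ i₂ (bit true) w true h) (single (badTail-zero t .from true _))

  bad-zero : ∀ {w} → Bad w → Zero w
  bad-zero (tail t) = badTail-zero t
  bad-zero (0∷ {w} t) .from false h = trans (row-∷ (bit false) (bit false) w true h) (single (bad-zero t .from false _))
  bad-zero (0∷ {w} t) .from true h = trans (row-∷ (bit true) (bit false) w true h)
    (0+ (bad-zero t .from₁ _) (0+ (bad-zero t .from false _) (single (bad-zero t .from₂ _))))
  bad-zero (0∷ {w} t) .from₁ h = trans (row-∷ i₁ (bit false) w true h) (single (bad-zero t .from₁ _))
  bad-zero (0∷ {w} t) .from₂ h = trans (row-∷ i₂ (bit false) w true h) (single (bad-zero t .from₁ _))
  bad-zero (i₁∷ {w} t) .from false h = trans (row-∷ (bit false) i₁ w true h) (single (bad-zero t .from true _))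
  bad-zero (i₁∷ {w} t) .from true h = trans (row-∷ (bit true) i₁ w true h) (single (bad-zero t .from true _))
  bad-zero (i₁∷ {w} t) .from₁ h = row-∷ i₁ i₁ w true h
  bad-zero (i₁∷ {w} t) .from₂ h = row-∷ i₂ i₁ w true h

  bad-δ : ∀ ν {w} → Bad w → δ ν w ≡ + 0
  bad-δ [] (tail (hex∷ _)) = refl
  bad-δ [] (tail (b∷ _ _)) = refl
  bad-δ [] (0∷ _)  = refl
  bad-δ [] (i₁∷ _) = refl
  bad-δ (true ∷ ν) (tail (hex∷ _))      = refl
  bad-δ (true ∷ ν) (tail (b∷ false t))  = refl
  bad-δ (true ∷ ν) (tail (b∷ true t))   = bad-δ ν (tail t)
  bad-δ (true ∷ ν) (0∷ _)  = refl
  bad-δ (true ∷ ν) (i₁∷ _) = refl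
  bad-δ (false ∷ ν) (tail (hex∷ _))     = refl
  bad-δ (false ∷ ν) (tail (b∷ false t)) = bad-δ ν (tail t)
  bad-δ (false ∷ ν) (tail (b∷ true t))  = refl
  bad-δ (false ∷ ν) (0∷ t)  = bad-δ ν t
  bad-δ (false ∷ ν) (i₁∷ _) = refl

  bad-PZ : ∀ ls k ν {w} → Bad w → PZ ls (replicate k true) (δ ν) w ≡ + 0
  bad-PZ []       zero    ν t = single (bad-δ ν t)
  bad-PZ []       (suc k) ν t = refl
  bad-PZ (l ∷ ls) zero    ν t = refl
  bad-PZ (l ∷ ls) (suc k) ν t = trans (PZ-∷ l ls true (replicate k true) (δ ν) _) (bad-zero t .from l _)

  tail-bits : ∀ u → Tail (bitWord u)
  tail-bits []      = []
  tail-bits (b ∷ u) = b∷ b (tail-bits u)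

  KillsBadTails KillsBad : (List Lab → ℤ) → Set
  KillsBadTails g = ∀ {w} → BadTail w → g w ≡ + 0
  KillsBad      g = ∀ {w} → Bad w → g w ≡ + 0

  -- Before a 0, three pieces may start from the left label 1. The vertical rhombus leaves the
  -- carried label 0 and cannot end in 1; the hexagon produces a bad tail, which `g` kills; only the
  -- single triangle survives.
  plain-from-1 : ∀ u g → KillsBadTails g → row (bit true) (bitWord u) true g ≡ g (bitWord (true ∷ u))
  plain-from-i₁ : ∀ u g → KillsBadTails g → row i₁ (bitWord u) true g ≡ g (bitWord (false ∷ u))
  plain-from-i₂ : ∀ u g → (∀ {w} → Tail w → g (i₃ ∷ w) ≡ + 0) → row i₂ (bitWord u) true g ≡ + 0
  plain-from-1 [] g k = trans (row-[] (bit true) true g) (single refl)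
  plain-from-1 (false ∷ u) g k = trans (row-∷ (bit true) (bit false) (bitWord u) true g)
    (trans (cong₂ _+_ (plain-from-i₁ u _ (k ∘ b∷ true)) (0+ (tail-from-0 (tail-bits u) _) (single (plain-from-i₂ u _ (k ∘ hex∷)))))
           (ℤₚ.+-identityʳ _))
  plain-from-1 (true ∷ u) g k = trans (row-∷ (bit true) (bit true) (bitWord u) true g) (single (plain-from-1 u _ (k ∘ b∷ true)))
  plain-from-i₁ [] g k = trans (row-[] i₁ true g) (single refl)
  plain-from-i₁ (false ∷ u) g k = trans (row-∷ i₁ (bit false) (bitWord u) true g) (single (plain-from-i₁ u _ (k ∘ b∷ false)))
  plain-from-i₁ (true ∷ u) g k  = trans (row-∷ i₁ (bit true) (bitWord u) true g) (single (plain-from-1 u _ (k ∘ b∷ false)))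
  plain-from-i₂ [] g k = trans (row-[] i₂ true g) (single (k []))
  plain-from-i₂ (false ∷ u) g k = trans (row-∷ i₂ (bit false) (bitWord u) true g)
    (single (trans (plain-from-i₁ u _ (k ∘ bad⇒tail)) (k (tail-bits (false ∷ u)))))
  plain-from-i₂ (true ∷ u) g k  = trans (row-∷ i₂ (bit true) (bitWord u) true g)
    (single (trans (plain-from-1 u _ (k ∘ bad⇒tail)) (k (tail-bits (true ∷ u)))))

  -- The carried i₁ crosses zeros unchanged until it reaches the first one in transit, an i₁ on the
  -- horizontal edge; no downward triangle has these two labels.
  blocked-i₁ : ∀ t u h → suc t ≤ countOnes u → row i₁ (mix (suc t) u) true h ≡ + 0
  blocked-i₁ t (false ∷ u) h le = trans (row-∷ i₁ (bit false) (mix (suc t) u) true h) (single (blocked-i₁ t u _ le))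
  blocked-i₁ t (true ∷ u)  h le = row-∷ i₁ i₁ (mix t u) true h

  blocked-i₂ : ∀ t u h → suc t ≤ countOnes u → row i₂ (mix (suc t) u) true h ≡ + 0
  blocked-i₂ t (false ∷ u) h le = trans (row-∷ i₂ (bit false) (mix (suc t) u) true h) (single (blocked-i₁ t u _ le))
  blocked-i₂ t (true ∷ u)  h le = row-∷ i₂ i₁ (mix t u) true h

  -- A row with right label 1 brings exactly one more one to the right side, and prepends its left
  -- label to the word.
  row-1-true  : ∀ t u g → t ≤ countOnes u → KillsBad g → row (bit true) (mix t u) true g ≡ g (mix t (true ∷ u))
  row-1-false : ∀ t u g → suc t ≤ countOnes u → KillsBad g → row (bit false) (mix (suc t) u) true g ≡ g (mix t (false ∷ u))
  row-1-true zero u g le k = trans (cong (λ w → row (bit true) w true g) (mix-zero u))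
    (trans (plain-from-1 u g (k ∘ tail)) (cong (g ∘ (bit true ∷_)) (sym (mix-zero u))))
  row-1-true (suc t) (false ∷ u) g le k = trans (row-∷ (bit true) (bit false) (mix (suc t) u) true g)
    (trans (cong₂ _+_ (blocked-i₁ t u _ le) (single′ (row-1-false t u _ le (k ∘ i₁∷)) (single (blocked-i₂ t u _ le))))
           (ℤₚ.+-identityˡ _))
    where
    single′ : ∀ {a b c} → a ≡ b → c ≡ + 0 → a + c ≡ b
    single′ refl refl = ℤₚ.+-identityʳ _
  row-1-true (suc t) (true ∷ u) g (s≤s le) k = trans (row-∷ (bit true) i₁ (mix t u) true g) (single (row-1-true t u _ le (k ∘ i₁∷)))
  row-1-false t (false ∷ u) g le k = trans (row-∷ (bit false) (bit false) (mix (suc t) u) true g) (single (row-1-false t u _ le (k ∘ 0∷)))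
  row-1-false t (true ∷ u) g (s≤s le) k = trans (row-∷ (bit false) i₁ (mix t u) true g) (single (row-1-true t u _ le (k ∘ 0∷)))

  row-0-i₁ : ∀ u h → row i₁ (mix (countOnes u) u) false h ≡ + 0
  row-0-i₁ [] h = row-[] i₁ false h
  row-0-i₁ (false ∷ u) h = trans (row-∷ i₁ (bit false) (mix (countOnes u) u) false h) (single (row-0-i₁ u _))
  row-0-i₁ (true ∷ u) h = row-∷ i₁ i₁ (mix (countOnes u) u) false h

  row-0-i₂ : ∀ u h → row i₂ (mix (countOnes u) u) false h ≡ + 0
  row-0-i₂ [] h = row-[] i₂ false h
  row-0-i₂ (false ∷ u) h = trans (row-∷ i₂ (bit false) (mix (countOnes u) u) false h) (single (row-0-i₁ u _))
  row-0-i₂ (true ∷ u) h = row-∷ i₂ i₁ (mix (countOnes u) u) false h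

  -- A right label 0 lets no one arrive: all of them stay in transit, including one that enters from
  -- the left.
  row-0 : ∀ l u g → row (bit l) (mix (countOnes u) u) false g ≡ g (mix (countOnes (l ∷ u)) (l ∷ u))
  row-0 false [] g = trans (row-[] (bit false) false g) (single refl)
  row-0 true  [] g = trans (row-[] (bit true) false g) (single refl)
  row-0 false (false ∷ u) g = trans (row-∷ (bit false) (bit false) (mix (countOnes u) u) false g) (single (row-0 false u _))
  row-0 false (true ∷ u) g = trans (row-∷ (bit false) i₁ (mix (countOnes u) u) false g) (single (row-0 true u _))
  row-0 true (false ∷ u) g = trans (row-∷ (bit true) (bit false) (mix (countOnes u) u) false g)
    (trans (cong₂ _+_ (row-0-i₁ u _) (cong₂ _+_ (row-0 false u _) (single (row-0-i₂ u _))))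
           (trans (ℤₚ.+-identityˡ _) (ℤₚ.+-identityʳ _)))
  row-0 true (true ∷ u) g = trans (row-∷ (bit true) i₁ (mix (countOnes u) u) false g) (single (row-0 true u _))

  countOnes≤length : ∀ w → countOnes w ≤ length w
  countOnes≤length []          = z≤n
  countOnes≤length (false ∷ w) = ℕₚ.m≤n⇒m≤1+n (countOnes≤length w)
  countOnes≤length (true ∷ w)  = s≤s (countOnes≤length w)

  -- The ones in transit together with those still to enter are as many as the remaining rows, and
  -- each row takes in one. A left label 0 with nothing in transit would need more ones than there
  -- are rows left.
  ones-phase : ∀ ls t u k ν → length ls ≡ k → t +ℕ countOnes ls ≡ k → t ≤ countOnes u →
               PZ ls (replicate k true) (δ ν) (mix t u) ≡ δ ν (bitWord (ls ʳ++ u))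
  ones-phase [] zero u zero ν _ _ _ = single (cong (δ ν) (mix-zero u))
  ones-phase (true ∷ ls) t u (suc k) ν eq sum le = trans (PZ-∷ true ls true (replicate k true) (δ ν) (mix t u))
    (trans (row-1-true t u _ le (bad-PZ ls k ν))
           (ones-phase ls t (true ∷ u) k ν (ℕₚ.suc-injective eq) (ℕₚ.suc-injective (trans (sym (ℕₚ.+-suc t _)) sum)) (ℕₚ.m≤n⇒m≤1+n le)))
  ones-phase (false ∷ ls) (suc t) u (suc k) ν eq sum le = trans (PZ-∷ false ls true (replicate k true) (δ ν) (mix (suc t) u))
    (trans (row-1-false t u _ le (bad-PZ ls k ν))
           (ones-phase ls t (false ∷ u) k ν (ℕₚ.suc-injective eq) (ℕₚ.suc-injective sum) (ℕₚ.≤-trans (ℕₚ.n≤1+n t) le)))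
  ones-phase (false ∷ ls) zero u (suc k) ν eq sum le =
    contradiction (subst₂ _≤_ sum (ℕₚ.suc-injective eq) (countOnes≤length ls)) (ℕₚ.<-irrefl refl)

  zeros-phase : ∀ a ls u k ν → length ls ≡ a +ℕ k → countOnes ls +ℕ countOnes u ≡ k →
                PZ ls (replicate a false ++ replicate k true) (δ ν) (mix (countOnes u) u) ≡ δ ν (bitWord (ls ʳ++ u))
  zeros-phase zero ls u k ν eq sum = ones-phase ls (countOnes u) u k ν eq (trans (ℕₚ.+-comm (countOnes u) _) sum) ℕₚ.≤-refl
  zeros-phase (suc a) (l ∷ ls) u k ν eq sum = trans (PZ-∷ l ls false (replicate a false ++ replicate k true) (δ ν) (mix (countOnes u) u))
    (trans (row-0 l u _) (zeros-phase a ls (l ∷ u) k ν (ℕₚ.suc-injective eq) (trans (move l) sum)))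
    where
    move : ∀ l → countOnes ls +ℕ countOnes (l ∷ u) ≡ countOnes (l ∷ ls) +ℕ countOnes u
    move false = refl
    move true  = ℕₚ.+-suc _ _

  countOnes-ʳ++ : ∀ ls u → countOnes (ls ʳ++ u) ≡ countOnes ls +ℕ countOnes u
  countOnes-ʳ++ []          u = refl
  countOnes-ʳ++ (false ∷ ls) u = countOnes-ʳ++ ls (false ∷ u)
  countOnes-ʳ++ (true ∷ ls)  u = trans (countOnes-ʳ++ ls (true ∷ u)) (ℕₚ.+-suc _ _)

  puzzles-unit : ∀ a k la ν → length la ≡ a +ℕ k → countOnes la ≡ k →
                 puzzles la (replicate a false ++ replicate k true) ν ≡ δ ν (bitWord la)
  puzzles-unit a k la ν eq ones = trans
    (zeros-phase a (reverse la) [] k ν (trans (length-reverse la) eq)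
      (trans (ℕₚ.+-identityʳ _) (trans (countOnes-ʳ++ la []) (trans (ℕₚ.+-identityʳ _) ones))))
    (cong (δ ν ∘ bitWord) (reverse-involutive la))

-- Signless Grothendieck polynomials and their linear independence.

module Uniqueness where

  open import Data.Bool using (Bool; true; false; if_then_else_; _∧_)
  open import Data.Nat using (ℕ; zero; suc; _≤_; _<_; _≡ᵇ_) renaming (_+_ to _+ℕ_; _*_ to _*ℕ_)
  import Data.Nat.Properties as ℕₚ
  open import Data.Nat.Induction using (<-rec)
  open import Data.List using (List; []; _∷_; _++_; map; length; replicate)
  open import Data.List.Properties using (length-++; length-replicate; ++-assoc)
  open import Data.Product using (_,_; ∃; proj₁; proj₂)
  open import Data.Sum using (inj₁; inj₂)
  open import Data.Integer using (ℤ; +_; -_; _+_; _*_; ∣_∣; _^_)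
  import Data.Integer.Properties as ℤₚ
  open import Data.Integer.Tactic.RingSolver using (solve-∀)
  open import Function using (_∘_)
  open import Relation.Binary.PropositionalEquality
  open import Relation.Nullary using (¬_; contradiction; yes; no)
  open import Defs using (countOnes)
  open Sums
  open Rows
  open Puzzle
  open UnitLaw using (bitWord)

  ∑-δ : ∀ w₀ (e : List Bool → ℤ) → ∑ (words (length w₀)) (λ w → e w * δ w₀ (bitWord w)) ≡ e w₀
  ∑-δ []           e = trans (ℤₚ.+-identityʳ _) (ℤₚ.*-identityʳ (e []))
  ∑-δ (false ∷ w₀) e = trans (∑-words-suc (length w₀) _) (trans
    (cong₂ _+_ (∑-δ w₀ (e ∘ (false ∷_))) (∑-zero-∈ (words (length w₀)) (λ w _ → ℤₚ.*-zeroʳ (e (true ∷ w))))) (ℤₚ.+-identityʳ _))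
  ∑-δ (true ∷ w₀)  e = trans (∑-words-suc (length w₀) _) (trans
    (cong₂ _+_ (∑-zero-∈ (words (length w₀)) (λ w _ → ℤₚ.*-zeroʳ (e (false ∷ w)))) (∑-δ w₀ (e ∘ (true ∷_)))) (ℤₚ.+-identityˡ _))

  δ-≢ : ∀ ν w → ν ≢ w → δ ν (bitWord w) ≡ + 0
  δ-≢ []          []          ne = contradiction refl ne
  δ-≢ []          (_ ∷ _)     ne = refl
  δ-≢ (_ ∷ _)     []          ne = refl
  δ-≢ (false ∷ ν) (false ∷ w) ne = δ-≢ ν w (ne ∘ cong (false ∷_))
  δ-≢ (false ∷ ν) (true ∷ w)  ne = refl
  δ-≢ (true ∷ ν)  (false ∷ w) ne = refl
  δ-≢ (true ∷ ν)  (true ∷ w)  ne = δ-≢ ν w (ne ∘ cong (true ∷_))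

  δ-refl : ∀ ν → δ ν (bitWord ν) ≡ + 1
  δ-refl []          = refl
  δ-refl (false ∷ ν) = δ-refl ν
  δ-refl (true ∷ ν)  = δ-refl ν

  -- The word of the empty partition in a box with b rows and c columns; also the common ending of
  -- words with b empty rows.
  tl : ℕ → ℕ → List Bool
  tl c b = replicate c false ++ replicate b true

  onesAfter : Mode → List Bool → ℕ
  onesAfter carry w = suc (countOnes w)
  onesAfter _     w = countOnes w

  pull-ones : ∀ y t w {g} → (∀ τ → countOnes τ ≡ onesAfter t w → g τ ≡ + 0) → Skew.pull y t w g ≡ + 0
  pull-ones y idle  [] e = e [] refl
  pull-ones y mark  [] e = refl
  pull-ones y carry [] e = refl
  pull-ones y idle  (false ∷ w) e = pull-ones y idle w (λ τ → e (false ∷ τ))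
  pull-ones y idle  (true  ∷ w) e rewrite pull-ones y idle w (λ τ h → e (true ∷ τ) (cong suc h))
    | pull-ones y mark w (λ τ h → e (true ∷ τ) (cong suc h)) | pull-ones y carry w (λ τ → e (false ∷ τ)) = refl
  pull-ones y mark  (false ∷ w) e rewrite pull-ones y idle w (λ τ → e (false ∷ τ)) = ℤₚ.*-zeroʳ y
  pull-ones y mark  (true  ∷ w) e = refl
  pull-ones y carry (false ∷ w) e rewrite pull-ones y idle w (λ τ h → e (true ∷ τ) (cong suc h))
    | pull-ones y mark w (λ τ h → e (true ∷ τ) (cong suc h)) | pull-ones y carry w (λ τ → e (false ∷ τ)) = ℤₚ.*-zeroʳ y
  pull-ones y carry (true  ∷ w) e = refl

  -- The signless stable Grothendieck polynomial of the partition with binary word w having k ones and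
  -- a zeros, in the variables of the list, the last one first; it is 0 for other words.
  gh : ℕ → ℕ → List ℤ → List Bool → ℤ
  gh a k []       w = δ (tl a k) (bitWord w)
  gh a k (y ∷ ys) w = Skew.pull y idle w (gh a k ys)

  countOnes-++ : ∀ u v → countOnes (u ++ v) ≡ countOnes u +ℕ countOnes v
  countOnes-++ []          v = refl
  countOnes-++ (false ∷ u) v = countOnes-++ u v
  countOnes-++ (true ∷ u)  v = cong suc (countOnes-++ u v)

  countOnes-0s : ∀ c → countOnes (replicate c false) ≡ 0
  countOnes-0s zero    = refl
  countOnes-0s (suc c) = countOnes-0s c

  countOnes-1s : ∀ b → countOnes (replicate b true) ≡ b
  countOnes-1s zero    = refl
  countOnes-1s (suc b) = cong suc (countOnes-1s b)

  countOnes-tl : ∀ c b → countOnes (tl c b) ≡ b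
  countOnes-tl c b = trans (countOnes-++ (replicate c false) _) (cong₂ _+ℕ_ (countOnes-0s c) (countOnes-1s b))

  length-tl : ∀ c b → length (tl c b) ≡ c +ℕ b
  length-tl c b = trans (length-++ (replicate c false)) (cong₂ _+ℕ_ (length-replicate c) (length-replicate b))

  gh-ones : ∀ a k ys w → countOnes w ≢ k → gh a k ys w ≡ + 0
  gh-ones a k []       w ne = δ-≢ (tl a k) w (λ { refl → ne (countOnes-tl a k) })
  gh-ones a k (y ∷ ys) w ne = pull-ones y idle w (λ τ h → gh-ones a k ys τ (λ h′ → ne (trans (sym h) h′)))

  module _ (y : ℤ) where
    open Skew y
    open ≡-Reasoning

    run-mark-1s : ∀ b f → run mark (replicate b true) f ≡ + 0
    run-mark-1s zero    f = refl
    run-mark-1s (suc b) f = refl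

    run-idle-1s : ∀ b f → run idle (replicate b true) f ≡ f (replicate b true)
    run-idle-1s zero    f = refl
    run-idle-1s (suc b) f = trans (cong₂ _+_ (run-idle-1s b _) (run-mark-1s b _)) (ℤₚ.+-identityʳ _)

    run-carry-tl : ∀ c b f → run carry (tl c (suc b)) f ≡ y ^ suc c * f (tl (suc c) b)
    run-carry-tl zero b f rewrite run-idle-1s b (f ∘ (false ∷_)) | run-mark-1s b (f ∘ (false ∷_)) =
      cong₂ _*_ (sym (ℤₚ.*-identityʳ y)) (ℤₚ.+-identityʳ _)
    run-carry-tl (suc c) b f = trans (cong (y *_) (run-carry-tl c b (f ∘ (false ∷_)))) (sym (ℤₚ.*-assoc y (y ^ suc c) _))

    -- In these words the last row before the b empty ones has length c′: `f` is zero on shapes for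
    -- which that row is shorter than c.
    Vanishes : ℕ → ℕ → (List Bool → ℤ) → Set
    Vanishes c b f = ∀ c′ → c′ < c → ∀ x → f (x ++ true ∷ tl c′ b) ≡ + 0

    vanishes-∷ : ∀ {c b f} d → Vanishes c b f → Vanishes c b (f ∘ (d ∷_))
    vanishes-∷ d v c′ lt x = v c′ lt (d ∷ x)

    -- Only the first of the b + 1 final ones has zeros to cross. Crossing fewer than c of them
    -- gives a word on which `f` vanishes; the full crossing has weight y^c.
    run-idle-tl : ∀ c b f → Vanishes c b f → run idle (tl c (suc b)) f ≡ y ^ c * f (true ∷ tl c b)
    run-idle-tl zero    b f v = trans (run-idle-1s (suc b) f) (sym (ℤₚ.*-identityˡ _))
    run-idle-tl (suc c) b f v = begin
      run idle (tl c (suc b)) f₀ + run carry (tl c (suc b)) f₁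
        ≡⟨ cong₂ _+_ (run-idle-tl c b f₀ (λ c′ lt x → v c′ (ℕₚ.m<n⇒m<1+n lt) (false ∷ x))) (run-carry-tl c b f₁) ⟩
      y ^ c * f₀ (true ∷ tl c b) + y ^ suc c * f₁ (tl (suc c) b)
        ≡⟨ cong (λ t → y ^ c * t + y ^ suc c * f₁ (tl (suc c) b)) (v c (ℕₚ.n<1+n c) (false ∷ [])) ⟩
      y ^ c * + 0 + y ^ suc c * f₁ (tl (suc c) b)
        ≡⟨ cong (_+ y ^ suc c * f₁ (tl (suc c) b)) (ℤₚ.*-zeroʳ (y ^ c)) ⟩
      + 0 + y ^ suc c * f₁ (tl (suc c) b)
        ≡⟨ ℤₚ.+-identityˡ _ ⟩
      y ^ suc c * f (true ∷ tl (suc c) b) ∎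
      where
      f₀ = f ∘ (false ∷_)
      f₁ = f ∘ (true ∷_)

    run-mark-tl : ∀ c b f → Vanishes c b f → run mark (tl c (suc b)) f ≡ + 0
    run-mark-tl zero    b f v = refl
    run-mark-tl (suc c) b f v = trans (cong (y *_) (trans
      (run-idle-tl c b (f ∘ (false ∷_)) (λ c′ lt x → v c′ (ℕₚ.m<n⇒m<1+n lt) (false ∷ x)))
      (trans (cong (y ^ c *_) (v c (ℕₚ.n<1+n c) (false ∷ []))) (ℤₚ.*-zeroʳ (y ^ c))))) (ℤₚ.*-zeroʳ y)

    -- Modulo y, no one of u can move; the last one of u 1 0ᶜ 1ᵇ must cross c zeros.
    run-leading : ∀ u c b f → Vanishes c b f →
                  ∃ λ q → run idle (u ++ tl c (suc b)) f ≡ y ^ c * (f (u ++ true ∷ tl c b) + y * q)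
    run-leading-mark : ∀ u c b f → Vanishes c b f → ∃ λ q → run mark (u ++ tl c (suc b)) f ≡ y ^ c * (y * q)
    run-leading-carry : ∀ u c b f → Vanishes c b f → ∃ λ q → run carry (u ++ tl c (suc b)) f ≡ y ^ c * (y * q)
    run-leading [] c b f v = + 0 , trans (run-idle-tl c b f v) (cong (y ^ c *_) (sym (trans (cong (_+_ (f (true ∷ tl c b))) (ℤₚ.*-zeroʳ y)) (ℤₚ.+-identityʳ _))))
    run-leading (false ∷ u) c b f v
      with q , e ← run-leading u c b (f ∘ (false ∷_)) (vanishes-∷ {f = f} false v)
      with q′ , e′ ← run-leading-carry u c b (f ∘ (true ∷_)) (vanishes-∷ {f = f} true v) =
      q + q′ , trans (cong₂ _+_ e e′) (ring (y ^ c) y (f (false ∷ u ++ true ∷ tl c b)) q q′)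
      where
      ring : ∀ Y y f q q′ → Y * (f + y * q) + Y * (y * q′) ≡ Y * (f + y * (q + q′))
      ring = solve-∀
    run-leading (true ∷ u) c b f v
      with q , e ← run-leading u c b (f ∘ (true ∷_)) (vanishes-∷ {f = f} true v)
      with q′ , e′ ← run-leading-mark u c b (f ∘ (true ∷_)) (vanishes-∷ {f = f} true v) =
      q + q′ , trans (cong₂ _+_ e e′) (ring (y ^ c) y (f (true ∷ u ++ true ∷ tl c b)) q q′)
      where
      ring : ∀ Y y f q q′ → Y * (f + y * q) + Y * (y * q′) ≡ Y * (f + y * (q + q′))
      ring = solve-∀
    run-leading-mark [] c b f v = + 0 , trans (run-mark-tl c b f v) (sym (trans (cong (y ^ c *_) (ℤₚ.*-zeroʳ y)) (ℤₚ.*-zeroʳ (y ^ c))))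
    run-leading-mark (true ∷ u) c b f v = + 0 , sym (trans (cong (y ^ c *_) (ℤₚ.*-zeroʳ y)) (ℤₚ.*-zeroʳ (y ^ c)))
    run-leading-mark (false ∷ u) c b f v
      with q , e ← run-leading u c b (f ∘ (false ∷_)) (vanishes-∷ {f = f} false v) =
      f (false ∷ u ++ true ∷ tl c b) + y * q , trans (cong (y *_) e) (*-left-comm y (y ^ c) _)
    run-leading-carry [] c b f v = f (tl (suc c) b) , trans (run-carry-tl c b f) (ring y (y ^ c) (f (tl (suc c) b)))
      where
      ring : ∀ y Y f → y * Y * f ≡ Y * (y * f)
      ring = solve-∀
    run-leading-carry (false ∷ u) c b f v
      with q , e ← run-leading-carry u c b (f ∘ (false ∷_)) (vanishes-∷ {f = f} false v) =
      y * q , trans (cong (y *_) e) (*-left-comm y (y ^ c) _)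
    run-leading-carry (true ∷ u) c b f v
      with q , e ← run-leading u c b (f ∘ (false ∷_)) (vanishes-∷ {f = f} false v)
      with q′ , e′ ← run-leading-mark u c b (f ∘ (false ∷_)) (vanishes-∷ {f = f} false v) =
      f (false ∷ u ++ true ∷ tl c b) + y * q + y * q′ ,
      trans (cong (y *_) (cong₂ _+_ e e′)) (ring (y ^ c) y (f (false ∷ u ++ true ∷ tl c b)) q q′)
      where
      ring : ∀ Y y f q q′ → y * (Y * (f + y * q) + Y * (y * q′)) ≡ Y * (y * (f + y * q + y * q′))
      ring = solve-∀

  -- The cofactor depends on j, as it does when a polynomial identity is known only through its
  -- values. For j = |e| the number e is a multiple of |e| + 1.
  divisible⇒zero : ∀ e → (∀ j → ∃ λ q → e + + suc j * q ≡ + 0) → e ≡ + 0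
  divisible⇒zero e h with q , eq ← h ∣ e ∣ = ℤₚ.∣i∣≡0⇒i≡0 (go ∣ e ∣ ∣ q ∣ size-eq)
    where
    e≡ : e ≡ + suc ∣ e ∣ * (- q)
    e≡ = trans (ℤₚ.i-j≡0⇒i≡j e (- (+ suc ∣ e ∣ * q)) (trans (cong (_+_ e) (ℤₚ.neg-involutive (+ suc ∣ e ∣ * q))) eq))
               (ℤₚ.neg-distribʳ-* (+ suc ∣ e ∣) q)
    size-eq : ∣ e ∣ ≡ suc ∣ e ∣ *ℕ ∣ q ∣
    size-eq = trans (cong ∣_∣ e≡) (trans (ℤₚ.∣i*j∣≡∣i∣*∣j∣ (+ suc ∣ e ∣) (- q)) (cong (suc ∣ e ∣ *ℕ_) (ℤₚ.∣-i∣≡∣i∣ q)))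
    go : ∀ m t → m ≡ suc m *ℕ t → m ≡ 0
    go m zero    eq = trans eq (ℕₚ.*-zeroʳ m)
    go m (suc t) eq = contradiction (subst (suc m ≤_) (sym eq) (ℕₚ.m≤m*n (suc m) (suc t))) (ℕₚ.<-irrefl refl)

  ^-nonzero : ∀ j c → ¬ ((+ suc j) ^ c ≡ + 0)
  ^-nonzero j zero    ()
  ^-nonzero j (suc c) eq with ℤₚ.i*j≡0⇒i≡0∨j≡0 (+ suc j) eq
  ... | inj₂ e = ^-nonzero j c e

  no-ones : ∀ u → countOnes u ≡ 0 → u ≡ replicate (length u) false
  no-ones []          _ = refl
  no-ones (false ∷ u) e = cong (false ∷_) (no-ones u e)

  record Split (m : ℕ) (u : List Bool) : Set where
    constructor split
    field
      c    : ℕ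
      u′   : List Bool
      form : u ≡ u′ ++ true ∷ replicate c false
      ones : countOnes u′ ≡ m

  splitLast : ∀ m u → countOnes u ≡ suc m → Split m u
  splitLast m (false ∷ u) e with split c u′ form ones ← splitLast m u e = split c (false ∷ u′) (cong (false ∷_) form) ones
  splitLast zero (true ∷ u) e = split (length u) [] (cong (true ∷_) (no-ones u (ℕₚ.suc-injective e))) refl
  splitLast (suc m) (true ∷ u) e with split c u′ form ones ← splitLast m u (ℕₚ.suc-injective e) =
    split c (true ∷ u′) (cong (true ∷_) form) (cong suc ones)

  module _ (a k : ℕ) where
    private
      n = a +ℕ k

    -- Cutting `e` down to the words of the box lets `Vanishes` hold for words of every length. The
    -- relation is unaffected: its sum runs over words of length n, and `gh` is zero unless there
    -- are k ones.
    onSupport : (List Bool → ℤ) → List Bool → ℤ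
    onSupport e w = if (length w ≡ᵇ n) ∧ (countOnes w ≡ᵇ k) then e w else + 0

    ok-true : ∀ w → length w ≡ n → countOnes w ≡ k → (length w ≡ᵇ n) ∧ (countOnes w ≡ᵇ k) ≡ true
    ok-true w h₁ h₂ = cong₂ _∧_ (trans (cong (_≡ᵇ n) h₁) (≡ᵇ-refl n)) (trans (cong (_≡ᵇ k) h₂) (≡ᵇ-refl k))

    onSupport-in : ∀ e w → length w ≡ n → countOnes w ≡ k → onSupport e w ≡ e w
    onSupport-in e w h₁ h₂ rewrite ok-true w h₁ h₂ = refl

    onSupport-zero : ∀ e w → (length w ≡ n → countOnes w ≡ k → e w ≡ + 0) → onSupport e w ≡ + 0
    onSupport-zero e w h with (length w ≡ᵇ n) ∧ (countOnes w ≡ᵇ k) in eq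
    ... | false = refl
    ... | true  = h (≡ᵇ-sound _ _ (proj₁ (∧-split eq))) (≡ᵇ-sound _ _ (proj₂ (∧-split {length w ≡ᵇ n} eq)))

    Rep : ℕ → (List Bool → ℤ) → Set
    Rep m e = ∀ ys → length ys ≡ m → ∑ (words n) (λ w → e w * gh a k ys w) ≡ + 0

    open import Data.List.Membership.Propositional using (_∈_)
    open import Data.List.Membership.Propositional.Properties using (∈-++⁻; ∈-map⁻)
    open import Data.List.Relation.Unary.Any using (here)

    words-length : ∀ n {w} → w ∈ words n → length w ≡ n
    words-length zero    (here refl) = refl
    words-length (suc n) w∈ with ∈-++⁻ (map (false ∷_) (words n)) w∈
    ... | inj₁ h with v , v∈ , refl ← ∈-map⁻ _ h = cong suc (words-length n v∈)
    ... | inj₂ h with v , v∈ , refl ← ∈-map⁻ _ h = cong suc (words-length n v∈)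

    rep-support : ∀ m e → Rep m e → Rep m (onSupport e)
    rep-support m e r ys eq = trans (∑-cong-∈ (words n) same) (r ys eq)
      where
      same : ∀ w → w ∈ words n → onSupport e w * gh a k ys w ≡ e w * gh a k ys w
      same w w∈ with countOnes w ℕₚ.≟ k
      ... | yes h = cong (_* gh a k ys w) (onSupport-in e w (words-length n w∈) h)
      ... | no ne rewrite gh-ones a k ys w ne = trans (ℤₚ.*-zeroʳ (onSupport e w)) (sym (ℤₚ.*-zeroʳ (e w)))

    rep-run : ∀ m e → Rep (suc m) e → ∀ y → Rep m (λ τ → Skew.run y idle τ e)
    rep-run m e r y ys eq = trans (sym (Skew.adjoint y n idle e (gh a k ys))) (r (y ∷ ys) (cong suc eq))

    -- The words are the shapes with at most m rows. Setting the last variable to y turns the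
    -- relation into one in one variable fewer; its coefficient at the shape with the last row, of
    -- length c, deleted is y^c (e + y q) by `run-leading`, as shapes with a shorter last row are
    -- settled first. It is 0 for every y, so e is divisible by every positive integer.
    unique : ∀ m e → Rep m e → ∀ b u → m +ℕ b ≡ k → countOnes u ≡ m → length u +ℕ b ≡ n → e (u ++ replicate b true) ≡ + 0
    unique zero e r b u mb ones len = begin
      e (u ++ replicate b true)   ≡⟨ cong e form ⟩
      e (tl a k)                  ≡⟨ sym (∑-δ (tl a k) e) ⟩
      ∑ (words (length (tl a k))) (λ w → e w * δ (tl a k) (bitWord w)) ≡⟨ cong (λ n → ∑ (words n) (λ w → e w * δ (tl a k) (bitWord w))) (length-tl a k) ⟩
      ∑ (words n) (λ w → e w * gh a k [] w) ≡⟨ r [] refl ⟩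
      + 0 ∎
      where
      open ≡-Reasoning
      form : u ++ replicate b true ≡ tl a k
      form = cong₂ _++_ (trans (no-ones u ones) (cong (λ l → replicate l false)
               (ℕₚ.+-cancelʳ-≡ b (length u) a (trans len (cong (a +ℕ_) (sym mb)))))) (cong (λ l → replicate l true) mb)
    unique (suc m) e r b u mb ones len with split c u′ refl ones′ ← splitLast m u ones =
      trans (cong e (++-assoc u′ (true ∷ replicate c false) (replicate b true)))
        (vanish c u′ ones′ (trans (cong (_+ℕ b) (sym (length-split u′ c))) len))
      where
      length-split : ∀ u c → length (u ++ true ∷ replicate c false) ≡ suc (length u +ℕ c)
      length-split u c = trans (length-++ u) (trans (cong (λ l → length u +ℕ suc l) (length-replicate c)) (ℕₚ.+-suc (length u) c))
      e′ = onSupport e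
      r′ : ∀ y → Rep m (λ τ → Skew.run y idle τ e′)
      r′ = rep-run m e′ (rep-support (suc m) e r)
      vanish : ∀ c u → countOnes u ≡ m → suc (length u +ℕ c) +ℕ b ≡ n → e (u ++ true ∷ tl c b) ≡ + 0
      vanish = <-rec _ λ c rec u ones len →
        let
          len′ : length (u ++ true ∷ tl c b) ≡ n
          len′ = trans (length-++ u) (trans (cong (λ l → length u +ℕ suc l) (length-tl c b))
                   (trans (ℕₚ.+-suc (length u) _) (trans (cong suc (sym (ℕₚ.+-assoc (length u) c b))) len)))
          ones′ : ∀ u → countOnes (u ++ true ∷ tl c b) ≡ countOnes u +ℕ suc b
          ones′ u = trans (countOnes-++ u _) (cong (λ l → countOnes u +ℕ suc l) (countOnes-tl c b))
          -- Words of the box are covered by the recursion on c, all others by the cut to the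
          -- support.
          v : ∀ c′ → c′ < c → ∀ x → e′ (x ++ true ∷ tl c′ b) ≡ + 0
          v c′ lt x = onSupport-zero e _ λ h₁ h₂ → rec {c′} lt x
            (ℕₚ.+-cancelʳ-≡ (suc b) _ m (trans (trans (cong (λ l → countOnes x +ℕ suc l) (sym (countOnes-tl c′ b))) (sym (countOnes-++ x _)))
               (trans h₂ (trans (sym mb) (sym (ℕₚ.+-suc m b))))))
            (trans (trans (cong suc (ℕₚ.+-assoc (length x) c′ b)) (sym (trans (length-++ x)
               (trans (cong (λ l → length x +ℕ suc l) (length-tl c′ b)) (ℕₚ.+-suc (length x) _))))) h₁)
          zero-run : ∀ y → Skew.run y idle (u ++ tl c (suc b)) e′ ≡ + 0
          zero-run y = trans (cong (λ w → Skew.run y idle w e′) (sym (++-assoc u (replicate c false) _)))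
            (unique m (λ τ → Skew.run y idle τ e′) (r′ y) (suc b) (u ++ replicate c false) (trans (ℕₚ.+-suc m b) mb)
              (trans (countOnes-++ u _) (trans (cong (countOnes u +ℕ_) (countOnes-0s c)) (trans (ℕₚ.+-identityʳ _) ones)))
              (trans (cong (_+ℕ suc b) (trans (length-++ u) (cong (length u +ℕ_) (length-replicate c)))) (trans (ℕₚ.+-suc _ b) len)))
          lead : ∀ j → ∃ λ q → e′ (u ++ true ∷ tl c b) + + suc j * q ≡ + 0
          lead j = let (q , eq) = run-leading (+ suc j) u c b e′ v
                   in q , cancel j c (trans (sym eq) (zero-run (+ suc j)))
        in trans (sym (onSupport-in e _ len′ (trans (ones′ u) (trans (cong (_+ℕ suc b) ones) (trans (ℕₚ.+-suc m b) mb)))))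
                 (divisible⇒zero _ lead)
        where
        cancel : ∀ j c {x} → (+ suc j) ^ c * x ≡ + 0 → x ≡ + 0
        cancel j c eq with ℤₚ.i*j≡0⇒i≡0∨j≡0 ((+ suc j) ^ c) eq
        ... | inj₁ z = contradiction z (^-nonzero j c)
        ... | inj₂ z = z

-- Branching rule for set-valued tableaux, by the largest entry.

module Branching where

  open import Data.Bool using (Bool; true; false; _∧_)
  open import Data.Bool.Properties using (∧-identityʳ; ∧-zeroʳ; T-≡)
  open import Data.Nat using (ℕ; zero; suc; _≤_; _<_; s≤s; _≤ᵇ_; _<ᵇ_)
  import Data.Nat.Properties as ℕₚ
  open import Data.List using (List; []; _∷_; _++_; map; length; filterᵇ; upTo; take)
  open import Data.List.Properties using (length-++; upTo-∷ʳ; map-++; ∷-injectiveˡ; ∷-injectiveʳ)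
  open import Data.Empty using (⊥-elim)
  open import Data.List.Membership.Propositional using (_∈_)
  open import Data.List.Membership.Propositional.Properties using (∈-filter⁻; ∈-map⁻; ∈-++⁻; ∈-upTo⁻)
  open import Data.List.Relation.Unary.All using (All; []; _∷_) renaming (map to All-map)
  open import Data.List.Relation.Unary.Any using (here)
  open import Data.Product using (_×_; _,_; proj₁; proj₂)
  open import Data.Sum using (inj₁; inj₂)
  open import Data.Integer using (ℤ; +_; _+_; _*_)
  import Data.Integer.Properties as ℤₚ
  open import Algebra.Properties.AbelianGroup ℤₚ.+-0-abelianGroup using (∙-cancelʳ)
  open import Data.Integer.Tactic.RingSolver using (solve-∀)
  open import Function using (_∘_; Equivalence)
  open import Relation.Binary.PropositionalEquality
  open import Relation.Nullary using (contradiction)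
  open import Defs using (sublists; oneTo; nonemptySets; all; leSets; ltSets; colOK; prodℤ; countOnes)
  open Sums
  open Rows using (Mode; idle; mark; carry)
  open Puzzle

  ≤ᵇ-true : ∀ {a b} → a ≤ b → (a ≤ᵇ b) ≡ true
  ≤ᵇ-true h = Equivalence.to T-≡ (ℕₚ.≤⇒≤ᵇ h)

  ≤ᵇ-false : ∀ {a b} → b < a → (a ≤ᵇ b) ≡ false
  ≤ᵇ-false {a} {b} h with a ≤ᵇ b in eq
  ... | false = refl
  ... | true  = contradiction (ℕₚ.≤ᵇ⇒≤ a b (Equivalence.from T-≡ eq)) (ℕₚ.<⇒≱ h)

  Box Row : Set
  Box = List ℕ
  Row = List Box

  ∑-sublists-∷ʳ : ∀ xs a (f : List ℕ → ℤ) → ∑ (sublists (xs ++ a ∷ [])) f ≡ ∑ (sublists xs) (λ s → f s + f (s ++ a ∷ []))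
  ∑-sublists-∷ʳ [] a f = ring (f (a ∷ [])) (f [])
    where
    ring : ∀ x y → x + (y + + 0) ≡ y + x + + 0
    ring = solve-∀
  ∑-sublists-∷ʳ (x ∷ xs) a f = begin
    ∑ (map (x ∷_) (sublists (xs ++ a ∷ [])) ++ sublists (xs ++ a ∷ [])) f
      ≡⟨ ∑-++ (map (x ∷_) (sublists (xs ++ a ∷ []))) _ f ⟩
    ∑ (map (x ∷_) (sublists (xs ++ a ∷ []))) f + ∑ (sublists (xs ++ a ∷ [])) f
      ≡⟨ cong₂ _+_ (trans (∑-map (x ∷_) (sublists (xs ++ a ∷ [])) f) (trans (∑-sublists-∷ʳ xs a (f ∘ (x ∷_))) (sym (∑-map (x ∷_) (sublists xs) _)))) (∑-sublists-∷ʳ xs a f) ⟩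
    ∑ (map (x ∷_) (sublists xs)) (λ s → f s + f (s ++ a ∷ [])) + ∑ (sublists xs) (λ s → f s + f (s ++ a ∷ []))
      ≡⟨ sym (∑-++ (map (x ∷_) (sublists xs)) _ _) ⟩
    ∑ (sublists (x ∷ xs)) (λ s → f s + f (s ++ a ∷ [])) ∎
    where open ≡-Reasoning

  -- The test `p` is arbitrary because the one inside `nonemptySets` is an anonymous
  -- pattern-matching function; it is known here only through its two values.
  ∑-nonempty : (p : List ℕ → Bool) → p [] ≡ false → (∀ x xs → p (x ∷ xs) ≡ true) → ∀ xs f →
               ∑ (sublists xs) f ≡ ∑ (filterᵇ p (sublists xs)) f + f []
  ∑-nonempty p p[] p∷ xs f = trans (go xs f) (cong (_+ f []) (sym (∑-filter p (sublists xs) f)))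
    where
    open ≡-Reasoning
    go : ∀ xs f → ∑ (sublists xs) f ≡ ∑ (sublists xs) (λ s → [ p s ]ᵇ * f s) + f []
    go [] f rewrite p[] = ring (f [])
      where
      ring : ∀ x → x + + 0 ≡ + 0 * x + + 0 + x
      ring = solve-∀
    go (x ∷ xs) f = begin
      ∑ (map (x ∷_) (sublists xs) ++ sublists xs) f
        ≡⟨ ∑-++ (map (x ∷_) (sublists xs)) _ f ⟩
      ∑ (map (x ∷_) (sublists xs)) f + ∑ (sublists xs) f
        ≡⟨ cong₂ _+_ (trans (∑-map (x ∷_) (sublists xs) f) (trans (∑-cong (sublists xs) full) (sym (∑-map (x ∷_) (sublists xs) _)))) (go xs f) ⟩
      ∑ (map (x ∷_) (sublists xs)) (λ s → [ p s ]ᵇ * f s) + (∑ (sublists xs) (λ s → [ p s ]ᵇ * f s) + f [])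
        ≡⟨ sym (ℤₚ.+-assoc (∑ (map (x ∷_) (sublists xs)) (λ s → [ p s ]ᵇ * f s)) _ (f [])) ⟩
      ∑ (map (x ∷_) (sublists xs)) (λ s → [ p s ]ᵇ * f s) + ∑ (sublists xs) (λ s → [ p s ]ᵇ * f s) + f []
        ≡⟨ cong (_+ f []) (sym (∑-++ (map (x ∷_) (sublists xs)) _ _)) ⟩
      ∑ (sublists (x ∷ xs)) (λ s → [ p s ]ᵇ * f s) + f [] ∎
      where
      full : ∀ s → f (x ∷ s) ≡ [ p (x ∷ s) ]ᵇ * f (x ∷ s)
      full s rewrite p∷ x s = sym (ℤₚ.*-identityˡ (f (x ∷ s)))

  oneTo-∷ʳ : ∀ m → oneTo (suc m) ≡ oneTo m ++ suc m ∷ []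
  oneTo-∷ʳ m = trans (cong (map suc) (sym (upTo-∷ʳ m))) (map-++ suc (upTo m) (m ∷ []))

  -- The empty set is added to both sides, so that the recursion for all subsets applies, and is
  -- cancelled afterwards.
  ∑-nonemptySets-suc : ∀ m f → ∑ (nonemptySets (suc m)) f
    ≡ ∑ (nonemptySets m) (λ s → f s + f (s ++ suc m ∷ [])) + f (suc m ∷ [])
  ∑-nonemptySets-suc m f = ∙-cancelʳ (f []) _ _ (begin
    ∑ (nonemptySets (suc m)) f + f []                 ≡⟨ sym (∑-nonempty _ refl (λ _ _ → refl) (oneTo (suc m)) f) ⟩
    ∑ (sublists (oneTo (suc m))) f                    ≡⟨ cong (λ xs → ∑ (sublists xs) f) (oneTo-∷ʳ m) ⟩
    ∑ (sublists (oneTo m ++ suc m ∷ [])) f            ≡⟨ ∑-sublists-∷ʳ (oneTo m) (suc m) f ⟩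
    ∑ (sublists (oneTo m)) g                          ≡⟨ ∑-nonempty _ refl (λ _ _ → refl) (oneTo m) g ⟩
    ∑ (nonemptySets m) g + (f [] + f (suc m ∷ []))    ≡⟨ ring (∑ (nonemptySets m) g) (f []) (f (suc m ∷ [])) ⟩
    ∑ (nonemptySets m) g + f (suc m ∷ []) + f []      ∎)
    where
    open ≡-Reasoning
    g : List ℕ → ℤ
    g s = f s + f (s ++ suc m ∷ [])
    ring : ∀ x y z → x + (y + z) ≡ x + z + y
    ring = solve-∀

  Bounded : ℕ → Box → Set
  Bounded m = All (_≤ m)

  data NonEmpty {A : Set} : List A → Set where
    nonEmpty : ∀ {x xs} → NonEmpty (x ∷ xs)

  sublists-All : {P : ℕ → Set} {xs s : List ℕ} → All P xs → s ∈ sublists xs → All P s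
  sublists-All {xs = []} ps (here refl) = []
  sublists-All {xs = x ∷ xs} (p ∷ ps) s∈ with ∈-++⁻ (map (x ∷_) (sublists xs)) s∈
  ... | inj₂ h = sublists-All ps h
  ... | inj₁ h with s′ , s′∈ , refl ← ∈-map⁻ _ h = p ∷ sublists-All ps s′∈

  oneTo-bounded : ∀ m → Bounded m (oneTo m)
  oneTo-bounded m = tabulate λ a∈ → bound (∈-map⁻ suc a∈)
    where
    open import Data.List.Relation.Unary.All using (tabulate)
    open import Data.Product using (∃)
    bound : ∀ {a} → (∃ λ i → i ∈ upTo m × a ≡ suc i) → a ≤ m
    bound (i , i∈ , refl) = ∈-upTo⁻ i∈

  nonemptySets-bounded : ∀ m {s} → s ∈ nonemptySets m → Bounded m s × NonEmpty s
  nonemptySets-bounded m {[]}    s∈ = ⊥-elim (proj₂ (∈-filter⁻ _ {xs = sublists (oneTo m)} s∈))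
  nonemptySets-bounded m {_ ∷ _} s∈ =
    sublists-All (oneTo-bounded m) (proj₁ (∈-filter⁻ _ {xs = sublists (oneTo m)} s∈)) , nonEmpty

  leSets-∷ʳ : ∀ {m} A s → Bounded m A → leSets A (s ++ suc m ∷ []) ≡ leSets A s
  leSets-∷ʳ []      s []       = refl
  leSets-∷ʳ (a ∷ A) s (a≤ ∷ h) = cong₂ _∧_ (go s) (leSets-∷ʳ A s h)
    where
    go : ∀ s → all (a ≤ᵇ_) (s ++ suc _ ∷ []) ≡ all (a ≤ᵇ_) s
    go []      = trans (∧-identityʳ _) (≤ᵇ-true (ℕₚ.m≤n⇒m≤1+n a≤))
    go (b ∷ s) = cong ((a ≤ᵇ b) ∧_) (go s)

  leSets-top : ∀ {m} A → Bounded (suc m) A → leSets A (suc m ∷ []) ≡ true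
  leSets-top []      []       = refl
  leSets-top (a ∷ A) (a≤ ∷ h) = cong₂ _∧_ (trans (∧-identityʳ _) (≤ᵇ-true a≤)) (leSets-top A h)

  data Top (m : ℕ) : Box → Set where
    top : ∀ s → Bounded m s → Top m (s ++ suc m ∷ [])

  top-bounded : ∀ {m B} → Top m B → Bounded (suc m) B
  top-bounded (top []      [])       = ℕₚ.≤-refl ∷ []
  top-bounded (top (b ∷ s) (b≤ ∷ h)) = ℕₚ.m≤n⇒m≤1+n b≤ ∷ top-bounded (top s h)

  leSets-below-top : ∀ {m B} b s → Top m B → b ≤ m → leSets B (b ∷ s) ≡ false
  leSets-below-top {m} b s (top []      [])      b≤ = cong (_∧ true) (cong (_∧ all (suc m ≤ᵇ_) s) (≤ᵇ-false (s≤s b≤)))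
  leSets-below-top b s (top (a ∷ B) (_ ∷ h)) b≤ =
    trans (cong (all (a ≤ᵇ_) (b ∷ s) ∧_) (leSets-below-top b s (top B h) b≤)) (∧-zeroʳ _)

  ltSets-∷ʳ : ∀ {m} A s → Bounded m A → ltSets A (s ++ suc m ∷ []) ≡ ltSets A s
  ltSets-∷ʳ []      s []       = refl
  ltSets-∷ʳ (a ∷ A) s (a≤ ∷ h) = cong₂ _∧_ (go s) (ltSets-∷ʳ A s h)
    where
    go : ∀ s → all (a <ᵇ_) (s ++ suc _ ∷ []) ≡ all (a <ᵇ_) s
    go []      = trans (∧-identityʳ _) (≤ᵇ-true (s≤s a≤))
    go (b ∷ s) = cong ((a <ᵇ b) ∧_) (go s)

  ltSets-top : ∀ {m B} b s → Top m B → b ≤ suc m → ltSets B (b ∷ s) ≡ false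
  ltSets-top {m} b s (top []      [])      b≤ = cong (_∧ true) (cong (_∧ all (suc m <ᵇ_) s) (≤ᵇ-false (s≤s b≤)))
  ltSets-top b s (top (a ∷ B) (_ ∷ h)) b≤ =
    trans (cong (all (a <ᵇ_) (b ∷ s) ∧_) (ltSets-top b s (top B h) b≤)) (∧-zeroʳ _)

  -- In a semistandard row with largest possible entry M, the boxes {M} form a final run, and at
  -- most one further box, just before that run, contains M next to smaller entries. `flag` produces
  -- that box.
  flag : ℕ → Row → Row
  flag M []           = []
  flag M (s ∷ [])     = (s ++ M ∷ []) ∷ []
  flag M (s ∷ t ∷ r)  = s ∷ flag M (t ∷ r)

  length-flag : ∀ M r → length (flag M r) ≡ length r
  length-flag M []          = refl
  length-flag M (s ∷ [])    = refl
  length-flag M (s ∷ t ∷ r) = cong suc (length-flag M (t ∷ r))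

  colOK-flag : ∀ {m} p r → All (Bounded m) p → colOK p (flag (suc m) r) ≡ colOK p r
  colOK-flag []      []          h = refl
  colOK-flag []      (s ∷ [])    h = refl
  colOK-flag []      (s ∷ t ∷ r) h = refl
  colOK-flag (A ∷ p) []          h = refl
  colOK-flag (A ∷ p) (s ∷ [])    (hA ∷ h) = cong (_∧ colOK p []) (ltSets-∷ʳ A s hA)
  colOK-flag (A ∷ p) (s ∷ t ∷ r) (hA ∷ h) = cong (ltSets A s ∧_) (colOK-flag p (t ∷ r) h)

  colOK-fill : ∀ {m} p r → All (Bounded m) p → colOK p (r ++ (suc m ∷ []) ∷ []) ≡ colOK p r
  colOK-fill []      []      h = refl
  colOK-fill []      (s ∷ r) h = refl
  colOK-fill (A ∷ p) []      (hA ∷ h) = cong₂ _∧_ (trans (ltSets-∷ʳ A [] hA) (lt-[] A)) (col-[] p)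
    where
    lt-[] : ∀ A → ltSets A [] ≡ true
    lt-[] []      = refl
    lt-[] (a ∷ A) = lt-[] A
    col-[] : ∀ p → colOK p [] ≡ true
    col-[] []      = refl
    col-[] (_ ∷ _) = refl
  colOK-fill (A ∷ p) (s ∷ r) (hA ∷ h) = cong (ltSets A s ∧_) (colOK-fill p r h)

  colOK-take : ∀ q r l → length r ≤ l → colOK (take l q) r ≡ colOK q r
  colOK-take []      r       zero    le = refl
  colOK-take []      r       (suc l) le = refl
  colOK-take (A ∷ q) []      zero    le = refl
  colOK-take (A ∷ q) []      (suc l) le = refl
  colOK-take (A ∷ q) (B ∷ r) (suc l) (s≤s le) = cong (ltSets A B ∧_) (colOK-take q r l le)

  data LastTop (m : ℕ) : Row → Set where
    last : ∀ {B} → Top m B → LastTop m (B ∷ [])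
    _∷_  : ∀ s {r} → LastTop m r → LastTop m (s ∷ r)

  -- Since the rows have equal length, a nonempty box with entries at most m + 1 lies directly below
  -- a box that contains m + 1.
  colOK-lastTop : ∀ {m q} r → LastTop m q → length r ≡ length q → All (λ s → Bounded (suc m) s × NonEmpty s) r → colOK q r ≡ false
  colOK-lastTop ((b ∷ s) ∷ []) (last t) eq (((b≤ ∷ _) , nonEmpty) ∷ []) = cong (_∧ true) (ltSets-top b s t b≤)
  colOK-lastTop (B ∷ r) (s ∷ h) eq (_ ∷ hs) =
    trans (cong (ltSets s B ∧_) (colOK-lastTop r h (ℕₚ.suc-injective eq) hs)) (∧-zeroʳ _)

  flag-lastTop : ∀ {m} s r → All (Bounded m) (s ∷ r) → LastTop m (flag (suc m) (s ∷ r))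
  flag-lastTop s []      (h ∷ []) = last (top s h)
  flag-lastTop s (t ∷ r) (h ∷ hs) = s ∷ flag-lastTop t r hs

  fill-lastTop : ∀ {m} r → LastTop m (r ++ (suc m ∷ []) ∷ [])
  fill-lastTop []      = last (top [] [])
  fill-lastTop (s ∷ r) = s ∷ fill-lastTop r

  take-flag : ∀ M l r → length r ≡ suc l → take l (flag M r) ≡ take l r
  take-flag M zero    r           eq = refl
  take-flag M (suc l) (s ∷ t ∷ r) eq = cong (s ∷_) (take-flag M l (t ∷ r) (ℕₚ.suc-injective eq))

  take-fill : ∀ (B : Box) l r → length r ≡ l → take l (r ++ B ∷ []) ≡ take l r
  take-fill B zero    r       eq = refl
  take-fill B (suc l) (s ∷ r) eq = cong (s ∷_) (take-fill B l r (ℕₚ.suc-injective eq))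

  take-shorter : ∀ l (q q′ : Row) → take (suc l) q ≡ take (suc l) q′ → take l q ≡ take l q′
  take-shorter zero    q       q′       eq = refl
  take-shorter (suc l) []      []       eq = refl
  take-shorter (suc l) (x ∷ q) (x′ ∷ q′) eq = cong₂ _∷_ (∷-injectiveˡ eq) (take-shorter l q q′ (∷-injectiveʳ eq))

  pr : (ℕ → ℤ) → Box → ℤ
  pr φ s = prodℤ (map φ s)

  pr-∷ʳ : ∀ φ s a → pr φ (s ++ a ∷ []) ≡ pr φ s * φ a
  pr-∷ʳ φ []      a = ℤₚ.*-comm (φ a) (+ 1)
  pr-∷ʳ φ (b ∷ s) a = trans (cong (φ b *_) (pr-∷ʳ φ s a)) (sym (ℤₚ.*-assoc (φ b) (pr φ s) (φ a)))

  -- Sum over the semistandard rows of l boxes that may follow the box A.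
  RF : (ℕ → ℤ) → ℕ → Box → ℕ → (Row → ℤ) → ℤ
  RF φ m A zero    F = F []
  RF φ m A (suc l) F = ∑ (nonemptySets m) (λ s → [ leSets A s ]ᵇ * (pr φ s * RF φ m s l (λ r → F (s ∷ r))))

  -- Sum over the semistandard tableaux with given row lengths that may lie below the row p.
  TS : (ℕ → ℤ) → ℕ → Row → List ℕ → ℤ
  TS φ m p []       = + 1
  TS φ m p (l ∷ ls) = RF φ m [] l (λ r → [ colOK p r ]ᵇ * TS φ m r ls)

  countZeros : List Bool → ℕ
  countZeros []          = 0
  countZeros (false ∷ w) = suc (countZeros w)
  countZeros (true ∷ w)  = countZeros w

  rowsOf : List Bool → List ℕ
  rowsOf []          = []
  rowsOf (false ∷ w) = rowsOf w
  rowsOf (true ∷ w)  = countZeros w ∷ rowsOf w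

  Boxes : ℕ → Row → Set
  Boxes m = All (λ s → Bounded m s × NonEmpty s)

  RF-cong : ∀ φ m A l {F G} → (∀ r → length r ≡ l → Boxes m r → F r ≡ G r) → RF φ m A l F ≡ RF φ m A l G
  RF-cong φ m A zero    h = h [] refl []
  RF-cong φ m A (suc l) h = ∑-cong-∈ (nonemptySets m) λ s s∈ → cong (λ t → [ leSets A s ]ᵇ * (pr φ s * t))
    (RF-cong φ m s l (λ r eq b → h (s ∷ r) (cong suc eq) (nonemptySets-bounded m s∈ ∷ b)))

  RF-+ : ∀ φ m A l F G → RF φ m A l (λ r → F r + G r) ≡ RF φ m A l F + RF φ m A l G
  RF-+ φ m A zero    F G = refl
  RF-+ φ m A (suc l) F G = trans (∑-cong (nonemptySets m) (λ s → trans
      (cong (λ t → [ leSets A s ]ᵇ * (pr φ s * t)) (RF-+ φ m s l (F ∘ (s ∷_)) (G ∘ (s ∷_))))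
      (ring [ leSets A s ]ᵇ (pr φ s) (RF φ m s l (F ∘ (s ∷_))) (RF φ m s l (G ∘ (s ∷_))))))
    (∑-+ (nonemptySets m) _ _)
    where
    ring : ∀ a b c d → a * (b * (c + d)) ≡ a * (b * c) + a * (b * d)
    ring = solve-∀

  RF-* : ∀ φ m A l c F → RF φ m A l (λ r → c * F r) ≡ c * RF φ m A l F
  RF-* φ m A zero    c F = refl
  RF-* φ m A (suc l) c F = trans (∑-cong (nonemptySets m) (λ s → trans
      (cong (λ t → [ leSets A s ]ᵇ * (pr φ s * t)) (RF-* φ m s l c (F ∘ (s ∷_))))
      (ring [ leSets A s ]ᵇ (pr φ s) c (RF φ m s l (F ∘ (s ∷_))))))
    (∑-*ˡ c (nonemptySets m) _)
    where
    ring : ∀ a b c d → a * (b * (c * d)) ≡ c * (a * (b * d))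
    ring = solve-∀

  RF-zero : ∀ φ m A l {F} → (∀ r → length r ≡ l → Boxes m r → F r ≡ + 0) → RF φ m A l F ≡ + 0
  RF-zero φ m A l {F} h = trans (RF-cong φ m A l h) (RF-* φ m A l (+ 0) (λ _ → + 0))

  pull-RF : ∀ y φ m t w A l (H : Row → List Bool → ℤ) →
    Skew.pull y t w (λ τ → RF φ m A l (λ r → H r τ)) ≡ RF φ m A l (λ r → Skew.pull y t w (H r))
  pull-RF y φ m t w A zero    H = refl
  pull-RF y φ m t w A (suc l) H = begin
    pull t w (λ τ → ∑ (nonemptySets m) (λ s → [ leSets A s ]ᵇ * (pr φ s * RF φ m s l (λ r → H (s ∷ r) τ))))
      ≡⟨ pull-cong t w (λ τ → ∑-cong (nonemptySets m) (λ s → sym (ℤₚ.*-assoc [ leSets A s ]ᵇ (pr φ s) _))) ⟩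
    pull t w (λ τ → ∑ (nonemptySets m) (λ s → [ leSets A s ]ᵇ * pr φ s * RF φ m s l (λ r → H (s ∷ r) τ)))
      ≡⟨ pull-∑ t w (nonemptySets m) (λ s → [ leSets A s ]ᵇ * pr φ s) (λ s τ → RF φ m s l (λ r → H (s ∷ r) τ)) ⟩
    ∑ (nonemptySets m) (λ s → [ leSets A s ]ᵇ * pr φ s * pull t w (λ τ → RF φ m s l (λ r → H (s ∷ r) τ)))
      ≡⟨ ∑-cong (nonemptySets m) (λ s → trans (cong ([ leSets A s ]ᵇ * pr φ s *_) (pull-RF y φ m t w s l (H ∘ (s ∷_))))
           (ℤₚ.*-assoc [ leSets A s ]ᵇ (pr φ s) _)) ⟩
    RF φ m A (suc l) (λ r → pull t w (H r)) ∎
    where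
    open Skew y
    open ≡-Reasoning

  pull-* : ∀ y t w c g → Skew.pull y t w (λ τ → c * g τ) ≡ c * Skew.pull y t w g
  pull-* y t w c g = trans (Skew.pull-cong y t w (λ τ → sym (ℤₚ.+-identityʳ (c * g τ))))
    (trans (Skew.pull-∑ y t w (c ∷ []) (λ c → c) (λ _ → g)) (ℤₚ.+-identityʳ _))

  -- Letter counts of the words at which `pull t w` evaluates its argument. In mode carry a one of
  -- the smaller shape is still to come, hence the shift by one.
  Similar : Mode → List Bool → List Bool → Set
  Similar carry w τ = (countOnes τ ≡ suc (countOnes w)) × (countZeros w ≡ suc (countZeros τ))
  Similar _     w τ = (countOnes τ ≡ countOnes w) × (countZeros w ≡ countZeros τ)

  pull-cong-on : ∀ y t w {g h} → (∀ τ → Similar t w τ → g τ ≡ h τ) → Skew.pull y t w g ≡ Skew.pull y t w h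
  pull-cong-on y idle  [] e = e [] (refl , refl)
  pull-cong-on y mark  [] e = refl
  pull-cong-on y carry [] e = refl
  pull-cong-on y idle  (false ∷ w) e = pull-cong-on y idle w (λ τ (o , z) → e (false ∷ τ) (o , cong suc z))
  pull-cong-on y idle  (true  ∷ w) e = cong₂ _+_
    (cong₂ _+_ (pull-cong-on y idle w (λ τ (o , z) → e (true ∷ τ) (cong suc o , z)))
               (pull-cong-on y mark w (λ τ (o , z) → e (true ∷ τ) (cong suc o , z))))
    (pull-cong-on y carry w (λ τ (o , z) → e (false ∷ τ) (o , z)))
  pull-cong-on y mark  (false ∷ w) e = cong (y *_) (pull-cong-on y idle w (λ τ (o , z) → e (false ∷ τ) (o , cong suc z)))
  pull-cong-on y mark  (true  ∷ w) e = refl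
  pull-cong-on y carry (false ∷ w) e = cong (y *_) (cong₂ _+_
    (pull-cong-on y carry w (λ τ (o , z) → e (false ∷ τ) (o , cong suc z)))
    (cong₂ _+_ (pull-cong-on y idle w (λ τ (o , z) → e (true ∷ τ) (cong suc o , cong suc z)))
               (pull-cong-on y mark w (λ τ (o , z) → e (true ∷ τ) (cong suc o , cong suc z)))))
  pull-cong-on y carry (true  ∷ w) e = refl

  module Largest (φ : ℕ → ℤ) (m : ℕ) where
    private
      M = suc m
      y = φ M
      fillBox : Box
      fillBox = M ∷ []
    open Skew y
    open ≡-Reasoning

    push : (Row → ℤ) → Row → ℤ
    push F r = y * F (r ++ fillBox ∷ [])

    marked : (Row → ℤ) → Row → ℤ
    marked F []      = + 0
    marked F (s ∷ r) = F (flag M (s ∷ r))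

    withMark : (Row → ℤ) → Row → ℤ
    withMark F r = F r + y * marked F r

    ft : ℕ → (Row → ℤ) → ℤ
    ft zero    F = F []
    ft (suc l) F = ft l (push F)

    ft-push : ∀ l F → ft l (push F) ≡ y * ft l (F ∘ (fillBox ∷_))
    ft-push zero    F = refl
    ft-push (suc l) F = ft-push l (push F)

    -- Rows are split according to the number of boxes equal to {M} at their end (each application of push).
    SR : Box → ℕ → (Row → ℤ) → ℤ
    SR A zero    F = RF φ m A zero (withMark F)
    SR A (suc t) F = RF φ m A (suc t) (withMark F) + SR A t (push F)

    private
      c : Box → Box → ℤ
      c A s = [ leSets A s ]ᵇ * pr φ s

    -- `SR` peels boxes {M} off the right end, while `RF` generates a row from the left. This
    -- recursion of `SR` by the first box is what makes the two comparable.
    SR-step : ∀ A t F → SR A (suc t) F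
      ≡ ∑ (nonemptySets m) (λ s → c A s * (SR s t (F ∘ (s ∷_)) + y * ft t (F ∘ ((s ++ M ∷ []) ∷_)))) + ft (suc t) F
    SR-step A zero F = cong₂ _+_ (∑-cong (nonemptySets m) (λ s → ring [ leSets A s ]ᵇ (pr φ s) (F (s ∷ [])) y (F ((s ++ M ∷ []) ∷ []))))
        (ring′ (push F []) y)
      where
      ring : ∀ a b x y z → a * (b * (x + y * z)) ≡ a * b * (x + y * + 0 + y * z)
      ring = solve-∀
      ring′ : ∀ x y → x + y * + 0 ≡ x
      ring′ = solve-∀
    SR-step A (suc t) F = begin
      RF φ m A (suc (suc t)) (withMark F) + SR A (suc t) (push F)
        ≡⟨ cong (_+_ (RF φ m A (suc (suc t)) (withMark F))) (SR-step A t (push F)) ⟩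
      ∑ (nonemptySets m) (λ s → [ leSets A s ]ᵇ * (pr φ s * E s)) +
        (∑ (nonemptySets m) (λ s → c A s * (S s + y * K s)) + ft (suc t) (push F))
        ≡⟨ sym (ℤₚ.+-assoc (∑ (nonemptySets m) (λ s → [ leSets A s ]ᵇ * (pr φ s * E s))) _ _) ⟩
      ∑ (nonemptySets m) (λ s → [ leSets A s ]ᵇ * (pr φ s * E s)) + ∑ (nonemptySets m) (λ s → c A s * (S s + y * K s)) + ft (suc t) (push F)
        ≡⟨ cong (_+ ft (suc t) (push F)) (trans (sym (∑-+ (nonemptySets m) _ _))
             (∑-cong (nonemptySets m) (λ s → ring [ leSets A s ]ᵇ (pr φ s) (E s) (S s) (y * K s)))) ⟩
      ∑ (nonemptySets m) (λ s → c A s * (E s + S s + y * K s)) + ft (suc (suc t)) F ∎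
      where
      E S K : Box → ℤ
      E s = RF φ m s (suc t) (withMark (F ∘ (s ∷_)))
      S s = SR s t (push (F ∘ (s ∷_)))
      K s = ft t (push (F ∘ ((s ++ M ∷ []) ∷_)))
      ring : ∀ a b e s k → a * (b * e) + a * b * (s + k) ≡ a * b * (e + s + k)
      ring = solve-∀

    -- The condition max ≤ min admits only {M} after a box that contains M.
    RF-top : ∀ l B F → Top m B → RF φ M B l F ≡ ft l F
    RF-top zero    B F t = refl
    RF-top (suc l) B F t = begin
      ∑ (nonemptySets M) g
        ≡⟨ ∑-nonemptySets-suc m g ⟩
      ∑ (nonemptySets m) (λ s → g s + g (s ++ M ∷ [])) + g fillBox
        ≡⟨ cong₂ _+_ (∑-zero-∈ (nonemptySets m) below) at-top ⟩
      + 0 + y * ft l (F ∘ (fillBox ∷_))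
        ≡⟨ trans (ℤₚ.+-identityˡ _) (sym (ft-push l F)) ⟩
      ft (suc l) F ∎
      where
      g : Box → ℤ
      g s = [ leSets B s ]ᵇ * (pr φ s * RF φ M s l (F ∘ (s ∷_)))
      below : ∀ s → s ∈ nonemptySets m → g s + g (s ++ M ∷ []) ≡ + 0
      below s s∈ with nonemptySets-bounded m s∈
      ... | (_∷_ {b} {s′} b≤ _) , nonEmpty rewrite leSets-below-top b s′ t b≤ | leSets-below-top b (s′ ++ M ∷ []) t b≤ = refl
      at-top : g fillBox ≡ y * ft l (F ∘ (fillBox ∷_))
      at-top rewrite leSets-top B (top-bounded t) | RF-top l fillBox (F ∘ (fillBox ∷_)) (top [] []) =
        trans (ℤₚ.*-identityˡ _) (cong (_* ft l (F ∘ (fillBox ∷_))) (ℤₚ.*-identityʳ y))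

    -- The first box is a set s below M, or s with M added, or {M}; in the last two cases the rest
    -- of the row is forced.
    RF-split : ∀ l A F → Bounded m A → RF φ M A l F ≡ SR A l F
    RF-split zero    A F h = sym (trans (cong (_+_ (F [])) (ℤₚ.*-zeroʳ y)) (ℤₚ.+-identityʳ _))
    RF-split (suc l) A F h = begin
      ∑ (nonemptySets M) g
        ≡⟨ ∑-nonemptySets-suc m g ⟩
      ∑ (nonemptySets m) (λ s → g s + g (s ++ M ∷ [])) + g fillBox
        ≡⟨ cong₂ _+_ (∑-cong-∈ (nonemptySets m) main) at-top ⟩
      ∑ (nonemptySets m) (λ s → c A s * (SR s l (F ∘ (s ∷_)) + y * ft l (F ∘ ((s ++ M ∷ []) ∷_)))) + ft (suc l) F
        ≡⟨ sym (SR-step A l F) ⟩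
      SR A (suc l) F ∎
      where
      g : Box → ℤ
      g s = [ leSets A s ]ᵇ * (pr φ s * RF φ M s l (F ∘ (s ∷_)))
      main : ∀ s → s ∈ nonemptySets m → g s + g (s ++ M ∷ []) ≡ c A s * (SR s l (F ∘ (s ∷_)) + y * ft l (F ∘ ((s ++ M ∷ []) ∷_)))
      main s s∈ with hs ← proj₁ (nonemptySets-bounded m s∈)
        rewrite leSets-∷ʳ A s h | pr-∷ʳ φ s M | RF-split l s (F ∘ (s ∷_)) hs
              | RF-top l (s ++ M ∷ []) (F ∘ ((s ++ M ∷ []) ∷_)) (top s hs) =
        ring [ leSets A s ]ᵇ (pr φ s) (SR s l (F ∘ (s ∷_))) y (ft l (F ∘ ((s ++ M ∷ []) ∷_)))
        where
        ring : ∀ a b x y z → a * (b * x) + a * (b * y * z) ≡ a * b * (x + y * z)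
        ring = solve-∀
      at-top : g fillBox ≡ ft (suc l) F
      at-top rewrite leSets-∷ʳ A [] h | RF-top l fillBox (F ∘ (fillBox ∷_)) (top [] []) =
        trans (cong (λ b → [ b ]ᵇ * (y * + 1 * ft l (F ∘ (fillBox ∷_)))) (le-[] A))
          (trans (ℤₚ.*-identityˡ _) (trans (cong (_* ft l (F ∘ (fillBox ∷_))) (ℤₚ.*-identityʳ y)) (sym (ft-push l F))))
        where
        le-[] : ∀ A → leSets A [] ≡ true
        le-[] []      = refl
        le-[] (a ∷ A) = le-[] A

    SR-cong : ∀ A t {F G} → (∀ r → length r ≡ t → F r ≡ G r) → SR A t F ≡ SR A t G
    withMark-cong : ∀ t {F G} → (∀ r → length r ≡ t → F r ≡ G r) → ∀ r → length r ≡ t → withMark F r ≡ withMark G r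
    withMark-cong t h []      eq = cong (_+ y * + 0) (h [] eq)
    withMark-cong t h (s ∷ r) eq = cong₂ (λ a b → a + y * b) (h (s ∷ r) eq) (h _ (trans (length-flag M (s ∷ r)) eq))
    SR-cong A zero    h = RF-cong φ m A zero (λ r eq _ → withMark-cong zero h r eq)
    SR-cong A (suc t) h = cong₂ _+_ (RF-cong φ m A (suc t) (λ r eq _ → withMark-cong (suc t) h r eq))
      (SR-cong A t (λ r eq → cong (y *_) (h _ (trans (length-++ r) (trans (ℕₚ.+-comm _ 1) (cong suc eq))))))

    SR-* : ∀ A t a F → SR A t (λ r → a * F r) ≡ a * SR A t F
    withMark-* : ∀ a F r → withMark (λ r → a * F r) r ≡ a * withMark F r
    withMark-* a F []      = ring a (F []) y
      where
      ring : ∀ a x y → a * x + y * + 0 ≡ a * (x + y * + 0)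
      ring = solve-∀
    withMark-* a F (s ∷ r) = ring a (F (s ∷ r)) y (F (flag M (s ∷ r)))
      where
      ring : ∀ a x y z → a * x + y * (a * z) ≡ a * (x + y * z)
      ring = solve-∀
    SR-* A zero    a F = withMark-* a F []
    SR-* A (suc t) a F = trans (cong₂ _+_
        (trans (RF-cong φ m A (suc t) (λ r _ _ → withMark-* a F r)) (RF-* φ m A (suc t) a (withMark F)))
        (trans (SR-cong A t (λ r _ → *-left-comm y a (F (r ++ fillBox ∷ [])))) (SR-* A t a (push F))))
      (sym (ℤₚ.*-distribˡ-+ a (RF φ m A (suc t) (withMark F)) (SR A t (push F))))

    Z Z′ : Row → List Bool → ℤ
    Z  p w = TS φ m p (rowsOf w)
    Z′ p w = TS φ M p (rowsOf w)

    -- Boxes of the upper row that stick out beyond the next row meet no column condition.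
    Z′-take : ∀ w q q′ → take (countZeros w) q ≡ take (countZeros w) q′ → Z′ q w ≡ Z′ q′ w
    Z′-take []          q q′ eq = refl
    Z′-take (false ∷ w) q q′ eq = Z′-take w q q′ (take-shorter (countZeros w) q q′ eq)
    Z′-take (true ∷ w)  q q′ eq = RF-cong φ M [] (countZeros w) λ r len _ → cong (λ b → [ b ]ᵇ * Z′ r w)
      (trans (sym (colOK-take q r (countZeros w) (ℕₚ.≤-reflexive len)))
        (trans (cong (λ q → colOK q r) eq) (colOK-take q′ r (countZeros w) (ℕₚ.≤-reflexive len))))

    Z′-lastTop : ∀ w q → LastTop m q → length q ≡ countZeros w → Z′ q (true ∷ w) ≡ + 0
    Z′-lastTop w q lt len = RF-zero φ M [] (countZeros w) λ r len′ b →
      cong (λ b → [ b ]ᵇ * Z′ r w) (colOK-lastTop r lt (trans len′ (sym len)) b)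

    below : Row → List Bool → Row → ℤ
    below p w r = [ colOK p r ]ᵇ * Z′ r w

    -- The part of `SR` with at least one final box {M}, that is, with a row that really becomes
    -- shorter when these boxes are removed.
    carried : ℕ → (Row → ℤ) → ℤ
    carried zero    F = + 0
    carried (suc l) F = SR [] l (push F)

    SR-carried : ∀ l F → SR [] l F ≡ RF φ m [] l (withMark F) + carried l F
    SR-carried zero    F = sym (ℤₚ.+-identityʳ _)
    SR-carried (suc l) F = refl

    -- Deleting the boxes {M} of a row corresponds to carrying its one across zeros, and an M added
    -- to the last remaining box corresponds to a mark. The statements are mutually recursive
    -- because the mode after one row constrains the next. The row `p` contains no M, so an M below
    -- it violates no column condition.
    branch : ∀ w p → All (Bounded m) p → Z′ p w ≡ pull idle w (Z p)
    -- An M in the last box of `p` forbids a box below it. If `w` begins with 1, the next row is as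
    -- long as `p` and both sides are 0; if it begins with 0, the next row is shorter and does not
    -- see that box.
    branch-mark : ∀ w p → All (Bounded m) p → length p ≡ countZeros w → pull mark w (Z p) ≡ y * marked (λ q → Z′ q w) p
    -- Each 0 crossed allows one more final box {M}. A 1 stops the move, since the next row would
    -- then put a box below the last {M}.
    branch-carry : ∀ w p → All (Bounded m) p → pull carry w (Z p) ≡ carried (countZeros w) (below p w)
    branch-drop : ∀ w p → All (Bounded m) p →
      pull idle w (λ τ → Z p (true ∷ τ)) + pull mark w (λ τ → Z p (true ∷ τ)) ≡ RF φ m [] (countZeros w) (withMark (below p w))

    branch []          p h = refl
    branch (false ∷ w) p h = branch w p h
    branch (true ∷ w)  p h = begin
      RF φ M [] (countZeros w) (below p w)
        ≡⟨ RF-split (countZeros w) [] (below p w) [] ⟩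
      SR [] (countZeros w) (below p w)
        ≡⟨ SR-carried (countZeros w) (below p w) ⟩
      RF φ m [] (countZeros w) (withMark (below p w)) + carried (countZeros w) (below p w)
        ≡⟨ sym (cong₂ _+_ (branch-drop w p h) (branch-carry w p h)) ⟩
      pull idle (true ∷ w) (Z p) ∎

    branch-drop w p h = begin
      pull idle w (λ τ → Z p (true ∷ τ)) + pull mark w (λ τ → Z p (true ∷ τ))
        ≡⟨ cong₂ _+_ (commute idle (λ τ → proj₂)) (commute mark (λ τ → proj₂)) ⟩
      RF φ m [] l (λ r → [ colOK p r ]ᵇ * pull idle w (Z r)) + RF φ m [] l (λ r → [ colOK p r ]ᵇ * pull mark w (Z r))
        ≡⟨ sym (RF-+ φ m [] l _ _) ⟩
      RF φ m [] l (λ r → [ colOK p r ]ᵇ * pull idle w (Z r) + [ colOK p r ]ᵇ * pull mark w (Z r))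
        ≡⟨ RF-cong φ m [] l same ⟩
      RF φ m [] l (withMark (below p w)) ∎
      where
      l = countZeros w
      Sized : Mode → Set
      Sized t = ∀ τ → Similar t w τ → l ≡ countZeros τ
      commute : ∀ t → Sized t → pull t w (λ τ → Z p (true ∷ τ)) ≡ RF φ m [] l (λ r → [ colOK p r ]ᵇ * pull t w (Z r))
      commute t sized = begin
        pull t w (λ τ → RF φ m [] (countZeros τ) (λ r → [ colOK p r ]ᵇ * Z r τ))
          ≡⟨ pull-cong-on y t w (λ τ s → cong (λ l → RF φ m [] l (λ r → [ colOK p r ]ᵇ * Z r τ)) (sym (sized τ s))) ⟩
        pull t w (λ τ → RF φ m [] l (λ r → [ colOK p r ]ᵇ * Z r τ))
          ≡⟨ pull-RF y φ m t w [] l (λ r τ → [ colOK p r ]ᵇ * Z r τ) ⟩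
        RF φ m [] l (λ r → pull t w (λ τ → [ colOK p r ]ᵇ * Z r τ))
          ≡⟨ RF-cong φ m [] l (λ r _ _ → pull-* y t w [ colOK p r ]ᵇ (Z r)) ⟩
        RF φ m [] l (λ r → [ colOK p r ]ᵇ * pull t w (Z r)) ∎
      same : ∀ r → length r ≡ l → Boxes m r →
        [ colOK p r ]ᵇ * pull idle w (Z r) + [ colOK p r ]ᵇ * pull mark w (Z r) ≡ withMark (below p w) r
      same r len b rewrite sym (branch w r (All-map proj₁ b)) | branch-mark w r (All-map proj₁ b) len = go r
        where
        ring : ∀ a x y z → a * x + a * (y * z) ≡ a * x + y * (a * z)
        ring = solve-∀
        go : ∀ r → [ colOK p r ]ᵇ * Z′ r w + [ colOK p r ]ᵇ * (y * marked (λ q → Z′ q w) r) ≡ withMark (below p w) r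
        go []      = trans (ring [ colOK p [] ]ᵇ (Z′ [] w) y (+ 0)) (cong (λ t → [ colOK p [] ]ᵇ * Z′ [] w + y * t) (ℤₚ.*-zeroʳ [ colOK p [] ]ᵇ))
        go (s ∷ r) = trans (ring [ colOK p (s ∷ r) ]ᵇ (Z′ (s ∷ r) w) y (Z′ (flag M (s ∷ r)) w))
          (cong (λ b → [ colOK p (s ∷ r) ]ᵇ * Z′ (s ∷ r) w + y * ([ b ]ᵇ * Z′ (flag M (s ∷ r)) w)) (sym (colOK-flag p (s ∷ r) h)))

    branch-mark []          []      h len = sym (ℤₚ.*-zeroʳ y)
    branch-mark (true ∷ w)  []      h len = sym (ℤₚ.*-zeroʳ y)
    branch-mark (true ∷ w)  (s ∷ r) h len =
      sym (trans (cong (y *_) (Z′-lastTop w (flag M (s ∷ r)) (flag-lastTop s r h) (trans (length-flag M (s ∷ r)) len))) (ℤₚ.*-zeroʳ y))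
    branch-mark (false ∷ w) (s ∷ r) h len = cong (y *_) (trans (sym (branch w (s ∷ r) h))
      (Z′-take w (s ∷ r) (flag M (s ∷ r)) (sym (take-flag M (countZeros w) (s ∷ r) len))))

    branch-carry []          p h = refl
    branch-carry (true ∷ w)  p h = sym (vanish (countZeros w) refl)
      where
      vanish : ∀ l → countZeros w ≡ l → carried l (below p (true ∷ w)) ≡ + 0
      vanish zero    eq = refl
      vanish (suc l) eq = trans (SR-cong [] l (λ r len → zero′ r (trans (length-++ r) (trans (ℕₚ.+-comm _ 1) (trans (cong suc len) (sym eq))))))
                                (SR-* [] l (+ 0) (λ _ → + 0))
        where
        zero′ : ∀ r → length (r ++ fillBox ∷ []) ≡ countZeros w → push (below p (true ∷ w)) r ≡ + 0
        zero′ r len rewrite Z′-lastTop w (r ++ fillBox ∷ []) (fill-lastTop r) len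
          | ℤₚ.*-zeroʳ [ colOK p (r ++ fillBox ∷ []) ]ᵇ = ℤₚ.*-zeroʳ y
    branch-carry (false ∷ w) p h = begin
      y * (pull carry w (Z p) + (pull idle w (λ τ → Z p (true ∷ τ)) + pull mark w (λ τ → Z p (true ∷ τ))))
        ≡⟨ cong (y *_) (cong₂ _+_ (branch-carry w p h) (branch-drop w p h)) ⟩
      y * (carried l (below p w) + RF φ m [] l (withMark (below p w)))
        ≡⟨ cong (y *_) (trans (ℤₚ.+-comm (carried l (below p w)) _) (sym (SR-carried l (below p w)))) ⟩
      y * SR [] l (below p w)
        ≡⟨ sym (SR-* [] l y (below p w)) ⟩
      SR [] l (λ r → y * below p w r)
        ≡⟨ SR-cong [] l (λ r len → cong (y *_) (cong₂ (λ b t → [ b ]ᵇ * t) (sym (colOK-fill p r h))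
             (Z′-take w r (r ++ fillBox ∷ []) (sym (take-fill fillBox l r len))))) ⟩
      SR [] l (push (below p (false ∷ w))) ∎
      where l = countZeros w

-- From sums over tableaux to the polynomials `G`.

module Tableaux where

  open import Data.Bool using (true; false; _∧_)
  open import Data.Nat using (ℕ; zero; suc; _≤_; z≤n; s≤s; _∸_) renaming (_+_ to _+ℕ_)
  import Data.Nat.Properties as ℕₚ
  open import Data.List using (List; []; _∷_; _++_; map; length; concat; concatMap; filterᵇ; reverse; replicate)
  open import Data.List.Properties using (length-++; concat-++; unfold-reverse; length-reverse; length-map)
  open import Data.List.Membership.Propositional using (_∈_; find)
  open import Data.List.Membership.Propositional.Properties using (∈-map⁻; ∈-concatMap⁻)
  open import Data.List.Relation.Unary.All using (All; []; _∷_)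
  open import Data.Product using (_,_; proj₁; proj₂)
  open import Data.Integer using (ℤ; +_; -_; _+_; _*_)
  import Data.Integer.Properties as ℤₚ
  open import Data.Integer.Tactic.RingSolver using (solve-∀)
  open import Function using (_∘_)
  open import Relation.Binary.PropositionalEquality
  open import Defs
  open Sums
  open Rows using (idle)
  open Puzzle
  open UnitLaw using (bitWord)
  open Uniqueness using (gh; tl)
  open Branching

  pr-cong : ∀ {φ ψ : ℕ → ℤ} s → All (λ a → φ a ≡ ψ a) s → pr φ s ≡ pr ψ s
  pr-cong []      []      = refl
  pr-cong (a ∷ s) (h ∷ hs) = cong₂ _*_ h (pr-cong s hs)

  RF-φ : ∀ {φ ψ : ℕ → ℤ} m → (∀ a → a ≤ m → φ a ≡ ψ a) → ∀ A l F → RF φ m A l F ≡ RF ψ m A l F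
  RF-φ m h A zero    F = refl
  RF-φ m h A (suc l) F = ∑-cong-∈ (nonemptySets m) λ s s∈ → cong ([ leSets A s ]ᵇ *_)
    (cong₂ _*_ (pr-cong s (All-map (λ {a} → h a) (proj₁ (nonemptySets-bounded m s∈)))) (RF-φ m h s l (F ∘ (s ∷_))))
    where open import Data.List.Relation.Unary.All using () renaming (map to All-map)

  TS-φ : ∀ {φ ψ : ℕ → ℤ} m → (∀ a → a ≤ m → φ a ≡ ψ a) → ∀ p ls → TS φ m p ls ≡ TS ψ m p ls
  TS-φ m h p []       = refl
  TS-φ m h p (l ∷ ls) = trans (RF-φ m h [] l _) (RF-cong _ m [] l (λ r _ _ → cong ([ colOK p r ]ᵇ *_) (TS-φ m h r ls)))

  colOK-[] : ∀ p → colOK p [] ≡ true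
  colOK-[] []      = refl
  colOK-[] (_ ∷ _) = refl

  var-∷ʳ-below : ∀ xs x a → a ≤ length xs → var (xs ++ x ∷ []) a ≡ var xs a
  var-∷ʳ-below []       x zero          le = refl
  var-∷ʳ-below (z ∷ xs) x zero          le = refl
  var-∷ʳ-below (z ∷ xs) x (suc zero)    le = refl
  var-∷ʳ-below (z ∷ xs) x (suc (suc a)) (s≤s le) = var-∷ʳ-below xs x (suc a) le

  var-∷ʳ-last : ∀ xs x → var (xs ++ x ∷ []) (suc (length xs)) ≡ x
  var-∷ʳ-last []           x = refl
  var-∷ʳ-last (_ ∷ [])     x = refl
  var-∷ʳ-last (_ ∷ z ∷ xs) x = var-∷ʳ-last (z ∷ xs) x

  -- Without admissible entries a row that has a box has no filling, so only the shape consisting of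
  -- k empty rows contributes.
  TS-no-variables : ∀ φ p w a k → countZeros w ≡ a → countOnes w ≡ k → δ (tl a k) (bitWord w) ≡ TS φ 0 p (rowsOf w)
  TS-no-variables φ p []          zero    zero    _ _ = refl
  TS-no-variables φ p (false ∷ w) (suc a) k       z o = TS-no-variables φ p w a k (ℕₚ.suc-injective z) o
  TS-no-variables φ p (true ∷ w)  zero    (suc k) z o rewrite z | colOK-[] p =
    trans (TS-no-variables φ [] w zero k z (ℕₚ.suc-injective o)) (sym (ℤₚ.*-identityˡ _))
  TS-no-variables φ p (true ∷ w)  (suc a) (suc k) z o rewrite z = refl

  -- The branching rule applied from the largest variable downwards; `gh` lists that variable first,
  -- hence the reversal.
  gh-tableaux : ∀ a k rs w → countZeros w ≡ a → countOnes w ≡ k →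
                gh a k rs w ≡ TS (var (reverse rs)) (length rs) [] (rowsOf w)
  gh-tableaux a k []       w z o = TS-no-variables (var []) [] w a k z o
  gh-tableaux a k (y ∷ rs) w z o = begin
    Skew.pull y idle w (gh a k rs)
      ≡⟨ pull-cong-on y idle w (λ τ (o′ , z′) → trans (gh-tableaux a k rs τ (trans (sym z′) z) (trans o′ o))
           (TS-φ (length rs) (λ a a≤ → sym (below-last a a≤)) [] (rowsOf τ))) ⟩
    Skew.pull y idle w (λ τ → TS φ (length rs) [] (rowsOf τ))
      ≡⟨ cong (λ y → Skew.pull y idle w (λ τ → TS φ (length rs) [] (rowsOf τ))) (sym last-y) ⟩
    Skew.pull (φ (suc (length rs))) idle w (λ τ → TS φ (length rs) [] (rowsOf τ))
      ≡⟨ sym (Largest.branch φ (length rs) w [] []) ⟩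
    TS φ (suc (length rs)) [] (rowsOf w) ∎
    where
    open ≡-Reasoning
    φ = var (reverse (y ∷ rs))
    below-last : ∀ a → a ≤ length rs → φ a ≡ var (reverse rs) a
    below-last a le = trans (cong (λ xs → var xs a) (unfold-reverse y rs)) (var-∷ʳ-below (reverse rs) y a (subst (a ≤_) (sym (length-reverse rs)) le))
    last-y : φ (suc (length rs)) ≡ y
    last-y = trans (cong₂ (λ xs l → var xs (suc l)) (unfold-reverse y rs) (sym (length-reverse rs))) (var-∷ʳ-last (reverse rs) y)

  TS-zeros : ∀ φ m p ls j → TS φ m p (ls ++ replicate j 0) ≡ TS φ m p ls
  TS-zeros φ m p []       zero    = refl
  TS-zeros φ m p []       (suc j) rewrite colOK-[] p = trans (ℤₚ.*-identityˡ _) (TS-zeros φ m [] [] j)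
  TS-zeros φ m p (l ∷ ls) j = RF-cong φ m [] l (λ r _ _ → cong ([ colOK p r ]ᵇ *_) (TS-zeros φ m r ls j))

  []ᵇ-∧ : ∀ a b → [ a ∧ b ]ᵇ ≡ [ a ]ᵇ * [ b ]ᵇ
  []ᵇ-∧ false b = refl
  []ᵇ-∧ true  b = sym (ℤₚ.*-identityˡ [ b ]ᵇ)

  pr-++ : ∀ φ s t → pr φ (s ++ t) ≡ pr φ s * pr φ t
  pr-++ φ []      t = sym (ℤₚ.*-identityˡ _)
  pr-++ φ (a ∷ s) t = trans (cong (φ a *_) (pr-++ φ s t)) (sym (ℤₚ.*-assoc (φ a) (pr φ s) (pr φ t)))

  ∑-rowFillings : ∀ φ m A l F → ∑ (rowFillings m l) (λ r → [ rowOK (A ∷ r) ]ᵇ * (pr φ (concat r) * F r)) ≡ RF φ m A l F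
  ∑-rowFillings φ m A zero    F = ring (F [])
    where
    ring : ∀ x → + 1 * (+ 1 * x) + + 0 ≡ x
    ring = solve-∀
  ∑-rowFillings φ m A (suc l) F = trans (∑-concatMap _ (nonemptySets m) _) (∑-cong (nonemptySets m) λ s → begin
    ∑ (map (s ∷_) (rowFillings m l)) (λ r → [ rowOK (A ∷ r) ]ᵇ * (pr φ (concat r) * F r))
      ≡⟨ ∑-map (s ∷_) (rowFillings m l) _ ⟩
    ∑ (rowFillings m l) (λ r → [ leSets A s ∧ rowOK (s ∷ r) ]ᵇ * (pr φ (s ++ concat r) * F (s ∷ r)))
      ≡⟨ ∑-cong (rowFillings m l) (λ r → trans (cong₂ (λ a b → a * (b * F (s ∷ r))) ([]ᵇ-∧ (leSets A s) (rowOK (s ∷ r))) (pr-++ φ s (concat r)))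
           (ring [ leSets A s ]ᵇ [ rowOK (s ∷ r) ]ᵇ (pr φ s) (pr φ (concat r)) (F (s ∷ r)))) ⟩
    ∑ (rowFillings m l) (λ r → [ leSets A s ]ᵇ * pr φ s * ([ rowOK (s ∷ r) ]ᵇ * (pr φ (concat r) * F (s ∷ r))))
      ≡⟨ ∑-*ˡ ([ leSets A s ]ᵇ * pr φ s) (rowFillings m l) _ ⟩
    [ leSets A s ]ᵇ * pr φ s * ∑ (rowFillings m l) (λ r → [ rowOK (s ∷ r) ]ᵇ * (pr φ (concat r) * F (s ∷ r)))
      ≡⟨ cong ([ leSets A s ]ᵇ * pr φ s *_) (∑-rowFillings φ m s l (F ∘ (s ∷_))) ⟩
    [ leSets A s ]ᵇ * pr φ s * RF φ m s l (F ∘ (s ∷_))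
      ≡⟨ ℤₚ.*-assoc [ leSets A s ]ᵇ (pr φ s) _ ⟩
    [ leSets A s ]ᵇ * (pr φ s * RF φ m s l (F ∘ (s ∷_))) ∎)
    where
    open ≡-Reasoning
    ring : ∀ a b c d e → a * b * (c * d * e) ≡ a * c * (b * (d * e))
    ring = solve-∀

  rowOK-[] : ∀ r → rowOK ([] ∷ r) ≡ rowOK r
  rowOK-[] []      = refl
  rowOK-[] (_ ∷ _) = refl

  -- A row `p` on top makes the recursion over rows uniform; the empty row imposes no condition.
  ∑-fillings : ∀ φ m p ls → ∑ (fillings m ls) (λ T → [ semistandard (p ∷ T) ]ᵇ * pr φ (entries T)) ≡ [ rowOK p ]ᵇ * TS φ m p ls
  ∑-fillings φ m p []       = ℤₚ.+-identityʳ _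
  ∑-fillings φ m p (l ∷ ls) = begin
    ∑ (concatMap (λ r → map (r ∷_) (fillings m ls)) (rowFillings m l)) _
      ≡⟨ ∑-concatMap _ (rowFillings m l) _ ⟩
    ∑ (rowFillings m l) (λ r → ∑ (map (r ∷_) (fillings m ls)) (λ T → [ semistandard (p ∷ T) ]ᵇ * pr φ (entries T)))
      ≡⟨ ∑-cong (rowFillings m l) row ⟩
    ∑ (rowFillings m l) (λ r → [ rowOK p ]ᵇ * ([ rowOK ([] ∷ r) ]ᵇ * (pr φ (concat r) * ([ colOK p r ]ᵇ * TS φ m r ls))))
      ≡⟨ ∑-*ˡ [ rowOK p ]ᵇ (rowFillings m l) _ ⟩
    [ rowOK p ]ᵇ * ∑ (rowFillings m l) (λ r → [ rowOK ([] ∷ r) ]ᵇ * (pr φ (concat r) * ([ colOK p r ]ᵇ * TS φ m r ls)))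
      ≡⟨ cong ([ rowOK p ]ᵇ *_) (∑-rowFillings φ m [] l (λ r → [ colOK p r ]ᵇ * TS φ m r ls)) ⟩
    [ rowOK p ]ᵇ * TS φ m p (l ∷ ls) ∎
    where
    open ≡-Reasoning
    ring : ∀ a b c d e → a * (b * c) * (d * e) ≡ a * b * d * (c * e)
    ring = solve-∀
    ring′ : ∀ a b c d e → a * b * c * (d * e) ≡ a * (d * (c * (b * e)))
    ring′ = solve-∀
    row : ∀ r → ∑ (map (r ∷_) (fillings m ls)) (λ T → [ semistandard (p ∷ T) ]ᵇ * pr φ (entries T))
              ≡ [ rowOK p ]ᵇ * ([ rowOK ([] ∷ r) ]ᵇ * (pr φ (concat r) * ([ colOK p r ]ᵇ * TS φ m r ls)))
    row r = begin
      ∑ (map (r ∷_) (fillings m ls)) (λ T → [ semistandard (p ∷ T) ]ᵇ * pr φ (entries T))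
        ≡⟨ ∑-map (r ∷_) (fillings m ls) _ ⟩
      ∑ (fillings m ls) (λ T → [ rowOK p ∧ colOK p r ∧ semistandard (r ∷ T) ]ᵇ * pr φ (entries (r ∷ T)))
        ≡⟨ ∑-cong (fillings m ls) (λ T → trans (cong₂ _*_
             (trans ([]ᵇ-∧ (rowOK p) _) (cong ([ rowOK p ]ᵇ *_) ([]ᵇ-∧ (colOK p r) (semistandard (r ∷ T)))))
             (trans (cong (pr φ) (sym (concat-++ r (concat T)))) (pr-++ φ (concat r) (entries T))))
             (ring [ rowOK p ]ᵇ [ colOK p r ]ᵇ [ semistandard (r ∷ T) ]ᵇ (pr φ (concat r)) (pr φ (entries T)))) ⟩
      ∑ (fillings m ls) (λ T → [ rowOK p ]ᵇ * [ colOK p r ]ᵇ * pr φ (concat r) * ([ semistandard (r ∷ T) ]ᵇ * pr φ (entries T)))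
        ≡⟨ ∑-*ˡ ([ rowOK p ]ᵇ * [ colOK p r ]ᵇ * pr φ (concat r)) (fillings m ls) _ ⟩
      [ rowOK p ]ᵇ * [ colOK p r ]ᵇ * pr φ (concat r) * ∑ (fillings m ls) (λ T → [ semistandard (r ∷ T) ]ᵇ * pr φ (entries T))
        ≡⟨ cong ([ rowOK p ]ᵇ * [ colOK p r ]ᵇ * pr φ (concat r) *_) (∑-fillings φ m r ls) ⟩
      [ rowOK p ]ᵇ * [ colOK p r ]ᵇ * pr φ (concat r) * ([ rowOK r ]ᵇ * TS φ m r ls)
        ≡⟨ ring′ [ rowOK p ]ᵇ [ colOK p r ]ᵇ (pr φ (concat r)) [ rowOK r ]ᵇ (TS φ m r ls) ⟩
      [ rowOK p ]ᵇ * ([ rowOK r ]ᵇ * (pr φ (concat r) * ([ colOK p r ]ᵇ * TS φ m r ls)))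
        ≡⟨ cong (λ b → [ rowOK p ]ᵇ * ([ b ]ᵇ * (pr φ (concat r) * ([ colOK p r ]ᵇ * TS φ m r ls)))) (sym (rowOK-[] r)) ⟩
      [ rowOK p ]ᵇ * ([ rowOK ([] ∷ r) ]ᵇ * (pr φ (concat r) * ([ colOK p r ]ᵇ * TS φ m r ls))) ∎

  sumℤ-map : ∀ {A : Set} (f : A → ℤ) xs → sumℤ (map f xs) ≡ ∑ xs f
  sumℤ-map f []       = refl
  sumℤ-map f (x ∷ xs) = cong (_+_ (f x)) (sumℤ-map f xs)

  negOnePow-suc : ∀ e → negOnePow (suc e) ≡ - negOnePow e
  negOnePow-suc zero          = refl
  negOnePow-suc (suc zero)    = refl
  negOnePow-suc (suc (suc e)) = negOnePow-suc e

  negOnePow-+ : ∀ a b → negOnePow (a +ℕ b) ≡ negOnePow a * negOnePow b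
  negOnePow-+ zero    b = sym (ℤₚ.*-identityˡ _)
  negOnePow-+ (suc a) b = trans (negOnePow-suc (a +ℕ b)) (trans (cong -_ (negOnePow-+ a b))
    (trans (ℤₚ.neg-distribˡ-* (negOnePow a) (negOnePow b)) (cong (_* negOnePow b) (sym (negOnePow-suc a)))))

  negOnePow-square : ∀ a → negOnePow a * negOnePow a ≡ + 1
  negOnePow-square zero          = refl
  negOnePow-square (suc zero)    = refl
  negOnePow-square (suc (suc a)) = negOnePow-square a

  var-neg : ∀ xs a → var (map -_ xs) a ≡ - var xs a
  var-neg []       a             = refl
  var-neg (x ∷ xs) zero          = refl
  var-neg (x ∷ xs) (suc zero)    = refl
  var-neg (x ∷ xs) (suc (suc a)) = var-neg xs (suc a)

  pr-neg : ∀ xs s → pr (var (map -_ xs)) s ≡ negOnePow (length s) * pr (var xs) s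
  pr-neg xs []      = refl
  pr-neg xs (a ∷ s) = trans (cong₂ _*_ (var-neg xs a) (pr-neg xs s))
    (trans (ring (var xs a) (negOnePow (length s)) (pr (var xs) s)) (cong (_* (var xs a * pr (var xs) s)) (sym (negOnePow-suc (length s)))))
    where
    ring : ∀ v n p → - v * (n * p) ≡ - n * (v * p)
    ring = solve-∀

  rowFillings-size : ∀ m l {r} → r ∈ rowFillings m l → l ≤ length (concat r)
  rowFillings-size m zero    r∈ = z≤n
  rowFillings-size m (suc l) r∈
    with s , s∈ , h ← find (∈-concatMap⁻ _ {xs = nonemptySets m} r∈)
    with r′ , r′∈ , refl ← ∈-map⁻ _ h
    with proj₂ (nonemptySets-bounded m s∈)
  ... | nonEmpty {x} {xs} = s≤s (subst (l ≤_) (sym (length-++ xs)) (ℕₚ.≤-trans (rowFillings-size m l r′∈) (ℕₚ.m≤n+m _ (length xs))))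

  fillings-size : ∀ m ls {T} → T ∈ fillings m ls → size ls ≤ length (entries T)
  fillings-size m []       T∈ = z≤n
  fillings-size m (l ∷ ls) T∈
    with r , r∈ , h ← find (∈-concatMap⁻ _ {xs = rowFillings m l} T∈)
    with T′ , T′∈ , refl ← ∈-map⁻ _ h =
    subst (l +ℕ size ls ≤_) (trans (sym (length-++ (concat r))) (cong length (concat-++ r (concat T′))))
      (ℕₚ.+-mono-≤ (rowFillings-size m l r∈) (fillings-size m ls T′∈))

  semistandard-[]∷ : ∀ T → semistandard ([] ∷ T) ≡ semistandard T
  semistandard-[]∷ []      = refl
  semistandard-[]∷ (_ ∷ _) = refl

  -- For a tableau T the negated variables contribute the parity of |T| and the definition that of
  -- |T| - |λ|, which together leave the parity of |λ|. As the exponent is a truncated difference,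
  -- |λ| ≤ |T| has to be established.
  G-tableaux : ∀ l xs → G l (map -_ xs) ≡ negOnePow (size l) * TS (var xs) (length xs) [] l
  G-tableaux l xs = begin
    sumℤ (map term (filterᵇ semistandard (fillings (length (map -_ xs)) l)))
      ≡⟨ sumℤ-map term (filterᵇ semistandard (fillings (length (map -_ xs)) l)) ⟩
    ∑ (filterᵇ semistandard (fillings (length (map -_ xs)) l)) term
      ≡⟨ cong (λ m → ∑ (filterᵇ semistandard (fillings m l)) term) (length-map -_ xs) ⟩
    ∑ (filterᵇ semistandard (fillings m l)) term
      ≡⟨ ∑-filter semistandard (fillings m l) term ⟩
    ∑ (fillings m l) (λ T → [ semistandard T ]ᵇ * term T)
      ≡⟨ ∑-cong-∈ (fillings m l) (λ T T∈ → trans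
           (cong₂ (λ b t → [ b ]ᵇ * t) (sym (semistandard-[]∷ T)) (unsigned T (fillings-size m l T∈)))
           (*-left-comm [ semistandard ([] ∷ T) ]ᵇ (negOnePow (size l)) (pr (var xs) (entries T)))) ⟩
    ∑ (fillings m l) (λ T → negOnePow (size l) * ([ semistandard ([] ∷ T) ]ᵇ * pr (var xs) (entries T)))
      ≡⟨ ∑-*ˡ (negOnePow (size l)) (fillings m l) _ ⟩
    negOnePow (size l) * ∑ (fillings m l) (λ T → [ semistandard ([] ∷ T) ]ᵇ * pr (var xs) (entries T))
      ≡⟨ cong (negOnePow (size l) *_) (trans (∑-fillings (var xs) m [] l) (ℤₚ.*-identityˡ _)) ⟩
    negOnePow (size l) * TS (var xs) m [] l ∎
    where
    open ≡-Reasoning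
    m = length xs
    term : List (List (List ℕ)) → ℤ
    term T = negOnePow (length (entries T) ∸ size l) * prodℤ (map (var (map -_ xs)) (entries T))
    unsigned : ∀ T → size l ≤ length (entries T) → term T ≡ negOnePow (size l) * pr (var xs) (entries T)
    unsigned T le = begin
      negOnePow d * pr (var (map -_ xs)) (entries T)
        ≡⟨ cong (negOnePow d *_) (pr-neg xs (entries T)) ⟩
      negOnePow d * (negOnePow (length (entries T)) * P)
        ≡⟨ cong (λ e → negOnePow d * (negOnePow e * P)) (sym (ℕₚ.m∸n+n≡m le)) ⟩
      negOnePow d * (negOnePow (d +ℕ size l) * P)
        ≡⟨ cong (λ e → negOnePow d * (e * P)) (negOnePow-+ d (size l)) ⟩
      negOnePow d * (negOnePow d * negOnePow (size l) * P)
        ≡⟨ ring (negOnePow d) (negOnePow (size l)) P ⟩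
      negOnePow d * negOnePow d * (negOnePow (size l) * P)
        ≡⟨ cong (_* (negOnePow (size l) * P)) (negOnePow-square d) ⟩
      + 1 * (negOnePow (size l) * P)
        ≡⟨ ℤₚ.*-identityˡ _ ⟩
      negOnePow (size l) * P ∎
      where
      d = length (entries T) ∸ size l
      P = pr (var xs) (entries T)
      ring : ∀ a b c → a * (a * b * c) ≡ a * a * (b * c)
      ring = solve-∀

-- The signless coproduct in terms of puzzle numbers.

module Coproduct where

  open import Data.Bool using (true; false)
  open import Data.Nat using (ℕ; suc) renaming (_+_ to _+ℕ_)
  import Data.Nat.Properties as ℕₚ
  open import Data.List using (List; []; _∷_; _++_; length)
  open import Data.List.Membership.Propositional using (_∈_)
  open import Data.Product using (_,_)
  open import Data.Integer using (_*_)
  import Data.Integer.Properties as ℤₚ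
  open import Relation.Binary.PropositionalEquality
  open import Relation.Nullary using (yes; no)
  open import Defs using (countOnes)
  open Sums
  open Rows using (idle)
  open Puzzle
  open UnitLaw
  open Uniqueness
  open Branching using (countZeros; pull-cong-on)

  length-counts : ∀ w → length w ≡ countZeros w +ℕ countOnes w
  length-counts []          = refl
  length-counts (false ∷ w) = cong suc (length-counts w)
  length-counts (true ∷ w)  = trans (cong suc (length-counts w)) (sym (ℕₚ.+-suc _ _))

  module _ (a k : ℕ) where
    private
      n = a +ℕ k
    open ≡-Reasoning

    -- Without variables `ys` only the empty shape survives in the inner sum, and the unit law
    -- applies. Each further variable y gives a `pull` on the bottom word, which `pull-puzzles` and
    -- `adjoint` transfer to the right word.
    coproduct : ∀ ys xs nu → length (false ∷ nu) ≡ n → gh a k (ys ++ xs) (false ∷ nu)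
      ≡ ∑ (words n) (λ la → gh a k xs la * ∑ (words n) (λ mu → puzzles la mu (false ∷ nu) * gh a k ys mu))
    coproduct [] xs nu len = sym (begin
      ∑ (words n) (λ la → gh a k xs la * ∑ (words n) (λ mu → puzzles la mu ν * δ (tl a k) (bitWord mu)))
        ≡⟨ ∑-cong-∈ (words n) unit ⟩
      ∑ (words n) (λ la → gh a k xs la * δ ν (bitWord la))
        ≡⟨ cong (λ l → ∑ (words l) (λ la → gh a k xs la * δ ν (bitWord la))) (sym len) ⟩
      ∑ (words (length ν)) (λ la → gh a k xs la * δ ν (bitWord la))
        ≡⟨ ∑-δ ν (gh a k xs) ⟩
      gh a k xs ν ∎)
      where
      ν = false ∷ nu
      unit : ∀ la → la ∈ words n → gh a k xs la * ∑ (words n) (λ mu → puzzles la mu ν * δ (tl a k) (bitWord mu))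
                                 ≡ gh a k xs la * δ ν (bitWord la)
      unit la la∈ with countOnes la ℕₚ.≟ k
      ... | no ne rewrite gh-ones a k xs la ne = refl
      ... | yes ones = cong (gh a k xs la *_) (begin
        ∑ (words n) (λ mu → puzzles la mu ν * δ (tl a k) (bitWord mu))
          ≡⟨ cong (λ l → ∑ (words l) (λ mu → puzzles la mu ν * δ (tl a k) (bitWord mu))) (sym (length-tl a k)) ⟩
        ∑ (words (length (tl a k))) (λ mu → puzzles la mu ν * δ (tl a k) (bitWord mu))
          ≡⟨ ∑-δ (tl a k) (λ mu → puzzles la mu ν) ⟩
        puzzles la (tl a k) ν
          ≡⟨ puzzles-unit a k la ν (words-length a k n la∈) ones ⟩
        δ ν (bitWord la) ∎)
    coproduct (y ∷ ys) xs nu len = begin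
      pull idle ν (gh a k (ys ++ xs))
        -- In mode idle a leading 0 is kept, so the induction hypothesis is applied only to words
        -- that begin with 0.
        ≡⟨ pull-cong-on y idle nu (λ τ (o , z) → coproduct ys xs τ (trans (cong suc
             (trans (length-counts τ) (trans (cong₂ _+ℕ_ (sym z) o) (sym (length-counts nu))))) len)) ⟩
      pull idle ν (λ τ → ∑ (words n) (λ la → gh a k xs la * ∑ (words n) (λ mu → puzzles la mu τ * gh a k ys mu)))
        ≡⟨ pull-∑ idle ν (words n) (gh a k xs) (λ la τ → ∑ (words n) (λ mu → puzzles la mu τ * gh a k ys mu)) ⟩
      ∑ (words n) (λ la → gh a k xs la * pull idle ν (λ τ → ∑ (words n) (λ mu → puzzles la mu τ * gh a k ys mu)))
        ≡⟨ ∑-cong-∈ (words n) (λ la la∈ → cong (gh a k xs la *_) (inner la la∈)) ⟩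
      ∑ (words n) (λ la → gh a k xs la * ∑ (words n) (λ mu → puzzles la mu ν * gh a k (y ∷ ys) mu)) ∎
      where
      open Skew y
      ν = false ∷ nu
      inner : ∀ la → la ∈ words n → pull idle ν (λ τ → ∑ (words n) (λ mu → puzzles la mu τ * gh a k ys mu))
                                  ≡ ∑ (words n) (λ mu → puzzles la mu ν * pull idle mu (gh a k ys))
      inner la la∈ = begin
        pull idle ν (λ τ → ∑ (words n) (λ mu → puzzles la mu τ * gh a k ys mu))
          ≡⟨ pull-cong idle ν (λ τ → ∑-cong (words n) (λ mu → ℤₚ.*-comm (puzzles la mu τ) (gh a k ys mu))) ⟩
        pull idle ν (λ τ → ∑ (words n) (λ mu → gh a k ys mu * puzzles la mu τ))
          ≡⟨ pull-∑ idle ν (words n) (gh a k ys) (puzzles la) ⟩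
        ∑ (words n) (λ mu → gh a k ys mu * pull idle ν (puzzles la mu))
          ≡⟨ ∑-cong-∈ (words n) (λ mu mu∈ → trans (ℤₚ.*-comm (gh a k ys mu) _)
               (cong (_* gh a k ys mu) (pull-puzzles la mu nu (trans (words-length a k n la∈) (sym (words-length a k n mu∈)))))) ⟩
        ∑ (words n) (λ mu → run idle mu (λ σ → puzzles la σ ν) * gh a k ys mu)
          ≡⟨ sym (adjoint n idle (λ σ → puzzles la σ ν) (gh a k ys)) ⟩
        ∑ (words n) (λ mu → puzzles la mu ν * pull idle mu (gh a k ys)) ∎

-- Partitions as words, and comparison of two expansions in a common box.

module Extract where

  open import Data.Bool using (Bool; true; false)
  import Data.Bool
  open import Data.Bool.Properties using (T-∧)
  open import Data.Nat using (ℕ; zero; suc; _≤_; _<_; z≤n; s≤s; _∸_; _⊓_; _≤ᵇ_) renaming (_+_ to _+ℕ_)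
  import Data.Nat.Properties as ℕₚ
  open import Data.List using (List; []; _∷_; _++_; map; length; replicate; applyUpTo; upTo; reverse; concatMap)
  open import Data.List.Properties using (∷-injectiveˡ; ∷-injectiveʳ; ++-identityʳ; ++-cancelˡ; ++-cancelʳ; ≡-dec)
  open import Data.List.Membership.Propositional using (_∈_; find)
  open import Data.List.Membership.Propositional.Properties using (∈-map⁻; ∈-concatMap⁻; ∈-upTo⁻)
  open import Data.List.Relation.Unary.All using (All; []; _∷_)
  open import Data.List.Relation.Unary.Any using (here)
  open import Data.Product using (_×_; _,_; proj₁; proj₂)
  open import Data.Integer using (ℤ; +_; -_; _+_; _*_)
  import Data.Integer.Properties as ℤₚ
  open import Function using (_∘_; Equivalence)
  open import Relation.Binary.PropositionalEquality
  open import Relation.Nullary using (yes; no; contradiction)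
  open import Defs using (IsPartition; size; part; oneTo; partsOf; partitionsUpTo; countOnes; zerosBeforeOne; IsBinaryString; var)
  open Sums
  open Puzzle using (δ)
  open UnitLaw using (bitWord)
  open Uniqueness
  open Branching using (countZeros; rowsOf; TS)
  open Tableaux using (gh-tableaux; TS-zeros)
  open Coproduct using (length-counts)

  data Par : ℕ → List ℕ → Set where
    []  : ∀ {b} → Par b []
    _∷_ : ∀ {a b l} → (1 ≤ a × a ≤ b) → Par a l → Par b (a ∷ l)

  par-mono : ∀ {b c l} → b ≤ c → Par b l → Par c l
  par-mono le []            = []
  par-mono le ((p , q) ∷ h) = (p , ℕₚ.≤-trans q le) ∷ h

  par-length : ∀ {b l} → Par b l → length l ≤ size l
  par-length []            = z≤n
  par-length ((p , q) ∷ h) = ℕₚ.+-mono-≤ p (par-length h)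

  partition⇒par : ∀ l → IsPartition l → Par (size l) l
  partition⇒par [] h = []
  partition⇒par (a ∷ []) h = (ℕₚ.≤ᵇ⇒≤ 1 a h , ℕₚ.m≤m+n a 0) ∷ []
  partition⇒par (a ∷ b ∷ l) h with partition⇒par (b ∷ l) (proj₂ (Equivalence.to (T-∧ {b ≤ᵇ a}) h))
  ... | (p , q) ∷ r = (ℕₚ.≤-trans p b≤a , ℕₚ.m≤m+n a _) ∷ ((p , b≤a) ∷ r)
    where b≤a = ℕₚ.≤ᵇ⇒≤ b a (proj₁ (Equivalence.to (T-∧ {b ≤ᵇ a}) h))

  par⇒partition : ∀ {b l} → Par b l → IsPartition l
  par⇒partition [] = _
  par⇒partition ((p , _) ∷ []) = ℕₚ.≤⇒≤ᵇ p
  par⇒partition (_ ∷ h@((_ , q) ∷ _)) = Equivalence.from T-∧ (ℕₚ.≤⇒≤ᵇ q , par⇒partition h)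

  partsOf-par : ∀ f s b {l} → l ∈ partsOf f s b → Par b l × size l ≡ s
  partsOf-par f       zero    b (here refl) = [] , refl
  partsOf-par (suc f) (suc s) b l∈
    with p , p∈ , h ← find (∈-concatMap⁻ _ {xs = oneTo (suc s ⊓ b)} l∈)
    with l′ , l′∈ , refl ← ∈-map⁻ _ h
    with i , i∈ , refl ← ∈-map⁻ suc p∈
    with par , sz ← partsOf-par f (suc s ∸ suc i) (suc i) l′∈ =
    ((s≤s z≤n , ℕₚ.≤-trans i< (ℕₚ.m⊓n≤n (suc s) b)) ∷ par) ,
    trans (cong (suc i +ℕ_) sz) (ℕₚ.m+[n∸m]≡n (ℕₚ.≤-trans i< (ℕₚ.m⊓n≤m (suc s) b)))
    where i< = ∈-upTo⁻ i∈

  partitionsUpTo-par : ∀ N {l} → l ∈ partitionsUpTo N → Par N l × length l ≤ N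
  partitionsUpTo-par N {l} l∈ with s , s∈ , h ← find (∈-concatMap⁻ _ {xs = upTo (suc N)} l∈)
    with par , refl ← partsOf-par s s s h =
    par-mono s≤N par , ℕₚ.≤-trans (par-length par) s≤N
    where s≤N = ℕₚ.≤-pred (∈-upTo⁻ s∈)

  partitionsUpTo-size : ∀ {N l} → l ∈ partitionsUpTo N → size l ≤ N
  partitionsUpTo-size {N} l∈ with s , s∈ , h ← find (∈-concatMap⁻ _ {xs = upTo (suc N)} l∈)
    with par , refl ← partsOf-par s s s h = ℕₚ.≤-pred (∈-upTo⁻ s∈)

  ∑-applyUpTo : ∀ n (g : ℕ → ℤ) (u : ℕ → ℕ) → ∑ (applyUpTo u n) g ≡ ∑ (upTo n) (g ∘ u)
  ∑-applyUpTo n g u = trans (cong (λ xs → ∑ xs g) (sym (map-upTo u n))) (∑-map u (upTo n) g)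
    where open import Data.List.Properties using (map-upTo)

  ∑-upTo-single : ∀ n i (g : ℕ → ℤ) → i < n → (∀ j → j ≢ i → g j ≡ + 0) → ∑ (upTo n) g ≡ g i
  ∑-upTo-single (suc n) zero g lt h = trans (cong (_+_ (g 0)) (trans (∑-applyUpTo n g suc) (∑-zero-∈ (upTo n) (λ j _ → h (suc j) (λ ())))))
    (ℤₚ.+-identityʳ _)
  ∑-upTo-single (suc n) (suc i) g (s≤s lt) h = trans (cong₂ _+_ (h 0 (λ ())) (∑-applyUpTo n g suc))
    (trans (ℤₚ.+-identityˡ _) (∑-upTo-single n i (g ∘ suc) lt (λ j ne → h (suc j) (ne ∘ ℕₚ.suc-injective))))

  Concentrated : List ℕ → (List ℕ → ℤ) → Set
  Concentrated l h = ∀ l′ → l′ ≢ l → h l′ ≡ + 0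

  partsOf-single : ∀ f l b h → Par b l → size l ≤ f → Concentrated l h → ∑ (partsOf f (size l) b) h ≡ h l
  partsOf-single f [] b h par le con = ℤₚ.+-identityʳ _
  partsOf-single zero (suc p ∷ l) b h par () con
  partsOf-single f (zero ∷ l) b h ((() , _) ∷ par) le con
  partsOf-single (suc f) (suc p ∷ l) b h ((_ , p≤b) ∷ par) (s≤s le) con = begin
    ∑ (concatMap (λ p → map (p ∷_) (partsOf f (S ∸ p) p)) (oneTo (S ⊓ b))) h
      ≡⟨ trans (∑-concatMap _ (oneTo (S ⊓ b)) h) (trans (∑-map suc (upTo (S ⊓ b)) _)
           (∑-cong (upTo (S ⊓ b)) (λ i → ∑-map (suc i ∷_) (partsOf f (S ∸ suc i) (suc i)) h))) ⟩
    ∑ (upTo (S ⊓ b)) (λ i → ∑ (partsOf f (S ∸ suc i) (suc i)) (λ l → h (suc i ∷ l)))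
      ≡⟨ ∑-upTo-single (S ⊓ b) p _ (ℕₚ.⊓-glb (ℕₚ.m≤m+n (suc p) (size l)) p≤b)
           (λ j ne → ∑-zero-∈ (partsOf f (S ∸ suc j) (suc j)) (λ l′ _ → con (suc j ∷ l′) (ne ∘ ℕₚ.suc-injective ∘ ∷-injectiveˡ))) ⟩
    ∑ (partsOf f (S ∸ suc p) (suc p)) (λ l → h (suc p ∷ l))
      ≡⟨ cong (λ s → ∑ (partsOf f s (suc p)) (λ l → h (suc p ∷ l))) (ℕₚ.m+n∸m≡n (suc p) (size l)) ⟩
    ∑ (partsOf f (size l) (suc p)) (λ l → h (suc p ∷ l))
      ≡⟨ partsOf-single f l (suc p) (h ∘ (suc p ∷_)) par (ℕₚ.≤-trans (ℕₚ.m≤n+m (size l) p) le) (λ l′ ne → con (suc p ∷ l′) (ne ∘ ∷-injectiveʳ)) ⟩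
    h (suc p ∷ l) ∎
    where
    open ≡-Reasoning
    S = suc p +ℕ size l

  -- The enumeration contains each partition exactly once, expressed through sums of functions
  -- supported at that partition.
  partitionsUpTo-single : ∀ N l h → Par (size l) l → size l ≤ N → Concentrated l h → ∑ (partitionsUpTo N) h ≡ h l
  partitionsUpTo-single N l h par le con = trans (∑-concatMap (λ s → partsOf s s s) (upTo (suc N)) h)
    (trans (∑-upTo-single (suc N) (size l) (λ s → ∑ (partsOf s s s) h) (s≤s le) (λ s ne → ∑-zero-∈ (partsOf s s s)
      (λ l′ l′∈ → con l′ (λ { refl → ne (sym (proj₂ (partsOf-par s s s l′∈))) }))))
    (partsOf-single (size l) l (size l) h par ℕₚ.≤-refl con))

  -- The first argument is the number of zeros still to be placed; it equals the length of the
  -- preceding row, or the width of the box at the start.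
  wordOf : ℕ → List ℕ → List Bool
  wordOf M []       = replicate M false
  wordOf M (a ∷ rs) = replicate (M ∸ a) false ++ true ∷ wordOf a rs

  data Chain : ℕ → List ℕ → Set where
    []  : ∀ {b} → Chain b []
    _∷_ : ∀ {a b l} → a ≤ b → Chain a l → Chain b (a ∷ l)

  countZeros-++ : ∀ u v → countZeros (u ++ v) ≡ countZeros u +ℕ countZeros v
  countZeros-++ []          v = refl
  countZeros-++ (false ∷ u) v = cong suc (countZeros-++ u v)
  countZeros-++ (true ∷ u)  v = countZeros-++ u v

  countZeros-0s : ∀ c → countZeros (replicate c false) ≡ c
  countZeros-0s zero    = refl
  countZeros-0s (suc c) = cong suc (countZeros-0s c)

  countZeros-1s : ∀ c → countZeros (replicate c true) ≡ 0
  countZeros-1s zero    = refl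
  countZeros-1s (suc c) = countZeros-1s c

  rowsOf-0s : ∀ c w → rowsOf (replicate c false ++ w) ≡ rowsOf w
  rowsOf-0s zero    w = refl
  rowsOf-0s (suc c) w = rowsOf-0s c w

  rowsOf-0s′ : ∀ c → rowsOf (replicate c false) ≡ []
  rowsOf-0s′ zero    = refl
  rowsOf-0s′ (suc c) = rowsOf-0s′ c

  length-rowsOf : ∀ w → length (rowsOf w) ≡ countOnes w
  length-rowsOf []          = refl
  length-rowsOf (false ∷ w) = length-rowsOf w
  length-rowsOf (true ∷ w)  = cong suc (length-rowsOf w)

  countZeros-wordOf : ∀ M rs → Chain M rs → countZeros (wordOf M rs) ≡ M
  countZeros-wordOf M []       []       = countZeros-0s M
  countZeros-wordOf M (a ∷ rs) (le ∷ h) = trans (countZeros-++ (replicate (M ∸ a) false) _)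
    (trans (cong₂ _+ℕ_ (countZeros-0s (M ∸ a)) (countZeros-wordOf a rs h)) (ℕₚ.m∸n+n≡m le))

  rowsOf-wordOf : ∀ M rs → Chain M rs → rowsOf (wordOf M rs) ≡ rs
  rowsOf-wordOf M []       []       = rowsOf-0s′ M
  rowsOf-wordOf M (a ∷ rs) (le ∷ h) = trans (rowsOf-0s (M ∸ a) _) (cong₂ _∷_ (countZeros-wordOf a rs h) (rowsOf-wordOf a rs h))

  head-≤ : ∀ w a rs → rowsOf w ≡ a ∷ rs → a ≤ countZeros w
  head-≤ (false ∷ w) a rs eq = ℕₚ.m≤n⇒m≤1+n (head-≤ w a rs eq)
  head-≤ (true ∷ w)  a rs eq = ℕₚ.≤-reflexive (sym (∷-injectiveˡ eq))

  wordOf-rowsOf : ∀ w → wordOf (countZeros w) (rowsOf w) ≡ w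
  wordOf-rowsOf []          = refl
  wordOf-rowsOf (false ∷ w) with rowsOf w in eq | wordOf-rowsOf w
  ... | []     | ih = cong (false ∷_) ih
  ... | a ∷ rs | ih = trans (cong (λ d → replicate d false ++ true ∷ wordOf a rs) (ℕₚ.+-∸-assoc 1 (head-≤ w a rs eq))) (cong (false ∷_) ih)
  wordOf-rowsOf (true ∷ w) = trans (cong (λ d → replicate d false ++ true ∷ wordOf (countZeros w) (rowsOf w)) (ℕₚ.n∸n≡0 (countZeros w)))
    (cong (true ∷_) (wordOf-rowsOf w))

  word-≡ : ∀ v w → countZeros v ≡ countZeros w → rowsOf v ≡ rowsOf w → v ≡ w
  word-≡ v w z r = trans (sym (wordOf-rowsOf v)) (trans (cong₂ wordOf z r) (wordOf-rowsOf w))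

  pad : ℕ → List ℕ → List ℕ
  pad k l = applyUpTo (part l) k

  pad-[] : ∀ k → pad k [] ≡ replicate k 0
  pad-[] zero    = refl
  pad-[] (suc k) = cong (0 ∷_) (pad-[] k)

  pad-++ : ∀ k l → length l ≤ k → pad k l ≡ l ++ replicate (k ∸ length l) 0
  pad-++ k       []      le       = pad-[] k
  pad-++ (suc k) (a ∷ l) (s≤s le) = cong (a ∷_) (pad-++ k l le)

  pad-+ : ∀ k N l → length l ≤ k → pad (k +ℕ N) l ≡ pad k l ++ replicate N 0
  pad-+ zero    N []      le = pad-[] N
  pad-+ (suc k) N []      le = cong (0 ∷_) (pad-+ k N [] z≤n)
  pad-+ (suc k) N (a ∷ l) (s≤s le) = cong (a ∷_) (pad-+ k N l le)

  pad-chain : ∀ k {b l} → Par b l → Chain b (pad k l)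
  pad-chain zero    h = []
  pad-chain (suc k) []            = z≤n ∷ pad-chain k []
  pad-chain (suc k) ((_ , q) ∷ h) = q ∷ pad-chain k h

  pad-injective : ∀ k {b c l l′} → Par b l → Par c l′ → length l ≤ k → length l′ ≤ k → pad k l ≡ pad k l′ → l ≡ l′
  pad-injective k       []             []              _ _ eq = refl
  pad-injective (suc k) []             ((p , _) ∷ _)   _ _ eq = contradiction (subst (1 ≤_) (sym (∷-injectiveˡ eq)) p) (λ ())
  pad-injective (suc k) ((p , _) ∷ _)  []              _ _ eq = contradiction (subst (1 ≤_) (∷-injectiveˡ eq) p) (λ ())
  pad-injective (suc k) ((_ , _) ∷ h)  ((_ , _) ∷ h′)  (s≤s le) (s≤s le′) eq =
    cong₂ _∷_ (∷-injectiveˡ eq) (pad-injective k h h′ le le′ (∷-injectiveʳ eq))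

  -- Binary strings count the zeros before a one, `rowsOf` those after it. Truncated subtraction
  -- could hide a part that is too long, so the bound travels with the induction: past a 0,
  -- positivity of the position yields the bound for the rest.
  binary-rows : ∀ k (f : ℕ → ℕ) w → countOnes w ≡ k → (∀ j → j < k → f j ≤ countZeros w) →
                (∀ j → j < k → zerosBeforeOne j w ≡ countZeros w ∸ f j) → rowsOf w ≡ applyUpTo f k
  binary-rows zero    f []          o le h = refl
  binary-rows k       f (false ∷ w) o le h =
    binary-rows k f w o (λ j lt → proj₁ (bound j _ _ (h j lt))) (λ j lt → proj₂ (bound j _ _ (h j lt)))
    where
    bound : ∀ j z a → suc z ≡ suc a ∸ f j → f j ≤ a × z ≡ a ∸ f j
    bound j z a eq with f j ℕₚ.≤? a
    ... | yes le = le , ℕₚ.suc-injective (trans eq (ℕₚ.+-∸-assoc 1 le))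
    ... | no nle = contradiction (trans eq (ℕₚ.m≤n⇒m∸n≡0 (ℕₚ.≰⇒> nle))) (λ ())
  binary-rows (suc k) f (true ∷ w)  o le h =
    cong₂ _∷_ (ℕₚ.≤-antisym (ℕₚ.m∸n≡0⇒m≤n (sym (h 0 (s≤s z≤n)))) (le 0 (s≤s z≤n)))
      (binary-rows k (f ∘ suc) w (ℕₚ.suc-injective o) (λ j lt → le (suc j) (s≤s lt)) (λ j lt → h (suc j) (s≤s lt)))

  part-≤ : ∀ {M} l → All (_≤ M) l → ∀ j → part l j ≤ M
  part-≤ []      h        j       = z≤n
  part-≤ (a ∷ l) (le ∷ h) zero    = le
  part-≤ (a ∷ l) (le ∷ h) (suc j) = part-≤ l h j

  record Encodes (a k : ℕ) (l : List ℕ) (w : List Bool) : Set where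
    field
      par   : Par (size l) l
      short : length l ≤ k
      zeros : countZeros w ≡ a
      ones  : countOnes w ≡ k
      rows  : rowsOf w ≡ pad k l

  encodes : ∀ {n k l w} → k ≤ n → IsPartition l → length l ≤ k → All (_≤ n ∸ k) l → IsBinaryString n k l w → Encodes (n ∸ k) k l w
  encodes {n} {k} {l} {w} k≤n p len le (lw , ow , pos) = record
    { par = partition⇒par l p ; short = len ; zeros = zs ; ones = ow
    ; rows = binary-rows k (part l) w ow (λ j _ → subst (part l j ≤_) (sym zs) (part-≤ l le j))
        (λ j lt → trans (pos j lt) (cong (_∸ part l j) (sym zs))) }
    where
    zs : countZeros w ≡ n ∸ k
    zs = trans (sym (ℕₚ.m+n∸n≡m (countZeros w) k)) (cong (_∸ k) (trans (cong (countZeros w +ℕ_) (sym ow)) (trans (sym (length-counts w)) lw)))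

  -- Zeros in front widen the box and ones at the end add empty rows; the shape itself does not
  -- change.
  ι : ℕ → List Bool → List Bool
  ι N w = replicate N false ++ (w ++ replicate N true)

  ι-injective : ∀ N v w → ι N v ≡ ι N w → v ≡ w
  ι-injective N v w eq = ++-cancelʳ (replicate N true) v w (++-cancelˡ (replicate N false) _ _ eq)

  countZeros-ι : ∀ N w → countZeros (ι N w) ≡ countZeros w +ℕ N
  countZeros-ι N w = trans (countZeros-++ (replicate N false) _) (trans (cong₂ _+ℕ_ (countZeros-0s N)
    (trans (countZeros-++ w _) (trans (cong (countZeros w +ℕ_) (countZeros-1s N)) (ℕₚ.+-identityʳ _)))) (ℕₚ.+-comm N _))

  countOnes-ι : ∀ N w → countOnes (ι N w) ≡ countOnes w +ℕ N
  countOnes-ι N w = trans (countOnes-++ (replicate N false) _) (trans (cong (_+ℕ countOnes (w ++ replicate N true)) (countOnes-0s N))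
    (trans (countOnes-++ w _) (cong (countOnes w +ℕ_) (countOnes-1s N))))

  rowsOf-1s : ∀ w N → rowsOf (w ++ replicate N true) ≡ rowsOf w ++ replicate N 0
  rowsOf-1s []          zero    = refl
  rowsOf-1s []          (suc N) = cong₂ _∷_ (countZeros-1s N) (rowsOf-1s [] N)
  rowsOf-1s (false ∷ w) N = rowsOf-1s w N
  rowsOf-1s (true ∷ w)  N = cong₂ _∷_ (trans (countZeros-++ w _) (trans (cong (countZeros w +ℕ_) (countZeros-1s N)) (ℕₚ.+-identityʳ _))) (rowsOf-1s w N)

  rowsOf-ι : ∀ N w → rowsOf (ι N w) ≡ rowsOf w ++ replicate N 0
  rowsOf-ι N w = trans (rowsOf-0s N _) (rowsOf-1s w N)

  -- All partitions of size at most N, and all those in the given box, fit in the larger box with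
  -- a + N columns and k + N rows, where the expansion in the gh is unique.
  module _ (a k N : ℕ) where
    private
      n = a +ℕ k
      A = a +ℕ N
      K = k +ℕ N
    open ≡-Reasoning

    private
      tableaux : List ℤ → List ℕ → ℤ
      tableaux rs = TS (var (reverse rs)) (length rs) []

    wd : List ℕ → List Bool
    wd l = wordOf A (pad K l)

    wd-zeros : ∀ {l} → l ∈ partitionsUpTo N → countZeros (wd l) ≡ A
    wd-zeros l∈ = countZeros-wordOf A _ (pad-chain K (par-mono (ℕₚ.m≤n+m N a) (proj₁ (partitionsUpTo-par N l∈))))

    wd-rows : ∀ {l} → l ∈ partitionsUpTo N → rowsOf (wd l) ≡ pad K l
    wd-rows l∈ = rowsOf-wordOf A _ (pad-chain K (par-mono (ℕₚ.m≤n+m N a) (proj₁ (partitionsUpTo-par N l∈))))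

    wd-ones : ∀ {l} → l ∈ partitionsUpTo N → countOnes (wd l) ≡ K
    wd-ones {l} l∈ = trans (sym (length-rowsOf (wd l))) (trans (cong length (wd-rows l∈)) (length-applyUpTo (part l) K))
      where open import Data.List.Properties using (length-applyUpTo)

    gh-wd : ∀ rs {l} → l ∈ partitionsUpTo N → gh A K rs (wd l) ≡ tableaux rs l
    gh-wd rs {l} l∈ = trans (gh-tableaux A K rs (wd l) (wd-zeros l∈) (wd-ones l∈)) (trans (cong (tableaux rs) (trans (wd-rows l∈) (pad-++ K l short)))
      (TS-zeros _ _ [] l (K ∸ length l)))
      where short = ℕₚ.≤-trans (proj₂ (partitionsUpTo-par N l∈)) (ℕₚ.m≤n+m N k)

    gh-ι : ∀ rs w → length w ≡ n → gh A K rs (ι N w) ≡ gh a k rs w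
    gh-ι rs w len with countOnes w ℕₚ.≟ k
    ... | no ne = trans (gh-ones A K rs (ι N w) (λ e → ne (ℕₚ.+-cancelʳ-≡ N _ _ (trans (sym (countOnes-ι N w)) e)))) (sym (gh-ones a k rs w ne))
    ... | yes o = trans (gh-tableaux A K rs (ι N w) (trans (countZeros-ι N w) (cong (_+ℕ N) z)) (trans (countOnes-ι N w) (cong (_+ℕ N) o)))
        (trans (cong (tableaux rs) (rowsOf-ι N w)) (trans (TS-zeros _ _ [] (rowsOf w) N) (sym (gh-tableaux a k rs w z o))))
      where
      z : countZeros w ≡ a
      z = ℕₚ.+-cancelʳ-≡ k _ _ (trans (cong (countZeros w +ℕ_) (sym o)) (trans (sym (length-counts w)) len))

    -- Both expansions are written over the words of the large box. Their difference `e` represents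
    -- 0, so it vanishes at the word of `l`, where the two parts of `e` are `c l` and `q w`. A shape
    -- too large to be listed contributes nothing to the first part, and `big` matches this.
    extract : ∀ (c : List ℕ → ℤ) (q : List Bool → ℤ) →
      (∀ rs → ∑ (partitionsUpTo N) (λ l → c l * tableaux rs l) ≡ ∑ (words n) (λ w → q w * gh a k rs w)) →
      ∀ l w → Encodes a k l w → (N < size l → c l ≡ + 0) → c l ≡ q w
    extract c q same l w enc big = trans (sym at-l) (trans (ℤₚ.i-j≡0⇒i≡j _ _ zero-at) at-w)
      where
      open Encodes enc
      u = ι N w
      e₁ e₂ e : List Bool → ℤ
      e₁ v = ∑ (partitionsUpTo N) (λ l → c l * δ (wd l) (bitWord v))
      e₂ v = ∑ (words n) (λ w → q w * δ (ι N w) (bitWord v))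
      e v = e₁ v + - e₂ v
      length-u : ∀ v → countZeros v ≡ A → countOnes v ≡ K → length v ≡ A +ℕ K
      length-u v z o = trans (length-counts v) (cong₂ _+ℕ_ z o)
      length-w : ∀ {w} → w ∈ words n → length (ι N w) ≡ A +ℕ K
      length-w {w} w∈ = begin
        length (ι N w)                                  ≡⟨ length-counts (ι N w) ⟩
        countZeros (ι N w) +ℕ countOnes (ι N w)         ≡⟨ cong₂ _+ℕ_ (countZeros-ι N w) (countOnes-ι N w) ⟩
        (countZeros w +ℕ N) +ℕ (countOnes w +ℕ N)       ≡⟨ ℕ-interchange (countZeros w) N (countOnes w) N ⟩
        (countZeros w +ℕ countOnes w) +ℕ (N +ℕ N)       ≡⟨ cong (_+ℕ (N +ℕ N)) (trans (sym (length-counts w)) (words-length a k n w∈)) ⟩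
        (a +ℕ k) +ℕ (N +ℕ N)                            ≡⟨ ℕ-interchange a k N N ⟩
        A +ℕ K                                          ∎
        where open import Algebra.Properties.CommutativeSemigroup ℕₚ.+-commutativeSemigroup using () renaming (interchange to ℕ-interchange)
      pick : ∀ v (g : List Bool → ℤ) → length v ≡ A +ℕ K → ∑ (words (A +ℕ K)) (λ x → δ v (bitWord x) * g x) ≡ g v
      pick v g len = trans (∑-cong (words (A +ℕ K)) (λ x → ℤₚ.*-comm (δ v (bitWord x)) (g x)))
        (trans (cong (λ m → ∑ (words m) (λ x → g x * δ v (bitWord x))) (sym len)) (∑-δ v g))
      spread : {I : Set} (xs : List I) (c : I → ℤ) (v : I → List Bool) (g : List Bool → ℤ) → (∀ i → i ∈ xs → length (v i) ≡ A +ℕ K) →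
        ∑ (words (A +ℕ K)) (λ x → ∑ xs (λ i → c i * δ (v i) (bitWord x)) * g x) ≡ ∑ xs (λ i → c i * g (v i))
      spread xs c v g len = begin
        ∑ (words (A +ℕ K)) (λ x → ∑ xs (λ i → c i * δ (v i) (bitWord x)) * g x)
          ≡⟨ ∑-cong (words (A +ℕ K)) (λ x → trans (sym (∑-*ʳ (g x) xs _)) (∑-cong xs (λ i → ℤₚ.*-assoc (c i) (δ (v i) (bitWord x)) (g x)))) ⟩
        ∑ (words (A +ℕ K)) (λ x → ∑ xs (λ i → c i * (δ (v i) (bitWord x) * g x)))
          ≡⟨ ∑-swap (words (A +ℕ K)) xs _ ⟩
        ∑ xs (λ i → ∑ (words (A +ℕ K)) (λ x → c i * (δ (v i) (bitWord x) * g x)))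
          ≡⟨ ∑-cong-∈ xs (λ i i∈ → trans (∑-*ˡ (c i) (words (A +ℕ K)) _) (cong (c i *_) (pick (v i) g (len i i∈)))) ⟩
        ∑ xs (λ i → c i * g (v i)) ∎
      rep : Rep A K K e
      rep rs _ = begin
        ∑ (words (A +ℕ K)) (λ x → e x * gh A K rs x)
          ≡⟨ ∑-cong (words (A +ℕ K)) (λ x → trans (ℤₚ.*-distribʳ-+ (gh A K rs x) (e₁ x) (- e₂ x))
               (cong (_+_ (e₁ x * gh A K rs x)) (trans (sym (ℤₚ.neg-distribˡ-* (e₂ x) (gh A K rs x))) (sym (ℤₚ.-1*i≡-i _))))) ⟩
        ∑ (words (A +ℕ K)) (λ x → e₁ x * gh A K rs x + - (+ 1) * (e₂ x * gh A K rs x))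
          ≡⟨ trans (∑-+ (words (A +ℕ K)) (λ x → e₁ x * gh A K rs x) (λ x → - (+ 1) * (e₂ x * gh A K rs x)))
               (cong (_+_ (∑ (words (A +ℕ K)) (λ x → e₁ x * gh A K rs x))) (trans (∑-*ˡ (- (+ 1)) (words (A +ℕ K)) (λ x → e₂ x * gh A K rs x)) (ℤₚ.-1*i≡-i _))) ⟩
        ∑ (words (A +ℕ K)) (λ x → e₁ x * gh A K rs x) + - ∑ (words (A +ℕ K)) (λ x → e₂ x * gh A K rs x)
          ≡⟨ cong₂ (λ s t → s + - t)
               (trans (spread (partitionsUpTo N) c wd (gh A K rs) (λ l l∈ → length-u (wd l) (wd-zeros l∈) (wd-ones l∈)))
                      (∑-cong-∈ (partitionsUpTo N) (λ l l∈ → cong (c l *_) (gh-wd rs l∈))))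
               (trans (spread (words n) q (ι N) (gh A K rs) (λ w → length-w))
                      (∑-cong-∈ (words n) (λ w w∈ → cong (q w *_) (gh-ι rs w (words-length a k n w∈))))) ⟩
        ∑ (partitionsUpTo N) (λ l → c l * tableaux rs l) + - ∑ (words n) (λ w → q w * gh a k rs w)
          ≡⟨ ℤₚ.i≡j⇒i-j≡0 (same rs) ⟩
        + 0 ∎
      zeros-u : countZeros u ≡ A
      zeros-u = trans (countZeros-ι N w) (cong (_+ℕ N) zeros)
      ones-u : countOnes u ≡ K
      ones-u = trans (countOnes-ι N w) (cong (_+ℕ N) ones)
      rows-u : rowsOf u ≡ pad K l
      rows-u = trans (rowsOf-ι N w) (trans (cong (_++ replicate N 0) rows) (sym (pad-+ k N l short)))
      zero-at : e u ≡ + 0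
      zero-at = trans (cong e (sym (++-identityʳ u)))
        -- With as many variables as rows, b = 0, every shape of the box is reached.
        (unique A K K e rep 0 u (ℕₚ.+-identityʳ K) ones-u (trans (ℕₚ.+-identityʳ _) (length-u u zeros-u ones-u)))
      at-w : e₂ u ≡ q w
      at-w = begin
        ∑ (words n) (λ v → q v * δ (ι N v) (bitWord u))  ≡⟨ ∑-cong (words n) (λ v → cong (q v *_) (δ-ι v)) ⟩
        ∑ (words n) (λ v → q v * δ w (bitWord v))        ≡⟨ cong (λ m → ∑ (words m) (λ v → q v * δ w (bitWord v))) (sym (trans (length-counts w) (cong₂ _+ℕ_ zeros ones))) ⟩
        ∑ (words (length w)) (λ v → q v * δ w (bitWord v)) ≡⟨ ∑-δ w q ⟩
        q w ∎
        where
        δ-ι : ∀ v → δ (ι N v) (bitWord u) ≡ δ w (bitWord v)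
        δ-ι v with ≡-dec Data.Bool._≟_ v w
        ... | yes refl = trans (δ-refl (ι N v)) (sym (δ-refl v))
        ... | no ne = trans (δ-≢ (ι N v) u (ne ∘ ι-injective N v w)) (sym (δ-≢ w v (ne ∘ sym)))
      other : ∀ l′ → l′ ∈ partitionsUpTo N → l′ ≢ l → wd l′ ≢ u
      other l′ l′∈ ne eq = ne (pad-injective K (proj₁ (partitionsUpTo-par N l′∈)) par
        (ℕₚ.≤-trans (proj₂ (partitionsUpTo-par N l′∈)) (ℕₚ.m≤n+m N k)) (ℕₚ.≤-trans short (ℕₚ.m≤m+n k N))
        (trans (sym (wd-rows l′∈)) (trans (cong rowsOf eq) rows-u)))
      indicator : List ℕ → ℤ
      indicator l′ with ≡-dec ℕₚ._≟_ l′ l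
      ... | yes _ = c l
      ... | no _  = + 0
      indicator-l : indicator l ≡ c l
      indicator-l with ≡-dec ℕₚ._≟_ l l
      ... | yes _ = refl
      ... | no ne = contradiction refl ne
      indicator-≢ : Concentrated l indicator
      indicator-≢ l′ ne with ≡-dec ℕₚ._≟_ l′ l
      ... | yes eq = contradiction eq ne
      ... | no _   = refl
      e₁-indicator : e₁ u ≡ ∑ (partitionsUpTo N) indicator
      e₁-indicator = ∑-cong-∈ (partitionsUpTo N) go
        where
        go : ∀ l′ → l′ ∈ partitionsUpTo N → c l′ * δ (wd l′) (bitWord u) ≡ indicator l′
        go l′ l′∈ with ≡-dec ℕₚ._≟_ l′ l
        ... | yes refl = trans (cong (λ v → c l′ * δ v (bitWord u)) (word-≡ (wd l′) u (trans (wd-zeros l′∈) (sym zeros-u)) (trans (wd-rows l′∈) (sym rows-u))))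
                           (trans (cong (c l′ *_) (δ-refl u)) (ℤₚ.*-identityʳ (c l′)))
        ... | no ne = trans (cong (c l′ *_) (δ-≢ (wd l′) u (other l′ l′∈ ne))) (ℤₚ.*-zeroʳ (c l′))
      at-l : e₁ u ≡ c l
      at-l with size l ℕₚ.≤? N
      ... | yes le = trans e₁-indicator (trans (partitionsUpTo-single N l indicator par le indicator-≢) indicator-l)
      ... | no nle = trans e₁-indicator (trans (∑-zero-∈ (partitionsUpTo N) tiny) (sym (big (ℕₚ.≰⇒> nle))))
        where
        tiny : ∀ l′ → l′ ∈ partitionsUpTo N → indicator l′ ≡ + 0
        tiny l′ l′∈ = indicator-≢ l′ (λ { refl → nle (partitionsUpTo-size l′∈) })

-- Identification of the coproduct coefficients with puzzle numbers.

module Coefficient where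

  open import Data.Bool using (true; false)
  open import Data.Nat using (ℕ; suc; _≤_; _<_; _∸_) renaming (_+_ to _+ℕ_)
  import Data.Nat.Properties as ℕₚ
  open import Data.List using (List; []; _∷_; _++_; map; length; reverse; concatMap)
  open import Data.List.Properties using (map-++; reverse-++; length-reverse)
  open import Data.List.Relation.Unary.All using (All)
  import Data.List.Relation.Unary.All as All
  open import Data.Product using (_,_; proj₁; ∃)
  open import Data.Sum using (inj₁; inj₂)
  open import Data.Integer using (ℤ; +_; -_; _+_; _*_)
  import Data.Integer.Properties as ℤₚ
  open import Data.Integer.Tactic.RingSolver using (solve-∀)
  open import Function using (_∘_)
  open import Relation.Binary.PropositionalEquality
  open import Relation.Nullary using (contradiction)
  open import Defs using (IsPartition; size; IsBinaryString; G; var; negOnePow; SupportedUpTo; CoproductExpansion; partitionsUpTo; sumℤ)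
  open Sums
  open Puzzle using (puzzles)
  open Uniqueness using (gh)
  open Branching using (TS)
  open Tableaux
  open Coproduct
  open Extract

  sumℤ-++ : ∀ xs ys → sumℤ (xs ++ ys) ≡ sumℤ xs + sumℤ ys
  sumℤ-++ []       ys = sym (ℤₚ.+-identityˡ _)
  sumℤ-++ (x ∷ xs) ys = trans (cong (_+_ x) (sumℤ-++ xs ys)) (sym (ℤₚ.+-assoc x (sumℤ xs) (sumℤ ys)))

  sumℤ-concatMap : {A : Set} (f : A → List ℤ) (xs : List A) → sumℤ (concatMap f xs) ≡ ∑ xs (sumℤ ∘ f)
  sumℤ-concatMap f []       = refl
  sumℤ-concatMap f (x ∷ xs) = trans (sumℤ-++ (f x) _) (cong (_+_ (sumℤ (f x))) (sumℤ-concatMap f xs))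

  tab : List ℤ → List ℕ → ℤ
  tab rs = TS (var (reverse rs)) (length rs) []

  G-tab : ∀ rs l → G l (map -_ (reverse rs)) ≡ negOnePow (size l) * tab rs l
  G-tab rs l = trans (G-tableaux l (reverse rs)) (cong (λ m → negOnePow (size l) * TS (var (reverse rs)) m [] l) (length-reverse rs))

  -- The parity of each of the two smaller shapes enters once through the expansion and once through
  -- `G` at negated variables, so it cancels; the remaining common sign of ν is its own inverse.
  signless : ∀ ν d N → CoproductExpansion ν d N → ∀ xs ys →
    tab (ys ++ xs) ν ≡ ∑ (partitionsUpTo N) (λ l → ∑ (partitionsUpTo N) (λ m → d l m * tab ys m) * tab xs l)
  signless ν d N exp xs ys = cancel (begin
    s * tab (ys ++ xs) ν
      ≡⟨ sym (G-tab (ys ++ xs) ν) ⟩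
    G ν (map -_ (reverse (ys ++ xs)))
      ≡⟨ cong (G ν) (trans (cong (map -_) (reverse-++ ys xs)) (map-++ -_ (reverse xs) (reverse ys))) ⟩
    G ν (X ++ Y)
      ≡⟨ exp X Y ⟩
    sumℤ (concatMap (λ l → map (term l) PU) PU)
      ≡⟨ trans (sumℤ-concatMap (λ l → map (term l) PU) PU) (∑-cong PU (λ l → sumℤ-map (term l) PU)) ⟩
    ∑ PU (λ l → ∑ PU (term l))
      ≡⟨ ∑-cong PU (λ l → trans (∑-cong PU (sign l)) (trans (∑-*ˡ (s * tab xs l) PU (λ m → d l m * tab ys m))
           (ring s (tab xs l) (∑ PU (λ m → d l m * tab ys m))))) ⟩
    ∑ PU (λ l → s * (∑ PU (λ m → d l m * tab ys m) * tab xs l))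
      ≡⟨ ∑-*ˡ s PU _ ⟩
    s * ∑ PU (λ l → ∑ PU (λ m → d l m * tab ys m) * tab xs l) ∎)
    where
    open ≡-Reasoning
    PU = partitionsUpTo N
    s = negOnePow (size ν)
    X = map -_ (reverse xs)
    Y = map -_ (reverse ys)
    term : List ℕ → List ℕ → ℤ
    term l m = negOnePow (size ν +ℕ size l +ℕ size m) * d l m * G l X * G m Y
    ring : ∀ s x t → s * x * t ≡ s * (t * x)
    ring = solve-∀
    sign : ∀ l m → term l m ≡ s * tab xs l * (d l m * tab ys m)
    sign l m = begin
      negOnePow (size ν +ℕ size l +ℕ size m) * d l m * G l X * G m Y
        ≡⟨ cong₂ _*_ (cong₂ (λ e g → e * d l m * g) (trans (negOnePow-+ (size ν +ℕ size l) (size m)) (cong (_* t) (negOnePow-+ (size ν) (size l)))) (G-tab xs l)) (G-tab ys m) ⟩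
      s * r * t * d l m * (r * tab xs l) * (t * tab ys m)
        ≡⟨ ring₁ s r t (d l m) (tab xs l) (tab ys m) ⟩
      (r * r) * (t * t) * (s * tab xs l * (d l m * tab ys m))
        ≡⟨ cong₂ (λ a b → a * b * (s * tab xs l * (d l m * tab ys m))) (negOnePow-square (size l)) (negOnePow-square (size m)) ⟩
      + 1 * + 1 * (s * tab xs l * (d l m * tab ys m))
        ≡⟨ ℤₚ.*-identityˡ _ ⟩
      s * tab xs l * (d l m * tab ys m) ∎
      where
      r = negOnePow (size l)
      t = negOnePow (size m)
      ring₁ : ∀ s r t d x y → s * r * t * d * (r * x) * (t * y) ≡ (r * r) * (t * t) * (s * x * (d * y))
      ring₁ = solve-∀
    cancel : ∀ {x y} → s * x ≡ s * y → x ≡ y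
    cancel {x} {y} eq = begin
      x              ≡⟨ sym (ℤₚ.*-identityˡ x) ⟩
      + 1 * x        ≡⟨ cong (_* x) (sym (negOnePow-square (size ν))) ⟩
      s * s * x      ≡⟨ ℤₚ.*-assoc s s x ⟩
      s * (s * x)    ≡⟨ cong (s *_) eq ⟩
      s * (s * y)    ≡⟨ sym (ℤₚ.*-assoc s s y) ⟩
      s * s * y      ≡⟨ cong (_* y) (negOnePow-square (size ν)) ⟩
      + 1 * y        ≡⟨ ℤₚ.*-identityˡ y ⟩
      y ∎

  -- A leading 1 has no zeros before it, so the largest part would be at least n - k.
  starts-with-zero : ∀ {n k l w} → 1 ≤ k → k < n → All (_≤ n ∸ k ∸ 1) l → IsBinaryString n k l w → ∃ λ v → w ≡ false ∷ v
  starts-with-zero {w = false ∷ v} _ _ _ _ = v , refl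
  starts-with-zero {n} {k} {l} {[]} _ k<n _ (len , _) = contradiction (subst (k <_) (sym len) k<n) (λ ())
  starts-with-zero {n} {k} {l} {true ∷ v} 1≤k k<n le (_ , _ , pos) =
    contradiction (ℕₚ.≤-trans (ℕₚ.m∸n≡0⇒m≤n (sym (pos 0 1≤k))) (part-≤ l le 0)) (ℕₚ.<⇒≱ (shrink (ℕₚ.m<n⇒0<n∸m k<n)))
    where
    shrink : ∀ {m} → 0 < m → m ∸ 1 < m
    shrink {suc m} _ = ℕₚ.n<1+n m

  -- Independence is used twice: in the variables `xs` with `ys` fixed, which isolates the terms of
  -- the first shape, and then in `ys`.
  coefficient : ∀ {n k} → 1 ≤ k → k < n → ∀ {l m ν wl wm wν} →
    IsPartition l → IsPartition m → IsPartition ν → length l ≤ k → length m ≤ k → length ν ≤ k →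
    All (_≤ n ∸ k ∸ 1) l → All (_≤ n ∸ k ∸ 1) m → All (_≤ n ∸ k ∸ 1) ν →
    IsBinaryString n k l wl → IsBinaryString n k m wm → IsBinaryString n k ν wν →
    ∀ d N → SupportedUpTo d N → CoproductExpansion ν d N → d l m ≡ puzzles wl wm wν
  coefficient {n} {k} 1≤k k<n {l} {m} {ν} {wl} {wm} {wν} pl pm pν ll lm lν bl bm bν sl sm sν d N sup exp
    with nu , refl ← starts-with-zero {n} {k} {ν} {wν} 1≤k k<n bν sν =
    extract a k N (d l) (λ mu → puzzles wl mu (false ∷ nu)) stage₂ m wm enc-m (λ big → sup l m pl pm (inj₂ big))
    where
    open ≡-Reasoning
    a = n ∸ k
    k≤n = ℕₚ.<⇒≤ k<n
    a+k : a +ℕ k ≡ n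
    a+k = ℕₚ.m∸n+n≡m k≤n
    weaken : ∀ {x} → All (_≤ n ∸ k ∸ 1) x → All (_≤ n ∸ k) x
    weaken = All.map (λ le → ℕₚ.≤-trans le (ℕₚ.m∸n≤m (n ∸ k) 1))
    enc-l : Encodes a k l wl
    enc-l = encodes k≤n pl ll (weaken bl) sl
    enc-m : Encodes a k m wm
    enc-m = encodes k≤n pm lm (weaken bm) sm
    enc-ν : Encodes a k ν wν
    enc-ν = encodes k≤n pν lν (weaken bν) sν
    gh-ν : ∀ rs → gh a k rs wν ≡ tab rs ν
    gh-ν rs = trans (gh-tableaux a k rs wν (Encodes.zeros enc-ν) (Encodes.ones enc-ν))
      (trans (cong (tab rs) (trans (Encodes.rows enc-ν) (pad-++ k ν lν))) (TS-zeros _ _ [] ν (k ∸ length ν)))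
    stage₁ : ∀ ys xs → ∑ (partitionsUpTo N) (λ l → ∑ (partitionsUpTo N) (λ m → d l m * tab ys m) * tab xs l)
                     ≡ ∑ (words (a +ℕ k)) (λ la → ∑ (words (a +ℕ k)) (λ mu → puzzles la mu wν * gh a k ys mu) * gh a k xs la)
    stage₁ ys xs = begin
      ∑ (partitionsUpTo N) (λ l → ∑ (partitionsUpTo N) (λ m → d l m * tab ys m) * tab xs l)
        ≡⟨ sym (signless ν d N exp xs ys) ⟩
      tab (ys ++ xs) ν
        ≡⟨ sym (gh-ν (ys ++ xs)) ⟩
      gh a k (ys ++ xs) wν
        ≡⟨ coproduct a k ys xs nu (trans (proj₁ sν) (sym a+k)) ⟩
      ∑ (words (a +ℕ k)) (λ la → gh a k xs la * ∑ (words (a +ℕ k)) (λ mu → puzzles la mu wν * gh a k ys mu))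
        ≡⟨ ∑-cong (words (a +ℕ k)) (λ la → ℤₚ.*-comm (gh a k xs la) _) ⟩
      ∑ (words (a +ℕ k)) (λ la → ∑ (words (a +ℕ k)) (λ mu → puzzles la mu wν * gh a k ys mu) * gh a k xs la) ∎
    stage₂ : ∀ ys → ∑ (partitionsUpTo N) (λ m → d l m * tab ys m) ≡ ∑ (words (a +ℕ k)) (λ mu → puzzles wl mu wν * gh a k ys mu)
    stage₂ ys = extract a k N (λ l → ∑ (partitionsUpTo N) (λ m → d l m * tab ys m))
      (λ la → ∑ (words (a +ℕ k)) (λ mu → puzzles la mu wν * gh a k ys mu)) (stage₁ ys) l wl enc-l
      -- If the first shape is not listed, the support condition kills every coefficient in the
      -- inner sum.
      (λ big → ∑-zero-∈ (partitionsUpTo N) (λ m m∈ → cong (_* tab ys m)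
        (sup l m pl (par⇒partition (proj₁ (partitionsUpTo-par N m∈))) (inj₁ big))))

-- Names for placed pieces, and the triangles that they cover.

module Codes where

  open import Data.Bool using (Bool; true; false)
  open import Data.Nat using (ℕ; zero; suc; _≤_; _<_; s≤s; _∸_; _≡ᵇ_)
  import Data.Nat.Properties as ℕₚ
  open import Data.List using (List; []; _∷_; _++_; map; upTo; concatMap)
  open import Data.List.Properties using (map-++; map-concatMap; concatMap-cong)
  open import Data.List.Membership.Propositional using (_∈_; find; lose)
  open import Data.List.Membership.Propositional.Properties using (∈-concatMap⁻; ∈-concatMap⁺; ∈-upTo⁻; ∈-upTo⁺; ∈-++⁻; ∈-++⁺ˡ; ∈-++⁺ʳ)
  open import Data.List.Relation.Unary.Any using (here; there)
  open import Data.List.Relation.Unary.All using (All; []; _∷_)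
  import Data.List.Relation.Unary.All as All
  open import Data.List.Relation.Unary.AllPairs using ([]; _∷_)
  open import Data.List.Relation.Unary.Unique.Propositional using (Unique)
  open import Data.List.Relation.Unary.Unique.Propositional.Properties using (++⁺; upTo⁺)
  open import Data.Product using (_×_; _,_; proj₁; proj₂; ∃; ∃₂)
  open import Data.Sum using (_⊎_; inj₁; inj₂)
  open import Data.Empty using (⊥)
  open import Function using (_∘_; id)
  open import Relation.Binary.PropositionalEquality
  open import Defs
  open Rows using (Lab; bit; i₁; i₂; i₃; Kind; sing; vR; lR; rR; hx₁; hx₂; hx₃; left; right; bot; ≡ᵇ-sound; ≡ᵇ-refl)

  -- Names of placed pieces: matching on a name replaces inspecting lists of cells and labels, and
  -- roles can be indexed by it.
  data Code : Set where
    upS dnS     : ℕ → ℕ → Bool → Code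
    vC lC rC hC : ℕ → ℕ → Code

  ⟦_⟧ : Code → Piece
  ⟦ upS r i b ⟧ = piece (up r i ∷ []) ((lE r i , b) ∷ (rE r i , b) ∷ (hE (suc r) i , b) ∷ [])
  ⟦ dnS r i b ⟧ = piece (down r i ∷ []) ((hE r i , b) ∷ (rE r i , b) ∷ (lE r (suc i) , b) ∷ [])
  ⟦ vC r i ⟧ = piece (up r i ∷ down (suc r) i ∷ [])
    ((lE r i , true) ∷ (rE r i , false) ∷ (lE (suc r) (suc i) , true) ∷ (rE (suc r) i , false) ∷ [])
  ⟦ lC r i ⟧ = piece (up r i ∷ down r i ∷ [])
    ((hE r i , true) ∷ (lE r (suc i) , false) ∷ (hE (suc r) i , true) ∷ (lE r i , false) ∷ [])
  ⟦ rC r i ⟧ = piece (down r i ∷ up r (suc i) ∷ [])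
    ((hE r i , false) ∷ (rE r (suc i) , true) ∷ (hE (suc r) (suc i) , false) ∷ (rE r i , true) ∷ [])
  ⟦ hC r′ i′ ⟧ = let r = suc r′ ; i = suc i′ in
    piece (up r i ∷ down r i ∷ up r′ i ∷ down r′ i′ ∷ up r′ i′ ∷ down r i′ ∷ [])
      ((hE (suc r) i , true) ∷ (lE r (suc i) , false) ∷ (rE r′ i , true) ∷ (hE r′ i′ , false) ∷ (lE r′ i′ , true) ∷ (rE r i′ , false) ∷ [])

  grid : {A : Set} → ℕ → (ℕ → ℕ) → (ℕ → ℕ → List A) → List A
  grid n g h = concatMap (λ r → concatMap (h r) (upTo (g r))) (upTo n)

  map-grid : {A B : Set} (f : A → B) (n : ℕ) (g : ℕ → ℕ) (h : ℕ → ℕ → List A) →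
             map f (grid n g h) ≡ grid n g (λ r i → map f (h r i))
  map-grid f n g h = trans (map-concatMap f (λ r → concatMap (h r) (upTo (g r))) (upTo n))
    (concatMap-cong (λ r → map-concatMap f (h r) (upTo (g r))) (upTo n))

  concatMap-singleton : {A B : Set} (f : A → B) (xs : List A) → map f xs ≡ concatMap (λ x → f x ∷ []) xs
  concatMap-singleton f []       = refl
  concatMap-singleton f (x ∷ xs) = cong (f x ∷_) (concatMap-singleton f xs)

  ∈-grid⁻ : {A : Set} (n : ℕ) (g : ℕ → ℕ) (h : ℕ → ℕ → List A) {c : A} → c ∈ grid n g h →
            ∃₂ λ r i → r < n × i < g r × c ∈ h r i
  ∈-grid⁻ n g h c∈ with r , r∈ , c∈′ ← find (∈-concatMap⁻ (λ r → concatMap (h r) (upTo (g r))) {xs = upTo n} c∈)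
    with i , i∈ , c∈″ ← find (∈-concatMap⁻ (h r) {xs = upTo (g r)} c∈′) = r , i , ∈-upTo⁻ r∈ , ∈-upTo⁻ i∈ , c∈″

  ∈-grid⁺ : {A : Set} (n : ℕ) (g : ℕ → ℕ) (h : ℕ → ℕ → List A) {c : A} (r i : ℕ) → r < n → i < g r → c ∈ h r i → c ∈ grid n g h
  ∈-grid⁺ n g h r i r< i< c∈ = ∈-concatMap⁺ (λ r → concatMap (h r) (upTo (g r))) (lose (∈-upTo⁺ r<) (∈-concatMap⁺ (h r) (lose (∈-upTo⁺ i<) c∈)))

  unique-concatMap : {A B : Set} (f : A → List B) (xs : List A) → Unique xs → (∀ x → Unique (f x)) →
    (∀ x x′ b → b ∈ f x → b ∈ f x′ → x ≡ x′) → Unique (concatMap f xs)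
  unique-concatMap f []       u        uf inj = []
  unique-concatMap f (x ∷ xs) (nx ∷ u) uf inj = ++⁺ (uf x) (unique-concatMap f xs u uf inj) disjoint
    where
    disjoint : ∀ {b} → (b ∈ f x × b ∈ concatMap f xs) → ⊥
    disjoint {b} (p , q) with x′ , x′∈ , q′ ← find (∈-concatMap⁻ f {xs = xs} q) = All.lookup nx x′∈ (inj x x′ b p q′)

  unique-grid : {A : Set} (n : ℕ) (g : ℕ → ℕ) (h : ℕ → ℕ → List A) → (∀ r i → Unique (h r i)) →
    (∀ {r i r′ i′ c} → c ∈ h r i → c ∈ h r′ i′ → r ≡ r′ × i ≡ i′) → Unique (grid n g h)
  unique-grid n g h u inj = unique-concatMap _ (upTo n) (upTo⁺ n)
    (λ r → unique-concatMap (h r) (upTo (g r)) (upTo⁺ (g r)) (u r) (λ i i′ b p q → proj₂ (inj p q)))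
    (λ r r′ b p q → let (i , _ , p′) = find (∈-concatMap⁻ (h r) {xs = upTo (g r)} p)
                        (i′ , _ , q′) = find (∈-concatMap⁻ (h r′) {xs = upTo (g r′)} q) in proj₁ (inj p′ q′))

  upH dnH vH lH rH hH : ℕ → ℕ → List Code
  upH r i = upS r i false ∷ upS r i true ∷ []
  dnH r i = dnS r i false ∷ dnS r i true ∷ []
  vH r i = vC r i ∷ []
  lH r i = lC r i ∷ []
  rH r i = rC r i ∷ []
  hH r i = hC r i ∷ []

  codes : ℕ → List Code
  codes n = grid n suc upH ++ grid n id dnH ++ grid (n ∸ 1) suc vH ++ grid n id lH ++ grid n id rH ++ grid (n ∸ 1) id hH

  allPieces-codes : ∀ n → allPieces n ≡ map ⟦_⟧ (codes n)
  allPieces-codes n = sym (begin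
    map ⟦_⟧ (codes n)
      ≡⟨ map-++ ⟦_⟧ (grid n suc upH) _ ⟩
    map ⟦_⟧ (grid n suc upH) ++ map ⟦_⟧ (grid n id dnH ++ rest₁)
      ≡⟨ cong₂ _++_ (map-grid ⟦_⟧ n suc upH) (map-++ ⟦_⟧ (grid n id dnH) rest₁) ⟩
    upSingles n ++ map ⟦_⟧ (grid n id dnH) ++ map ⟦_⟧ rest₁
      ≡⟨ cong (upSingles n ++_) (cong₂ _++_ (map-grid ⟦_⟧ n id dnH) (map-++ ⟦_⟧ (grid (n ∸ 1) suc vH) rest₂)) ⟩
    upSingles n ++ downSingles n ++ map ⟦_⟧ (grid (n ∸ 1) suc vH) ++ map ⟦_⟧ rest₂
      ≡⟨ cong (λ x → upSingles n ++ downSingles n ++ x) (cong₂ _++_ (single vC (n ∸ 1) suc) (trans (map-++ ⟦_⟧ (grid n id lH) rest₃)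
           (cong₂ _++_ (single lC n id) (trans (map-++ ⟦_⟧ (grid n id rH) (grid (n ∸ 1) id hH))
             (cong₂ _++_ (single rC n id) (single hC (n ∸ 1) id)))))) ⟩
    allPieces n ∎)
    where
    open ≡-Reasoning
    rest₃ = grid n id rH ++ grid (n ∸ 1) id hH
    rest₂ = grid n id lH ++ rest₃
    rest₁ = grid (n ∸ 1) suc vH ++ rest₂
    single : (C : ℕ → ℕ → Code) (n : ℕ) (g : ℕ → ℕ) →
      map ⟦_⟧ (grid n g (λ r i → C r i ∷ [])) ≡ concatMap (λ r → map (λ i → ⟦ C r i ⟧) (upTo (g r))) (upTo n)
    single C n g = trans (map-grid ⟦_⟧ n g (λ r i → C r i ∷ [])) (concatMap-cong (λ r → sym (concatMap-singleton (λ i → ⟦ C r i ⟧) (upTo (g r)))) (upTo n))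

  InRange : ℕ → Code → Set
  InRange n (upS r i b) = r < n × i ≤ r
  InRange n (dnS r i b) = r < n × i < r
  InRange n (vC r i)    = suc r < n × i ≤ r
  InRange n (lC r i)    = r < n × i < r
  InRange n (rC r i)    = r < n × i < r
  InRange n (hC r i)    = suc r < n × i < r

  <∸1 : ∀ {r n} → r < n ∸ 1 → suc r < n
  <∸1 {n = suc n} h = s≤s h

  ∸1< : ∀ {r n} → suc r < n → r < n ∸ 1
  ∸1< {n = suc n} (s≤s h) = h

  codes-range : ∀ n {c} → c ∈ codes n → InRange n c
  codes-range n c∈ with ∈-++⁻ (grid n suc upH) c∈
  ... | inj₁ h with ∈-grid⁻ n suc upH h
  ...   | r , i , p , s≤s q , here refl = p , q
  ...   | r , i , p , s≤s q , there (here refl) = p , q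
  codes-range n c∈ | inj₂ c∈₁ with ∈-++⁻ (grid n id dnH) c∈₁
  ... | inj₁ h with ∈-grid⁻ n id dnH h
  ...   | r , i , p , q , here refl = p , q
  ...   | r , i , p , q , there (here refl) = p , q
  codes-range n c∈ | inj₂ c∈₁ | inj₂ c∈₂ with ∈-++⁻ (grid (n ∸ 1) suc vH) c∈₂
  ... | inj₁ h with ∈-grid⁻ (n ∸ 1) suc vH h
  ...   | r , i , p , s≤s q , here refl = <∸1 p , q
  codes-range n c∈ | inj₂ c∈₁ | inj₂ c∈₂ | inj₂ c∈₃ with ∈-++⁻ (grid n id lH) c∈₃
  ... | inj₁ h with ∈-grid⁻ n id lH h
  ...   | r , i , p , q , here refl = p , q
  codes-range n c∈ | inj₂ c∈₁ | inj₂ c∈₂ | inj₂ c∈₃ | inj₂ c∈₄ with ∈-++⁻ (grid n id rH) c∈₄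
  ... | inj₁ h with ∈-grid⁻ n id rH h
  ...   | r , i , p , q , here refl = p , q
  codes-range n c∈ | inj₂ c∈₁ | inj₂ c∈₂ | inj₂ c∈₃ | inj₂ c∈₄ | inj₂ c∈₅ with ∈-grid⁻ (n ∸ 1) id hH c∈₅
  ...   | r , i , p , q , here refl = <∸1 p , q

  range-codes : ∀ n c → InRange n c → c ∈ codes n
  range-codes n (upS r i b) (p , q) = ∈-++⁺ˡ (∈-grid⁺ n suc upH r i p (s≤s q) (pick b))
    where
    pick : ∀ b → upS r i b ∈ upH r i
    pick false = here refl
    pick true  = there (here refl)
  range-codes n (dnS r i b) (p , q) = ∈-++⁺ʳ (grid n suc upH) (∈-++⁺ˡ (∈-grid⁺ n id dnH r i p q (pick b)))
    where
    pick : ∀ b → dnS r i b ∈ dnH r i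
    pick false = here refl
    pick true  = there (here refl)
  range-codes n (vC r i) (p , q) = ∈-++⁺ʳ (grid n suc upH) (∈-++⁺ʳ (grid n id dnH)
    (∈-++⁺ˡ (∈-grid⁺ (n ∸ 1) suc vH r i (∸1< p) (s≤s q) (here refl))))
  range-codes n (lC r i) (p , q) = ∈-++⁺ʳ (grid n suc upH) (∈-++⁺ʳ (grid n id dnH) (∈-++⁺ʳ (grid (n ∸ 1) suc vH)
    (∈-++⁺ˡ (∈-grid⁺ n id lH r i p q (here refl)))))
  range-codes n (rC r i) (p , q) = ∈-++⁺ʳ (grid n suc upH) (∈-++⁺ʳ (grid n id dnH) (∈-++⁺ʳ (grid (n ∸ 1) suc vH)
    (∈-++⁺ʳ (grid n id lH) (∈-++⁺ˡ (∈-grid⁺ n id rH r i p q (here refl))))))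
  range-codes n (hC r i) (p , q) = ∈-++⁺ʳ (grid n suc upH) (∈-++⁺ʳ (grid n id dnH) (∈-++⁺ʳ (grid (n ∸ 1) suc vH)
    (∈-++⁺ʳ (grid n id lH) (∈-++⁺ʳ (grid n id rH) (∈-grid⁺ (n ∸ 1) id hH r i (∸1< p) q (here refl))))))

  -- A tag that turns disjointness of the six lists in `codes` into a comparison of numbers.
  family : Code → ℕ
  family (upS _ _ _) = 0
  family (dnS _ _ _) = 1
  family (vC _ _)    = 2
  family (lC _ _)    = 3
  family (rC _ _)    = 4
  family (hC _ _)    = 5

  codes-unique : ∀ n → Unique (codes n)
  codes-unique n =
    ++⁺ (unique-grid n suc upH (λ r i → ((λ ()) ∷ []) ∷ [] ∷ []) (λ { (here refl) (here refl) → refl , refl ; (here refl) (there (here ())) ; (there (here refl)) (here ()) ; (there (here refl)) (there (here refl)) → refl , refl }))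
    (++⁺ (unique-grid n id dnH (λ r i → ((λ ()) ∷ []) ∷ [] ∷ []) (λ { (here refl) (here refl) → refl , refl ; (here refl) (there (here ())) ; (there (here refl)) (here ()) ; (there (here refl)) (there (here refl)) → refl , refl }))
    (++⁺ (unique-grid (n ∸ 1) suc vH (λ r i → [] ∷ []) (λ { (here refl) (here refl) → refl , refl }))
    (++⁺ (unique-grid n id lH (λ r i → [] ∷ []) (λ { (here refl) (here refl) → refl , refl }))
    (++⁺ (unique-grid n id rH (λ r i → [] ∷ []) (λ { (here refl) (here refl) → refl , refl }))
         (unique-grid (n ∸ 1) id hH (λ r i → [] ∷ []) (λ { (here refl) (here refl) → refl , refl }))
      d₄) d₃) d₂) d₁) d₀
    where
    fam : ∀ h {k} (g : ℕ → ℕ) m → (∀ r i {c} → c ∈ h r i → family c ≡ k) → ∀ {c} → c ∈ grid m g h → family c ≡ k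
    fam h g m f c∈ = let (r , i , _ , _ , q) = ∈-grid⁻ m g h c∈ in f r i q
    f₀ : ∀ {c} → c ∈ grid n suc upH → family c ≡ 0
    f₀ = fam upH suc n (λ { r i (here refl) → refl ; r i (there (here refl)) → refl })
    f₁ : ∀ {c} → c ∈ grid n id dnH → family c ≡ 1
    f₁ = fam dnH id n (λ { r i (here refl) → refl ; r i (there (here refl)) → refl })
    f₂ : ∀ {c} → c ∈ grid (n ∸ 1) suc vH → family c ≡ 2
    f₂ = fam vH suc (n ∸ 1) (λ { r i (here refl) → refl })
    f₃ : ∀ {c} → c ∈ grid n id lH → family c ≡ 3
    f₃ = fam lH id n (λ { r i (here refl) → refl })
    f₄ : ∀ {c} → c ∈ grid n id rH → family c ≡ 4
    f₄ = fam rH id n (λ { r i (here refl) → refl })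
    f₅ : ∀ {c} → c ∈ grid (n ∸ 1) id hH → family c ≡ 5
    f₅ = fam hH id (n ∸ 1) (λ { r i (here refl) → refl })
    clash : ∀ {j k} {xs ys : List Code} → j < k → (∀ {c} → c ∈ xs → family c ≡ j) → (∀ {c} → c ∈ ys → k ≤ family c) →
            ∀ {c} → (c ∈ xs × c ∈ ys) → ⊥
    clash lt f g (p , q) = ℕₚ.<⇒≱ lt (subst (_ ≤_) (f p) (g q))
    join : ∀ {k} {xs ys : List Code} → (∀ {c} → c ∈ xs → k ≤ family c) → (∀ {c} → c ∈ ys → k ≤ family c) → ∀ {c} → c ∈ xs ++ ys → k ≤ family c
    join {xs = xs} f g c∈ with ∈-++⁻ xs c∈
    ... | inj₁ p = f p
    ... | inj₂ q = g q
    at : ∀ {k j} {xs : List Code} → k ≤ j → (∀ {c} → c ∈ xs → family c ≡ j) → ∀ {c} → c ∈ xs → k ≤ family c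
    at le f c∈ = subst (_ ≤_) (sym (f c∈)) le
    g₄ : ∀ {c} → c ∈ grid n id rH ++ grid (n ∸ 1) id hH → 4 ≤ family c
    g₄ = join (at ℕₚ.≤-refl f₄) (at (ℕₚ.n≤1+n 4) f₅)
    g₃ : ∀ {c} → c ∈ grid n id lH ++ (grid n id rH ++ grid (n ∸ 1) id hH) → 3 ≤ family c
    g₃ = join (at ℕₚ.≤-refl f₃) (ℕₚ.≤-trans (ℕₚ.n≤1+n 3) ∘ g₄)
    g₂ : ∀ {c} → c ∈ grid (n ∸ 1) suc vH ++ (grid n id lH ++ (grid n id rH ++ grid (n ∸ 1) id hH)) → 2 ≤ family c
    g₂ = join (at ℕₚ.≤-refl f₂) (ℕₚ.≤-trans (ℕₚ.n≤1+n 2) ∘ g₃)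
    g₁ : ∀ {c} → c ∈ grid n id dnH ++ (grid (n ∸ 1) suc vH ++ (grid n id lH ++ (grid n id rH ++ grid (n ∸ 1) id hH))) → 1 ≤ family c
    g₁ = join (at ℕₚ.≤-refl f₁) (ℕₚ.≤-trans (ℕₚ.n≤1+n 1) ∘ g₂)
    d₄ : ∀ {c} → (c ∈ grid n id rH × c ∈ grid (n ∸ 1) id hH) → ⊥
    d₄ = clash (ℕₚ.n<1+n 4) f₄ (at ℕₚ.≤-refl f₅)
    d₃ : ∀ {c} → (c ∈ grid n id lH × c ∈ grid n id rH ++ grid (n ∸ 1) id hH) → ⊥
    d₃ = clash (ℕₚ.n<1+n 3) f₃ g₄
    d₂ : ∀ {c} → (c ∈ grid (n ∸ 1) suc vH × c ∈ grid n id lH ++ (grid n id rH ++ grid (n ∸ 1) id hH)) → ⊥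
    d₂ = clash (ℕₚ.n<1+n 2) f₂ g₃
    d₁ : ∀ {c} → (c ∈ grid n id dnH × c ∈ grid (n ∸ 1) suc vH ++ (grid n id lH ++ (grid n id rH ++ grid (n ∸ 1) id hH))) → ⊥
    d₁ = clash (ℕₚ.n<1+n 1) f₁ g₂
    d₀ : ∀ {c} → (c ∈ grid n suc upH × c ∈ grid n id dnH ++ (grid (n ∸ 1) suc vH ++ (grid n id lH ++ (grid n id rH ++ grid (n ∸ 1) id hH)))) → ⊥
    d₀ = clash (ℕₚ.n<1+n 0) f₀ g₁

  -- A hexagon is named by its upper left upward triangle, hence the shifted coordinates of its
  -- other roles.
  data UpRole : Code → ℕ → ℕ → Kind → Set where
    sing : ∀ {r i b} → UpRole (upS r i b) r i (sing b)
    vert : ∀ {r i} → UpRole (vC r i) r i vR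
    lft : ∀ {r i} → UpRole (lC r i) r i lR
    rgt : ∀ {r i} → UpRole (rC r i) r (suc i) rR
    h₁   : ∀ {r i} → UpRole (hC r i) r i hx₁
    h₂   : ∀ {r i} → UpRole (hC r i) r (suc i) hx₂
    h₃   : ∀ {r i} → UpRole (hC r i) (suc r) (suc i) hx₃

  -- The downward counterpart of `Kind`; d₄, d₅, d₆ are the top, lower left and lower right downward
  -- triangles of H.
  data DnKind : Set where
    dsing             : Bool → DnKind
    dv dl dr d₄ d₅ d₆ : DnKind

  hD rD lD : DnKind → Lab
  hD (dsing b) = bit b
  hD dv = i₁
  hD dl = bit true
  hD dr = bit false
  hD d₄ = bit false
  hD d₅ = i₂
  hD d₆ = i₃
  rD (dsing b) = bit b
  rD dv = bit false
  rD dl = i₁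
  rD dr = bit true
  rD d₄ = i₂
  rD d₅ = bit false
  rD d₆ = i₃
  lD (dsing b) = bit b
  lD dv = bit true
  lD dl = bit false
  lD dr = i₁
  lD d₄ = i₂
  lD d₅ = i₃
  lD d₆ = bit false

  data DnRole : Code → ℕ → ℕ → DnKind → Set where
    sing : ∀ {r i b} → DnRole (dnS r i b) r i (dsing b)
    vert : ∀ {r i} → DnRole (vC r i) (suc r) i dv
    lft : ∀ {r i} → DnRole (lC r i) r i dl
    rgt : ∀ {r i} → DnRole (rC r i) r i dr
    h₄   : ∀ {r i} → DnRole (hC r i) r i d₄
    h₅   : ∀ {r i} → DnRole (hC r i) (suc r) i d₅
    h₆   : ∀ {r i} → DnRole (hC r i) (suc r) (suc i) d₆

  upRole-code : ∀ {c c′ r i κ} → UpRole c r i κ → UpRole c′ r i κ → c ≡ c′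
  upRole-code sing sing = refl
  upRole-code vert vert = refl
  upRole-code lft lft = refl
  upRole-code rgt rgt = refl
  upRole-code h₁ h₁ = refl
  upRole-code h₂ h₂ = refl
  upRole-code h₃ h₃ = refl

  dnRole-code : ∀ {c c′ r i δ} → DnRole c r i δ → DnRole c′ r i δ → c ≡ c′
  dnRole-code sing sing = refl
  dnRole-code vert vert = refl
  dnRole-code lft lft = refl
  dnRole-code rgt rgt = refl
  dnRole-code h₄ h₄ = refl
  dnRole-code h₅ h₅ = refl
  dnRole-code h₆ h₆ = refl

  upRole-kind : ∀ {c r i κ κ′} → UpRole c r i κ → UpRole c r i κ′ → κ ≡ κ′
  upRole-kind sing sing = refl
  upRole-kind vert vert = refl
  upRole-kind lft lft = refl
  upRole-kind rgt rgt = refl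
  upRole-kind h₁ h₁ = refl
  upRole-kind h₂ h₂ = refl
  upRole-kind h₃ h₃ = refl

  dnRole-kind : ∀ {c r i δ δ′} → DnRole c r i δ → DnRole c r i δ′ → δ ≡ δ′
  dnRole-kind sing sing = refl
  dnRole-kind vert vert = refl
  dnRole-kind lft lft = refl
  dnRole-kind rgt rgt = refl
  dnRole-kind h₄ h₄ = refl
  dnRole-kind h₅ h₅ = refl
  dnRole-kind h₆ h₆ = refl

  upRole-range : ∀ {n c r i κ} → InRange n c → UpRole c r i κ → r < n × i ≤ r
  upRole-range h sing = h
  upRole-range (p , q) vert = ℕₚ.<⇒≤ p , q
  upRole-range (p , q) lft = p , ℕₚ.<⇒≤ q
  upRole-range (p , q) rgt = p , q
  upRole-range (p , q) h₁ = ℕₚ.<⇒≤ p , ℕₚ.<⇒≤ q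
  upRole-range (p , q) h₂ = ℕₚ.<⇒≤ p , q
  upRole-range (p , q) h₃ = p , ℕₚ.≤-trans q (ℕₚ.n≤1+n _)

  dnRole-range : ∀ {n c r i δ} → InRange n c → DnRole c r i δ → r < n × i < r
  dnRole-range h sing = h
  dnRole-range (p , q) vert = p , s≤s q
  dnRole-range h lft = h
  dnRole-range h rgt = h
  dnRole-range (p , q) h₄ = ℕₚ.<⇒≤ p , q
  dnRole-range (p , q) h₅ = p , ℕₚ.m<n⇒m<1+n q
  dnRole-range (p , q) h₆ = p , s≤s q

  1+n≡ᵇn : ∀ n → (suc n ≡ᵇ n) ≡ false
  1+n≡ᵇn zero    = refl
  1+n≡ᵇn (suc n) = 1+n≡ᵇn n

  n≡ᵇ1+n : ∀ n → (n ≡ᵇ suc n) ≡ false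
  n≡ᵇ1+n zero    = refl
  n≡ᵇ1+n (suc n) = n≡ᵇ1+n n

  covers : Tri → Code → Bool
  covers t c = count (eqTri t) (cells ⟦ c ⟧) ≡ᵇ 1

  eqTri-sound : ∀ t t′ → eqTri t t′ ≡ true → t ≡ t′
  eqTri-sound (up r i) (up s j) h with r ≡ᵇ s in e | i ≡ᵇ j in e′
  ... | true | true = cong₂ up (≡ᵇ-sound r s e) (≡ᵇ-sound i j e′)
  eqTri-sound (down r i) (down s j) h with r ≡ᵇ s in e | i ≡ᵇ j in e′
  ... | true | true = cong₂ down (≡ᵇ-sound r s e) (≡ᵇ-sound i j e′)

  count-positive : {A : Set} (p : A → Bool) (xs : List A) → (count p xs ≡ᵇ 1) ≡ true → ∃ λ x → x ∈ xs × p x ≡ true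
  count-positive p (x ∷ xs) h with p x in e
  ... | true  = x , here refl , e
  ... | false with y , y∈ , q ← count-positive p xs h = y , there y∈ , q

  covers⇒cell : ∀ {t c} → covers t c ≡ true → t ∈ cells ⟦ c ⟧
  covers⇒cell {t} {c} h with t′ , t′∈ , e ← count-positive (eqTri t) (cells ⟦ c ⟧) h rewrite eqTri-sound t t′ e = t′∈

  covers⇒upRole : ∀ {r i} c → covers (up r i) c ≡ true → ∃ (UpRole c r i)
  covers⇒upRole c h = go c (covers⇒cell {c = c} h)
    where
    go : ∀ {r i} c → up r i ∈ cells ⟦ c ⟧ → ∃ (UpRole c r i)
    go (upS _ _ b) (here refl) = _ , sing
    go (dnS _ _ _) (here ())
    go (dnS _ _ _) (there ())
    go (vC _ _) (here refl) = _ , vert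
    go (vC _ _) (there (here ()))
    go (lC _ _) (here refl) = _ , lft
    go (lC _ _) (there (here ()))
    go (rC _ _) (there (here refl)) = _ , rgt
    go (hC _ _) (here refl) = _ , h₃
    go (hC _ _) (there (there (here refl))) = _ , h₂
    go (hC _ _) (there (there (there (there (here refl))))) = _ , h₁
    go (hC _ _) (there (there (there (there (there (here ()))))))

  covers⇒dnRole : ∀ {r i} c → covers (down r i) c ≡ true → ∃ (DnRole c r i)
  covers⇒dnRole c h = go c (covers⇒cell {c = c} h)
    where
    go : ∀ {r i} c → down r i ∈ cells ⟦ c ⟧ → ∃ (DnRole c r i)
    go (upS _ _ b) (here ())
    go (upS _ _ b) (there ())
    go (dnS _ _ _) (here refl) = _ , sing
    go (vC _ _) (there (here refl)) = _ , vert
    go (lC _ _) (there (here refl)) = _ , lft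
    go (rC _ _) (here refl) = _ , rgt
    go (rC _ _) (there (here ()))
    go (hC _ _) (there (here refl)) = _ , h₆
    go (hC _ _) (there (there (there (here refl)))) = _ , h₄
    go (hC _ _) (there (there (there (there (there (here refl)))))) = _ , h₅

  upRole⇒covers : ∀ {c r i κ} → UpRole c r i κ → covers (up r i) c ≡ true
  upRole⇒covers (sing {r} {i}) rewrite ≡ᵇ-refl r | ≡ᵇ-refl i = refl
  upRole⇒covers (vert {r} {i}) rewrite ≡ᵇ-refl r | ≡ᵇ-refl i = refl
  upRole⇒covers (lft {r} {i}) rewrite ≡ᵇ-refl r | ≡ᵇ-refl i = refl
  upRole⇒covers (rgt {r} {i}) rewrite ≡ᵇ-refl r | ≡ᵇ-refl i = refl
  upRole⇒covers (h₁ {r} {i}) rewrite n≡ᵇ1+n r | ≡ᵇ-refl r | n≡ᵇ1+n i | ≡ᵇ-refl r | ≡ᵇ-refl i = refl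
  upRole⇒covers (h₂ {r} {i}) rewrite n≡ᵇ1+n r | ≡ᵇ-refl r | ≡ᵇ-refl i | ≡ᵇ-refl r | 1+n≡ᵇn i = refl
  upRole⇒covers (h₃ {r} {i}) rewrite ≡ᵇ-refl r | ≡ᵇ-refl i | 1+n≡ᵇn r | 1+n≡ᵇn r = refl

  dnRole⇒covers : ∀ {c r i δ} → DnRole c r i δ → covers (down r i) c ≡ true
  dnRole⇒covers (sing {r} {i}) rewrite ≡ᵇ-refl r | ≡ᵇ-refl i = refl
  dnRole⇒covers (vert {r} {i}) rewrite ≡ᵇ-refl r | ≡ᵇ-refl i = refl
  dnRole⇒covers (lft {r} {i}) rewrite ≡ᵇ-refl r | ≡ᵇ-refl i = refl
  dnRole⇒covers (rgt {r} {i}) rewrite ≡ᵇ-refl r | ≡ᵇ-refl i = refl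
  dnRole⇒covers (h₄ {r} {i}) rewrite n≡ᵇ1+n r | ≡ᵇ-refl r | ≡ᵇ-refl i | n≡ᵇ1+n r = refl
  dnRole⇒covers (h₅ {r} {i}) rewrite ≡ᵇ-refl r | n≡ᵇ1+n i | 1+n≡ᵇn r | ≡ᵇ-refl r | ≡ᵇ-refl i = refl
  dnRole⇒covers (h₆ {r} {i}) rewrite ≡ᵇ-refl r | ≡ᵇ-refl i | 1+n≡ᵇn r | ≡ᵇ-refl r | 1+n≡ᵇn i = refl

  private
    0th : {A : Set} {x : A} {xs : List A} → x ∈ x ∷ xs
    0th = here refl
    1st : {A : Set} {x y : A} {xs : List A} → x ∈ y ∷ x ∷ xs
    1st = there 0th
    2nd : {A : Set} {x y z : A} {xs : List A} → x ∈ y ∷ z ∷ x ∷ xs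
    2nd = there 1st
    3rd : {A : Set} {x y z u : A} {xs : List A} → x ∈ y ∷ z ∷ u ∷ x ∷ xs
    3rd = there 2nd
    4th : {A : Set} {x y z u t : A} {xs : List A} → x ∈ y ∷ z ∷ u ∷ t ∷ x ∷ xs
    4th = there 3rd
    5th : {A : Set} {x y z u t s : A} {xs : List A} → x ∈ y ∷ z ∷ u ∷ t ∷ s ∷ x ∷ xs
    5th = there 4th

  -- An edge of a covered triangle either carries a bit on the boundary of the piece, or the piece
  -- also covers the triangle on the other side.
  Labelled : Code → Edge → Lab → Set
  Labelled c e λ′ = ∃ λ b → λ′ ≡ bit b × (e , b) ∈ labels ⟦ c ⟧

  across-bot : ∀ {c r i κ} → UpRole c r i κ →
    Labelled c (hE (suc r) i) (bot κ) ⊎ ∃ λ δ → DnRole c (suc r) i δ × hD δ ≡ bot κ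
  across-bot sing = inj₁ (_ , refl , 2nd)
  across-bot vert  = inj₂ (_ , vert , refl)
  across-bot lft  = inj₁ (_ , refl , 2nd)
  across-bot rgt  = inj₁ (_ , refl , 2nd)
  across-bot h₁ = inj₂ (_ , h₅ , refl)
  across-bot h₂ = inj₂ (_ , h₆ , refl)
  across-bot h₃ = inj₁ (_ , refl , 0th)

  across-right : ∀ {c r i κ} → UpRole c r i κ →
    Labelled c (rE r i) (right κ) ⊎ ∃ λ δ → DnRole c r i δ × rD δ ≡ right κ
  across-right sing = inj₁ (_ , refl , 1st)
  across-right vert  = inj₁ (_ , refl , 1st)
  across-right lft  = inj₂ (_ , lft , refl)
  across-right rgt  = inj₁ (_ , refl , 1st)
  across-right h₁ = inj₂ (_ , h₄ , refl)
  across-right h₂ = inj₁ (_ , refl , 2nd)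
  across-right h₃ = inj₂ (_ , h₆ , refl)

  across-left : ∀ {c r i κ} → UpRole c r i κ →
    Labelled c (lE r i) (left κ) ⊎ ∃₂ λ i′ δ → i ≡ suc i′ × DnRole c r i′ δ × lD δ ≡ left κ
  across-left sing = inj₁ (_ , refl , 0th)
  across-left vert  = inj₁ (_ , refl , 0th)
  across-left lft  = inj₁ (_ , refl , 3rd)
  across-left rgt  = inj₂ (_ , _ , refl , rgt , refl)
  across-left h₁ = inj₁ (_ , refl , 4th)
  across-left h₂ = inj₂ (_ , _ , refl , h₄ , refl)
  across-left h₃ = inj₂ (_ , _ , refl , h₅ , refl)

  across-hD : ∀ {c r i δ} → DnRole c (suc r) i δ →
    Labelled c (hE (suc r) i) (hD δ) ⊎ ∃ λ κ → UpRole c r i κ × bot κ ≡ hD δ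
  across-hD sing = inj₁ (_ , refl , 0th)
  across-hD vert  = inj₂ (_ , vert , refl)
  across-hD lft  = inj₁ (_ , refl , 0th)
  across-hD rgt  = inj₁ (_ , refl , 0th)
  across-hD h₄ = inj₁ (_ , refl , 3rd)
  across-hD h₅ = inj₂ (_ , h₁ , refl)
  across-hD h₆ = inj₂ (_ , h₂ , refl)

  across-rD : ∀ {c r i δ} → DnRole c r i δ →
    Labelled c (rE r i) (rD δ) ⊎ ∃ λ κ → UpRole c r i κ × right κ ≡ rD δ
  across-rD sing = inj₁ (_ , refl , 1st)
  across-rD vert  = inj₁ (_ , refl , 3rd)
  across-rD lft  = inj₂ (_ , lft , refl)
  across-rD rgt  = inj₁ (_ , refl , 3rd)
  across-rD h₄ = inj₂ (_ , h₁ , refl)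
  across-rD h₅ = inj₁ (_ , refl , 5th)
  across-rD h₆ = inj₂ (_ , h₃ , refl)

  across-lD : ∀ {c r i δ} → DnRole c r i δ →
    Labelled c (lE r (suc i)) (lD δ) ⊎ ∃ λ κ → UpRole c r (suc i) κ × left κ ≡ lD δ
  across-lD sing = inj₁ (_ , refl , 2nd)
  across-lD vert  = inj₁ (_ , refl , 2nd)
  across-lD lft  = inj₁ (_ , refl , 1st)
  across-lD rgt  = inj₂ (_ , rgt , refl)
  across-lD h₄ = inj₂ (_ , h₂ , refl)
  across-lD h₅ = inj₂ (_ , h₃ , refl)
  across-lD h₆ = inj₁ (_ , refl , 1st)

-- Puzzles as arrays of kinds of upward triangles.

module Arrays where

  open import Data.Bool using (Bool; true; false; if_then_else_; T)
  open import Data.Bool.Properties using (T-≡)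
  open import Data.Nat using (ℕ; zero; suc; _<_; z≤n; s≤s; _∸_) renaming (_+_ to _+ℕ_)
  import Data.Nat.Properties as ℕₚ
  open import Data.List using (List; []; _∷_; _++_; map; length; concatMap; applyUpTo; reverse)
  open import Data.List.Properties using (length-applyUpTo; length-map; map-applyUpTo; unfold-reverse; length-reverse)
  open import Data.List.Membership.Propositional using (_∈_; find; lose)
  open import Data.List.Membership.Propositional.Properties using (∈-map⁻; ∈-map⁺; ∈-concatMap⁻; ∈-concatMap⁺; ∈-filter⁻; ∈-filter⁺)
  open import Data.List.Relation.Unary.Any using (here; there)
  open import Data.List.Relation.Unary.All using ([]; _∷_)
  open import Data.List.Relation.Unary.AllPairs using ([]; _∷_)
  open import Data.List.Relation.Unary.Unique.Propositional using (Unique)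
  open import Data.List.Relation.Unary.Unique.Propositional.Properties using (map⁺; filter⁺)
  open import Data.List.Properties using (∷-injectiveˡ; ∷-injectiveʳ)
  open import Data.Maybe using (just; nothing)
  open import Data.Product using (_×_; _,_; ∃)
  open import Data.Integer using (+_; _+_)
  import Data.Integer.Properties as ℤₚ
  import Data.Sum
  open import Function using (_∘_; Equivalence)
  open import Relation.Binary.PropositionalEquality
  open Sums
  open Rows
  open Puzzle
  open UnitLaw using (bitWord)
  open Codes using (unique-concatMap)

  at : {A : Set} → A → List A → ℕ → A
  at d []       i       = d
  at d (x ∷ xs) zero    = x
  at d (x ∷ xs) (suc i) = at d xs i

  at-map : {A B : Set} (f : A → B) (d : A) (xs : List A) (i : ℕ) → at (f d) (map f xs) i ≡ f (at d xs i)
  at-map f d []       i       = refl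
  at-map f d (x ∷ xs) zero    = refl
  at-map f d (x ∷ xs) (suc i) = at-map f d xs i

  at-applyUpTo : {A : Set} (d : A) (f : ℕ → A) (n i : ℕ) → i < n → at d (applyUpTo f n) i ≡ f i
  at-applyUpTo d f (suc n) zero    h       = refl
  at-applyUpTo d f (suc n) (suc i) (s≤s h) = at-applyUpTo d (f ∘ suc) n i h

  at-∷ʳ : {A : Set} (d : A) (xs : List A) (x : A) (i : ℕ) → i < length xs → at d (xs ++ x ∷ []) i ≡ at d xs i
  at-∷ʳ d (y ∷ xs) x zero    h       = refl
  at-∷ʳ d (y ∷ xs) x (suc i) (s≤s h) = at-∷ʳ d xs x i h

  at-∷ʳ-last : {A : Set} (d : A) (xs : List A) (x : A) → at d (xs ++ x ∷ []) (length xs) ≡ x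
  at-∷ʳ-last d []       x = refl
  at-∷ʳ-last d (y ∷ xs) x = at-∷ʳ-last d xs x

  at-reverse : {A : Set} (d : A) (xs : List A) (i : ℕ) → i < length xs → at d (reverse xs) i ≡ at d xs (length xs ∸ suc i)
  at-reverse d (x ∷ xs) i (s≤s i≤) rewrite unfold-reverse x xs with ℕₚ.m≤n⇒m<n∨m≡n i≤
  ... | Data.Sum.inj₁ lt = trans (at-∷ʳ d (reverse xs) x i (subst (i <_) (sym (length-reverse xs)) lt))
    (trans (at-reverse d xs i lt) (sym (cong (at d (x ∷ xs)) (ℕₚ.+-∸-assoc 1 lt))))
  ... | Data.Sum.inj₂ refl = trans (cong (at d (reverse xs ++ x ∷ [])) (sym (length-reverse xs))) (trans (at-∷ʳ-last d (reverse xs) x)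
    (sym (cong (at d (x ∷ xs)) (ℕₚ.n∸n≡0 (length xs)))))

  at-ext : {A : Set} (d : A) (xs ys : List A) → length xs ≡ length ys → (∀ i → i < length xs → at d xs i ≡ at d ys i) → xs ≡ ys
  at-ext d []       []       len h = refl
  at-ext d (x ∷ xs) (y ∷ ys) len h = cong₂ _∷_ (h 0 (s≤s z≤n)) (at-ext d xs ys (ℕₚ.suc-injective len) (λ i lt → h (suc i) (s≤s lt)))

  kindsFrom-complete : ∀ κ → κ ∈ kindsFrom (left κ)
  kindsFrom-complete (sing false) = here refl
  kindsFrom-complete (sing true)  = here refl
  kindsFrom-complete vR  = there (here refl)
  kindsFrom-complete lR  = there (here refl)
  kindsFrom-complete rR  = here refl
  kindsFrom-complete hx₁ = there (there (here refl))
  kindsFrom-complete hx₂ = here refl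
  kindsFrom-complete hx₃ = here refl

  kindsFrom-sound : ∀ ρ {κ} → κ ∈ kindsFrom ρ → left κ ≡ ρ
  kindsFrom-sound (bit false) (here refl) = refl
  kindsFrom-sound (bit false) (there (here refl)) = refl
  kindsFrom-sound (bit true) (here refl) = refl
  kindsFrom-sound (bit true) (there (here refl)) = refl
  kindsFrom-sound (bit true) (there (there (here refl))) = refl
  kindsFrom-sound i₁ (here refl) = refl
  kindsFrom-sound i₂ (here refl) = refl
  kindsFrom-sound i₃ (here refl) = refl

  kindsFrom-unique : ∀ ρ → Unique (kindsFrom ρ)
  kindsFrom-unique (bit false) = ((λ ()) ∷ []) ∷ [] ∷ []
  kindsFrom-unique (bit true)  = ((λ ()) ∷ (λ ()) ∷ []) ∷ ((λ ()) ∷ []) ∷ [] ∷ []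
  kindsFrom-unique i₁ = [] ∷ []
  kindsFrom-unique i₂ = [] ∷ []
  kindsFrom-unique i₃ = [] ∷ []

  isBit-sound : ∀ b c → T (isBit b c) → c ≡ bit b
  isBit-sound true  (bit true)  h = refl
  isBit-sound false (bit false) h = refl

  isBit-bit : ∀ b → isBit b (bit b) ≡ true
  isBit-bit true  = refl
  isBit-bit false = refl

  -- An arbitrary value for positions outside a list; configurations are compared only at positions
  -- inside the triangle.
  K₀ : Kind
  K₀ = sing false

  record IsRow (ρ : Lab) (w : List Lab) (b : Bool) (ks : List Kind) : Set where
    field
      len   : length ks ≡ suc (length w)
      first : left (at K₀ ks 0) ≡ ρ
      step  : ∀ i → i < length w → dn (right (at K₀ ks i)) (at (bit false) w i) ≡ just (left (at K₀ ks (suc i)))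
      last  : right (at K₀ ks (length w)) ≡ bit b

  rows⇒ : ∀ ρ w b {ks} → ks ∈ rows ρ w b → IsRow ρ w b ks
  rows⇒ ρ [] b ks∈ with κ , κ∈ , refl ← ∈-map⁻ (_∷ []) ks∈
    with κ∈′ , h ← ∈-filter⁻ _ {xs = kindsFrom ρ} κ∈ = record
    { len = refl ; first = kindsFrom-sound ρ κ∈′ ; step = λ _ () ; last = isBit-sound b _ h }
  rows⇒ ρ (u ∷ w) b ks∈ with κ , κ∈ , h ← find (∈-concatMap⁻ _ {xs = kindsFrom ρ} ks∈)
    with dn (right κ) u in e
  ... | just ρ′ with ks , ks∈′ , refl ← ∈-map⁻ (κ ∷_) h with ih ← rows⇒ ρ′ w b ks∈′ = record
    { len = cong suc (IsRow.len ih) ; first = kindsFrom-sound ρ κ∈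
    ; step = λ { zero _ → trans e (cong just (sym (IsRow.first ih))) ; (suc i) (s≤s lt) → IsRow.step ih i lt }
    ; last = IsRow.last ih }

  rows⇐ : ∀ ρ w b {ks} → IsRow ρ w b ks → ks ∈ rows ρ w b
  rows⇐ ρ [] b {κ ∷ []} h = ∈-map⁺ (_∷ []) (∈-filter⁺ _ (subst (λ ρ → κ ∈ kindsFrom ρ) (IsRow.first h) (kindsFrom-complete κ))
    (Equivalence.from T-≡ (trans (cong (isBit b) (IsRow.last h)) (isBit-bit b))))
  rows⇐ ρ [] b {κ ∷ κ′ ∷ ks} h with () ← IsRow.len h
  rows⇐ ρ (u ∷ w) b {κ ∷ ks} h = ∈-concatMap⁺ _ (lose (subst (λ ρ → κ ∈ kindsFrom ρ) (IsRow.first h) (kindsFrom-complete κ))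
    (subst (λ m → κ ∷ ks ∈ extend m (λ ρ′ → map (κ ∷_) (rows ρ′ w b))) (sym (IsRow.step h 0 (s≤s z≤n)))
      (∈-map⁺ (κ ∷_) (rows⇐ _ w b record { len = ℕₚ.suc-injective (IsRow.len h) ; first = refl
        ; step = λ i lt → IsRow.step h (suc i) (s≤s lt) ; last = IsRow.last h }))))

  unique-map-∷ : {A : Set} (x : A) {xss : List (List A)} → Unique xss → Unique (map (x ∷_) xss)
  unique-map-∷ x = map⁺ ∷-injectiveʳ

  rows-unique : ∀ ρ w b → Unique (rows ρ w b)
  rows-unique ρ []      b = map⁺ ∷-injectiveˡ (filter⁺ _ (kindsFrom-unique ρ))
  rows-unique ρ (u ∷ w) b = unique-concatMap _ (kindsFrom ρ) (kindsFrom-unique ρ) each heads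
    where
    each : ∀ κ → Unique (extend (dn (right κ) u) (λ ρ′ → map (κ ∷_) (rows ρ′ w b)))
    each κ with dn (right κ) u
    ... | nothing = []
    ... | just ρ′ = unique-map-∷ κ (rows-unique ρ′ w b)
    head-of : ∀ κ {ks} → ks ∈ extend (dn (right κ) u) (λ ρ′ → map (κ ∷_) (rows ρ′ w b)) → ∃ λ ks′ → ks ≡ κ ∷ ks′
    head-of κ h with dn (right κ) u
    ... | just ρ′ with ks′ , _ , e ← ∈-map⁻ (κ ∷_) h = ks′ , e
    heads : ∀ κ κ′ ks → ks ∈ extend (dn (right κ) u) (λ ρ′ → map (κ ∷_) (rows ρ′ w b)) →
            ks ∈ extend (dn (right κ′) u) (λ ρ′ → map (κ′ ∷_) (rows ρ′ w b)) → κ ≡ κ′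
    heads κ κ′ ks p q with _ , refl ← head-of κ p with _ , e ← head-of κ′ q = ∷-injectiveˡ e

  Conf : Set
  Conf = List (List Kind)

  bottom : List Bool → List Lab → List Conf
  bottom []      []      = [] ∷ []
  bottom (b ∷ ν) (c ∷ w) = if isBit b c then bottom ν w else []
  bottom _       _       = []

  confs : List Bool → List Bool → List Bool → List Lab → List Conf
  confs ν (l ∷ ls) (m ∷ ms) w = concatMap (λ ks → map (ks ∷_) (confs ν ls ms (map bot ks))) (rows (bit l) w m)
  confs ν []       []       w = bottom ν w
  confs ν _        _        w = []

  ∑-bottom : ∀ ν w → ∑ (bottom ν w) (λ _ → + 1) ≡ δ ν w
  ∑-bottom []      []      = refl
  ∑-bottom []      (_ ∷ _) = refl
  ∑-bottom (_ ∷ _) []      = refl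
  ∑-bottom (b ∷ ν) (c ∷ w) with isBit b c
  ... | true  = ∑-bottom ν w
  ... | false = refl

  ∑-confs : ∀ ν ls ms w → ∑ (confs ν ls ms w) (λ _ → + 1) ≡ PZ ls ms (δ ν) w
  ∑-confs ν []       []       w = trans (∑-bottom ν w) (sym (ℤₚ.+-identityʳ _))
  ∑-confs ν []       (_ ∷ _)  w = refl
  ∑-confs ν (_ ∷ _)  []       w = refl
  ∑-confs ν (l ∷ ls) (m ∷ ms) w = trans (∑-concatMap _ (rows (bit l) w m) _)
    (trans (∑-cong (rows (bit l) w m) (λ ks → trans (∑-map (ks ∷_) (confs ν ls ms (map bot ks)) _) (∑-confs ν ls ms (map bot ks))))
           (sym (∑-concatMap _ (rows (bit l) w m) _)))

  bottom⇒ : ∀ ν w {c} → c ∈ bottom ν w → c ≡ [] × w ≡ bitWord ν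
  bottom⇒ []      []      (here refl) = refl , refl
  bottom⇒ (b ∷ ν) (c ∷ w) h with isBit b c in e
  ... | true with e₁ , e₂ ← bottom⇒ ν w h = e₁ , cong₂ _∷_ (isBit-sound b c (Equivalence.from T-≡ e)) e₂

  bottom⇐ : ∀ ν → [] ∈ bottom ν (bitWord ν)
  bottom⇐ []      = here refl
  bottom⇐ (b ∷ ν) rewrite isBit-bit b = bottom⇐ ν

  bottom-unique : ∀ ν w → Unique (bottom ν w)
  bottom-unique []      []      = [] ∷ []
  bottom-unique []      (_ ∷ _) = []
  bottom-unique (_ ∷ _) []      = []
  bottom-unique (b ∷ ν) (c ∷ w) with isBit b c
  ... | true  = bottom-unique ν w
  ... | false = []

  confs-unique : ∀ ν ls ms w → Unique (confs ν ls ms w)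
  confs-unique ν []       []       w = bottom-unique ν w
  confs-unique ν []       (_ ∷ _)  w = []
  confs-unique ν (_ ∷ _)  []       w = []
  confs-unique ν (l ∷ ls) (m ∷ ms) w = unique-concatMap _ (rows (bit l) w m) (rows-unique (bit l) w m)
    (λ ks → unique-map-∷ ks (confs-unique ν ls ms (map bot ks))) heads
    where
    heads : ∀ ks ks′ c → c ∈ map (ks ∷_) (confs ν ls ms (map bot ks)) → c ∈ map (ks′ ∷_) (confs ν ls ms (map bot ks′)) → ks ≡ ks′
    heads ks ks′ c p q with _ , _ , refl ← ∈-map⁻ (ks ∷_) p with _ , _ , e ← ∈-map⁻ (ks′ ∷_) q = ∷-injectiveˡ e

  kind : Conf → ℕ → ℕ → Kind
  kind c r i = at K₀ (at [] c r) i

  above : (ℕ → Lab) → (ℕ → ℕ → Kind) → ℕ → ℕ → Lab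
  above H K zero    i = H i
  above H K (suc r) i = bot (K r i)

  above-shift : ∀ H K r i → above (λ i → bot (K 0 i)) (K ∘ suc) r i ≡ above H K (suc r) i
  above-shift H K zero    i = refl
  above-shift H K (suc r) i = refl

  -- A trapezoid of m rows below a word of length a. The general a is what the induction needs:
  -- without its top row the array lies below a word of length a + 1. Puzzles are the case a = 0.
  record Array (a m : ℕ) (H : ℕ → Lab) (ls ms ν : List Bool) (K : ℕ → ℕ → Kind) : Set where
    field
      first : ∀ r → r < m → left (K r 0) ≡ bit (at false ls r)
      step  : ∀ r i → r < m → i < a +ℕ r → dn (right (K r i)) (above H K r i) ≡ just (left (K r (suc i)))
      last  : ∀ r → r < m → right (K r (a +ℕ r)) ≡ bit (at false ms r)
      end   : ∀ i → i < a +ℕ m → above H K m i ≡ bit (at false ν i)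

  confOf : ℕ → ℕ → (ℕ → ℕ → Kind) → Conf
  confOf a m K = applyUpTo (λ r → applyUpTo (K r) (suc (a +ℕ r))) m

  confOf-suc : ∀ a m K → confOf a (suc m) K ≡ applyUpTo (K 0) (suc a) ∷ confOf (suc a) m (K ∘ suc)
  confOf-suc a m K = cong₂ _∷_ (cong (λ l → applyUpTo (K 0) (suc l)) (ℕₚ.+-identityʳ a))
    (applyUpTo-cong m (λ r → cong (λ l → applyUpTo (K (suc r)) (suc l)) (ℕₚ.+-suc a r)))
    where
    applyUpTo-cong : {A : Set} {f g : ℕ → A} → ∀ m → (∀ r → f r ≡ g r) → applyUpTo f m ≡ applyUpTo g m
    applyUpTo-cong zero    h = refl
    applyUpTo-cong (suc m) h = cong₂ _∷_ (h 0) (applyUpTo-cong m (h ∘ suc))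

  array⇒conf : ∀ a m H ls ms ν K → length ls ≡ m → length ms ≡ m → length ν ≡ a +ℕ m → Array a m H ls ms ν K →
               confOf a m K ∈ confs ν ls ms (applyUpTo H a)
  array⇒conf a zero H [] [] ν K _ _ lν A = subst (λ w → [] ∈ bottom ν w) (sym word) (bottom⇐ ν)
    where
    word : applyUpTo H a ≡ bitWord ν
    word = at-ext (bit false) _ _ (trans (length-applyUpTo H a) (sym (trans (length-map bit ν) (trans lν (ℕₚ.+-identityʳ a)))))
      (λ i lt → let lt′ = subst (i <_) (length-applyUpTo H a) lt in
        trans (at-applyUpTo (bit false) H a i lt′) (trans (Array.end A i (ℕₚ.≤-trans lt′ (ℕₚ.m≤m+n a 0))) (sym (at-map bit false ν i))))
  array⇒conf a (suc m) H (l ∷ ls) (b ∷ ms) ν K lls lms lν A = subst (_∈ confs ν (l ∷ ls) (b ∷ ms) (applyUpTo H a)) (sym (confOf-suc a m K))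
    (∈-concatMap⁺ _ (lose (rows⇐ (bit l) (applyUpTo H a) b topRow) (∈-map⁺ (ks ∷_)
      (subst (λ w → confOf (suc a) m (K ∘ suc) ∈ confs ν ls ms w) (sym (map-applyUpTo (K 0) bot (suc a)))
        (array⇒conf (suc a) m (λ i → bot (K 0 i)) ls ms ν (K ∘ suc) (ℕₚ.suc-injective lls) (ℕₚ.suc-injective lms) (trans lν (ℕₚ.+-suc a m)) shifted)))))
    where
    open Array A
    ks = applyUpTo (K 0) (suc a)
    la = length-applyUpTo H a
    topRow : IsRow (bit l) (applyUpTo H a) b ks
    topRow = record
      { len = trans (length-applyUpTo (K 0) (suc a)) (cong suc (sym la))
      ; first = first 0 (s≤s z≤n)
      ; step = λ i lt → let lt′ = subst (i <_) la lt in
          trans (cong₂ (λ κ h → dn (right κ) h) (at-applyUpTo K₀ (K 0) (suc a) i (ℕₚ.m<n⇒m<1+n lt′)) (at-applyUpTo (bit false) H a i lt′))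
            (trans (step 0 i (s≤s z≤n) (ℕₚ.≤-trans lt′ (ℕₚ.m≤m+n a 0)))
              (cong (just ∘ left) (sym (at-applyUpTo K₀ (K 0) (suc a) (suc i) (s≤s lt′)))))
      ; last = trans (cong right (trans (cong (at K₀ ks) la) (at-applyUpTo K₀ (K 0) (suc a) a (ℕₚ.n<1+n a))))
          (trans (cong (λ j → right (K 0 j)) (sym (ℕₚ.+-identityʳ a))) (last 0 (s≤s z≤n))) }
    shifted : Array (suc a) m (λ i → bot (K 0 i)) ls ms ν (K ∘ suc)
    shifted = record
      { first = λ r lt → first (suc r) (s≤s lt)
      ; step = λ r i lt lt′ → trans (cong (dn (right (K (suc r) i))) (above-shift H K r i))
          (step (suc r) i (s≤s lt) (subst (i <_) (sym (ℕₚ.+-suc a r)) lt′))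
      ; last = λ r lt → trans (cong (λ j → right (K (suc r) j)) (sym (ℕₚ.+-suc a r))) (last (suc r) (s≤s lt))
      ; end = λ i lt → trans (above-shift H K m i) (end i (subst (i <_) (sym (ℕₚ.+-suc a m)) lt)) }

  conf⇒array : ∀ ν ls ms w c → c ∈ confs ν ls ms w →
               Array (length w) (length ls) (at (bit false) w) ls ms ν (kind c)
  conf⇒array ν [] [] w c c∈ with refl , refl ← bottom⇒ ν w c∈ = record
    { first = λ _ () ; step = λ _ _ () ; last = λ _ () ; end = λ i _ → at-map bit false ν i }
  conf⇒array ν (l ∷ ls) (b ∷ ms) w c c∈
    with ks , ks∈ , h ← find (∈-concatMap⁻ _ {xs = rows (bit l) w b} c∈)
    with c′ , c′∈ , refl ← ∈-map⁻ (ks ∷_) h = record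
    { first = λ { zero _ → R.first ; (suc r) (s≤s lt) → A.first r lt }
    ; step = λ { zero i _ lt → R.step i (subst (i <_) (ℕₚ.+-identityʳ _) lt)
               ; (suc r) i (s≤s lt) lt′ → trans (cong (dn (right (kind c′ r i))) (sym (shift r i)))
                   (A.step r i lt (subst (i <_) (trans (ℕₚ.+-suc _ r) (cong (_+ℕ r) (sym len′))) lt′)) }
    ; last = λ { zero _ → trans (cong (λ j → right (at K₀ ks j)) (ℕₚ.+-identityʳ _)) R.last
               ; (suc r) (s≤s lt) → trans (cong (λ j → right (kind c′ r j)) (trans (ℕₚ.+-suc _ r) (cong (_+ℕ r) (sym len′)))) (A.last r lt) }
    ; end = λ i lt → trans (sym (shift (length ls) i)) (A.end i (subst (i <_) (trans (ℕₚ.+-suc _ _) (cong (_+ℕ length ls) (sym len′))) lt)) }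
    where
    module R = IsRow (rows⇒ (bit l) w b ks∈)
    module A = Array (conf⇒array ν ls ms (map bot ks) c′ c′∈)
    len′ : length (map bot ks) ≡ suc (length w)
    len′ = trans (length-map bot ks) R.len
    shift : ∀ r i → above (at (bit false) (map bot ks)) (kind c′) r i ≡ above (at (bit false) w) (kind (ks ∷ c′)) (suc r) i
    shift zero    i = at-map bot K₀ ks i
    shift (suc r) i = refl

  conf-shape : ∀ ν ls ms w c → c ∈ confs ν ls ms w → length c ≡ length ls × (∀ r → r < length ls → length (at [] c r) ≡ suc (length w +ℕ r))
  conf-shape ν [] [] w c c∈ with refl , refl ← bottom⇒ ν w c∈ = refl , λ _ ()
  conf-shape ν (l ∷ ls) (b ∷ ms) w c c∈
    with ks , ks∈ , h ← find (∈-concatMap⁻ _ {xs = rows (bit l) w b} c∈)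
    with c′ , c′∈ , refl ← ∈-map⁻ (ks ∷_) h
    with len , shape ← conf-shape ν ls ms (map bot ks) c′ c′∈ = cong suc len ,
    λ { zero _ → trans R.len (cong suc (sym (ℕₚ.+-identityʳ _)))
      ; (suc r) (s≤s lt) → trans (shape r lt) (cong suc (trans (cong (_+ℕ r) (trans (length-map bot ks) R.len)) (sym (ℕₚ.+-suc _ r)))) }
    where module R = IsRow (rows⇒ (bit l) w b ks∈)

-- The tiling determined by an array.

module Tiling where

  open import Data.Bool using (Bool; true; false)
  open import Data.Nat using (ℕ; zero; suc; _≤_; _<_; z≤n; s≤s)
  import Data.Nat.Properties as ℕₚ
  open import Data.List using (List; [])
  open import Data.List.Membership.Propositional using (_∈_)
  open import Data.List.Relation.Unary.Any using (here; there)
  open import Data.Maybe using (just)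
  open import Data.Product using (_×_; _,_; proj₁; proj₂; ∃; ∃₂)
  open import Data.Sum using (inj₁; inj₂)
  open import Data.Empty using (⊥; ⊥-elim)
  open import Relation.Binary.PropositionalEquality
  open import Relation.Nullary using (Dec; no)
  open import Relation.Nullary.Decidable using (map′; _×-dec_)
  open import Defs
  open Rows using (Lab; bit; i₁; i₂; i₃; Kind; sing; vR; lR; rR; hx₁; hx₂; hx₃; left; right; bot; dn; codeLab; uncodeLab; uncode-codeLab)
  open Codes
  open Arrays

  -- The eight defined values of `dn` correspond to the eight kinds of downward triangles, so each
  -- step condition of an array says that such a triangle fits in the gap.
  dn-view : ∀ ρ h {λ′} → dn ρ h ≡ just λ′ → ∃ λ δ → hD δ ≡ h × rD δ ≡ ρ × lD δ ≡ λ′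
  dn-view (bit false) (bit false) refl = dsing false , refl , refl , refl
  dn-view (bit false) i₁ refl = dv , refl , refl , refl
  dn-view (bit false) i₂ refl = d₅ , refl , refl , refl
  dn-view (bit true) (bit false) refl = dr , refl , refl , refl
  dn-view (bit true) (bit true) refl = dsing true , refl , refl , refl
  dn-view i₁ (bit true) refl = dl , refl , refl , refl
  dn-view i₂ (bit false) refl = d₄ , refl , refl , refl
  dn-view i₃ i₃ refl = d₆ , refl , refl , refl

  dn-labels : ∀ δ → dn (rD δ) (hD δ) ≡ just (lD δ)
  dn-labels (dsing false) = refl
  dn-labels (dsing true)  = refl
  dn-labels dv = refl
  dn-labels dl = refl
  dn-labels dr = refl
  dn-labels d₄ = refl
  dn-labels d₅ = refl
  dn-labels d₆ = refl

  dnKind : Lab → Lab → DnKind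
  dnKind i₁ _ = dv
  dnKind i₂ _ = d₅
  dnKind i₃ _ = d₆
  dnKind (bit true)  i₁ = dl
  dnKind (bit false) i₂ = d₄
  dnKind (bit false) (bit true) = dr
  dnKind (bit b) _ = dsing b

  dnKind-labels : ∀ δ → dnKind (hD δ) (rD δ) ≡ δ
  dnKind-labels (dsing false) = refl
  dnKind-labels (dsing true)  = refl
  dnKind-labels dv = refl
  dnKind-labels dl = refl
  dnKind-labels dr = refl
  dnKind-labels d₄ = refl
  dnKind-labels d₅ = refl
  dnKind-labels d₆ = refl

  dnKind-injective : ∀ {δ δ′} → hD δ ≡ hD δ′ → rD δ ≡ rD δ′ → δ ≡ δ′
  dnKind-injective {δ} {δ′} p q = trans (sym (dnKind-labels δ)) (trans (cong₂ dnKind p q) (dnKind-labels δ′))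

  -- Rigidity: an interior label, together with the direction of its edge, determines the triangle
  -- on either side. This is why a rhombus or hexagon, once begun, is completed correctly.
  left-i₁ : ∀ κ → left κ ≡ i₁ → κ ≡ rR
  left-i₁ rR refl = refl
  left-i₂ : ∀ κ → left κ ≡ i₂ → κ ≡ hx₂
  left-i₂ hx₂ refl = refl
  left-i₃ : ∀ κ → left κ ≡ i₃ → κ ≡ hx₃
  left-i₃ hx₃ refl = refl
  right-i₁ : ∀ κ → right κ ≡ i₁ → κ ≡ lR
  right-i₁ lR refl = refl
  right-i₂ : ∀ κ → right κ ≡ i₂ → κ ≡ hx₁
  right-i₂ hx₁ refl = refl
  bot-i₁ : ∀ κ → bot κ ≡ i₁ → κ ≡ vR
  bot-i₁ vR refl = refl
  bot-i₂ : ∀ κ → bot κ ≡ i₂ → κ ≡ hx₁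
  bot-i₂ hx₁ refl = refl
  bot-i₃ : ∀ κ → bot κ ≡ i₃ → κ ≡ hx₂
  bot-i₃ hx₂ refl = refl
  hD-i₁ : ∀ δ → hD δ ≡ i₁ → δ ≡ dv
  hD-i₁ dv refl = refl
  hD-i₂ : ∀ δ → hD δ ≡ i₂ → δ ≡ d₅
  hD-i₂ d₅ refl = refl
  hD-i₃ : ∀ δ → hD δ ≡ i₃ → δ ≡ d₆
  hD-i₃ d₆ refl = refl
  rD-i₁ : ∀ δ → rD δ ≡ i₁ → δ ≡ dl
  rD-i₁ dl refl = refl
  rD-i₂ : ∀ δ → rD δ ≡ i₂ → δ ≡ d₄
  rD-i₂ d₄ refl = refl
  lD-i₁ : ∀ δ → lD δ ≡ i₁ → δ ≡ dr
  lD-i₁ dr refl = refl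
  lD-i₂ : ∀ δ → lD δ ≡ i₂ → δ ≡ d₄
  lD-i₂ d₄ refl = refl
  lD-i₃ : ∀ δ → lD δ ≡ i₃ → δ ≡ d₅
  lD-i₃ d₅ refl = refl

  _≟ᴸ_ : (l m : Lab) → Dec (l ≡ m)
  l ≟ᴸ m = map′ (λ e → trans (sym (uncode-codeLab l)) (trans (cong uncodeLab e) (uncode-codeLab m))) (cong codeLab) (codeLab l ℕₚ.≟ codeLab m)

  codeKind : Kind → ℕ
  codeKind (sing false) = 0
  codeKind (sing true)  = 1
  codeKind vR  = 2
  codeKind lR  = 3
  codeKind rR  = 4
  codeKind hx₁ = 5
  codeKind hx₂ = 6
  codeKind hx₃ = 7

  uncodeKind : ℕ → Kind
  uncodeKind 0 = sing false
  uncodeKind 1 = sing true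
  uncodeKind 2 = vR
  uncodeKind 3 = lR
  uncodeKind 4 = rR
  uncodeKind 5 = hx₁
  uncodeKind 6 = hx₂
  uncodeKind _ = hx₃

  uncode-codeKind : ∀ κ → uncodeKind (codeKind κ) ≡ κ
  uncode-codeKind (sing false) = refl
  uncode-codeKind (sing true)  = refl
  uncode-codeKind vR  = refl
  uncode-codeKind lR  = refl
  uncode-codeKind rR  = refl
  uncode-codeKind hx₁ = refl
  uncode-codeKind hx₂ = refl
  uncode-codeKind hx₃ = refl

  _≟ᴷ_ : (κ κ′ : Kind) → Dec (κ ≡ κ′)
  κ ≟ᴷ κ′ = map′ (λ e → trans (sym (uncode-codeKind κ)) (trans (cong uncodeKind e) (uncode-codeKind κ′))) (cong codeKind) (codeKind κ ℕₚ.≟ codeKind κ′)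

  -- A piece with an upward part is recognised by one of its upward triangles, since interior labels
  -- force the rest. A single downward triangle leaves no trace of its own in the array and is
  -- recognised by its three edges.
  Placed : (ℕ → ℕ → Kind) → Code → Set
  Placed K (upS r i b) = K r i ≡ sing b
  Placed K (vC r i)    = K r i ≡ vR
  Placed K (lC r i)    = K r i ≡ lR
  Placed K (rC r i)    = K r (suc i) ≡ rR
  Placed K (hC r i)    = K r i ≡ hx₁
  Placed K (dnS zero i b)    = ⊥
  Placed K (dnS (suc r) i b) = bot (K r i) ≡ bit b × right (K (suc r) i) ≡ bit b × left (K (suc r) (suc i)) ≡ bit b

  placed? : ∀ K c → Dec (Placed K c)
  placed? K (upS r i b) = K r i ≟ᴷ sing b
  placed? K (vC r i)    = K r i ≟ᴷ vR
  placed? K (lC r i)    = K r i ≟ᴷ lR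
  placed? K (rC r i)    = K r (suc i) ≟ᴷ rR
  placed? K (hC r i)    = K r i ≟ᴷ hx₁
  placed? K (dnS zero i b)    = no (λ ())
  placed? K (dnS (suc r) i b) = (bot (K r i) ≟ᴸ bit b) ×-dec (right (K (suc r) i) ≟ᴸ bit b) ×-dec (left (K (suc r) (suc i)) ≟ᴸ bit b)

  DnAt : (ℕ → ℕ → Kind) → ℕ → ℕ → DnKind → Set
  DnAt K r i δ = hD δ ≡ bot (K r i) × rD δ ≡ right (K (suc r) i) × lD δ ≡ left (K (suc r) (suc i))

  module FromArray {n : ℕ} {H : ℕ → Lab} {ls ms ν : List Bool} {K : ℕ → ℕ → Kind} (A : Array 0 n H ls ms ν K) where
    open Array A

    dnAt : ∀ r i → suc r < n → i ≤ r → ∃ (DnAt K r i)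
    dnAt r i r< i≤ = dn-view _ _ (step (suc r) i r< (s≤s i≤))

    -- The sides of the puzzle carry bits, so an edge with an interior label is not on the boundary;
    -- pieces therefore stay inside the triangle.
    bot-interior : ∀ r i → r < n → i ≤ r → (∀ b → bot (K r i) ≢ bit b) → suc r < n
    bot-interior r i r< i≤ ne with ℕₚ.m≤n⇒m<n∨m≡n r<
    ... | inj₁ lt = lt
    ... | inj₂ refl = ⊥-elim (ne _ (end i (s≤s i≤)))

    right-interior : ∀ r i → r < n → i ≤ r → (∀ b → right (K r i) ≢ bit b) → i < r
    right-interior r i r< i≤ ne with ℕₚ.m≤n⇒m<n∨m≡n i≤
    ... | inj₁ lt = lt
    ... | inj₂ refl = ⊥-elim (ne _ (last r r<))

    left-interior : ∀ r i → r < n → (∀ b → left (K r i) ≢ bit b) → ∃ λ i′ → i ≡ suc i′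
    left-interior r zero    r< ne = ⊥-elim (ne _ (first r r<))
    left-interior r (suc i) r< ne = i , refl

    via-h : ∀ {r i} δ → suc r < n → i ≤ r → (∀ δ′ → hD δ′ ≡ bot (K r i) → δ′ ≡ δ) → DnAt K r i δ
    via-h {r} {i} δ r< i≤ inv with δ′ , d@(p , _) ← dnAt r i r< i≤ with refl ← inv δ′ p = d

    via-r : ∀ {r i} δ → suc r < n → i ≤ r → (∀ δ′ → rD δ′ ≡ right (K (suc r) i) → δ′ ≡ δ) → DnAt K r i δ
    via-r {r} {i} δ r< i≤ inv with δ′ , d@(_ , p , _) ← dnAt r i r< i≤ with refl ← inv δ′ p = d

    via-l : ∀ {r i} δ → suc r < n → i ≤ r → (∀ δ′ → lD δ′ ≡ left (K (suc r) (suc i)) → δ′ ≡ δ) → DnAt K r i δ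
    via-l {r} {i} δ r< i≤ inv with δ′ , d@(_ , _ , p) ← dnAt r i r< i≤ with refl ← inv δ′ p = d

    hex-d₄ : ∀ {r i} → K (suc r) i ≡ hx₁ → suc r < n → i ≤ r → DnAt K r i d₄
    hex-d₄ e r< i≤ = via-r d₄ r< i≤ (λ δ p → rD-i₂ δ (trans p (cong right e)))

    hex-d₅ : ∀ {r i} → K r i ≡ hx₁ → suc r < n → i ≤ r → DnAt K r i d₅
    hex-d₅ e r< i≤ = via-h d₅ r< i≤ (λ δ p → hD-i₂ δ (trans p (cong bot e)))

    hex-hx₂ : ∀ {r i} → K r i ≡ hx₁ → suc r < n → i < r → K r (suc i) ≡ hx₂
    hex-hx₂ {suc r} e r< (s≤s i≤) = left-i₂ _ (sym (proj₂ (proj₂ (hex-d₄ e (ℕₚ.<⇒≤ r<) i≤))))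

    hex-hx₃ : ∀ {r i} → K r i ≡ hx₁ → suc r < n → i < r → K (suc r) (suc i) ≡ hx₃
    hex-hx₃ e r< i< = left-i₃ _ (sym (proj₂ (proj₂ (hex-d₅ e r< (ℕₚ.<⇒≤ i<)))))

    placed-up : ∀ {c r i κ} → InRange n c → Placed K c → UpRole c r i κ → K r i ≡ κ
    placed-up _ e sing = e
    placed-up _ e vert = e
    placed-up _ e lft  = e
    placed-up _ e rgt  = e
    placed-up _ e h₁   = e
    placed-up (p , q) e h₂ = hex-hx₂ e p q
    placed-up (p , q) e h₃ = hex-hx₃ e p q

    placed-dn : ∀ {c r i δ} → InRange n c → Placed K c → DnRole c (suc r) i δ → DnAt K r i δ
    placed-dn _ (p , q , s) sing = sym p , sym q , sym s
    placed-dn (p , q) e vert = via-h dv p q (λ δ h → hD-i₁ δ (trans h (cong bot e)))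
    placed-dn (p , s≤s q) e lft = via-r dl p q (λ δ h → rD-i₁ δ (trans h (cong right e)))
    placed-dn (p , s≤s q) e rgt = via-l dr p q (λ δ h → lD-i₁ δ (trans h (cong left e)))
    placed-dn (p , s≤s q) e h₄ = hex-d₄ e (ℕₚ.<⇒≤ p) q
    placed-dn (p , q) e h₅ = hex-d₅ e p (ℕₚ.<⇒≤ q)
    placed-dn (p , q) e h₆ = via-h d₆ p q (λ δ h → hD-i₃ δ (trans h (cong bot (hex-hx₂ e p q))))

    interior : ∀ {l m : Lab} → l ≡ m → (∀ b → m ≢ bit b) → ∀ b → l ≢ bit b
    interior refl ne = ne

    -- For hx₂ and hx₃ the interior labels lead back through d₄ or d₅ to the triangle hx₁ by which
    -- the hexagon is named.
    cover-up : ∀ r i → r < n → i ≤ r → ∃ λ c → InRange n c × Placed K c × UpRole c r i (K r i)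
    cover-up r i r< i≤ with K r i in e
    ... | sing b = upS r i b , (r< , i≤) , e , sing
    ... | vR  = vC r i , (bot-interior r i r< i≤ (interior (cong bot e) (λ _ ())) , i≤) , e , vert
    ... | lR  = lC r i , (r< , right-interior r i r< i≤ (interior (cong right e) (λ _ ()))) , e , lft
    ... | hx₁ = hC r i , (bot-interior r i r< i≤ (interior (cong bot e) (λ _ ())) , right-interior r i r< i≤ (interior (cong right e) (λ _ ()))) , e , h₁
    ... | rR with i′ , refl ← left-interior r i r< (interior (cong left e) (λ _ ())) = rC r i′ , (r< , i≤) , e , rgt
    cover-up (suc r) i r< i≤ | hx₂ with i′ , refl ← left-interior (suc r) i r< (interior (cong left e) (λ _ ())) =
      hC (suc r) i′ , (bot-interior (suc r) i r< i≤ (interior (cong bot e) (λ _ ())) , i≤) ,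
      right-i₂ _ (sym (proj₁ (proj₂ (via-l d₄ r< (ℕₚ.≤-pred i≤) (λ δ p → lD-i₂ δ (trans p (cong left e))))))) , h₂
    cover-up (suc r) i r< i≤ | hx₃ with i′ , refl ← left-interior (suc r) i r< (interior (cong left e) (λ _ ())) =
      hC r i′ , (r< , right-interior r i′ (ℕₚ.<⇒≤ r<) (ℕₚ.≤-pred i≤) (interior (cong right e′) (λ _ ()))) , e′ , h₃
      where
      e′ : K r i′ ≡ hx₁
      e′ = bot-i₂ _ (sym (proj₁ (via-l d₅ r< (ℕₚ.≤-pred i≤) (λ δ p → lD-i₃ δ (trans p (cong left e))))))
    cover-up zero i r< z≤n | hx₂ with () ← proj₂ (left-interior zero i r< (interior (cong left e) (λ _ ())))
    cover-up zero i r< z≤n | hx₃ with () ← proj₂ (left-interior zero i r< (interior (cong left e) (λ _ ())))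

    cover-dn : ∀ r i → suc r < n → i ≤ r → ∃₂ λ c δ → InRange n c × Placed K c × DnRole c (suc r) i δ
    cover-dn r i r< i≤ with dnAt r i r< i≤
    ... | dsing b , p , q , s = dnS (suc r) i b , _ , (r< , s≤s i≤) , (sym p , sym q , sym s) , sing
    ... | dv , p , q , s = vC r i , _ , (r< , i≤) , bot-i₁ _ (sym p) , vert
    ... | dl , p , q , s = lC (suc r) i , _ , (r< , s≤s i≤) , right-i₁ _ (sym q) , lft
    ... | dr , p , q , s = rC (suc r) i , _ , (r< , s≤s i≤) , left-i₁ _ (sym s) , rgt
    ... | d₄ , p , q , s = hC (suc r) i , _ , (bot-interior (suc r) i r< (ℕₚ.m≤n⇒m≤1+n i≤) (interior (cong bot e) (λ _ ())) , s≤s i≤) , e , h₄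
      where e = right-i₂ (K (suc r) i) (sym q)
    ... | d₅ , p , q , s = hC r i , _ , (r< , right-interior r i (ℕₚ.<⇒≤ r<) i≤ (interior (cong right e) (λ _ ()))) , e , h₅
      where e = bot-i₂ (K r i) (sym p)
    ... | d₆ , p , q , s with cover-up r i (ℕₚ.<⇒≤ r<) i≤
    ...   | c , rg , pl , role rewrite bot-i₃ (K r i) (sym p) with h₂ ← role = c , _ , rg , pl , h₆

    unique-up : ∀ {c c′ r i κ κ′} → InRange n c → InRange n c′ → Placed K c → Placed K c′ → UpRole c r i κ → UpRole c′ r i κ′ → c ≡ c′
    unique-up rg rg′ pl pl′ u u′ with refl ← trans (sym (placed-up rg pl u)) (placed-up rg′ pl′ u′) = upRole-code u u′

    unique-dn : ∀ {c c′ r i δ δ′} → InRange n c → InRange n c′ → Placed K c → Placed K c′ → DnRole c r i δ → DnRole c′ r i δ′ → c ≡ c′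
    unique-dn {r = zero} rg rg′ pl pl′ d d′ with _ , () ← dnRole-range rg d
    unique-dn {r = suc r} rg rg′ pl pl′ d d′ with p , q , _ ← placed-dn rg pl d with p′ , q′ , _ ← placed-dn rg′ pl′ d′
      with refl ← dnKind-injective (trans p (sym p′)) (trans q (sym q′)) = dnRole-code d d′

    edgeLabel : Edge → Lab
    edgeLabel (lE r i)       = left (K r i)
    edgeLabel (rE r i)       = right (K r i)
    edgeLabel (hE zero i)    = bit false
    edgeLabel (hE (suc r) i) = bot (K r i)

    placed-labels : ∀ c {e b} → InRange n c → Placed K c → (e , b) ∈ labels ⟦ c ⟧ → edgeLabel e ≡ bit b
    placed-labels (upS r i b) _ e (here refl) = cong left e
    placed-labels (upS r i b) _ e (there (here refl)) = cong right e
    placed-labels (upS r i b) _ e (there (there (here refl))) = cong bot e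
    placed-labels (dnS (suc r) i b) _ (p , q , s) (here refl) = p
    placed-labels (dnS (suc r) i b) _ (p , q , s) (there (here refl)) = q
    placed-labels (dnS (suc r) i b) _ (p , q , s) (there (there (here refl))) = s
    placed-labels (vC r i) rg e (here refl) = cong left e
    placed-labels (vC r i) rg e (there (here refl)) = cong right e
    placed-labels (vC r i) rg e (there (there (here refl))) = sym (proj₂ (proj₂ (placed-dn rg e vert)))
    placed-labels (vC r i) rg e (there (there (there (here refl)))) = sym (proj₁ (proj₂ (placed-dn rg e vert)))
    placed-labels (lC (suc r) i) rg e (here refl) = sym (proj₁ (placed-dn rg e lft))
    placed-labels (lC zero i) (_ , ()) e (here refl)
    placed-labels (lC (suc r) i) rg e (there (here refl)) = sym (proj₂ (proj₂ (placed-dn rg e lft)))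
    placed-labels (lC zero i) (_ , ()) e (there (here refl))
    placed-labels (lC r i) rg e (there (there (here refl))) = cong bot e
    placed-labels (lC r i) rg e (there (there (there (here refl)))) = cong left e
    placed-labels (rC (suc r) i) rg e (here refl) = sym (proj₁ (placed-dn rg e rgt))
    placed-labels (rC zero i) (_ , ()) e (here refl)
    placed-labels (rC r i) rg e (there (here refl)) = cong right e
    placed-labels (rC r i) rg e (there (there (here refl))) = cong bot e
    placed-labels (rC (suc r) i) rg e (there (there (there (here refl)))) = sym (proj₁ (proj₂ (placed-dn rg e rgt)))
    placed-labels (rC zero i) (_ , ()) e (there (there (there (here refl))))
    placed-labels (hC r i) rg e (here refl) = cong bot (placed-up rg e h₃)
    placed-labels (hC r i) rg e (there (here refl)) = sym (proj₂ (proj₂ (placed-dn rg e h₆)))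
    placed-labels (hC r i) rg e (there (there (here refl))) = cong right (placed-up rg e h₂)
    placed-labels (hC (suc r) i) rg e (there (there (there (here refl)))) = sym (proj₁ (placed-dn rg e h₄))
    placed-labels (hC zero i) (_ , ()) e (there (there (there (here refl))))
    placed-labels (hC r i) rg e (there (there (there (there (here refl))))) = cong left e
    placed-labels (hC r i) rg e (there (there (there (there (there (here refl)))))) = sym (proj₁ (proj₂ (placed-dn rg e h₅)))

-- Bijection between tilings and configurations.

module Counting where

  open import Data.Bool using (Bool; true; false; _∧_; _∨_; not)
  open import Data.Bool.Properties using (T-≡)
  open import Data.Nat using (ℕ; zero; suc; _≤_; _<_; z≤n; s≤s; _∸_; _≡ᵇ_)
  import Data.Nat.Properties as ℕₚ
  open import Data.List using (List; []; _∷_; _++_; map; length; concatMap; filterᵇ; filter; upTo; zip; reverse; applyUpTo)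
  open import Data.List.Properties using (length-reverse; length-map; length-++; map-upTo; filter-accept; filter-reject)
  open import Data.List.Membership.Propositional using (_∈_; find; lose)
  open import Data.List.Membership.Propositional.Properties
  open import Data.List.Relation.Unary.Any using (here; there)
  open import Data.List.Relation.Unary.All using (All; []; _∷_)
  import Data.List.Relation.Unary.All as All
  open import Data.List.Relation.Unary.AllPairs using ([]; _∷_)
  open import Data.List.Relation.Unary.Unique.Propositional using (Unique)
  import Data.List.Relation.Unary.Unique.Propositional.Properties as Uniqueₚ
  open import Data.Maybe using (just)
  open import Data.Product using (_×_; _,_; proj₁; proj₂; ∃; ∃₂)
  open import Data.Sum using (_⊎_; inj₁; inj₂)
  open import Data.Empty using (⊥; ⊥-elim)
  open import Data.Integer using (+_)
  open import Function using (_∘_; Equivalence)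
  open import Relation.Binary.PropositionalEquality
  open import Relation.Nullary using (yes; no; contradiction)
  open import Relation.Unary using (Pred; Decidable)
  open import Level using (0ℓ)
  open import Defs
  open Sums using (∑-length)
  open Rows using (bit; Kind; sing; left; right; bot; dn; ≡ᵇ-sound; ≡ᵇ-refl; ∧-split)
  open Puzzle using (puzzles)
  open Codes
  open Arrays
  open Tiling

  private variable
    X Y : Set

  all⇒ : (p : X → Bool) {xs : List X} → all p xs ≡ true → ∀ {x} → x ∈ xs → p x ≡ true
  all⇒ p {y ∷ xs} h (here refl) = proj₁ (∧-split h)
  all⇒ p {y ∷ xs} h (there x∈)  = all⇒ p (proj₂ (∧-split {p y} h)) x∈

  all⇐ : (p : X → Bool) (xs : List X) → (∀ {x} → x ∈ xs → p x ≡ true) → all p xs ≡ true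
  all⇐ p []       h = refl
  all⇐ p (x ∷ xs) h = cong₂ _∧_ (h (here refl)) (all⇐ p xs (h ∘ there))

  filterᵇ⇒ : (p : X → Bool) {xs : List X} {x : X} → x ∈ filterᵇ p xs → x ∈ xs × p x ≡ true
  filterᵇ⇒ p {xs} x∈ with x∈′ , h ← ∈-filter⁻ _ {xs = xs} x∈ = x∈′ , Equivalence.to T-≡ h

  filterᵇ⇐ : (p : X → Bool) {xs : List X} {x : X} → x ∈ xs → p x ≡ true → x ∈ filterᵇ p xs
  filterᵇ⇐ p x∈ h = ∈-filter⁺ _ x∈ (Equivalence.from T-≡ h)

  count-one⇒ : (p : X → Bool) (xs : List X) → (count p xs ≡ᵇ 1) ≡ true →
               (∃ λ x → x ∈ xs × p x ≡ true) × (∀ {x y} → x ∈ xs → y ∈ xs → p x ≡ true → p y ≡ true → x ≡ y)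
  count-one⇒ p xs h = count-positive p xs h , λ x∈ y∈ px py → single (≡ᵇ-sound _ 1 h) (filterᵇ⇐ p x∈ px) (filterᵇ⇐ p y∈ py)
    where
    single : ∀ {zs : List _} → length zs ≡ 1 → ∀ {x y} → x ∈ zs → y ∈ zs → x ≡ y
    single {_ ∷ []} _ (here refl) (here refl) = refl

  count-one⇐ : (p : X → Bool) (xs : List X) → Unique xs → ∀ {x} → x ∈ xs → p x ≡ true →
               (∀ {y} → y ∈ xs → p y ≡ true → y ≡ x) → (count p xs ≡ᵇ 1) ≡ true
  count-one⇐ p xs u {x} x∈ px same = singleton (Uniqueₚ.filter⁺ _ u) (filterᵇ⇐ p x∈ px) (λ y∈ → let (q , r) = filterᵇ⇒ p {xs} y∈ in same q r)
    where
    singleton : ∀ {zs} → Unique zs → x ∈ zs → (∀ {y} → y ∈ zs → y ≡ x) → (length zs ≡ᵇ 1) ≡ true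
    singleton {_ ∷ []}     u _ h = refl
    singleton {_ ∷ _ ∷ _} ((ne ∷ _) ∷ _) _ h = contradiction (trans (h (here refl)) (sym (h (there (here refl))))) ne

  count-map : (p : Y → Bool) (f : X → Y) (xs : List X) → count p (map f xs) ≡ count (p ∘ f) xs
  count-map p f []       = refl
  count-map p f (x ∷ xs) with p (f x)
  ... | true  = cong suc (count-map p f xs)
  ... | false = count-map p f xs

  count-cong : {p q : X → Bool} (xs : List X) → (∀ x → p x ≡ q x) → count p xs ≡ count q xs
  count-cong []       h = refl
  count-cong {p = p} {q} (x ∷ xs) h with p x | q x | h x
  ... | true  | true  | refl = cong suc (count-cong xs h)
  ... | false | false | refl = count-cong xs h

  sublists-map : (f : X → Y) (xs : List X) → sublists (map f xs) ≡ map (map f) (sublists xs)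
  sublists-map f []       = refl
  sublists-map f (x ∷ xs) = trans (cong₂ _++_ (trans (cong (map (f x ∷_)) (sublists-map f xs)) (trans (sym (map-∘ (sublists xs))) (map-∘ (sublists xs)))) (sublists-map f xs))
    (sym (map-++ (map f) (map (x ∷_) (sublists xs)) (sublists xs)))
    where open import Data.List.Properties using (map-∘; map-++)

  sublists⊆ : {xs s : List X} → s ∈ sublists xs → ∀ {x} → x ∈ s → x ∈ xs
  sublists⊆ {xs = []} (here refl) ()
  sublists⊆ {xs = y ∷ xs} s∈ x∈ with ∈-++⁻ (map (y ∷_) (sublists xs)) s∈
  ... | inj₂ h = there (sublists⊆ h x∈)
  ... | inj₁ h with s′ , s′∈ , refl ← ∈-map⁻ (y ∷_) h with x∈
  ...   | here refl = here refl
  ...   | there x∈′ = there (sublists⊆ s′∈ x∈′)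

  sublists-elem-unique : {xs s : List X} → Unique xs → s ∈ sublists xs → Unique s
  sublists-elem-unique {xs = []} u (here refl) = []
  sublists-elem-unique {xs = y ∷ xs} (n ∷ u) s∈ with ∈-++⁻ (map (y ∷_) (sublists xs)) s∈
  ... | inj₂ h = sublists-elem-unique u h
  ... | inj₁ h with s′ , s′∈ , refl ← ∈-map⁻ (y ∷_) h =
    All.tabulate (λ x∈ → All.lookup n (sublists⊆ s′∈ x∈)) ∷ sublists-elem-unique u s′∈

  sublists-unique : {xs : List X} → Unique xs → Unique (sublists xs)
  sublists-unique {xs = []} u = [] ∷ []
  sublists-unique {xs = y ∷ xs} (n ∷ u) = Uniqueₚ.++⁺ (unique-map-∷ y (sublists-unique u)) (sublists-unique u) disjoint
    where
    disjoint : ∀ {s} → (s ∈ map (y ∷_) (sublists xs) × s ∈ sublists xs) → ⊥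
    disjoint (p , q) with s′ , _ , refl ← ∈-map⁻ (y ∷_) p = All.lookup n (sublists⊆ q (here refl)) refl

  filter∈sublists : {P : Pred X 0ℓ} (P? : Decidable P) (xs : List X) → filter P? xs ∈ sublists xs
  filter∈sublists P? [] = here refl
  filter∈sublists P? (x ∷ xs) with P? x
  ... | yes _ = ∈-++⁺ˡ (∈-map⁺ (x ∷_) (filter∈sublists P? xs))
  ... | no _  = ∈-++⁺ʳ (map (x ∷_) (sublists xs)) (filter∈sublists P? xs)

  -- In a list without repetitions a sublist is determined by its members, so tilings may be
  -- compared as sets of pieces.
  sublist≡filter : {P : Pred X 0ℓ} (P? : Decidable P) {xs s : List X} → Unique xs → s ∈ sublists xs →
    (∀ {x} → x ∈ xs → x ∈ s → P x) → (∀ {x} → x ∈ xs → P x → x ∈ s) → filter P? xs ≡ s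
  sublist≡filter P? {[]} u (here refl) to from = refl
  sublist≡filter P? {x ∷ xs} (n ∷ u) s∈ to from with ∈-++⁻ (map (x ∷_) (sublists xs)) s∈
  ... | inj₁ h with s′ , s′∈ , refl ← ∈-map⁻ (x ∷_) h =
    trans (filter-accept P? (to (here refl) (here refl))) (cong (x ∷_) (sublist≡filter P? u s′∈ (λ y∈ y∈s → to (there y∈) (there y∈s)) from′))
    where
    from′ : ∀ {y} → y ∈ xs → _ → y ∈ s′
    from′ y∈ p with from (there y∈) p
    ... | here refl = ⊥-elim (All.lookup n y∈ refl)
    ... | there q   = q
  ... | inj₂ h = trans (filter-reject P? (λ p → All.lookup n (sublists⊆ h (from (here refl) p)) refl))
    (sublist≡filter P? u h (λ y∈ → to (there y∈)) (λ y∈ → from (there y∈)))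

  unique-⊆-length : {xs ys : List X} → Unique xs → (∀ {x} → x ∈ xs → x ∈ ys) → length xs ≤ length ys
  unique-⊆-length {xs = []} u sub = z≤n
  unique-⊆-length {xs = x ∷ xs} (n ∷ u) sub with as , bs , refl ← ∈-∃++ (sub (here refl)) =
    subst (suc (length xs) ≤_) (sym (trans (length-++ as) (trans (ℕₚ.+-suc (length as) (length bs)) (cong suc (sym (length-++ as))))))
      (s≤s (unique-⊆-length u sub′))
    where
    sub′ : ∀ {y} → y ∈ xs → y ∈ as ++ bs
    sub′ y∈ with ∈-++⁻ as (sub (there y∈))
    ... | inj₁ p = ∈-++⁺ˡ p
    ... | inj₂ (here refl) = ⊥-elim (All.lookup n y∈ refl)
    ... | inj₂ (there p) = ∈-++⁺ʳ as p

  unique-map-on : (f : X → Y) {xs : List X} → Unique xs → (∀ {x y} → x ∈ xs → y ∈ xs → f x ≡ f y → x ≡ y) → Unique (map f xs)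
  unique-map-on f {[]} u inj = []
  unique-map-on f {x ∷ xs} (n ∷ u) inj =
    All.tabulate (λ z∈ e → let (y , y∈ , e′) = ∈-map⁻ f z∈ in All.lookup n y∈ (inj (here refl) (there y∈) (trans e e′)))
    ∷ unique-map-on f u (λ p q → inj (there p) (there q))

  bijection-length : (f : X → Y) {xs : List X} {ys : List Y} → Unique xs → Unique ys → (∀ {x} → x ∈ xs → f x ∈ ys) →
    (∀ {x y} → x ∈ xs → y ∈ xs → f x ≡ f y → x ≡ y) → (∀ {y} → y ∈ ys → ∃ λ x → x ∈ xs × f x ≡ y) → length xs ≡ length ys
  bijection-length f {xs} {ys} ux uy into inj onto = ℕₚ.≤-antisym
    (subst (_≤ length ys) (length-map f xs) (unique-⊆-length (unique-map-on f ux inj) λ z∈ → let (x , x∈ , e) = ∈-map⁻ f z∈ in subst (_∈ ys) (sym e) (into x∈)))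
    (subst (length ys ≤_) (length-map f xs) (unique-⊆-length uy λ y∈ → let (x , x∈ , e) = onto y∈ in subst (_∈ map f xs) e (∈-map⁺ f x∈)))

  eqEdge-refl : ∀ e → eqEdge e e ≡ true
  eqEdge-refl (hE r i) rewrite ≡ᵇ-refl r | ≡ᵇ-refl i = refl
  eqEdge-refl (lE r i) rewrite ≡ᵇ-refl r | ≡ᵇ-refl i = refl
  eqEdge-refl (rE r i) rewrite ≡ᵇ-refl r | ≡ᵇ-refl i = refl

  eqEdge-sound : ∀ e e′ → eqEdge e e′ ≡ true → e ≡ e′
  eqEdge-sound (hE r i) (hE s j) h = cong₂ hE (≡ᵇ-sound r s (proj₁ (∧-split h))) (≡ᵇ-sound i j (proj₂ (∧-split {r ≡ᵇ s} h)))
  eqEdge-sound (lE r i) (lE s j) h = cong₂ lE (≡ᵇ-sound r s (proj₁ (∧-split h))) (≡ᵇ-sound i j (proj₂ (∧-split {r ≡ᵇ s} h)))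
  eqEdge-sound (rE r i) (rE s j) h = cong₂ rE (≡ᵇ-sound r s (proj₁ (∧-split h))) (≡ᵇ-sound i j (proj₂ (∧-split {r ≡ᵇ s} h)))

  beq-sound : ∀ b b′ → beq b b′ ≡ true → b ≡ b′
  beq-sound true  true  h = refl
  beq-sound false false h = refl

  beq-refl : ∀ b → beq b b ≡ true
  beq-refl true  = refl
  beq-refl false = refl

  Consistent : List (Edge × Bool) → List (Edge × Bool) → Set
  Consistent L M = ∀ {e b b′} → (e , b) ∈ L → (e , b′) ∈ M → b ≡ b′

  consistent⇒ : ∀ L M → consistent L M ≡ true → Consistent L M
  consistent⇒ L M h {e} {b} {b′} p q = beq-sound b b′ (trans (sym (cong (λ x → not x ∨ beq b b′) (eqEdge-refl e))) (all⇒ _ (all⇒ _ h p) q))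

  consistent⇐ : ∀ L M → Consistent L M → consistent L M ≡ true
  consistent⇐ L M h = all⇐ _ L (λ {(e , b)} p → all⇐ _ M (λ {(e′ , b′)} q → agree e b e′ b′ p q))
    where
    agree : ∀ e b e′ b′ → (e , b) ∈ L → (e′ , b′) ∈ M → not (eqEdge e e′) ∨ beq b b′ ≡ true
    agree e b e′ b′ p q with eqEdge e e′ in eq
    ... | false = refl
    ... | true with refl ← eqEdge-sound e e′ eq with refl ← h p q = beq-refl b

  up∈allTris : ∀ {n r i} → r < n → i ≤ r → up r i ∈ allTris n
  up∈allTris {n} {r} r< i≤ = ∈-concatMap⁺ (λ r → map (up r) (upTo (suc r)) ++ map (down r) (upTo r)) (lose (∈-upTo⁺ r<) (∈-++⁺ˡ (∈-map⁺ (up r) (∈-upTo⁺ (s≤s i≤)))))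

  down∈allTris : ∀ {n r i} → r < n → i < r → down r i ∈ allTris n
  down∈allTris {n} {r} r< i< = ∈-concatMap⁺ (λ r → map (up r) (upTo (suc r)) ++ map (down r) (upTo r)) (lose (∈-upTo⁺ r<) (∈-++⁺ʳ (map (up r) (upTo (suc r))) (∈-map⁺ (down r) (∈-upTo⁺ i<))))

  allTris⇒ : ∀ n {t} → t ∈ allTris n → (∃₂ λ r i → t ≡ up r i × r < n × i ≤ r) ⊎ (∃₂ λ r i → t ≡ down r i × r < n × i < r)
  allTris⇒ n t∈ with r , r∈ , h ← find (∈-concatMap⁻ (λ r → map (up r) (upTo (suc r)) ++ map (down r) (upTo r)) {xs = upTo n} t∈)
    with ∈-++⁻ (map (up r) (upTo (suc r))) h
  ... | inj₁ p with i , i∈ , refl ← ∈-map⁻ (up r) p = inj₁ (r , i , refl , ∈-upTo⁻ r∈ , ℕₚ.≤-pred (∈-upTo⁻ i∈))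
  ... | inj₂ p with i , i∈ , refl ← ∈-map⁻ (down r) p = inj₂ (r , i , refl , ∈-upTo⁻ r∈ , ∈-upTo⁻ i∈)

  ∈-labels⁺ : ∀ {S c x} → c ∈ S → x ∈ labels ⟦ c ⟧ → x ∈ concatMap labels (map ⟦_⟧ S)
  ∈-labels⁺ c∈ x∈ = ∈-concatMap⁺ labels (lose (∈-map⁺ ⟦_⟧ c∈) x∈)

  ∈-labels⁻ : ∀ S {x} → x ∈ concatMap labels (map ⟦_⟧ S) → ∃ λ c → c ∈ S × x ∈ labels ⟦ c ⟧
  ∈-labels⁻ S x∈ with p , p∈ , x∈′ ← find (∈-concatMap⁻ labels {xs = map ⟦_⟧ S} x∈) with c , c∈ , refl ← ∈-map⁻ ⟦_⟧ p∈ = c , c∈ , x∈′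

  ∈-zip⁺ : (f : ℕ → Edge) (n : ℕ) (w : List Bool) → length w ≡ n → ∀ j → j < n → (f j , at false w j) ∈ zip (map f (upTo n)) w
  ∈-zip⁺ f n w len j j< = subst (λ es → (f j , at false w j) ∈ zip es w) (sym (map-upTo f n)) (go f n w len j j<)
    where
    go : (f : ℕ → Edge) (n : ℕ) (w : List Bool) → length w ≡ n → ∀ j → j < n → (f j , at false w j) ∈ zip (applyUpTo f n) w
    go f (suc n) (b ∷ w) len zero    j<       = here refl
    go f (suc n) (b ∷ w) len (suc j) (s≤s j<) = there (go (f ∘ suc) n w (ℕₚ.suc-injective len) j j<)

  ∈-zip⁻ : (f : ℕ → Edge) (n : ℕ) (w : List Bool) {x : Edge × Bool} → x ∈ zip (map f (upTo n)) w → ∃ λ j → j < n × x ≡ (f j , at false w j)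
  ∈-zip⁻ f n w {x} x∈ = go f n w (subst (λ es → x ∈ zip es w) (map-upTo f n) x∈)
    where
    go : (f : ℕ → Edge) (n : ℕ) (w : List Bool) → x ∈ zip (applyUpTo f n) w → ∃ λ j → j < n × x ≡ (f j , at false w j)
    go f (suc n) (b ∷ w) (here refl) = 0 , s≤s z≤n , refl
    go f (suc n) (b ∷ w) (there h) with j , j< , e ← go (f ∘ suc) n w h = suc j , s≤s j< , e

  module _ (n : ℕ) (wl wm ν : List Bool) (len-l : length wl ≡ n) (len-m : length wm ≡ n) (len-ν : length ν ≡ n) where
    private
      ls = reverse wl
      len-ls : length ls ≡ n
      len-ls = trans (length-reverse wl) len-l
      B = boundaryLabels n wl wm ν
      lB = λ j → lE (n ∸ 1 ∸ j) 0
      rB = λ j → rE j j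
      bB = λ j → hE n j

    -- The left side is listed from bottom to top: its edge number r lies in row n - 1 - r, and this
    -- renumbering is an involution.
    mirror : ∀ r → r < n → n ∸ 1 ∸ r < n × n ∸ 1 ∸ (n ∸ 1 ∸ r) ≡ r
    mirror r r< with s≤s {n = n′} r≤ ← r< = s≤s (ℕₚ.m∸n≤m n′ r) , ℕₚ.m∸[m∸n]≡n r≤

    at-ls : ∀ r → r < n → at false ls r ≡ at false wl (n ∸ 1 ∸ r)
    at-ls r r< = trans (at-reverse false wl r (subst (r <_) (sym len-l) r<))
      (cong (at false wl) (trans (cong (_∸ suc r) len-l) (sym (ℕₚ.∸-+-assoc n 1 r))))

    bound-left : ∀ r → r < n → (lE r 0 , at false ls r) ∈ B
    bound-left r r< = ∈-++⁺ˡ (subst (_∈ zip (map lB (upTo n)) wl)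
      (cong₂ _,_ (cong (λ j → lE j 0) (proj₂ (mirror r r<))) (sym (at-ls r r<)))
      (∈-zip⁺ lB n wl len-l (n ∸ 1 ∸ r) (proj₁ (mirror r r<))))

    bound-right : ∀ r → r < n → (rE r r , at false wm r) ∈ B
    bound-right r r< = ∈-++⁺ʳ (zip (map lB (upTo n)) wl) (∈-++⁺ˡ (∈-zip⁺ rB n wm len-m r r<))

    bound-bottom : ∀ i → i < n → (hE n i , at false ν i) ∈ B
    bound-bottom i i< = ∈-++⁺ʳ (zip (map lB (upTo n)) wl) (∈-++⁺ʳ (zip (map rB (upTo n)) wm) (∈-zip⁺ bB n ν len-ν i i<))

    bound⇒ : ∀ {e b} → (e , b) ∈ B → (∃ λ r → r < n × e ≡ lE r 0 × b ≡ at false ls r) ⊎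
      (∃ λ r → r < n × e ≡ rE r r × b ≡ at false wm r) ⊎ (∃ λ i → i < n × e ≡ hE n i × b ≡ at false ν i)
    bound⇒ x∈ with ∈-++⁻ (zip (map lB (upTo n)) wl) x∈
    ... | inj₁ p with j , j< , refl ← ∈-zip⁻ lB n wl p = inj₁ (n ∸ 1 ∸ j , proj₁ (mirror j j<) , refl ,
      sym (trans (at-ls _ (proj₁ (mirror j j<))) (cong (at false wl) (proj₂ (mirror j j<)))))
    ... | inj₂ p with ∈-++⁻ (zip (map rB (upTo n)) wm) p
    ...   | inj₁ q with j , j< , refl ← ∈-zip⁻ rB n wm q = inj₂ (inj₁ (j , j< , refl , refl))
    ...   | inj₂ q with j , j< , refl ← ∈-zip⁻ bB n ν q = inj₂ (inj₂ (j , j< , refl , refl))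

    tiling : List Code → Bool
    tiling S = isTiling n wl wm ν (map ⟦_⟧ S)

    coversOnce : List Code → Tri → Bool
    coversOnce S t = count (λ p → count (eqTri t) (cells p) ≡ᵇ 1) (map ⟦_⟧ S) ≡ᵇ 1

    place : (ℕ → ℕ → Kind) → List Code
    place K = filter (placed? K) (codes n)

    place⇒ : ∀ {K c} → c ∈ place K → InRange n c × Placed K c
    place⇒ {K} c∈ with c∈′ , p ← ∈-filter⁻ (placed? K) {xs = codes n} c∈ = codes-range n c∈′ , p

    place⇐ : ∀ {K c} → InRange n c → Placed K c → c ∈ place K
    place⇐ {K} {c} rg p = ∈-filter⁺ (placed? K) (range-codes n c rg) p

    place-tiling : ∀ {H K} → Array 0 n H ls wm ν K → tiling (place K) ≡ true
    place-tiling {H} {K} A = cong₂ _∧_ covered (cong₂ _∧_ (consistent⇐ LL LL inner) (consistent⇐ B LL outer))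
      where
      open FromArray A
      S = place K
      LL = concatMap labels (map ⟦_⟧ S)
      S-unique : Unique S
      S-unique = Uniqueₚ.filter⁺ (placed? K) (codes-unique n)
      once : ∀ t c → c ∈ S → covers t c ≡ true → (∀ {c′} → c′ ∈ S → covers t c′ ≡ true → c′ ≡ c) → coversOnce S t ≡ true
      once t c c∈ h same = trans (cong (_≡ᵇ 1) (count-map _ ⟦_⟧ S)) (count-one⇐ (covers t) S S-unique c∈ h same)
      covered : all (coversOnce S) (allTris n) ≡ true
      covered = all⇐ (coversOnce S) (allTris n) go
        where
        go : ∀ {t} → t ∈ allTris n → coversOnce S t ≡ true
        go t∈ with allTris⇒ n t∈
        ... | inj₁ (r , i , refl , r< , i≤) with c , rg , pl , role ← cover-up r i r< i≤ =
          once (up r i) c (place⇐ rg pl) (upRole⇒covers role) (λ {c′} c′∈ h → let (rg′ , pl′) = place⇒ c′∈ in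
            unique-up rg′ rg pl′ pl (proj₂ (covers⇒upRole c′ h)) role)
        ... | inj₂ (suc r , i , refl , r< , s≤s i≤) with c , δ , rg , pl , role ← cover-dn r i r< i≤ =
          once (down (suc r) i) c (place⇐ rg pl) (dnRole⇒covers role) (λ {c′} c′∈ h → let (rg′ , pl′) = place⇒ c′∈ in
            unique-dn rg′ rg pl′ pl (proj₂ (covers⇒dnRole c′ h)) role)
      bit-injective : ∀ {b b′} → bit b ≡ bit b′ → b ≡ b′
      bit-injective refl = refl
      label : ∀ {e b} → (e , b) ∈ LL → edgeLabel e ≡ bit b
      label x∈ with c , c∈ , h ← ∈-labels⁻ S x∈ with rg , pl ← place⇒ c∈ = placed-labels c rg pl h
      inner : Consistent LL LL
      inner p q = bit-injective (trans (sym (label p)) (label q))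
      edge-bound : ∀ {e b} → (e , b) ∈ B → edgeLabel e ≡ bit b
      edge-bound p with bound⇒ p
      ... | inj₁ (r , r< , refl , refl) = Array.first A r r<
      ... | inj₂ (inj₁ (r , r< , refl , refl)) = Array.last A r r<
      ... | inj₂ (inj₂ (i , i< , refl , refl)) = at-end n (Array.end A) i i<
        where
        at-end : ∀ m → (∀ i → i < m → above H K m i ≡ bit (at false ν i)) → ∀ i → i < m → edgeLabel (hE m i) ≡ bit (at false ν i)
        at-end (suc m) h i i< = h i i<
      outer : Consistent B LL
      outer p q = bit-injective (trans (sym (edge-bound p)) (label q))

    module FromTiling (S : List Code) (S∈ : S ∈ sublists (codes n)) (ok : tiling S ≡ true) where
      LL : List (Edge × Bool)
      LL = concatMap labels (map ⟦_⟧ S)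

      range : ∀ {c} → c ∈ S → InRange n c
      range c∈ = codes-range n (sublists⊆ S∈ c∈)

      once : ∀ {t} → t ∈ allTris n → (∃ λ c → c ∈ S × covers t c ≡ true) ×
             (∀ {c c′} → c ∈ S → c′ ∈ S → covers t c ≡ true → covers t c′ ≡ true → c ≡ c′)
      once {t} t∈ = count-one⇒ (covers t) S (trans (cong (_≡ᵇ 1) (sym (count-map _ ⟦_⟧ S)))
        (all⇒ (coversOnce S) (proj₁ (∧-split ok)) t∈))

      cover-up : ∀ r i → r < n → i ≤ r → ∃₂ λ c κ → c ∈ S × UpRole c r i κ
      cover-up r i r< i≤ with c , c∈ , h ← proj₁ (once (up∈allTris r< i≤)) with κ , role ← covers⇒upRole c h = c , κ , c∈ , role

      cover-dn : ∀ r i → r < n → i < r → ∃₂ λ c δ → c ∈ S × DnRole c r i δ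
      cover-dn r i r< i< with c , c∈ , h ← proj₁ (once (down∈allTris r< i<)) with δ , role ← covers⇒dnRole c h = c , δ , c∈ , role

      unique-up : ∀ {c c′ r i κ κ′} → c ∈ S → c′ ∈ S → UpRole c r i κ → UpRole c′ r i κ′ → c ≡ c′
      unique-up c∈ c′∈ u u′ with r< , i≤ ← upRole-range (range c∈) u =
        proj₂ (once (up∈allTris r< i≤)) c∈ c′∈ (upRole⇒covers u) (upRole⇒covers u′)

      unique-dn : ∀ {c c′ r i δ δ′} → c ∈ S → c′ ∈ S → DnRole c r i δ → DnRole c′ r i δ′ → c ≡ c′
      unique-dn c∈ c′∈ d d′ with r< , i< ← dnRole-range (range c∈) d =
        proj₂ (once (down∈allTris r< i<)) c∈ c′∈ (dnRole⇒covers d) (dnRole⇒covers d′)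

      agree : Consistent LL LL
      agree = consistent⇒ LL LL (proj₁ (∧-split (proj₂ (∧-split {all (coversOnce S) (allTris n)} ok))))

      boundary : Consistent B LL
      boundary = consistent⇒ B LL (proj₂ (∧-split {consistent LL LL} (proj₂ (∧-split {all (coversOnce S) (allTris n)} ok))))

      match : ∀ {c c′ e l m} → c ∈ S → c′ ∈ S → Labelled c e l → Labelled c′ e m → l ≡ m
      match c∈ c′∈ (b , refl , p) (b′ , refl , q) = cong bit (agree (∈-labels⁺ c∈ p) (∈-labels⁺ c′∈ q))

      -- If the edge is interior to one of the pieces, that piece covers both triangles and is the
      -- other piece by unique covering. Otherwise both pieces label the edge by bits, and
      -- consistency makes these equal.
      match-bot : ∀ {c c′ r i κ δ} → c ∈ S → c′ ∈ S → UpRole c r i κ → DnRole c′ (suc r) i δ → bot κ ≡ hD δ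
      match-bot c∈ c′∈ u d with across-bot u
      ... | inj₂ (δ′ , d′ , e) with refl ← unique-dn c∈ c′∈ d′ d = trans (sym e) (cong hD (dnRole-kind d′ d))
      ... | inj₁ lab with across-hD d
      ...   | inj₂ (κ′ , u′ , e) with refl ← unique-up c∈ c′∈ u u′ = trans (cong bot (upRole-kind u u′)) e
      ...   | inj₁ lab′ = match c∈ c′∈ lab lab′

      match-right : ∀ {c c′ r i κ δ} → c ∈ S → c′ ∈ S → UpRole c r i κ → DnRole c′ r i δ → right κ ≡ rD δ
      match-right c∈ c′∈ u d with across-right u
      ... | inj₂ (δ′ , d′ , e) with refl ← unique-dn c∈ c′∈ d′ d = trans (sym e) (cong rD (dnRole-kind d′ d))
      ... | inj₁ lab with across-rD d
      ...   | inj₂ (κ′ , u′ , e) with refl ← unique-up c∈ c′∈ u u′ = trans (cong right (upRole-kind u u′)) e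
      ...   | inj₁ lab′ = match c∈ c′∈ lab lab′

      match-left : ∀ {c c′ r i κ δ} → c ∈ S → c′ ∈ S → UpRole c r (suc i) κ → DnRole c′ r i δ → left κ ≡ lD δ
      match-left c∈ c′∈ u d with across-left u
      ... | inj₂ (i′ , δ′ , refl , d′ , e) with refl ← unique-dn c∈ c′∈ d′ d = trans (sym e) (cong lD (dnRole-kind d′ d))
      ... | inj₁ lab with across-lD d
      ...   | inj₂ (κ′ , u′ , e) with refl ← unique-up c∈ c′∈ u u′ = trans (cong left (upRole-kind u u′)) e
      ...   | inj₁ lab′ = match c∈ c′∈ lab lab′

      -- The Boolean is passed together with its equation, so that later proofs can split on it
      -- while the covering proof stays well typed.
      kindOf : ∀ c r i b → covers (up r i) c ≡ b → Kind → Kind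
      kindOf c r i true  e κ = proj₁ (covers⇒upRole c e)
      kindOf c r i false e κ = κ

      kindIn : List Code → ℕ → ℕ → Kind
      kindIn []       r i = K₀
      kindIn (c ∷ S′) r i = kindOf c r i (covers (up r i) c) refl (kindIn S′ r i)

      K : ℕ → ℕ → Kind
      K = kindIn S

      K-role : ∀ {c r i κ} → c ∈ S → UpRole c r i κ → K r i ≡ κ
      K-role {c} {r} {i} {κ} c∈ u = go S (λ h → h) c∈
        where
        go : ∀ S′ → (∀ {c′} → c′ ∈ S′ → c′ ∈ S) → c ∈ S′ → kindIn S′ r i ≡ κ
        go (c′ ∷ S′) sub c∈′ = choose (covers (up r i) c′) refl c∈′
          where
          choose : ∀ b (e : covers (up r i) c′ ≡ b) → c ∈ c′ ∷ S′ → kindOf c′ r i b e (kindIn S′ r i) ≡ κ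
          choose true  e _ with u′ ← proj₂ (covers⇒upRole c′ e) with refl ← unique-up c∈ (sub (here refl)) u u′ = upRole-kind u′ u
          choose false e (here refl) = contradiction (trans (sym e) (upRole⇒covers u)) (λ ())
          choose false e (there p)   = go S′ (sub ∘ there) p

      dn-labels-K : ∀ {c r i δ} → c ∈ S → DnRole c (suc r) i δ → DnAt K r i δ
      dn-labels-K {c} {r} {i} c∈ d with r< , s≤s i≤ ← dnRole-range (range c∈) d
        with c₀ , κ₀ , c₀∈ , u₀ ← cover-up r i (ℕₚ.<⇒≤ r<) i≤
        with c₁ , κ₁ , c₁∈ , u₁ ← cover-up (suc r) i r< (ℕₚ.m≤n⇒m≤1+n i≤)
        with c₂ , κ₂ , c₂∈ , u₂ ← cover-up (suc r) (suc i) r< (s≤s i≤) =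
        sym (trans (cong bot (K-role c₀∈ u₀)) (match-bot c₀∈ c∈ u₀ d)) ,
        sym (trans (cong right (K-role c₁∈ u₁)) (match-right c₁∈ c∈ u₁ d)) ,
        sym (trans (cong left (K-role c₂∈ u₂)) (match-left c₂∈ c∈ u₂ d))

      array : Array 0 n (λ _ → bit false) ls wm ν K
      array = record { first = first ; step = step ; last = last ; end = end n refl }
        where
        first : ∀ r → r < n → left (K r 0) ≡ bit (at false ls r)
        first r r< with c , κ , c∈ , u ← cover-up r 0 r< z≤n with across-left u
        ... | inj₁ (b , e , h) = trans (cong left (K-role c∈ u)) (trans e (cong bit (sym (boundary (bound-left r r<) (∈-labels⁺ c∈ h)))))
        step : ∀ r i → r < n → i < r → dn (right (K r i)) (above (λ _ → bit false) K r i) ≡ just (left (K r (suc i)))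
        step (suc r) i r< i< with c , δ , c∈ , d ← cover-dn (suc r) i r< i< with p , q , s ← dn-labels-K c∈ d =
          trans (cong₂ dn (sym q) (sym p)) (trans (dn-labels δ) (cong just s))
        last : ∀ r → r < n → right (K r r) ≡ bit (at false wm r)
        last r r< with c , κ , c∈ , u ← cover-up r r r< ℕₚ.≤-refl with across-right u
        ... | inj₁ (b , e , h) = trans (cong right (K-role c∈ u)) (trans e (cong bit (sym (boundary (bound-right r r<) (∈-labels⁺ c∈ h)))))
        -- A piece crossing the right side would cover a downward triangle outside the puzzle.
        ... | inj₂ (δ , d , _) = ⊥-elim (ℕₚ.<-irrefl refl (proj₂ (dnRole-range (range c∈) d)))
        end : ∀ m → m ≡ n → ∀ i → i < m → above (λ _ → bit false) K m i ≡ bit (at false ν i)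
        end (suc m) refl i (s≤s i≤) with c , κ , c∈ , u ← cover-up m i ℕₚ.≤-refl i≤ with across-bot u
        ... | inj₁ (b , e , h) = trans (cong bot (K-role c∈ u)) (trans e (cong bit (sym (boundary (bound-bottom i (s≤s i≤)) (∈-labels⁺ c∈ h)))))
        ... | inj₂ (δ , d , _) = ⊥-elim (ℕₚ.<-irrefl refl (proj₁ (dnRole-range (range c∈) d)))

      conf : Conf
      conf = confOf 0 n K

      kind-conf : ∀ r i → r < n → i ≤ r → kind conf r i ≡ K r i
      kind-conf r i r< i≤ = trans (cong (λ ks → at K₀ ks i) (at-applyUpTo [] (λ r → applyUpTo (K r) (suc r)) n r r<))
        (at-applyUpTo K₀ (K r) (suc r) i (s≤s i≤))

      conf-role : ∀ {c r i κ} → c ∈ S → UpRole c r i κ → kind conf r i ≡ κ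
      conf-role c∈ u with r< , i≤ ← upRole-range (range c∈) u = trans (kind-conf _ _ r< i≤) (K-role c∈ u)

      conf-dnAt : ∀ {c r i δ} → c ∈ S → DnRole c (suc r) i δ → DnAt (kind conf) r i δ
      conf-dnAt {c} {r} {i} c∈ d with r< , s≤s i≤ ← dnRole-range (range c∈) d with p , q , s ← dn-labels-K c∈ d =
        trans p (cong bot (sym (kind-conf r i (ℕₚ.<⇒≤ r<) i≤))) ,
        trans q (cong right (sym (kind-conf (suc r) i r< (ℕₚ.m≤n⇒m≤1+n i≤)))) ,
        trans s (cong left (sym (kind-conf (suc r) (suc i) r< (s≤s i≤))))

      conf∈ : conf ∈ confs ν ls wm []
      conf∈ = array⇒conf 0 n (λ _ → bit false) ls wm ν K len-ls len-m len-ν array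

      to : ∀ c → c ∈ S → Placed (kind conf) c
      to (upS r i b) c∈ = conf-role c∈ sing
      to (vC r i)    c∈ = conf-role c∈ vert
      to (lC r i)    c∈ = conf-role c∈ lft
      to (rC r i)    c∈ = conf-role c∈ rgt
      to (hC r i)    c∈ = conf-role c∈ h₁
      to (dnS zero i b) c∈ with _ , () ← range c∈
      to (dnS (suc r) i b) c∈ with p , q , s ← conf-dnAt c∈ sing = sym p , sym q , sym s

      from-up : ∀ {c r i κ} → InRange n c → UpRole c r i κ → kind conf r i ≡ κ → c ∈ S
      from-up {c} {r} {i} rg u e with r< , i≤ ← upRole-range rg u with c′ , κ′ , c′∈ , u′ ← cover-up r i r< i≤
        with refl ← trans (sym (conf-role c′∈ u′)) e = subst (_∈ S) (upRole-code u′ u) c′∈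

      from : ∀ c → InRange n c → Placed (kind conf) c → c ∈ S
      from (upS r i b) rg p = from-up rg sing p
      from (vC r i)    rg p = from-up rg vert p
      from (lC r i)    rg p = from-up rg lft p
      from (rC r i)    rg p = from-up rg rgt p
      from (hC r i)    rg p = from-up rg h₁ p
      from (dnS (suc r) i b) (r< , i<) (p , q , _) with c′ , δ , c′∈ , d ← cover-dn (suc r) i r< i<
        with p′ , q′ , _ ← conf-dnAt c′∈ d
        with refl ← dnKind-injective {δ} {dsing b} (trans p′ p) (trans q′ q) = subst (_∈ S) (dnRole-code d sing) c′∈

      place-conf : place (kind conf) ≡ S
      place-conf = sublist≡filter (placed? (kind conf)) (codes-unique n) S∈ (λ {c} _ → to c) (λ {c} c∈ → from c (codes-range n c∈))

    private
      conf-array : ∀ {c} → c ∈ confs ν ls wm [] → Array 0 n (at (bit false) []) ls wm ν (kind c)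
      conf-array {c} c∈ = subst (λ m → Array 0 m (at (bit false) []) ls wm ν (kind c)) len-ls (conf⇒array ν ls wm [] c c∈)

    -- Each upward triangle is covered by a placed piece, and its role in that piece fixes its kind
    -- in every array that places the piece.
    place-injective : ∀ {c c′} → c ∈ confs ν ls wm [] → c′ ∈ confs ν ls wm [] → place (kind c) ≡ place (kind c′) → c ≡ c′
    place-injective {c} {c′} c∈ c′∈ eq = at-ext [] c c′ (trans (proj₁ shape) (sym (proj₁ shape′))) λ r r< →
      let r<′ = subst (r <_) (proj₁ shape) r< in
      at-ext K₀ (at [] c r) (at [] c′ r) (trans (proj₂ shape r r<′) (sym (proj₂ shape′ r r<′))) λ i i< →
        same r i (subst (r <_) len-ls r<′) (ℕₚ.≤-pred (subst (i <_) (proj₂ shape r r<′) i<))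
      where
      shape = conf-shape ν ls wm [] c c∈
      shape′ = conf-shape ν ls wm [] c′ c′∈
      same : ∀ r i → r < n → i ≤ r → kind c r i ≡ kind c′ r i
      same r i r< i≤ with k , rg , pl , u ← FromArray.cover-up (conf-array c∈) r i r< i≤ =
        sym (FromArray.placed-up (conf-array c′∈) rg (proj₂ (place⇒ (subst (k ∈_) eq (place⇐ rg pl)))) u)

    -- `place` is the bijection; its inverse reads off, for every upward triangle, the kind given by
    -- the unique piece that covers it.
    puzzleCount-confs : puzzleCount n wl wm ν ≡ length (confs ν ls wm [])
    puzzleCount-confs = begin
      count (isTiling n wl wm ν) (sublists (allPieces n))
        ≡⟨ cong (λ ps → count (isTiling n wl wm ν) (sublists ps)) (allPieces-codes n) ⟩
      count (isTiling n wl wm ν) (sublists (map ⟦_⟧ (codes n)))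
        ≡⟨ cong (count (isTiling n wl wm ν)) (sublists-map ⟦_⟧ (codes n)) ⟩
      count (isTiling n wl wm ν) (map (map ⟦_⟧) (sublists (codes n)))
        ≡⟨ count-map (isTiling n wl wm ν) (map ⟦_⟧) (sublists (codes n)) ⟩
      count tiling (sublists (codes n))
        ≡⟨ sym (bijection-length (place ∘ kind) (confs-unique ν ls wm [])
             (Uniqueₚ.filter⁺ _ (sublists-unique (codes-unique n)))
             (λ {c} c∈ → filterᵇ⇐ tiling (filter∈sublists (placed? (kind c)) (codes n)) (place-tiling (conf-array c∈)))
             place-injective onto) ⟩
      length (confs ν ls wm []) ∎
      where
      open ≡-Reasoning
      onto : ∀ {S} → S ∈ filterᵇ tiling (sublists (codes n)) → ∃ λ c → c ∈ confs ν ls wm [] × place (kind c) ≡ S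
      onto {S} S∈ with S∈′ , ok ← filterᵇ⇒ tiling {sublists (codes n)} S∈ =
        FromTiling.conf S S∈′ ok , FromTiling.conf∈ S S∈′ ok , FromTiling.place-conf S S∈′ ok

    puzzleCount-puzzles : + puzzleCount n wl wm ν ≡ puzzles wl wm ν
    puzzleCount-puzzles = trans (cong +_ puzzleCount-confs) (trans (sym (∑-length (confs ν ls wm []))) (∑-confs ν ls wm []))

-- Puzzle counts as coproduct coefficients.

open import Defs
open import Data.Bool using (Bool)
open import Data.Nat using (ℕ; _+_; _∸_; _≤_; _<_)
open import Data.List using (List; length)
open import Data.List.Relation.Unary.All using (All)
open import Data.Integer using (ℤ; +_)
open import Relation.Binary.PropositionalEquality using (_≡_; trans; sym)
open import Data.Product using (proj₁)
open Counting using (puzzleCount-puzzles)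
open Coefficient using (coefficient)

theorem3p3 : (n k : ℕ) → 1 ≤ k → k < n →
    (λ' μ ν : List ℕ) →
    IsPartition λ' → IsPartition μ → IsPartition ν →
    length λ' ≤ k → length μ ≤ k → length ν ≤ k →
    All (_≤ n ∸ k ∸ 1) λ' → All (_≤ n ∸ k ∸ 1) μ → All (_≤ n ∸ k ∸ 1) ν →
    size ν ≤ size λ' + size μ →
    (wλ wμ wν : List Bool) →
    IsBinaryString n k λ' wλ → IsBinaryString n k μ wμ → IsBinaryString n k ν wν →
    (d : List ℕ → List ℕ → ℤ) (N : ℕ) →
    SupportedUpTo d N → CoproductExpansion ν d N →
    + puzzleCount n wλ wμ wν ≡ d λ' μ
theorem3p3 n k 1≤k k<n λ' μ ν pλ pμ pν lλ lμ lν bλ bμ bν _ wλ wμ wν sλ sμ sν d N sup exp =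
  trans (puzzleCount-puzzles n wλ wμ wν (proj₁ sλ) (proj₁ sμ) (proj₁ sν))
        (sym (coefficient 1≤k k<n {wl = wλ} {wm = wμ} {wν = wν} pλ pμ pν lλ lμ lν bλ bμ bν sλ sμ sν d N sup exp))
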